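{- For every prime $q \equiv 2 \pmod 3$ there exists a constant $C(q) > 0$ such that the following holds. Let $G$ be a finite Abelian group of Type I$(q)$ and order $n$, and let $m \geqslant C(q)\sqrt{n \log n}$. Then almost every sum-free subset of $G$ of size $m$ is contained in a maximum-size sum-free subset of $G$, and hence $$|\mathrm{SF}(G,m)| \,=\, \lambda_q \cdot \Big( \#\{\text{elements of } G \text{ of order } q\} + o(1) \Big) \binom{\mu(G) n}{m}$$ as $n \to \infty$, where $\lambda_q = 1$ if $q = 2$ and $\lambda_q = 1/2$ otherwise.
   Context: A subset $A$ of an Abelian group $G$ is sum-free if $(A+A)\cap A = \emptyset$, i.e. there are no $x,y,z \in A$ (not necessarily distinct) with $x+y=z$. $\mathrm{SF}(G,m)$ denotes the family of sum-free subsets of $G$ of size $m$. $\mu(G)$ is the maximum of $|A|/|G|$ over sum-free $A \subseteq G$. A finite Abelian group $G$ is of Type I$(q)$ if $q$ is the smallest prime divisor of $|G|$ satisfying $q \equiv 2 \pmod 3$. "Almost every set in a family $\mathcal{F}$ of subsets of $G$ has property $\mathcal{P}$" means that the ratio of the number of sets in $\mathcal{F}$ with $\mathcal{P}$ to $|\mathcal{F}|$ tends to $1$ as $|G| \to \infty$; here $o(1)$ refers to a quantity tending to $0$ as $n = |G| \to \infty$. $\log$ is the natural logarithm. -}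

module Defs where

open import Level using (0ℓ)
open import Algebra.Bundles using (AbelianGroup)
open import Data.Nat as ℕ using (ℕ; zero; suc; _+_; _*_; _^_; _%_; _≤_; _<_; _⊔_)
open import Data.Nat.Base using (_!)
open import Data.Nat.Divisibility using (_∣_)
open import Data.Nat.Primality using (Prime)
open import Data.Integer using (+_)
open import Data.Rational using (ℚ; _/_; 1ℚ; ½)
open import Data.Fin using (Fin; toℕ)
open import Data.Fin.Subset using (Subset; _∈_; _⊆_; ∣_∣; inside; outside)
open import Data.Fin.Subset.Properties using (_∈?_; _⊆?_; anySubset?)
import Data.Fin.Properties as FinP
open import Data.Vec using ([]; _∷_)
open import Data.List using (List; []; _∷_; _++_; map; filter; length; foldr; allFin)
open import Data.Product using (Σ; _×_; _,_; ∃; ∃-syntax)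
open import Relation.Nullary using (¬_; Dec; yes; no; ¬?)
open import Relation.Nullary.Decidable using (_×-dec_; _→-dec_)
open import Relation.Binary.PropositionalEquality using (_≡_)
open import Relation.Binary using (Decidable)
import Relation.Unary as U

record FiniteAbelianGroup : Set₁ where
  field
    abGroup : AbelianGroup 0ℓ 0ℓ
  open AbelianGroup abGroup public
  field
    size      : ℕ
    elem      : Fin size → Carrier
    elem-surj : ∀ x → ∃[ i ] elem i ≈ x
    elem-inj  : ∀ i j → elem i ≈ elem j → i ≡ j
    _≈?_      : Decidable _≈_

module _ (G : FiniteAbelianGroup) where
  open FiniteAbelianGroup G

  mul : ℕ → Carrier → Carrier
  mul zero    g = ε
  mul (suc k) g = g ∙ mul k g

  HasOrder : ℕ → Carrier → Set
  HasOrder k g = (0 < k) × (mul k g ≈ ε) × (∀ (j : Fin k) → 0 < toℕ j → ¬ (mul (toℕ j) g ≈ ε))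

  hasOrder? : ∀ k g → Dec (HasOrder k g)
  hasOrder? k g = (0 ℕ.<? k) ×-dec ((mul k g ≈? ε) ×-dec
                   FinP.all? (λ j → (0 ℕ.<? toℕ j) →-dec ¬? (mul (toℕ j) g ≈? ε)))

  #elementsOfOrder : ℕ → ℕ
  #elementsOfOrder k = length (filter (λ i → hasOrder? k (elem i)) (allFin size))

  -- Subsets of G are subsets of the index set Fin size (via elem).
  SumFree : Subset size → Set
  SumFree A = ∀ i j k → i ∈ A → j ∈ A → k ∈ A → ¬ ((elem i ∙ elem j) ≈ elem k)

  sumFree? : (A : Subset size) → Dec (SumFree A)
  sumFree? A = FinP.all? λ i → FinP.all? λ j → FinP.all? λ k →
    (i ∈? A) →-dec ((j ∈? A) →-dec ((k ∈? A) →-dec ¬? ((elem i ∙ elem j) ≈? elem k)))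

allSubsets : ∀ n → List (Subset n)
allSubsets zero    = [] ∷ []
allSubsets (suc n) = map (outside ∷_) (allSubsets n) ++ map (inside ∷_) (allSubsets n)

module _ (G : FiniteAbelianGroup) where
  open FiniteAbelianGroup G

  maxSumFreeSize : ℕ
  maxSumFreeSize = foldr _⊔_ 0 (map ∣_∣ (filter (sumFree? G) (allSubsets size)))

  InSF : ℕ → Subset size → Set
  InSF m A = SumFree G A × ∣ A ∣ ≡ m

  inSF? : ∀ m A → Dec (InSF m A)
  inSF? m A = sumFree? G A ×-dec (∣ A ∣ ℕ.≟ m)

  #SF : ℕ → ℕ
  #SF m = length (filter (inSF? m) (allSubsets size))

  InMaximumSF : Subset size → Set
  InMaximumSF A = ∃[ B ] (SumFree G B × ∣ B ∣ ≡ maxSumFreeSize × A ⊆ B)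

  inMaximumSF? : ∀ A → Dec (InMaximumSF A)
  inMaximumSF? A = anySubset? λ B → sumFree? G B ×-dec ((∣ B ∣ ℕ.≟ maxSumFreeSize) ×-dec (A ⊆? B))

  #SFinMaximum : ℕ → ℕ
  #SFinMaximum m = length (filter (λ A → inSF? m A ×-dec inMaximumSF? A) (allSubsets size))

  TypeI : ℕ → Set
  TypeI q = Prime q × q ∣ size × q % 3 ≡ 2
          × (∀ p → Prime p → p ∣ size → p % 3 ≡ 2 → q ≤ p)

-- Natural logarithm, via exact integer arithmetic.
-- expS a k = k! · Σ_{i ≤ k} a^i / i!   (so expS a k / k! ↑ e^a).

expS : ℕ → ℕ → ℕ
expS a zero    = 1
expS a (suc k) = suc k * expS a k + a ^ suc k

-- b · ln n ≤ a   ⇔   n^b ≤ e^a   ⇔   ∃ k. n^b · k! ≤ expS a k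
-- (exact: e^a is irrational for a > 0, and for a = 0 take k = 0).
MulLogLe : ℕ → ℕ → ℕ → Set
MulLogLe b n a = ∃[ k ] (n ^ b * k ! ≤ expS a k)

ℕtoℚ : ℕ → ℚ
ℕtoℚ k = + k / 1

lambdaQ : ℕ → ℚ
lambdaQ 2 = 1ℚ
lambdaQ _ = ½

{-# OPTIONS --safe #-}
-- Write q = 3k + 2, n = q h and N = (k + 1) h. Stability: let A be a maximal sum-free set with nearly N elements. By Mann's
-- theorem, applied to A - A, some coset union A + H is small; it is still sum-free, so A is periodic, and Lagrange's theorem with
-- the minimality of q gives |G/H| = q and |A| = N. By Vosper's theorem for ℤ/q, A is then the preimage of {k + 1, ..., 2k + 1}
-- under a homomorphism χ onto ℤ/q, which is unique up to sign. By duality there are as many such χ as elements of order q, so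
-- the number of maximum sum-free sets is λ_q times that number.
--
-- A sum-free m-set lying in no maximum one is either near some maximum set B or far from all of them. A far set is revealed one
-- element at a time: while many available elements differ by chosen ones, each choice excludes many others, and when this stops
-- either fewer than N - h/θ elements are available or, by stability, all of them lie in one maximum set; few far sets fit in.
-- A near set is S ∪ J with S outside B small and J ⊆ B independent in the Cayley graph of S on B. Every s ∉ B is a difference of
-- at least h pairs of B, so this graph has many edges and few independent sets. The same bound for single s ∉ B shows that few
-- m-sets lie in two maximum sum-free sets, so the m-subsets of the maximum sum-free sets are counted almost without overlap.
module Submission where

open import Defs
open import Data.Nat using (ℕ; _*_; _<_; _≤_; _%_)
open import Data.Nat.Primality using (Prime)
open import Data.Nat.Combinatorics using (_C_)
open import Data.Rational using (ℚ; 0ℚ; 1ℚ; ½) renaming (_*_ to _*ℚ_; _-_ to _-ℚ_; _≤_ to _≤ℚ_; _<_ to _<ℚ_)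
open import Data.Product using (_×_; ∃-syntax)
open import Relation.Binary.PropositionalEquality using (_≡_)
open import Level using (0ℓ)
open import Data.Nat
open import Data.Nat.Properties
open import Data.Nat.Divisibility
open import Data.Nat.DivMod
open import Data.Nat.Primality
open import Data.Nat.Primality.Factorisation using (factorise; PrimeFactorisation)
open import Data.Nat.Combinatorics using (nCk+nC[k+1]≡[n+1]C[k+1]; nCk≡n!/k![n-k]!; k>n⇒nCk≡0; k![n∸k]!∣n!; nCn≡1; nCk≡nC[n∸k])
open import Data.Nat.Tactic.RingSolver using (solve-∀)
import Data.Integer as ℤ
open import Data.Bool using (Bool; true; false; not; _∧_; _∨_; if_then_else_) renaming (_≟_ to _≟ᵇ_)
open import Data.Bool.Properties using (∧-comm; ∨-comm; ∧-zeroʳ; ∧-identityʳ)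
open import Data.Fin using (Fin; zero; suc; toℕ; fromℕ<)
open import Data.Fin.Properties as FinP using (any?; all?; toℕ<n; toℕ-injective; toℕ-fromℕ<)
open import Data.Fin.Permutation using (permutation)
open import Data.Fin.Subset using (Subset; ∣_∣)
open import Data.Fin.Subset.Properties using (anySubset?)
open import Data.Vec using (Vec; []; _∷_; lookup; tabulate)
open import Data.Vec.Properties using (≡-dec; lookup-zipWith; lookup∘tabulate; tabulate∘lookup; tabulate-cong; []=⇒lookup; lookup⇒[]=)
open import Data.List using (List; []; _∷_; _++_; map; filter; length; foldr; allFin)
open import Data.Product using (_,_; ∃; proj₁; proj₂)
open import Data.Sum using (_⊎_; inj₁; inj₂; [_,_]′)
open import Data.Empty using (⊥; ⊥-elim)
open import Function using (_∘_; id; case_of_)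
open import Relation.Nullary using (¬_; Dec; yes; no; ¬?)
open import Relation.Nullary.Decidable using (⌊_⌋; _×-dec_; _→-dec_; map′)
open import Relation.Binary.PropositionalEquality
open import Relation.Binary.Definitions using (tri<; tri≈; tri>)
open import Induction.WellFounded using (Acc; acc)
open import Data.Nat.Induction using (<-wellFounded)
import Algebra.Properties.CommutativeMonoid.Sum as CMSum
import Algebra.Solver.CommutativeMonoid as CMSolver
open import Algebra.Bundles using (CommutativeMonoid)
import Algebra.Solver.CommutativeMonoid.Normal as CMNormal
open import Data.Nat.ListAction using (product)
open import Data.List.Relation.Unary.All using (All; []; _∷_)
open import Data.Nat.Coprimality using (Coprime; coprime-Bézout)
open import Data.Nat.GCD using (module Bézout)
open import Data.Rational using (mkℚ; ↧ₙ_; toℚᵘ; *<*)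
import Data.Rational as ℚ
import Data.Rational.Properties as ℚP
open import Data.Rational.Unnormalised using (mkℚᵘ; *≡*; *≤*)
import Data.Rational.Unnormalised as ℚᵘ
import Data.Rational.Unnormalised.Properties as ℚᵘP
import Data.Integer.Properties as ℤP

-- Finite sets as Boolean predicates

-- The logarithm is forced by sets with a single element s outside a maximum set B. Such an s
-- forbids about h pairs of B, each present with probability about (m/N)², so it saves only 2^e with
-- e of order m²/n (`gain-small`), and this must beat the polynomially many choices of s and B. All
-- other savings are of the form 2^(m/c), and m of order √n is enough for them. Sets are counted by
-- weight: v gets m^|v| b^(n - |v|) with b = N - m, as in a random set of density m/N, so that
-- subsets of different sizes can be summed as products over coordinates. `mode-bound` returns to
-- sets of size exactly m at the price of a factor N + 1. This needs b to be at least h/θ; for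
-- larger m, stability applies to the m-sets themselves. Every estimate is a cross-multiplied
-- inequality between natural numbers, with powers of 2 in place of exponentials (`power-gap`,
-- `exp-bound`). Mann's and Vosper's theorems have one source, Hamidoune's r-atoms, used with r = 1
-- and r = 2.

Pr : ℕ → Set
Pr n = Fin n → Bool

⟦_⟧ : Bool → ℕ
⟦ true ⟧ = 1
⟦ false ⟧ = 0

⟦⟧≤1 : ∀ b → ⟦ b ⟧ ≤ 1
⟦⟧≤1 true = ≤-refl
⟦⟧≤1 false = z≤n

true≢false : true ≢ false
true≢false ()

absurd-b : ∀ {a} {A : Set a} {b : Bool} → b ≡ true → b ≡ false → A
absurd-b p q = ⊥-elim (true≢false (trans (sym p) q))

∧-true : ∀ {a b} → a ∧ b ≡ true → a ≡ true × b ≡ true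
∧-true {true} {true} _ = refl , refl
∧-true {true} {false} ()
∧-true {false} ()

∧-intro : ∀ {a b} → a ≡ true → b ≡ true → a ∧ b ≡ true
∧-intro refl refl = refl

∨-true : ∀ {a b} → a ∨ b ≡ true → a ≡ true ⊎ b ≡ true
∨-true {true} _ = inj₁ refl
∨-true {false} p = inj₂ p

∨-introˡ : ∀ {a b} → a ≡ true → a ∨ b ≡ true
∨-introˡ refl = refl

∨-introʳ : ∀ {a b} → b ≡ true → a ∨ b ≡ true
∨-introʳ {true} _ = refl
∨-introʳ {false} p = p

not-true : ∀ {a} → not a ≡ true → a ≡ false
not-true {false} _ = refl

not-intro : ∀ {a} → a ≡ false → not a ≡ true
not-intro refl = refl

not-intro′ : ∀ {a} → ¬ (a ≡ true) → not a ≡ true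
not-intro′ {true} p = ⊥-elim (p refl)
not-intro′ {false} _ = refl

bool-cases : ∀ b → b ≡ true ⊎ b ≡ false
bool-cases true = inj₁ refl
bool-cases false = inj₂ refl

¬true : ∀ {b} → ¬ (b ≡ true) → b ≡ false
¬true {true} p = ⊥-elim (p refl)
¬true {false} _ = refl

bool-ext : ∀ {a b} → (a ≡ true → b ≡ true) → (b ≡ true → a ≡ true) → a ≡ b
bool-ext {true} {true} f g = refl
bool-ext {true} {false} f g = sym (f refl)
bool-ext {false} {true} f g = g refl
bool-ext {false} {false} f g = refl

⌊⌋-true : ∀ {P : Set} {d : Dec P} → ⌊ d ⌋ ≡ true → P
⌊⌋-true {d = yes p} _ = p

⌊⌋-intro : ∀ {P : Set} {d : Dec P} → P → ⌊ d ⌋ ≡ true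
⌊⌋-intro {d = yes _} _ = refl
⌊⌋-intro {d = no ¬p} p = ⊥-elim (¬p p)

⌊⌋-false : ∀ {P : Set} {d : Dec P} → ¬ P → ⌊ d ⌋ ≡ false
⌊⌋-false {d = yes p} ¬p = ⊥-elim (¬p p)
⌊⌋-false {d = no _} _ = refl

anyb : ∀ {n} → Pr n → Bool
anyb A = ⌊ any? (λ i → A i ≟ᵇ true) ⌋

anyb-true : ∀ {n} (A : Pr n) → anyb A ≡ true → ∃[ i ] A i ≡ true
anyb-true A p = ⌊⌋-true p

anyb-intro : ∀ {n} (A : Pr n) i → A i ≡ true → anyb A ≡ true
anyb-intro A i p = ⌊⌋-intro (i , p)

module S = CMSum +-0-commutativeMonoid

_==_ : ∀ {n} → Fin n → Fin n → Bool
i == j = ⌊ i FinP.≟ j ⌋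

==-suc : ∀ {n} (i j : Fin n) → (Fin.suc i == suc j) ≡ (i == j)
==-suc i j with i FinP.≟ j
... | yes _ = refl
... | no _ = refl

opaque
  -- Opaque, so that cardinalities stay visible as `sum` terms and are handled only through the laws
  -- of this block.
  sum : ∀ {n} → (Fin n → ℕ) → ℕ
  sum {zero} f = 0
  sum {suc n} f = f zero + sum (f ∘ suc)

  sum≡ : ∀ {n} (f : Fin n → ℕ) → sum f ≡ S.sum f
  sum≡ {zero} f = refl
  sum≡ {suc n} f = cong (f zero +_) (sum≡ (f ∘ suc))

  sum-cong-≗ : ∀ {n} {f g : Fin n → ℕ} → (∀ i → f i ≡ g i) → sum f ≡ sum g
  sum-cong-≗ {zero} h = refl
  sum-cong-≗ {suc n} h = cong₂ _+_ (h zero) (sum-cong-≗ (h ∘ suc))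

  +-interchange : ∀ a b c d → a + b + (c + d) ≡ a + c + (b + d)
  +-interchange = solve-∀

  ∑-distrib-+ : ∀ {n} (f g : Fin n → ℕ) → sum (λ i → f i + g i) ≡ sum f + sum g
  ∑-distrib-+ {zero} f g = refl
  ∑-distrib-+ {suc n} f g = trans (cong (f zero + g zero +_) (∑-distrib-+ (f ∘ suc) (g ∘ suc))) (+-interchange (f zero) (g zero) _ _)

  sum-zero : ∀ {n} (f : Fin n → ℕ) → (∀ i → f i ≡ 0) → sum f ≡ 0
  sum-zero {zero} f h = refl
  sum-zero {suc n} f h = cong₂ _+_ (h zero) (sum-zero (f ∘ suc) (h ∘ suc))

  ∑-comm : ∀ {m n} (f : Fin m → Fin n → ℕ) → sum (λ i → sum (f i)) ≡ sum (λ j → sum (λ i → f i j))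
  ∑-comm {zero} {n} f = sym (sum-zero {n} _ (λ _ → refl))
  ∑-comm {suc m} f = trans (cong (sum (f zero) +_) (∑-comm (f ∘ suc))) (sym (∑-distrib-+ (f zero) _))

  sum-reindex : ∀ {n} (f : Fin n → ℕ) (to from : Fin n → Fin n) →
    (∀ x → to (from x) ≡ x) → (∀ x → from (to x) ≡ x) → sum (λ i → f (to i)) ≡ sum f
  sum-reindex f to from p q = sym (trans (sum≡ f) (trans (S.sum-permute f (permutation to from
    p q)) (sym (sum≡ (λ i → f (to i))))))

  sum-suc : ∀ {n} (f : Fin (suc n) → ℕ) → sum f ≡ f zero + sum (f ∘ suc)
  sum-suc f = refl

  sum-0 : (f : Fin 0 → ℕ) → sum f ≡ 0
  sum-0 f = refl

  sum-mono : ∀ {n} {f g : Fin n → ℕ} → (∀ i → f i ≤ g i) → sum f ≤ sum g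
  sum-mono {zero} h = z≤n
  sum-mono {suc n} h = +-mono-≤ (h zero) (sum-mono (h ∘ suc))

  sum-*ˡ : ∀ {n} c (f : Fin n → ℕ) → sum (λ i → c * f i) ≡ c * sum f
  sum-*ˡ {zero} c f = sym (*-zeroʳ c)
  sum-*ˡ {suc n} c f = trans (cong (c * f zero +_) (sum-*ˡ c (f ∘ suc))) (sym (*-distribˡ-+ c (f zero) _))

  sum-const : ∀ n c → sum {n} (λ _ → c) ≡ n * c
  sum-const zero c = refl
  sum-const (suc n) c = cong (c +_) (sum-const n c)

  term≤sum : ∀ {n} (f : Fin n → ℕ) i → f i ≤ sum f
  term≤sum f zero = m≤m+n _ _
  term≤sum f (suc i) = ≤-trans (term≤sum (f ∘ suc) i) (m≤n+m _ _)

  sum-δ : ∀ {n} i (f : Fin n → ℕ) → sum (λ j → ⟦ i == j ⟧ * f j) ≡ f i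
  sum-δ {suc n} zero f = trans (cong₂ _+_ (+-identityʳ (f zero)) (sum-zero {n} (λ _ → 0) (λ _ → refl))) (+-identityʳ _)
  sum-δ {suc n} (suc i) f = trans (sum-cong-≗ (λ j → cong (λ b → ⟦ b ⟧ * f (suc j)) (==-suc i j))) (sum-δ i (f ∘ suc))

infix 30 #_
#_ : ∀ {n} → Pr n → ℕ
# A = sum (λ i → ⟦ A i ⟧)

infix 4 _⊑_
_⊑_ : ∀ {n} → Pr n → Pr n → Set
A ⊑ B = ∀ i → A i ≡ true → B i ≡ true

infixr 6 _∩_
infixr 5 _∪_
_∩_ _∪_ : ∀ {n} → Pr n → Pr n → Pr n
(A ∩ B) i = A i ∧ B i
(A ∪ B) i = A i ∨ B i

∁ : ∀ {n} → Pr n → Pr n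
∁ A i = not (A i)

⟦⟧-mono : ∀ {a b} → (a ≡ true → b ≡ true) → ⟦ a ⟧ ≤ ⟦ b ⟧
⟦⟧-mono {false} h = z≤n
⟦⟧-mono {true} {true} h = ≤-refl
⟦⟧-mono {true} {false} h = ⊥-elim (true≢false (sym (h refl)))

#-mono : ∀ {n} {A B : Pr n} → A ⊑ B → # A ≤ # B
#-mono h = sum-mono (λ i → ⟦⟧-mono (h i))

#-cong : ∀ {n} {A B : Pr n} → (∀ i → A i ≡ B i) → # A ≡ # B
#-cong h = sum-cong-≗ (λ i → cong ⟦_⟧ (h i))

#-∪∩ : ∀ {n} (A B : Pr n) → # (A ∪ B) + # (A ∩ B) ≡ # A + # B
#-∪∩ A B = trans (sym (∑-distrib-+ _ _)) (trans (sum-cong-≗ (λ i → h (A i) (B i))) (∑-distrib-+ _ _))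
  where
  h : ∀ a b → ⟦ a ∨ b ⟧ + ⟦ a ∧ b ⟧ ≡ ⟦ a ⟧ + ⟦ b ⟧
  h true true = refl
  h true false = refl
  h false true = refl
  h false false = refl

#-∁ : ∀ {n} (A : Pr n) → # A + # (∁ A) ≡ n
#-∁ {n} A = trans (sym (∑-distrib-+ _ _)) (trans (sum-cong-≗ (λ i → h (A i))) (trans (sum-const n 1) (*-identityʳ n)))
  where
  h : ∀ a → ⟦ a ⟧ + ⟦ not a ⟧ ≡ 1
  h true = refl
  h false = refl

#-split : ∀ {n} (A B : Pr n) → # (A ∩ B) + # (A ∩ ∁ B) ≡ # A
#-split A B = trans (sym (∑-distrib-+ _ _)) (sum-cong-≗ (λ i → h (A i) (B i)))
  where
  h : ∀ a b → ⟦ a ∧ b ⟧ + ⟦ a ∧ not b ⟧ ≡ ⟦ a ⟧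
  h true true = refl
  h true false = refl
  h false b = refl

#≤n : ∀ {n} (A : Pr n) → # A ≤ n
#≤n A = subst (# A ≤_) (#-∁ A) (m≤m+n _ _)

#>0 : ∀ {n} (A : Pr n) i → A i ≡ true → 1 ≤ # A
#>0 A i p = ≤-trans (≤-reflexive (sym (cong ⟦_⟧ p))) (term≤sum (λ i → ⟦ A i ⟧) i)

#-inhab : ∀ {n} (A : Pr n) → 1 ≤ # A → ∃[ i ] A i ≡ true
#-inhab A p with any? (λ i → A i ≟ᵇ true)
... | yes q = q
... | no ¬q = ⊥-elim (<⇒≱ p (≤-reflexive (sum-zero _ (λ i → cong ⟦_⟧ (¬true (λ r → ¬q (i , r)))))))

-- The usual way below to prove two sets equal: one inclusion and a comparison of sizes.
⊑-eq : ∀ {n} {A B : Pr n} → A ⊑ B → # B ≤ # A → B ⊑ A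
⊑-eq {A = A} {B} A⊑B B≤A i Bi with bool-cases (A i)
... | inj₁ p = p
... | inj₂ p = ⊥-elim (<⇒≱ lt B≤A)
  where
  e : # (B ∩ A) + # (B ∩ ∁ A) ≡ # B
  e = #-split B A
  lt : # A < # B
  lt = begin-strict
    # A ≤⟨ #-mono {A = A} {B ∩ A} (λ j Aj → ∧-intro (A⊑B j Aj) Aj) ⟩
    # (B ∩ A) <⟨ m<m+n _ (#>0 (B ∩ ∁ A) i (∧-intro Bi (not-intro p))) ⟩
    # (B ∩ A) + # (B ∩ ∁ A) ≡⟨ e ⟩
    # B ∎
    where open ≤-Reasoning

#-overlap : ∀ {n} (A B U : Pr n) → A ⊑ U → B ⊑ U → # U < # A + # B → ∃[ i ] (A i ≡ true × B i ≡ true)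
#-overlap A B U a b lt with any? (λ i → (A ∩ B) i ≟ᵇ true)
... | yes (i , p) = i , ∧-true p
... | no ¬q = ⊥-elim (<⇒≱ lt (begin
    # A + # B ≡⟨ #-∪∩ A B ⟨
    # (A ∪ B) + # (A ∩ B) ≡⟨ cong (# (A ∪ B) +_) (sum-zero _ (λ i → cong ⟦_⟧ (¬true (λ r → ¬q (i , r))))) ⟩
    # (A ∪ B) + 0 ≡⟨ +-identityʳ _ ⟩
    # (A ∪ B) ≤⟨ #-mono {A = A ∪ B} {U} (λ i p → [ a i , b i ]′ (∨-true p)) ⟩
    # U ∎))
  where open ≤-Reasoning

#-singleton : ∀ {n} (i : Fin n) → # (i ==_) ≡ 1
#-singleton i = trans (sum-cong-≗ (λ j → sym (*-identityʳ ⟦ i == j ⟧))) (sum-δ i (λ _ → 1))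

#-lookup : ∀ {n} (v : Subset n) → # (lookup v) ≡ ∣ v ∣
#-lookup [] = sum-0 _
#-lookup (true ∷ v) = trans (sum-suc _) (cong suc (#-lookup v))
#-lookup (false ∷ v) = trans (sum-suc _) (#-lookup v)

opaque
  -- Extremal objects are chosen among vectors, over which existence is decidable, and predicates
  -- pass to and fro by `tabulate` and `lookup`. Atoms, maximal subgroups and maximal sum-free sets
  -- are all found in this way.
  argmin : ∀ {n} {P : Subset n → Set} (P? : ∀ v → Dec (P v)) (g : Subset n → ℕ) →
    ∃ P → ∃[ v ] (P v × (∀ w → P w → g v ≤ g w))
  argmin {n} {P} P? g (v , Pv) = go v Pv (<-wellFounded (g v))
    where
    go : ∀ v → P v → Acc _<_ (g v) → ∃[ v ] (P v × (∀ w → P w → g v ≤ g w))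
    go v Pv (acc rec) with anySubset? (λ w → P? w ×-dec (g w <? g v))
    ... | yes (w , Pw , lt) = go w Pw (rec lt)
    ... | no ¬q = v , Pv , λ w Pw → ≮⇒≥ (λ lt → ¬q (w , Pw , lt))

  argmax : ∀ {n} {P : Subset n → Set} (P? : ∀ v → Dec (P v)) (g : Subset n → ℕ) (b : ℕ) → (∀ v → g v ≤ b) →
    ∃ P → ∃[ v ] (P v × (∀ w → P w → g w ≤ g v))
  argmax P? g b gb e with argmin P? (λ v → b ∸ g v) e
  ... | v , Pv , m = v , Pv , λ w Pw → ∸-cancelʳ-≤ (gb w) (m w Pw)

  least : ∀ {P : ℕ → Set} (P? : ∀ k → Dec (P k)) → ∀ k → P k → ∃[ j ] (P j × j ≤ k × (∀ i → i < j → ¬ P i))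
  least {P} P? k Pk = go k Pk (<-wellFounded k)
    where
    go : ∀ k → P k → Acc _<_ k → ∃[ j ] (P j × j ≤ k × (∀ i → i < j → ¬ P i))
    go k Pk (acc rec) with any? (λ (i : Fin k) → P? (toℕ i))
    ... | no ¬q = k , Pk , ≤-refl , λ i lt Pi → ¬q (fromℕ< lt , subst P (sym (toℕ-fromℕ< lt)) Pi)
    ... | yes (i , Pi) with go (toℕ i) Pi (rec (toℕ<n i))
    ... | j , Pj , le , mn = j , Pj , ≤-trans le (<⇒≤ (toℕ<n i)) , mn

  _≤b_ : ℕ → ℕ → Bool
  a ≤b b = ⌊ a ≤? b ⌋

  ≤b-true : ∀ {a b} → a ≤b b ≡ true → a ≤ b
  ≤b-true {a} {b} p = ⌊⌋-true {d = a ≤? b} p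

  ≤b-intro : ∀ {a b} → a ≤ b → a ≤b b ≡ true
  ≤b-intro {a} {b} p = ⌊⌋-intro {d = a ≤? b} p

  ≤b-false : ∀ {a b} → ¬ (a ≤ b) → a ≤b b ≡ false
  ≤b-false {a} {b} p = ⌊⌋-false {d = a ≤? b} p

infix 5 _≤b_

-- Sumsets, atoms and Mann's theorem

-- The group lives on indices with propositional equality, so that subsets are Boolean functions and
-- elements can be rewritten inside them. `Transfer` brings an abstract group into this form.
record FG (n : ℕ) : Set where
  infixl 6 _⊕_
  field
    _⊕_ : Fin n → Fin n → Fin n
    neg : Fin n → Fin n
    𝟘 : Fin n
    ⊕-assoc : ∀ x y z → (x ⊕ y) ⊕ z ≡ x ⊕ (y ⊕ z)
    ⊕-comm : ∀ x y → x ⊕ y ≡ y ⊕ x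
    ⊕-identityˡ : ∀ x → 𝟘 ⊕ x ≡ x
    ⊕-inverseˡ : ∀ x → neg x ⊕ x ≡ 𝟘

infix 4 _∋∋_
_∋∋_ : ∀ {n} → Pr n → Fin n → Set
A ∋∋ x = A x ≡ true

module Grp {n : ℕ} (G : FG n) where
  open FG G public

  infixl 6 _⊖_
  _⊖_ : Fin n → Fin n → Fin n
  x ⊖ y = x ⊕ neg y

  ⊕-commutativeMonoid : CommutativeMonoid 0ℓ 0ℓ
  ⊕-commutativeMonoid = record
    { Carrier = Fin n ; _≈_ = _≡_ ; _∙_ = _⊕_ ; ε = 𝟘
    ; isCommutativeMonoid = record
      { isMonoid = record
        { isSemigroup = record
          { isMagma = record { isEquivalence = isEquivalence ; ∙-cong = cong₂ _⊕_ }
          ; assoc = ⊕-assoc }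
        ; identity = ⊕-identityˡ , λ x → trans (⊕-comm x 𝟘) (⊕-identityˡ x) }
      ; comm = ⊕-comm } }

  module CM = CMSolver ⊕-commutativeMonoid
  module CMN = CMNormal ⊕-commutativeMonoid

  ⊕-cancelʳ : ∀ z x y → x ⊕ z ≡ y ⊕ z → x ≡ y
  ⊕-cancelʳ z x y e = trans (sym (h x)) (trans (cong (_⊕ neg z) e) (h y))
    where
    h : ∀ x → x ⊕ z ⊕ neg z ≡ x
    h x = trans (⊕-assoc x z (neg z)) (trans (cong (x ⊕_) (trans (⊕-comm z _) (⊕-inverseˡ z))) (trans (⊕-comm x 𝟘) (⊕-identityˡ x)))

  infixl 6 _:+_ _:-_
  data E (k : ℕ) : Set where
    V : Fin k → E k
    :0 : E k
    _:+_ _:-_ : E k → E k → E k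
    :-_ : E k → E k

  ev : ∀ {k} → E k → Vec (Fin n) k → Fin n
  ev (V i) ρ = lookup ρ i
  ev :0 ρ = 𝟘
  ev (a :+ b) ρ = ev a ρ ⊕ ev b ρ
  ev (a :- b) ρ = ev a ρ ⊖ ev b ρ
  ev (:- a) ρ = neg (ev a ρ)

  -- Every expression e satisfies e ⊕ minus e ≡ plus e, with plus e and minus e free of inverses.
  plus minus : ∀ {k} → E k → CM.Expr k
  plus (V i) = CM.var i
  plus :0 = CM.id
  plus (a :+ b) = plus a CM.⊕ plus b
  plus (a :- b) = plus a CM.⊕ minus b
  plus (:- a) = minus a
  minus (V i) = CM.id
  minus :0 = CM.id
  minus (a :+ b) = minus a CM.⊕ minus b
  minus (a :- b) = minus a CM.⊕ plus b
  minus (:- a) = plus a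

  plus-minus : ∀ {k} (e : E k) ρ → ev e ρ ⊕ CM.⟦ minus e ⟧ ρ ≡ CM.⟦ plus e ⟧ ρ
  plus-minus (V i) ρ = trans (⊕-comm _ 𝟘) (⊕-identityˡ _)
  plus-minus :0 ρ = ⊕-identityˡ _
  plus-minus (a :+ b) ρ = trans
    (CM.prove 4 ((CM.var zero CM.⊕ CM.var (suc zero)) CM.⊕ (CM.var (suc (suc zero)) CM.⊕ CM.var (suc (suc (suc zero)))))
      ((CM.var zero CM.⊕ CM.var (suc (suc zero))) CM.⊕ (CM.var (suc zero) CM.⊕ CM.var (suc (suc (suc zero)))))
      (ev a ρ ∷ ev b ρ ∷ CM.⟦ minus a ⟧ ρ ∷ CM.⟦ minus b ⟧ ρ ∷ []))
    (cong₂ _⊕_ (plus-minus a ρ) (plus-minus b ρ))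
  plus-minus (a :- b) ρ = trans (cong (λ z → ev a ρ ⊖ ev b ρ ⊕ (CM.⟦ minus a ⟧ ρ ⊕ z)) (sym (plus-minus b ρ))) (trans
    (CM.prove 5 ((CM.var zero CM.⊕ CM.var (suc zero)) CM.⊕ (CM.var (suc (suc zero)) CM.⊕ (CM.var (suc (suc (suc (suc zero)))) CM.⊕ CM.var (suc (suc (suc zero))))))
      (((CM.var zero CM.⊕ CM.var (suc (suc zero))) CM.⊕ CM.var (suc (suc (suc zero)))) CM.⊕ (CM.var (suc zero) CM.⊕ CM.var (suc (suc (suc (suc zero))))))
      (ev a ρ ∷ neg (ev b ρ) ∷ CM.⟦ minus a ⟧ ρ ∷ CM.⟦ minus b ⟧ ρ ∷ ev b ρ ∷ []))
    (trans (cong₂ _⊕_ (cong (_⊕ CM.⟦ minus b ⟧ ρ) (plus-minus a ρ)) (⊕-inverseˡ (ev b ρ))) (trans (⊕-comm _ 𝟘) (⊕-identityˡ _))))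
  plus-minus (:- a) ρ = trans (cong (neg (ev a ρ) ⊕_) (sym (plus-minus a ρ)))
    (trans (sym (⊕-assoc _ _ _)) (trans (cong (_⊕ CM.⟦ minus a ⟧ ρ) (⊕-inverseˡ (ev a ρ))) (⊕-identityˡ _)))

  -- Solver for identities in abelian groups. With inverses moved to the other side, l = r becomes
  -- `plus l` + `minus r` = `plus r` + `minus l`, which is an identity of commutative monoids and is
  -- settled by normalisation; the added terms are then cancelled.
  gsolve : ∀ {k} (l r : E k) → CM.normalise (plus l CM.⊕ minus r) ≡ CM.normalise (plus r CM.⊕ minus l) →
    ∀ ρ → ev l ρ ≡ ev r ρ
  gsolve l r e ρ = ⊕-cancelʳ (ml ⊕ mr) (ev l ρ) (ev r ρ) (begin
    ev l ρ ⊕ (ml ⊕ mr) ≡⟨ ⊕-assoc _ _ _ ⟨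
    ev l ρ ⊕ ml ⊕ mr ≡⟨ cong (_⊕ mr) (plus-minus l ρ) ⟩
    CM.⟦ plus l CM.⊕ minus r ⟧ ρ ≡⟨ CMN.correct (plus l CM.⊕ minus r) ρ ⟨
    CM.⟦ CM.normalise (plus l CM.⊕ minus r) ⟧⇓ ρ ≡⟨ cong (λ z → CM.⟦ z ⟧⇓ ρ) e ⟩
    CM.⟦ CM.normalise (plus r CM.⊕ minus l) ⟧⇓ ρ ≡⟨ CMN.correct (plus r CM.⊕ minus l) ρ ⟩
    CM.⟦ plus r ⟧ ρ ⊕ ml ≡⟨ cong (_⊕ ml) (plus-minus r ρ) ⟨
    ev r ρ ⊕ mr ⊕ ml ≡⟨ ⊕-assoc _ _ _ ⟩
    ev r ρ ⊕ (mr ⊕ ml) ≡⟨ cong (ev r ρ ⊕_) (⊕-comm mr ml) ⟩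
    ev r ρ ⊕ (ml ⊕ mr) ∎)
    where
    open ≡-Reasoning
    ml = CM.⟦ minus l ⟧ ρ
    mr = CM.⟦ minus r ⟧ ρ

  pattern v0 = V zero
  pattern v1 = V (suc zero)
  pattern v2 = V (suc (suc zero))
  pattern v3 = V (suc (suc (suc zero)))

  ⊖⊕ : ∀ x y → x ⊖ y ⊕ y ≡ x
  ⊖⊕ x y = gsolve (v0 :- v1 :+ v1) v0 refl (x ∷ y ∷ [])
  ⊕⊖ : ∀ x y → x ⊕ y ⊖ y ≡ x
  ⊕⊖ x y = gsolve (v0 :+ v1 :- v1) v0 refl (x ∷ y ∷ [])
  ⊕⊖ˡ : ∀ x y → x ⊕ y ⊖ x ≡ y
  ⊕⊖ˡ x y = gsolve (v0 :+ v1 :- v0) v1 refl (x ∷ y ∷ [])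
  ⊖⊖ : ∀ x y → x ⊖ (x ⊖ y) ≡ y
  ⊖⊖ x y = gsolve (v0 :- (v0 :- v1)) v1 refl (x ∷ y ∷ [])
  ⊕⊖′ : ∀ x y → x ⊕ (y ⊖ x) ≡ y
  ⊕⊖′ x y = gsolve (v0 :+ (v1 :- v0)) v1 refl (x ∷ y ∷ [])
  neg-neg : ∀ x → neg (neg x) ≡ x
  neg-neg x = gsolve (:- (:- v0)) v0 refl (x ∷ [])
  ⊕𝟘 : ∀ x → x ⊕ 𝟘 ≡ x
  ⊕𝟘 x = gsolve (v0 :+ :0) v0 refl (x ∷ [])
  x⊖x : ∀ x → x ⊖ x ≡ 𝟘
  x⊖x x = gsolve (v0 :- v0) :0 refl (x ∷ [])

  sum-shift : ∀ f g → sum (λ x → f (x ⊕ g)) ≡ sum f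
  sum-shift f g = sum-reindex f (_⊕ g) (_⊖ g) (λ x → ⊖⊕ x g) (λ x → ⊕⊖ x g)

  #-shift : ∀ (A : Pr n) g → # (λ x → A (x ⊕ g)) ≡ # A
  #-shift A g = sum-shift (λ x → ⟦ A x ⟧) g

  #-neg : ∀ (A : Pr n) → # (λ x → A (neg x)) ≡ # A
  #-neg A = sum-reindex (λ x → ⟦ A x ⟧) neg neg neg-neg neg-neg

  #-reflect : ∀ (A : Pr n) g → # (λ x → A (g ⊖ x)) ≡ # A
  #-reflect A g = sum-reindex (λ x → ⟦ A x ⟧) (g ⊖_) (g ⊖_) (⊖⊖ g) (⊖⊖ g)

  τ : Fin n → Pr n → Pr n
  τ g X x = X (x ⊖ g)

  #-τ : ∀ g X → # (τ g X) ≡ # X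
  #-τ g X = #-shift X (neg g)

  infixl 6 _⊞_
  opaque
    _⊞_ : Pr n → Pr n → Pr n
    (X ⊞ S) z = anyb (λ x → X x ∧ S (z ⊖ x))

    ⊞-intro : ∀ {X S : Pr n} {x s} → X ∋∋ x → S ∋∋ s → X ⊞ S ∋∋ x ⊕ s
    ⊞-intro {X} {S} {x} {s} p q = anyb-intro _ x (∧-intro p (trans (cong S (⊕⊖ˡ x s)) q))

    ⊞-intro′ : ∀ {X S : Pr n} {z} x → X ∋∋ x → S ∋∋ z ⊖ x → X ⊞ S ∋∋ z
    ⊞-intro′ x p q = anyb-intro _ x (∧-intro p q)

    ⊞-elim : ∀ {X S : Pr n} {z} → X ⊞ S ∋∋ z → ∃[ x ] (X ∋∋ x × S ∋∋ z ⊖ x)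
    ⊞-elim p with anyb-true _ p
    ... | x , q = x , ∧-true q

  ⊞-mono : ∀ {X Y S : Pr n} → X ⊑ Y → X ⊞ S ⊑ Y ⊞ S
  ⊞-mono h z p with ⊞-elim p
  ... | x , a , b = ⊞-intro′ x (h x a) b

  ⊞-τ : ∀ g X S z → (τ g X ⊞ S) z ≡ τ g (X ⊞ S) z
  ⊞-τ g X S z = bool-ext
    (λ p → case ⊞-elim p of λ (x , a , b) → ⊞-intro′ (x ⊖ g) a
      (trans (cong S (gsolve (v0 :- v1 :- (v2 :- v1)) (v0 :- v2) refl (z ∷ g ∷ x ∷ []))) b))
    (λ p → case ⊞-elim p of λ (x , a , b) → ⊞-intro′ (x ⊕ g) (trans (cong X (⊕⊖ x g)) a)
      (trans (cong S (gsolve (v0 :- (v2 :+ v1)) (v0 :- v1 :- v2) refl (z ∷ g ∷ x ∷ []))) b))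

  #-⊞-τ : ∀ g X S → # (τ g X ⊞ S) ≡ # (X ⊞ S)
  #-⊞-τ g X S = trans (#-cong (⊞-τ g X S)) (#-τ g (X ⊞ S))

  #≤#⊞ : ∀ X S s → S ∋∋ s → # X ≤ # (X ⊞ S)
  #≤#⊞ X S s p = ≤-trans (≤-reflexive (sym (#-τ s X)))
    (#-mono {A = τ s X} {X ⊞ S} (λ z q → ⊞-intro′ (z ⊖ s) q (trans (cong S (⊖⊖ z s)) p)))

  -- Adding `S` commutes with unions, while (X ∩ Y) + S is only contained in the intersection of the
  -- two sumsets. This inequality drives the whole theory of atoms.
  ⊞-submodular : ∀ X Y S → # ((X ∪ Y) ⊞ S) + # ((X ∩ Y) ⊞ S) ≤ # (X ⊞ S) + # (Y ⊞ S)
  ⊞-submodular X Y S = ≤-trans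
    (+-mono-≤ (#-mono {A = (X ∪ Y) ⊞ S} {(X ⊞ S) ∪ (Y ⊞ S)} u) (#-mono {A = (X ∩ Y) ⊞ S} {(X ⊞ S) ∩ (Y ⊞ S)} i))
    (≤-reflexive (#-∪∩ (X ⊞ S) (Y ⊞ S)))
    where
    u : (X ∪ Y) ⊞ S ⊑ (X ⊞ S) ∪ (Y ⊞ S)
    u z p with ⊞-elim {X ∪ Y} p
    ... | x , a , b with ∨-true {X x} a
    ... | inj₁ c = ∨-introˡ (⊞-intro′ x c b)
    ... | inj₂ c = ∨-introʳ {(X ⊞ S) z} (⊞-intro′ x c b)
    i : (X ∩ Y) ⊞ S ⊑ (X ⊞ S) ∩ (Y ⊞ S)
    i z p with ⊞-elim {X ∩ Y} p
    ... | x , a , b with ∧-true {X x} a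
    ... | c , d = ∧-intro (⊞-intro′ x c b) (⊞-intro′ x d b)

  ⊞-cong : ∀ {X Y S : Pr n} → (∀ x → X x ≡ Y x) → ∀ z → (X ⊞ S) z ≡ (Y ⊞ S) z
  ⊞-cong h z = bool-ext (⊞-mono (λ x p → trans (sym (h x)) p) z) (⊞-mono (λ x p → trans (h x) p) z)

  -- The isoperimetric setting of Hamidoune: `X` has at least r elements and X + S misses at least
  -- r. The case r = 1 leads to Mann's theorem and r = 2 to Vosper's.
  Adm : ℕ → Pr n → Pr n → Set
  Adm r S X = r ≤ # X × # (X ⊞ S) + r ≤ n

  Adm? : ∀ r S X → Dec (Adm r S X)
  Adm? r S X = (r ≤? # X) ×-dec (# (X ⊞ S) + r ≤? n)

  -- the deficiency |X + S| - |X|, shifted by n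
  defi : Pr n → Pr n → ℕ
  defi S X = # (X ⊞ S) + # (∁ X)

  record IsAtom (r : ℕ) (S X : Pr n) : Set where
    field
      adm : Adm r S X
      min : ∀ Y → Adm r S Y → defi S X ≤ defi S Y
      min-size : ∀ Y → Adm r S Y → defi S Y ≤ defi S X → # X ≤ # Y

  Adm-cong : ∀ {r S X Y} → (∀ x → X x ≡ Y x) → Adm r S X → Adm r S Y
  Adm-cong {r} {S} {X} h (a , b) = subst (r ≤_) (#-cong h) a , subst (λ z → z + r ≤ n) (#-cong (⊞-cong {X} h)) b

  defi-cong : ∀ {S X Y} → (∀ x → X x ≡ Y x) → defi S X ≡ defi S Y
  defi-cong {S} {X} h = cong₂ _+_ (#-cong (⊞-cong {X} h)) (#-cong (λ x → cong not (h x)))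

  -- Lets one `argmin` minimise the deficiency first and the size second, the pair being packed as
  -- digits in base n + 1.
  lex-lemma : ∀ k f f′ a a′ → f * suc k + a ≤ f′ * suc k + a′ → a′ ≤ k → f ≤ f′
  lex-lemma k f f′ a a′ h a′≤k = ≮⇒≥ λ lt → <⇒≱ (begin-strict
    f′ * suc k + a′ <⟨ +-monoʳ-< (f′ * suc k) (s≤s a′≤k) ⟩
    f′ * suc k + suc k ≡⟨ +-comm (f′ * suc k) (suc k) ⟩
    suc f′ * suc k ≤⟨ *-monoˡ-≤ (suc k) lt ⟩
    f * suc k ≤⟨ m≤m+n _ a ⟩
    f * suc k + a ∎) h
    where open ≤-Reasoning

  opaque
    atom-exists : ∀ r S W → Adm r S W → ∃[ X ] IsAtom r S X
    atom-exists r S W aW with argmin {P = λ v → Adm r S (lookup v)} (λ v → Adm? r S (lookup v))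
      (λ v → defi S (lookup v) * suc n + # (lookup v)) (tabulate W , Adm-cong (λ x → sym (lookup∘tabulate W x)) aW)
    ... | v , a , m = lookup v , record
      { adm = a
      ; min = λ Y aY → lex-lemma n _ _ _ _ (key Y aY) (#≤n Y)
      ; min-size = λ Y aY le → +-cancelˡ-≤ (defi S (lookup v) * suc n) _ _
          (≤-trans (key Y aY) (+-monoˡ-≤ (# Y) (*-monoˡ-≤ (suc n) le))) }
      where
      key : ∀ Y → Adm r S Y → defi S (lookup v) * suc n + # (lookup v) ≤ defi S Y * suc n + # Y
      key Y aY = ≤-trans (m (tabulate Y) (Adm-cong (λ x → sym (lookup∘tabulate Y x)) aY))
        (≤-reflexive (cong₂ (λ p q → p * suc n + q) (defi-cong {S} (lookup∘tabulate Y)) (#-cong (lookup∘tabulate Y))))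

  -- The reflected complement Y of X + S satisfies Y + S ⊆ -(complement of X). It is therefore
  -- admissible with a deficiency no larger than that of `X`, and an atom is smallest among such
  -- sets.
  atom-dual : ∀ {r S X} → IsAtom r S X → # X + # (X ⊞ S) ≤ n
  atom-dual {r} {S} {X} at = ≤-trans (+-monoˡ-≤ (# (X ⊞ S)) (min-size Y (Y-adm₁ , Y-adm₂) Y-defi)) (≤-reflexive (trans (+-comm (# Y) _) Y-size))
    where
    open IsAtom at
    Y : Pr n
    Y y = not ((X ⊞ S) (neg y))
    Y-size : # (X ⊞ S) + # Y ≡ n
    Y-size = trans (cong (# (X ⊞ S) +_) (#-neg (∁ (X ⊞ S)))) (#-∁ (X ⊞ S))
    Y⊞S : Y ⊞ S ⊑ λ z → not (X (neg z))
    Y⊞S z p with ⊞-elim {Y} p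
    ... | y , a , b = not-intro′ λ c → absurd-b (⊞-intro {X} {S} c b) (trans (cong (X ⊞ S)
      (gsolve (:- v0 :+ (v0 :- v1)) (:- v1) refl (z ∷ y ∷ []))) (not-true a))
    Y⊞S-size : # (Y ⊞ S) ≤ # (∁ X)
    Y⊞S-size = ≤-trans (#-mono {A = Y ⊞ S} Y⊞S) (≤-reflexive (#-neg (∁ X)))
    Y-adm₁ : r ≤ # Y
    Y-adm₁ = +-cancelˡ-≤ (# (X ⊞ S)) _ _ (≤-trans (proj₂ adm) (≤-reflexive (sym Y-size)))
    Y-adm₂ : # (Y ⊞ S) + r ≤ n
    Y-adm₂ = ≤-trans (+-mono-≤ Y⊞S-size (proj₁ adm)) (≤-reflexive (trans (+-comm (# (∁ X)) _) (#-∁ X)))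
    Y-defi : defi S Y ≤ defi S X
    Y-defi = ≤-trans (+-mono-≤ Y⊞S-size (≤-reflexive (+-cancelˡ-≡ (# Y) _ _ (trans (#-∁ Y) (trans (sym Y-size) (+-comm _ (# Y)))))))
      (≤-reflexive (+-comm (# (∁ X)) _))

  defi→ : ∀ {S X Y} → defi S X ≤ defi S Y → # (X ⊞ S) + # Y ≤ # (Y ⊞ S) + # X
  defi→ {S} {X} {Y} h = ar (# (X ⊞ S)) (# (∁ X)) (# (Y ⊞ S)) (# (∁ Y)) (# X) (# Y) h (trans (#-∁ X) (sym (#-∁ Y)))
    where
    ar : ∀ a b c d x y → a + b ≤ c + d → x + b ≡ y + d → a + y ≤ c + x
    ar a b c d x y h e = +-cancelʳ-≤ (b + d) (a + y) (c + x) (begin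
      a + y + (b + d) ≡⟨ l₁ a y b d ⟩
      a + b + (y + d) ≤⟨ +-monoˡ-≤ (y + d) h ⟩
      c + d + (y + d) ≡⟨ cong (c + d +_) e ⟨
      c + d + (x + b) ≡⟨ l₂ c d x b ⟩
      c + x + (b + d) ∎)
      where
      open ≤-Reasoning
      l₁ : ∀ a y b d → a + y + (b + d) ≡ a + b + (y + d)
      l₁ = solve-∀
      l₂ : ∀ c d x b → c + d + (x + b) ≡ c + x + (b + d)
      l₂ = solve-∀

  defi← : ∀ {S X Y} → # (X ⊞ S) + # Y ≤ # (Y ⊞ S) + # X → defi S X ≤ defi S Y
  defi← {S} {X} {Y} h = ar (# (X ⊞ S)) (# (∁ X)) (# (Y ⊞ S)) (# (∁ Y)) (# X) (# Y) h (trans (#-∁ X) (sym (#-∁ Y)))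
    where
    ar : ∀ a b c d x y → a + y ≤ c + x → x + b ≡ y + d → a + b ≤ c + d
    ar a b c d x y h e = +-cancelʳ-≤ (x + y) (a + b) (c + d) (begin
      a + b + (x + y) ≡⟨ l₁ a b x y ⟩
      a + y + (x + b) ≤⟨ +-monoˡ-≤ (x + b) h ⟩
      c + x + (x + b) ≡⟨ cong (c + x +_) e ⟩
      c + x + (y + d) ≡⟨ l₂ c x y d ⟩
      c + d + (x + y) ∎)
      where
      open ≤-Reasoning
      l₁ : ∀ a b x y → a + b + (x + y) ≡ a + y + (x + b)
      l₁ = solve-∀
      l₂ : ∀ c x y d → c + x + (y + d) ≡ c + d + (x + y)
      l₂ = solve-∀

  -- The intersection property of atoms. If the intersection with the translate were smaller than
  -- `X`, its deficiency would be strictly larger by the choice of `X`; submodularity then makes the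
  -- union too good.
  atom-translate : ∀ {r S X} → IsAtom r S X → ∀ g → r ≤ # (X ∩ τ g X) → X ⊑ τ g X
  atom-translate {r} {S} {X} at g r≤i = λ x Xx → proj₂ (∧-true {X x} (⊑-eq {A = I} {X} I⊑X a≤i x Xx))
    where
    open IsAtom at
    X′ = τ g X
    I = X ∩ X′
    U = X ∪ X′
    I⊑X : I ⊑ X
    I⊑X x p = proj₁ (∧-true {X x} p)
    I-adm : Adm r S I
    I-adm = r≤i , ≤-trans (+-monoˡ-≤ r (#-mono (⊞-mono {I} {X} {S} I⊑X))) (proj₂ adm)
    u+i : # U + # I ≡ # X + # X
    u+i = trans (#-∪∩ X X′) (cong (# X +_) (#-τ g X))
    us+is : # (U ⊞ S) + # (I ⊞ S) ≤ # (X ⊞ S) + # (X ⊞ S)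
    us+is = ≤-trans (⊞-submodular X X′ S) (≤-reflexive (cong (# (X ⊞ S) +_) (#-⊞-τ g X S)))
    a≤i : # X ≤ # I
    a≤i = ≮⇒≥ λ i<a → contra i<a
      where
      ar₁ : ∀ A a i u is us → suc (A + i) ≤ is + a → us + is ≤ A + A → u + i ≡ a + a → suc (us + a) ≤ A + u
      ar₁ A a i u is us h₁ h₂ h₃ = +-cancelʳ-≤ (i + is + A + a) _ _ (begin
        suc (us + a) + (i + is + A + a) ≡⟨ l₁ A a i is us ⟩
        suc (A + i) + (us + is) + (a + a) ≤⟨ +-mono-≤ (+-mono-≤ h₁ h₂) (≤-reflexive (sym h₃)) ⟩
        is + a + (A + A) + (u + i) ≡⟨ l₂ A a i u is ⟩
        A + u + (i + is + A + a) ∎)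
        where
        open ≤-Reasoning
        l₁ : ∀ A a i is us → suc (us + a) + (i + is + A + a) ≡ suc (A + i) + (us + is) + (a + a)
        l₁ = solve-∀
        l₂ : ∀ A a i u is → is + a + (A + A) + (u + i) ≡ A + u + (i + is + A + a)
        l₂ = solve-∀
      ar₂ : ∀ A a i is us → suc (A + i) ≤ is + a → us + is ≤ A + A → suc n ≤ us + r → a + A ≤ n → r ≤ i → ⊥
      ar₂ A a i is us h₁ h₂ h₃ h₄ h₅ = <⇒≱ (begin-strict
        A + i + (us + is) + n + (a + A) + r <⟨ +-monoˡ-< r (+-mono-<-≤ (+-monoˡ-< n (+-mono-<-≤ h₁ h₂)) h₄) ⟩
        is + a + (A + A) + n + n + r ≤⟨ +-monoʳ-≤ (is + a + (A + A) + n + n) h₅ ⟩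
        is + a + (A + A) + n + n + i ≤⟨ +-monoˡ-≤ i (+-monoʳ-≤ (is + a + (A + A) + n) (≤-trans (n≤1+n n) h₃)) ⟩
        is + a + (A + A) + n + (us + r) + i ≡⟨ l A a i is us n r ⟩
        A + i + (us + is) + n + (a + A) + r ∎) ≤-refl
        where
        open ≤-Reasoning
        l : ∀ A a i is us n r → is + a + (A + A) + n + (us + r) + i ≡ A + i + (us + is) + n + (a + A) + r
        l = solve-∀
      contra : # I < # X → ⊥
      -- An admissible union would have smaller deficiency than the atom. If U + S is too large for
      -- admissibility, `atom-dual` and submodularity leave fewer than r elements for the
      -- intersection.
      contra i<a with # (U ⊞ S) + r ≤? n
      ... | yes le = <⇒≱ (ar₁ (# (X ⊞ S)) (# X) (# I) (# U) (# (I ⊞ S)) (# (U ⊞ S)) strict us+is u+i) (defi→ {S} {X} {U} (min U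
              (≤-trans (proj₁ adm) (#-mono {A = X} {U} (λ x p → ∨-introˡ p)) , le)))
        where
        strict : suc (# (X ⊞ S) + # I) ≤ # (I ⊞ S) + # X
        strict = ≰⇒> λ le′ → <⇒≱ i<a (min-size I I-adm (defi← {S} {I} {X} le′))
      ... | no ¬le = ar₂ (# (X ⊞ S)) (# X) (# I) (# (I ⊞ S)) (# (U ⊞ S)) strict us+is (≰⇒> ¬le) (atom-dual at) r≤i
        where
        strict : suc (# (X ⊞ S) + # I) ≤ # (I ⊞ S) + # X
        strict = ≰⇒> λ le′ → <⇒≱ i<a (min-size I I-adm (defi← {S} {I} {X} le′))

  record IsSub (H : Pr n) : Set where
    field
      has-𝟘 : H ∋∋ 𝟘
      has-⊕ : ∀ {x y} → H ∋∋ x → H ∋∋ y → H ∋∋ x ⊕ y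
      has-neg : ∀ {x} → H ∋∋ x → H ∋∋ neg x

  opaque
    -- A 1-atom moved so as to contain 0 is a subgroup: its translate by any of its elements meets
    -- it, hence equals it. The last component says that this subgroup minimises |Y + S| - |Y|.
    mann : ∀ S W → 1 ≤ # W → # (W ⊞ S) < n →
      ∃[ H ] (IsSub H × # (H ⊞ S) < n × (∀ Y → 1 ≤ # Y → # (Y ⊞ S) < n → # (H ⊞ S) + # Y ≤ # (Y ⊞ S) + # H))
    mann S W w ws with atom-exists 1 S W (w , subst (_≤ n) (+-comm 1 (# (W ⊞ S))) ws)
    ... | X , at with #-inhab X (proj₁ (IsAtom.adm at))
    ... | x₀ , Xx₀ = H , sub , subst (_< n) (sym HS-size) (subst (_≤ n) (+-comm _ 1) (proj₂ adm)) ,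
        λ Y y ys → subst₂ (λ p q → p + # Y ≤ # (Y ⊞ S) + q) (sym HS-size) (sym H-size)
          (defi→ {S} {X} {Y} (min Y (y , subst (_≤ n) (+-comm 1 (# (Y ⊞ S))) ys)))
      where
      open IsAtom at
      H : Pr n
      H h = X (x₀ ⊕ h)
      H≡τ : ∀ h → H h ≡ τ (neg x₀) X h
      H≡τ h = cong X (gsolve (v0 :+ v1) (v1 :- (:- v0)) refl (x₀ ∷ h ∷ []))
      H-size : # H ≡ # X
      H-size = trans (#-cong H≡τ) (#-τ (neg x₀) X)
      HS-size : # (H ⊞ S) ≡ # (X ⊞ S)
      HS-size = trans (#-cong (⊞-cong {H} H≡τ)) (#-⊞-τ (neg x₀) X S)
      stable : ∀ {h} → H ∋∋ h → X ⊑ τ h X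
      stable {h} p = atom-translate at h (#>0 (X ∩ τ h X) (x₀ ⊕ h) (∧-intro p (trans (cong X (⊕⊖ x₀ h)) Xx₀)))
      unstable : ∀ {h} → H ∋∋ h → τ h X ⊑ X
      unstable {h} p = ⊑-eq {A = X} {τ h X} (stable p) (≤-reflexive (#-τ h X))
      sub : IsSub H
      sub = record
        { has-𝟘 = trans (cong X (⊕𝟘 x₀)) Xx₀
        ; has-⊕ = λ {x} {y} p q → unstable q (x₀ ⊕ (x ⊕ y)) (trans (cong X (gsolve (v0 :+ (v1 :+ v2) :- v2) (v0 :+ v1) refl (x₀ ∷ x ∷ y ∷ []))) p)
        ; has-neg = λ {x} p → stable p x₀ Xx₀ }

-- Stability of dense sum-free sets

-- Residues 0 and 1 modulo 3 are closed under products, so some prime factor must be 2. This turns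
-- the minimality of q among primes into minimality among all divisors congruent to 2.
prime-factor-2mod3 : ∀ N → N % 3 ≡ 2 → ∃[ p ] (Prime p × p ∣ N × p % 3 ≡ 2)
prime-factor-2mod3 zero ()
prime-factor-2mod3 N@(suc _) N≡2 = go factors (subst (λ z → z % 3 ≡ 2) isFactorisation N≡2) factorsPrime
    (subst (product factors ∣_) (sym isFactorisation) ∣-refl)
  where
  open PrimeFactorisation (factorise N)
  two : ∀ a b → a < 3 → b < 3 → (a * b) % 3 ≡ 2 → a ≡ 2 ⊎ b ≡ 2
  two 0 b _ _ ()
  two 1 0 _ _ ()
  two 1 1 _ _ ()
  two 1 2 _ _ e = inj₂ refl
  two 2 b _ _ e = inj₁ refl
  two 1 (suc (suc (suc b))) _ (s≤s (s≤s (s≤s ()))) e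
  two (suc (suc (suc a))) b (s≤s (s≤s (s≤s ()))) _ e
  go : ∀ ps → product ps % 3 ≡ 2 → All Prime ps → product ps ∣ N → ∃[ p ] (Prime p × p ∣ N × p % 3 ≡ 2)
  go [] () _ _
  go (p ∷ ps) e (pr ∷ prs) d with two (p % 3) (product ps % 3) (m%n<n p 3) (m%n<n (product ps) 3)
      (trans (sym (%-distribˡ-* p (product ps) 3)) e)
  ... | inj₁ p2 = p , pr , ∣-trans (m∣m*n (product ps)) d , p2
  ... | inj₂ r2 = go ps r2 prs (∣-trans (n∣m*n p) d)

module Structure {n : ℕ} (G : FG n) where
  open Grp G public

  SF : Pr n → Set
  SF A = ∀ x y → A ∋∋ x → A ∋∋ y → ¬ (A ∋∋ x ⊕ y)

  Per : Pr n → Pr n → Set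
  Per H A = ∀ x h → A ∋∋ x → H ∋∋ h → A ∋∋ x ⊕ h

  n≥1 : 1 ≤ n
  n≥1 = ≤-trans (s≤s z≤n) (toℕ<n 𝟘)

  module _ {H : Pr n} (sub : IsSub H) where
    open IsSub sub

    has-⊖ : ∀ {x y} → H ∋∋ x → H ∋∋ y → H ∋∋ x ⊖ y
    has-⊖ p q = has-⊕ p (has-neg q)

    #H≥1 : 1 ≤ # H
    #H≥1 = #>0 H 𝟘 has-𝟘

    -- A periodic set is a disjoint union of cosets, split off one at a time. Both the index of `H`
    -- and the number of cosets in a set are obtained as quotients of such divisibilities.
    lagrange : ∀ A → Per H A → # H ∣ # A
    lagrange A perA = go A perA (<-wellFounded (# A))
      where
      go : ∀ A → Per H A → Acc _<_ (# A) → # H ∣ # A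
      go A perA (acc rec) with # A in e
      ... | zero = (# H) ∣0
      ... | suc a with #-inhab A (subst (1 ≤_) (sym e) (s≤s z≤n))
      ... | x , Ax = subst (# H ∣_) (trans size e) (∣m∣n⇒∣m+n (∣-reflexive (sym (trans A₁ (#-τ x H)))) (go (A ∩ ∁ (τ x H)) per′ (rec lt)))
        where
        size : # (A ∩ τ x H) + # (A ∩ ∁ (τ x H)) ≡ # A
        size = #-split A (τ x H)
        A₁ : # (A ∩ τ x H) ≡ # (τ x H)
        A₁ = #-cong {A = A ∩ τ x H} {τ x H} (λ y → bool-ext (λ p → proj₂ (∧-true {A y} p))
          (λ p → ∧-intro (trans (cong A (sym (⊕⊖′ x y))) (perA x (y ⊖ x) Ax p)) p))
        per′ : Per H (A ∩ ∁ (τ x H))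
        per′ y h p q with ∧-true {A y} p
        ... | a , b = ∧-intro (perA y h a q) (not-intro′ λ c → absurd-b
          (trans (cong H (gsolve (v0 :- v2) (v0 :+ v1 :- v2 :- v1) refl (y ∷ h ∷ x ∷ []))) (has-⊖ c q)) (not-true b))
        lt : # (A ∩ ∁ (τ x H)) < suc a
        lt = subst (# (A ∩ ∁ (τ x H)) <_) (trans size e) (m<n+m _ (≤-trans #H≥1 (≤-reflexive (sym (trans A₁ (#-τ x H))))))

    lagrange-group : # H ∣ n
    lagrange-group = subst (# H ∣_) (trans (sum-const n 1) (*-identityʳ n)) (lagrange (λ _ → true) (λ _ _ _ _ → refl))

  neg-⊞-SF : ∀ B → SF B → (λ x → B (neg x)) ⊞ B ⊑ ∁ B
  neg-⊞-SF B sf z p with ⊞-elim {λ x → B (neg x)} {B} p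
  ... | x , a , b = not-intro′ λ c → sf (neg x) z a c (trans (cong B (⊕-comm (neg x) z)) b)

  -- From `small` and 3|S| > n it follows that |H + S| - |S| < |H|: the holes of `S` in its cosets
  -- are fewer than one coset. Two different cosets that meet `S` are thus full enough for the
  -- pigeonhole principle to turn a sum relation between cosets into one between elements.
  module Saturate (S H : Pr n) (sf : SF S) (sub : IsSub H) (3S>n : n < 3 * # S)
      (small : # (H ⊞ S) + (# S + # S) ≤ n + # H) (proper : # (H ⊞ S) < n) where
    open IsSub sub

    S⊑HS : S ⊑ H ⊞ S
    S⊑HS x p = ⊞-intro′ {H} 𝟘 has-𝟘 (trans (cong S (gsolve (v0 :- :0) v0 refl (x ∷ []))) p)

    portion : Fin n → Pr n
    portion s h = H h ∧ S (s ⊕ h)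

    missing : Fin n → Pr n
    missing s = τ s H ∩ ∁ S

    portion-missing : ∀ s → # (portion s) + # (missing s) ≡ # H
    portion-missing s = trans (cong (_+ # (missing s)) (trans (#-cong (λ h → cong₂ _∧_ (cong H (sym (⊕⊖ h s))) (cong S (⊕-comm s h))))
      (#-shift (τ s H ∩ S) s))) (trans (#-split (τ s H) S) (#-τ s H))

    missing⊑ : ∀ {s} → S ∋∋ s → missing s ⊑ (H ⊞ S) ∩ ∁ S
    missing⊑ {s} p x q with ∧-true {τ s H x} q
    ... | a , b = ∧-intro (⊞-intro′ {H} (x ⊖ s) a (trans (cong S (⊖⊖ x s)) p)) b

    -- Because fewer than |H| elements of H + S lie outside S.
    portions-large : ∀ s t → S ∋∋ s → S ∋∋ t → ¬ (H ∋∋ s ⊖ t) → # H < # (portion s) + # (portion t)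
    portions-large s t Ss St ¬st = ar (# H) (# S) (# (portion s)) (# (portion t)) (# (missing s)) (# (missing t))
        (# ((H ⊞ S) ∩ ∁ S)) (# (H ⊞ S)) 3S>n small (portion-missing s) (portion-missing t) m≤ hs
      where
      hs : # S + # ((H ⊞ S) ∩ ∁ S) ≤ # (H ⊞ S)
      hs = ≤-trans (+-monoˡ-≤ _ (#-mono {A = S} {(H ⊞ S) ∩ S} (λ x p → ∧-intro (S⊑HS x p) p))) (≤-reflexive (#-split (H ⊞ S) S))
      disj : # (missing s ∩ missing t) ≡ 0
      disj = sum-zero _ (λ x → cong ⟦_⟧ (¬true (λ p → let (a , b) = ∧-true {missing s x} p in
        ¬st (trans (cong H (gsolve (v0 :- v1) (v2 :- v1 :- (v2 :- v0)) refl (s ∷ t ∷ x ∷ [])))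
          (has-⊖ sub (proj₁ (∧-true {τ t H x} b)) (proj₁ (∧-true {τ s H x} a)))))))
      m≤ : # (missing s) + # (missing t) ≤ # ((H ⊞ S) ∩ ∁ S)
      m≤ = ≤-trans (≤-reflexive (trans (sym (#-∪∩ (missing s) (missing t))) (trans (cong (# (missing s ∪ missing t) +_) disj) (+-identityʳ _))))
        (#-mono {A = missing s ∪ missing t} (λ x p → [ missing⊑ Ss x , missing⊑ St x ]′ (∨-true {missing s x} p)))
      ar : ∀ H S p p′ m m′ M A → n < 3 * S → A + (S + S) ≤ n + H → p + m ≡ H → p′ + m′ ≡ H → m + m′ ≤ M → S + M ≤ A → H < p + p′
      ar H S p p′ m m′ M A h₁ h₂ h₃ h₄ h₅ h₆ = +-cancelʳ-≤ (A + M + n + 3 * S + m + m′ + H) _ _ (begin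
        suc H + (A + M + n + 3 * S + m + m′ + H) ≡⟨ l₁ H S m m′ M A n ⟩
        suc n + (A + (S + S)) + H + H + (m + m′) + (S + M) ≤⟨ +-mono-≤ (+-mono-≤ (+-mono-≤ (+-mono-≤ (+-mono-≤ h₁ h₂) (≤-reflexive (sym h₃))) (≤-reflexive (sym h₄))) h₅) h₆ ⟩
        3 * S + (n + H) + (p + m) + (p′ + m′) + M + A ≡⟨ l₂ H S p p′ m m′ M A n ⟩
        p + p′ + (A + M + n + 3 * S + m + m′ + H) ∎)
        where
        open ≤-Reasoning
        l₁ : ∀ H S m m′ M A n → suc H + (A + M + n + 3 * S + m + m′ + H) ≡ suc n + (A + (S + S)) + H + H + (m + m′) + (S + M)
        l₁ = solve-∀
        l₂ : ∀ H S p p′ m m′ M A n → 3 * S + (n + H) + (p + m) + (p′ + m′) + M + A ≡ p + p′ + (A + M + n + 3 * S + m + m′ + H)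
        l₂ = solve-∀

    -- With c = u - s - t, the pigeonhole finds h such that s + h and t + (c - h) are both in `S`;
    -- they add up to u.
    no-sum : ∀ s t u → S ∋∋ s → S ∋∋ t → S ∋∋ u → H ∋∋ u ⊖ s ⊖ t → ¬ (H ∋∋ s ⊖ t) → ⊥
    no-sum s t u Ss St Su c ¬st with #-overlap (portion s) (λ h → portion t ((u ⊖ s ⊖ t) ⊖ h)) H
        (λ h p → proj₁ (∧-true {H h} p))
        (λ h p → trans (cong H (sym (⊖⊖ (u ⊖ s ⊖ t) h))) (has-⊖ sub c (proj₁ (∧-true {H ((u ⊖ s ⊖ t) ⊖ h)} p))))
        (subst (λ z → # H < # (portion s) + z) (sym (#-reflect (portion t) (u ⊖ s ⊖ t))) (portions-large s t Ss St ¬st))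
    ... | h , p , q = sf _ _ (proj₂ (∧-true {H h} p)) (proj₂ (∧-true {H ((u ⊖ s ⊖ t) ⊖ h)} q))
        (trans (cong S (gsolve (v0 :+ v3 :+ (v1 :+ (v2 :- v0 :- v1 :- v3))) v2 refl (s ∷ t ∷ u ∷ h ∷ []))) Su)

    -- As in `no-sum`, but with a shift in place of a reflection: (s + h + c) + t = u + h.
    no-diff : ∀ s t u → S ∋∋ s → S ∋∋ t → S ∋∋ u → H ∋∋ u ⊖ s ⊖ t → ¬ (H ∋∋ u ⊖ s) → ⊥
    no-diff s t u Ss St Su c ¬us with #-overlap (portion u) (λ h → portion s (h ⊕ (u ⊖ s ⊖ t))) H
        (λ h p → proj₁ (∧-true {H h} p))
        (λ h p → trans (cong H (sym (⊕⊖ h (u ⊖ s ⊖ t)))) (has-⊖ sub (proj₁ (∧-true {H (h ⊕ (u ⊖ s ⊖ t))} p)) c))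
        (subst (λ z → # H < # (portion u) + z) (sym (#-shift (portion s) (u ⊖ s ⊖ t))) (portions-large u s Su Ss ¬us))
    ... | h , p , q = sf _ _ (proj₂ (∧-true {H (h ⊕ (u ⊖ s ⊖ t))} q)) St
        (trans (cong S (gsolve (v0 :+ (v3 :+ (v2 :- v0 :- v1)) :+ v1) (v2 :+ v3) refl (s ∷ t ∷ u ∷ h ∷ []))) (proj₂ (∧-true {H h} p)))

    -- Inside `H` the sets S and S + s are disjoint, so 2|S| ≤ |H|; since `H` is proper, |H| ≤ n/2,
    -- against 3|S| > n.
    inside-H : ∀ s → S ∋∋ s → H ∋∋ s → S ⊑ H → ⊥
    inside-H s Ss Hs S⊑H = c≢ (lagrange-group sub)
      where
      2S≤H : # S + # S ≤ # H
      2S≤H = ≮⇒≥ λ lt → case #-overlap S (τ s S) H S⊑H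
          (λ x p → trans (cong H (sym (⊖⊕ x s))) (has-⊕ (S⊑H _ p) Hs))
          (subst (λ z → # H < # S + z) (sym (#-τ s S)) lt) of
        λ (x , a , b) → sf _ _ b Ss (trans (cong S (⊖⊕ x s)) a)
      H<n : # H < n
      H<n = ≤-<-trans (#≤#⊞ H S s Ss) proper
      c≢ : # H ∣ n → ⊥
      c≢ (divides zero e) = <⇒≱ n≥1 (≤-reflexive e)
      c≢ (divides 1 e) = <⇒≢ H<n (sym (trans e (+-identityʳ _)))
      c≢ (divides (suc (suc c)) e) = <⇒≱ (begin-strict
        2 * # H ≤⟨ m≤m+n (2 * # H) (c * # H) ⟩
        2 * # H + c * # H ≡⟨ *-distribʳ-+ (# H) 2 c ⟨
        suc (suc c) * # H ≡⟨ e ⟨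
        n <⟨ 3S>n ⟩
        3 * # S ≤⟨ *-monoˡ-≤ (# S) (s≤s (s≤s (s≤s (z≤n {1})))) ⟩
        4 * # S ≡⟨ l (# S) ⟩
        2 * (# S + # S) ≤⟨ *-monoʳ-≤ 2 2S≤H ⟩
        2 * # H ∎) ≤-refl
        where
        open ≤-Reasoning
        l : ∀ s → 4 * s ≡ 2 * (s + s)
        l = solve-∀

    HS-SF : SF (H ⊞ S)
    HS-SF x y p q r with ⊞-elim {H} {S} p | ⊞-elim {H} {S} q | ⊞-elim {H} {S} r
    ... | h₁ , a₁ , b₁ | h₂ , a₂ , b₂ | h₃ , a₃ , b₃ = main
      where
      s = x ⊖ h₁
      t = y ⊖ h₂
      u = x ⊕ y ⊖ h₃
      c : H ∋∋ u ⊖ s ⊖ t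
      c = trans (cong H (gsolve (v0 :+ v1 :- v4 :- (v0 :- v2) :- (v1 :- v3)) (v2 :+ v3 :- v4) refl (x ∷ y ∷ h₁ ∷ h₂ ∷ h₃ ∷ [])))
        (has-⊖ sub (has-⊕ a₁ a₂) a₃)
        where pattern v4 = V (suc (suc (suc (suc zero))))
      main : ⊥
      main with H (s ⊖ t) ≟ᵇ true | H (u ⊖ s) ≟ᵇ true
      ... | no ¬p | _ = no-sum s t u b₁ b₂ b₃ c ¬p
      ... | yes _ | no ¬p = no-diff s t u b₁ b₂ b₃ c ¬p
      -- All representatives lie in `H`. An element z of `S` outside `H` would give the relation s +
      -- z ≡ z between two different cosets, which `no-sum` excludes; hence S ⊆ H.
      ... | yes st | yes us = inside-H s b₁ Hs (λ z Sz → [ id , (λ Hz → ⊥-elim (no-sum s z z b₁ Sz Sz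
              (trans (cong H (gsolve (v1 :- v0 :- v1) (:- v0) refl (s ∷ z ∷ []))) (has-neg Hs))
              (λ p → absurd-b (trans (cong H (sym (⊖⊖ s z))) (has-⊖ sub Hs p)) Hz))) ]′ (bool-cases (H z)))
        where
        Ht : H ∋∋ t
        Ht = trans (cong H (gsolve v1 ((v2 :- v0) :- (v2 :- v0 :- v1)) refl (s ∷ t ∷ u ∷ []))) (has-⊖ sub us c)
        Hs : H ∋∋ s
        Hs = trans (cong H (sym (⊖⊕ s t))) (has-⊕ st Ht)

  -- What later parts need to know of a maximum sum-free set. `minimal` is Mann's inequality after
  -- |H + B| = |B| and |H| = h have been put in; it serves for `many-differences`.
  record MaxStr (N h : ℕ) (B : Pr n) : Set where
    field
      sumfree : SF B
      size : # B ≡ N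
      period : Pr n
      period-sub : IsSub period
      period-size : # period ≡ h
      periodic : Per period B
      minimal : ∀ Y → 1 ≤ # Y → # (Y ⊞ B) < n → # B + # Y ≤ # (Y ⊞ B) + h

  module TypeI (q k h : ℕ) (q≡ : q ≡ 3 * k + 2) (n≡ : n ≡ q * h) (q-least : ∀ c → c ∣ n → c % 3 ≡ 2 → q ≤ c) where

    -- Note that 3N = n + h and θ = 3(q + 1). A set with more than N - h/θ elements thus satisfies
    -- 3s > n + h(1 - 1/(q + 1)), which exceeds n and is just enough for `index-upper`.
    N θ : ℕ
    N = suc k * h
    θ = 9 * suc k

    n≡′ : n ≡ (3 * k + 2) * h
    n≡′ = trans n≡ (cong (_* h) q≡)

    h≥1 : 1 ≤ h
    h≥1 = n≢0⇒n>0 λ h0 → <⇒≱ n≥1 (≤-reflexive (trans n≡ (trans (cong (q *_) h0) (*-zeroʳ q))))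

    dense : ∀ s → θ * N < θ * s + h → n < 3 * s
    dense s lt = subst (_< 3 * s) (sym n≡′) (*-cancelˡ-< (3 * suc k) _ _ (+-cancelʳ-< h _ _ (begin-strict
      3 * suc k * ((3 * k + 2) * h) + h ≤⟨ m≤m+n _ (suc (k + k + k + 1) * h) ⟩
      3 * suc k * ((3 * k + 2) * h) + h + suc (k + k + k + 1) * h ≡⟨ l₁ k h ⟩
      9 * suc k * (suc k * h) <⟨ lt ⟩
      9 * suc k * s + h ≡⟨ l₂ k h s ⟩
      3 * suc k * (3 * s) + h ∎)))
      where
      open ≤-Reasoning
      l₁ : ∀ k h → 3 * suc k * ((3 * k + 2) * h) + h + suc (k + k + k + 1) * h ≡ 9 * suc k * (suc k * h)
      l₁ = solve-∀
      l₂ : ∀ k h s → 9 * suc k * s + h ≡ 3 * suc k * (3 * s) + h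
      l₂ = solve-∀

    -- Here 3uH = n + H, so the hypothesis says H > h(1 - 1/(q + 1)) = hq/(q + 1). Hence c = n/H < q
    -- + 1.
    index-upper : ∀ u c H → θ * N < θ * (u * H) + h → 3 * u ≡ c + 1 → n ≡ c * H → c ≤ q
    index-upper u c H lt 3u nc = subst (c ≤_) (sym q≡) (s≤s⁻¹ (*-cancelˡ-< (3 * k + 2) _ _ (*-cancelʳ-< H _ _ (+-cancelʳ-< X _ _ main))))
      where
      open ≤-Reasoning
      X = ((3 * k + 2) * (3 * suc k) + 1) * c * H
      cH : (3 * k + 2) * h ≡ c * H
      cH = trans (sym n≡′) nc
      l₁ : ∀ k c H → (3 * k + 2) * c * H + ((3 * k + 2) * (3 * suc k) + 1) * c * H ≡ 9 * suc k * (suc k * (c * H))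
      l₁ = solve-∀
      l₂ : ∀ k h → 9 * suc k * (suc k * ((3 * k + 2) * h)) ≡ (3 * k + 2) * (9 * suc k * (suc k * h))
      l₂ = solve-∀
      l₃ : ∀ k h u H → (3 * k + 2) * (9 * suc k * (u * H) + h) ≡ (3 * k + 2) * (3 * suc k) * (3 * u) * H + (3 * k + 2) * h
      l₃ = solve-∀
      l₄ : ∀ k c H → (3 * k + 2) * (3 * suc k) * (c + 1) * H + c * H ≡ (3 * k + 2) * suc (suc (suc (3 * k))) * H + ((3 * k + 2) * (3 * suc k) + 1) * c * H
      l₄ = solve-∀
      l₅ : ∀ k → 3 + 3 * k ≡ suc (3 * k + 2)
      l₅ = solve-∀
      main : (3 * k + 2) * c * H + X < (3 * k + 2) * suc (3 * k + 2) * H + X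
      main = begin-strict
        (3 * k + 2) * c * H + X ≡⟨ l₁ k c H ⟩
        9 * suc k * (suc k * (c * H)) ≡⟨ cong (λ z → 9 * suc k * (suc k * z)) cH ⟨
        9 * suc k * (suc k * ((3 * k + 2) * h)) ≡⟨ l₂ k h ⟩
        (3 * k + 2) * (9 * suc k * (suc k * h)) <⟨ *-monoʳ-< (3 * k + 2) {{>-nonZero (≤-trans (s≤s z≤n) (m≤n+m 2 (3 * k)))}} lt ⟩
        (3 * k + 2) * (9 * suc k * (u * H) + h) ≡⟨ l₃ k h u H ⟩
        (3 * k + 2) * (3 * suc k) * (3 * u) * H + (3 * k + 2) * h ≡⟨ cong₂ (λ a b → (3 * k + 2) * (3 * suc k) * a * H + b) 3u cH ⟩
        (3 * k + 2) * (3 * suc k) * (c + 1) * H + c * H ≡⟨ l₄ k c H ⟩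
        (3 * k + 2) * (3 + 3 * k) * H + X ≡⟨ cong (λ z → (3 * k + 2) * z * H + X) (l₅ k) ⟩
        (3 * k + 2) * suc (3 * k + 2) * H + X ∎

    stability : ∀ A → SF A → θ * N < θ * # A + h → ∃[ B ] (A ⊑ B × MaxStr N h B)
    stability A sfA big with argmax {P = λ v → (A ⊑ lookup v) × SF (lookup v)}
        (λ v → all? (λ i → (A i ≟ᵇ true) →-dec (lookup v i ≟ᵇ true)) ×-dec
          all? (λ x → all? (λ y → (lookup v x ≟ᵇ true) →-dec ((lookup v y ≟ᵇ true) →-dec ¬? (lookup v (x ⊕ y) ≟ᵇ true)))))
        (λ v → # (lookup v)) n (λ v → #≤n (lookup v))
        (tabulate A , (λ i p → trans (lookup∘tabulate A i) p) ,
          λ x y p q r → sfA x y (trans (sym (lookup∘tabulate A x)) p) (trans (sym (lookup∘tabulate A y)) q) (trans (sym (lookup∘tabulate A (x ⊕ y))) r))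
    ... | v , (A⊑S , sf) , maxi = S , A⊑S , record
        { sumfree = sf ; size = trans #S (cong₂ _*_ u≡ H≡h) ; period = H ; period-sub = sub ; period-size = H≡h
        ; periodic = per
        ; minimal = λ Y y ys → subst₂ (λ a b → a + # Y ≤ # (Y ⊞ S) + b) HS≡S H≡h (mn Y y ys) }
      where
      S = lookup v
      W : Pr n
      W x = S (neg x)
      bigS : θ * N < θ * # S + h
      bigS = <-≤-trans big (+-monoˡ-≤ h (*-monoʳ-≤ θ (#-mono A⊑S)))
      3S>n : n < 3 * # S
      3S>n = dense (# S) bigS
      S≥1 : 1 ≤ # S
      S≥1 = n≢0⇒n>0 λ e → <⇒≱ 3S>n (≤-trans (≤-reflexive (cong (3 *_) e)) z≤n)
      WS : # S + # (W ⊞ S) ≤ n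
      WS = ≤-trans (+-monoʳ-≤ (# S) (#-mono (neg-⊞-SF S sf))) (≤-reflexive (#-∁ S))
      WS<n : # (W ⊞ S) < n
      WS<n = ≤-trans (+-monoˡ-≤ _ S≥1) WS
      M = mann S W (subst (1 ≤_) (sym (#-neg S)) S≥1) WS<n
      H = proj₁ M
      sub = proj₁ (proj₂ M)
      proper = proj₁ (proj₂ (proj₂ M))
      mn = proj₂ (proj₂ (proj₂ M))
      -- The competitor for `H` in Mann's theorem is -S, whose sumset with `S` is S - S and misses
      -- `S`.
      small : # (H ⊞ S) + (# S + # S) ≤ n + # H
      small = begin
        # (H ⊞ S) + (# S + # S) ≡⟨ +-assoc (# (H ⊞ S)) (# S) (# S) ⟨
        # (H ⊞ S) + # S + # S ≡⟨ cong (λ z → # (H ⊞ S) + z + # S) (#-neg S) ⟨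
        # (H ⊞ S) + # W + # S ≤⟨ +-monoˡ-≤ (# S) (mn W (subst (1 ≤_) (sym (#-neg S)) S≥1) WS<n) ⟩
        # (W ⊞ S) + # H + # S ≡⟨ +-assoc (# (W ⊞ S)) (# H) (# S) ⟩
        # (W ⊞ S) + (# H + # S) ≡⟨ cong (# (W ⊞ S) +_) (+-comm (# H) (# S)) ⟩
        # (W ⊞ S) + (# S + # H) ≡⟨ +-assoc (# (W ⊞ S)) (# S) (# H) ⟨
        # (W ⊞ S) + # S + # H ≡⟨ cong (_+ # H) (+-comm (# (W ⊞ S)) (# S)) ⟩
        # S + # (W ⊞ S) + # H ≤⟨ +-monoˡ-≤ (# H) WS ⟩
        n + # H ∎
        where open ≤-Reasoning
      open Saturate S H sf sub 3S>n small proper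
      T : Subset n
      T = tabulate (H ⊞ S)
      HS≤S : # (H ⊞ S) ≤ # S
      HS≤S = ≤-trans (≤-reflexive (#-cong (λ x → sym (lookup∘tabulate (H ⊞ S) x))))
        (maxi T ((λ x p → trans (lookup∘tabulate (H ⊞ S) x) (S⊑HS x (A⊑S x p))) ,
          λ x y p q r → HS-SF x y (trans (sym (lookup∘tabulate (H ⊞ S) x)) p) (trans (sym (lookup∘tabulate (H ⊞ S) y)) q) (trans (sym (lookup∘tabulate (H ⊞ S) (x ⊕ y))) r)))
      HS≡S : # (H ⊞ S) ≡ # S
      HS≡S = ≤-antisym HS≤S (#-mono S⊑HS)
      per : Per H S
      per x y p q = ⊑-eq S⊑HS HS≤S (x ⊕ y) (trans (cong (H ⊞ S) (⊕-comm x y)) (⊞-intro {H} q p))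
      c = quotient (lagrange-group sub)
      u = quotient (lagrange sub S per)
      nc : n ≡ c * # H
      nc = _∣_.equality (lagrange-group sub)
      #S : # S ≡ u * # H
      #S = _∣_.equality (lagrange sub S per)
      instance
        H-nz : NonZero (# H)
        H-nz = >-nonZero (#H≥1 sub)
      c<3u : c < 3 * u
      c<3u = *-cancelʳ-< (# H) _ _ (subst₂ _<_ nc (trans (cong (3 *_) #S) (sym (*-assoc 3 u (# H)))) 3S>n)
      -- Since H + S = S, `small` reads 3|S| ≤ n + |H|. Together with n < 3|S| it pins 3u to c + 1,
      -- so the index c is 2 modulo 3.
      3u≤c+1 : 3 * u ≤ c + 1
      3u≤c+1 = *-cancelʳ-≤ (3 * u) (c + 1) (# H) (+-cancelˡ-≤ 0 _ _ (begin
        3 * u * # H ≡⟨ *-assoc 3 u (# H) ⟩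
        3 * (u * # H) ≡⟨ cong (3 *_) #S ⟨
        3 * # S ≡⟨ l (# S) ⟩
        # S + (# S + # S) ≡⟨ cong (_+ (# S + # S)) HS≡S ⟨
        # (H ⊞ S) + (# S + # S) ≤⟨ small ⟩
        n + # H ≡⟨ cong (_+ # H) nc ⟩
        c * # H + # H ≡⟨ l′ c (# H) ⟩
        (c + 1) * # H ∎))
        where
        open ≤-Reasoning
        l : ∀ s → 3 * s ≡ s + (s + s)
        l = solve-∀
        l′ : ∀ c h → c * h + h ≡ (c + 1) * h
        l′ = solve-∀
      3u≡c+1 : 3 * u ≡ c + 1
      3u≡c+1 = ≤-antisym 3u≤c+1 (subst (_≤ 3 * u) (+-comm 1 c) c<3u)
      c%3 : c % 3 ≡ 2
      c%3 = m c u 3u≡c+1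
        where
        m : ∀ c u → 3 * u ≡ c + 1 → c % 3 ≡ 2
        m c zero e = ⊥-elim (<⇒≢ (m<m+n 0 (≤-trans (s≤s z≤n) (m≤n+m 1 c))) e)
        m c (suc u) e = trans (cong (_% 3) (+-cancelʳ-≡ 1 c (2 + u * 3) (trans (sym e) (l u)))) ([m+kn]%n≡m%n 2 u 3)
          where
          l : ∀ u → 3 * suc u ≡ 2 + u * 3 + 1
          l = solve-∀
      c≡q : c ≡ q
      c≡q = ≤-antisym (index-upper u c (# H) (subst (λ z → θ * N < θ * z + h) #S bigS) 3u≡c+1 nc)
        (q-least c (divides (# H) (trans nc (*-comm c (# H)))) c%3)
      u≡ : u ≡ suc k
      u≡ = *-cancelˡ-≡ u (suc k) 3 (trans 3u≡c+1 (trans (cong (_+ 1) (trans c≡q q≡)) (l k)))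
        where
        l : ∀ k → 3 * k + 2 + 1 ≡ 3 * suc k
        l = solve-∀
      H≡h : # H ≡ h
      H≡h = *-cancelˡ-≡ (# H) h q {{>-nonZero (subst (1 ≤_) (sym q≡) (≤-trans (s≤s z≤n) (m≤n+m 2 (3 * k))))}}
        (trans (cong (_* # H) (sym c≡q)) (trans (sym nc) n≡))

-- Multiples, orders and maximum sum-free sets

opaque
  inverse-mod : ∀ q d → Prime q → ¬ (q ∣ d) → ∃[ a ] ∃[ b ] a * d ≡ 1 + b * q
  inverse-mod q d pr ∤ with coprime-Bézout {q} {d} cop
    where
    cop : Coprime q d
    cop (e∣q , e∣d) with prime⇒irreducible pr e∣q
    ... | inj₁ e1 = e1
    ... | inj₂ refl = ⊥-elim (∤ e∣d)
  ... | Bézout.-+ x y eq = y , x , sym eq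
  ... | Bézout.+- x y eq = go q x (nonTrivial⇒n>1 q {{prime⇒nonTrivial pr}}) eq
    where
    go : ∀ q x → 1 < q → 1 + y * d ≡ x * q → ∃[ a ] ∃[ b ] a * d ≡ 1 + b * q
    -- Bézout's identity came with the wrong sign, y d ≡ -1; multiplication by q - 1 = suc r repairs
    -- it.
    go (suc (suc r)) (suc x) (s≤s (s≤s z≤n)) eq = suc r * y , r + suc r * x ,
      +-cancelˡ-≡ (suc r) _ _ (trans (l₁ r y d) (trans (cong (suc r *_) eq) (l₂ r x)))
      where
      l₁ : ∀ r y d → suc r + suc r * y * d ≡ suc r * (1 + y * d)
      l₁ = solve-∀
      l₂ : ∀ r x → suc r * (suc x * suc (suc r)) ≡ suc r + (1 + (r + suc r * x) * suc (suc r))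
      l₂ = solve-∀

sum-unique : ∀ {m} (f : Pr m) → (∀ i j → f i ≡ true → f j ≡ true → i ≡ j) → # f ≡ ⟦ anyb f ⟧
sum-unique {m} f uniq with bool-cases (anyb f)
... | inj₁ t with anyb-true f t
... | i , fi = trans (trans (#-cong {A = f} {i ==_} (λ j → bool-ext (λ fj → ⌊⌋-intro (uniq i j fi fj)) (λ e → trans (cong f (sym (⌊⌋-true e))) fi)))
        (#-singleton i)) (sym (cong ⟦_⟧ t))
sum-unique f uniq | inj₂ e = trans (sum-zero _ (λ i → cong ⟦_⟧ (¬true (λ fi → absurd-b (anyb-intro f i fi) e)))) (sym (cong ⟦_⟧ e))

module Multiples {n : ℕ} (G : FG n) where
  open Structure G public

  infixl 7 _·_
  _·_ : ℕ → Fin n → Fin n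
  zero · x = 𝟘
  suc j · x = x ⊕ j · x

  ·-+ : ∀ i j x → (i + j) · x ≡ i · x ⊕ j · x
  ·-+ zero j x = sym (⊕-identityˡ _)
  ·-+ (suc i) j x = trans (cong (x ⊕_) (·-+ i j x)) (sym (⊕-assoc _ _ _))

  ·-* : ∀ i j x → (i * j) · x ≡ i · (j · x)
  ·-* zero j x = refl
  ·-* (suc i) j x = trans (·-+ j (i * j) x) (cong (j · x ⊕_) (·-* i j x))

  ·-⊕ : ∀ j x y → j · (x ⊕ y) ≡ j · x ⊕ j · y
  ·-⊕ zero x y = sym (⊕-identityˡ _)
  ·-⊕ (suc j) x y = trans (cong (x ⊕ y ⊕_) (·-⊕ j x y)) (gsolve (v0 :+ v1 :+ (v2 :+ v3)) (v0 :+ v2 :+ (v1 :+ v3)) refl (x ∷ y ∷ j · x ∷ j · y ∷ []))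

  ·-𝟘 : ∀ j → j · 𝟘 ≡ 𝟘
  ·-𝟘 zero = refl
  ·-𝟘 (suc j) = trans (⊕-identityˡ _) (·-𝟘 j)

  1· : ∀ x → 1 · x ≡ x
  1· x = ⊕𝟘 x

  ·-neg : ∀ j x → j · neg x ≡ neg (j · x)
  ·-neg j x = ⊕-cancelʳ (j · x) _ _ (trans (sym (·-⊕ j (neg x) x)) (trans (cong (j ·_) (⊕-inverseˡ x)) (trans (·-𝟘 j) (sym (⊕-inverseˡ _)))))

  ·-⊖ : ∀ j x y → j · (x ⊖ y) ≡ j · x ⊖ j · y
  ·-⊖ j x y = trans (·-⊕ j x (neg y)) (cong (j · x ⊕_) (·-neg j y))

  module _ {K : Pr n} (sub : IsSub K) where
    open IsSub sub

    has-· : ∀ j {x} → K ∋∋ x → K ∋∋ j · x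
    has-· zero p = has-𝟘
    has-· (suc j) p = has-⊕ p (has-· j p)

    -- `ext` is the subgroup generated by K and x, and `ord` the order of x modulo K. Arguments
    -- about the cyclic quotient are made with these two.
    record Ext (x : Fin n) : Set where
      field
        ord : ℕ
        ord≥1 : 1 ≤ ord
        ord-in : K ∋∋ ord · x
        ord-div : ∀ i → K ∋∋ i · x → ord ∣ i
        ext : Pr n
        ext-sub : IsSub ext
        ext-size : # ext ≡ ord * # K
        ext-intro : ∀ {z} i → K ∋∋ z ⊖ i · x → ext ∋∋ z
        ext-elim : ∀ {z} → ext ∋∋ z → ∃[ i ] K ∋∋ z ⊖ i · x

    opaque
      -- Two of the n + 1 multiples 0x, ..., nx coincide, so some positive multiple is in K; the
      -- least one divides the others by division with remainder.
      relative-order : ∀ x → ∃[ j ] (1 ≤ j × K ∋∋ j · x × (∀ i → K ∋∋ i · x → j ∣ i))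
      relative-order x with FinP.pigeonhole (n<1+n n) (λ i → toℕ i · x)
      ... | i , j , i<j , e with least {λ d → 1 ≤ d × K ∋∋ d · x} (λ d → (1 ≤? d) ×-dec (K (d · x) ≟ᵇ true)) (toℕ j ∸ toℕ i)
            (m<n⇒0<n∸m i<j , subst (K ∋∋_) (sym (⊕-cancelʳ (toℕ i · x) _ _ (trans (sym (·-+ (toℕ j ∸ toℕ i) (toℕ i) x))
              (trans (cong (_· x) (m∸n+n≡m (<⇒≤ i<j))) (trans (sym e) (sym (⊕-identityˡ _))))))) has-𝟘)
      ... | d , (d≥1 , Kd) , _ , mn = d , d≥1 , Kd , div
        where
        instance
          d-nz : NonZero d
          d-nz = >-nonZero d≥1
        div : ∀ i → K ∋∋ i · x → d ∣ i
        div i Ki = m%n≡0⇒n∣m i d (n≮0⇒n≡0 (λ lt → mn (i % d) (m%n<n i d) (lt , Kr)))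
          where
          n≮0⇒n≡0 : ∀ {r} → ¬ (1 ≤ r) → r ≡ 0
          n≮0⇒n≡0 {zero} _ = refl
          n≮0⇒n≡0 {suc r} f = ⊥-elim (f (s≤s z≤n))
          Kr : K ∋∋ (i % d) · x
          Kr = trans (cong K (trans (sym (⊕⊖ ((i % d) · x) ((i / d * d) · x))) (cong (_⊖ (i / d * d) · x)
              (trans (sym (·-+ (i % d) (i / d * d) x)) (cong (_· x) (sym (m≡m%n+[m/n]*n i d)))))))
            (has-⊖ sub Ki (subst (K ∋∋_) (sym (·-* (i / d) d x)) (has-· (i / d) Kd)))

    extend-by : ∀ x d → 1 ≤ d → K ∋∋ d · x → (∀ i → K ∋∋ i · x → d ∣ i) → Ext x
    extend-by x d d≥1 Kd div = record
      { ord = d ; ord≥1 = d≥1 ; ord-in = Kd ; ord-div = div ; ext = K′ ; ext-sub = K′-sub ; ext-size = K′-size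
      ; ext-intro = λ {z} → K′-intro z ; ext-elim = λ {z} → K′-elim z }
      where
      instance
        d-nz : NonZero d
        d-nz = >-nonZero d≥1
      K′ : Pr n
      K′ z = anyb (λ (i : Fin d) → K (z ⊖ toℕ i · x))
      K-shift : ∀ z i j → K ∋∋ z ⊖ i · x → K ∋∋ (i · x ⊖ j · x) → K ∋∋ z ⊖ j · x
      K-shift z i j p q = trans (cong K (gsolve (v0 :- v2) (v0 :- v1 :+ (v1 :- v2)) refl (z ∷ i · x ∷ j · x ∷ []))) (has-⊕ p q)
      K′-intro : ∀ z i → K ∋∋ z ⊖ i · x → K′ ∋∋ z
      K′-intro z i p = anyb-intro (λ (i : Fin d) → K (z ⊖ toℕ i · x)) (fromℕ< (m%n<n i d)) (K-shift z i (toℕ (fromℕ< (m%n<n i d))) p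
        (subst (λ r → K ∋∋ i · x ⊖ r · x) (sym (toℕ-fromℕ< (m%n<n i d)))
          (trans (cong K (trans (cong (λ w → w · x ⊖ (i % d) · x) (m≡m%n+[m/n]*n i d)) (trans (cong (_⊖ (i % d) · x) (·-+ (i % d) (i / d * d) x))
            (trans (⊕⊖ˡ _ _) (·-* (i / d) d x))))) (has-· (i / d) Kd))))
      K′-elim : ∀ z → K′ ∋∋ z → ∃[ i ] K ∋∋ z ⊖ i · x
      K′-elim z p with anyb-true (λ (i : Fin d) → K (z ⊖ toℕ i · x)) p
      ... | i , q = toℕ i , q
      K′-sub : IsSub K′
      K′-sub = record
        { has-𝟘 = K′-intro 𝟘 0 (subst (K ∋∋_) (sym (x⊖x 𝟘)) has-𝟘)
        ; has-⊕ = λ {y} {z} p q → let (i , a) = K′-elim y p ; (j , b) = K′-elim z q in K′-intro (y ⊕ z) (i + j)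
            (trans (cong K (trans (cong (y ⊕ z ⊖_) (·-+ i j x)) (gsolve (v0 :+ v1 :- (v2 :+ v3)) (v0 :- v2 :+ (v1 :- v3)) refl (y ∷ z ∷ i · x ∷ j · x ∷ [])))) (has-⊕ a b))
        ; has-neg = λ {z} p → let (i , a) = K′-elim z p in K′-intro (neg z) (i * (d ∸ 1))
            (trans (cong K (trans (gsolve (:- v0 :- v2) (:- (v0 :- v1) :- (v1 :+ v2)) refl (z ∷ i · x ∷ (i * (d ∸ 1)) · x ∷ []))
               (cong (neg (z ⊖ i · x) ⊖_) (trans (sym (·-+ i (i * (d ∸ 1)) x)) (trans (cong (_· x) (trans (sym (*-suc i (d ∸ 1))) (cong (i *_) (suc-pred d)))) (·-* i d x))))))
              (has-⊖ sub (has-neg a) (has-· i Kd))) }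
      uniq : ∀ z (i j : Fin d) → K ∋∋ z ⊖ toℕ i · x → K ∋∋ z ⊖ toℕ j · x → toℕ i < toℕ j → ⊥
      uniq z i j p q lt = <⇒≱ (≤-<-trans (m∸n≤m (toℕ j) (toℕ i)) (toℕ<n j)) (∣⇒≤ {{>-nonZero (m<n⇒0<n∸m lt)}} (div (toℕ j ∸ toℕ i)
        (trans (cong K (⊕-cancelʳ (toℕ i · x) _ _ (trans (sym (·-+ (toℕ j ∸ toℕ i) (toℕ i) x)) (trans (cong (_· x) (m∸n+n≡m (<⇒≤ lt)))
          (gsolve v2 (v0 :- v1 :- (v0 :- v2) :+ v1) refl (z ∷ toℕ i · x ∷ toℕ j · x ∷ [])))))) (has-⊖ sub p q))))
      K′-size : # K′ ≡ d * # K
      K′-size = begin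
        # K′ ≡⟨ sum-cong-≗ (λ z → sum-unique (λ (i : Fin d) → K (z ⊖ toℕ i · x)) (λ i j p q → case <-cmp (toℕ i) (toℕ j) of λ where
            (tri< lt _ _) → ⊥-elim (uniq z i j p q lt)
            (tri≈ _ e _) → toℕ-injective e
            (tri> _ _ gt) → ⊥-elim (uniq z j i q p gt))) ⟨
        sum (λ z → sum (λ (i : Fin d) → ⟦ K (z ⊖ toℕ i · x) ⟧)) ≡⟨ ∑-comm (λ z (i : Fin d) → ⟦ K (z ⊖ toℕ i · x) ⟧) ⟩
        sum (λ (i : Fin d) → # (τ (toℕ i · x) K)) ≡⟨ sum-cong-≗ (λ (i : Fin d) → #-τ (toℕ i · x) K) ⟩
        sum {d} (λ _ → # K) ≡⟨ sum-const d (# K) ⟩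
        d * # K ∎
        where open ≡-Reasoning

    opaque
      extend : ∀ x → Ext x
      extend x = extend-by x (proj₁ r) (proj₁ (proj₂ r)) (proj₁ (proj₂ (proj₂ r))) (proj₂ (proj₂ (proj₂ r)))
        where
        r : ∃[ j ] (1 ≤ j × K ∋∋ j · x × (∀ i → K ∋∋ i · x → j ∣ i))
        r = relative-order x

  trivial : Pr n
  trivial = 𝟘 ==_

  trivial-sub : IsSub trivial
  trivial-sub = record
    { has-𝟘 = ⌊⌋-intro refl
    ; has-⊕ = λ p q → ⌊⌋-intro (sym (trans (cong₂ _⊕_ (sym (⌊⌋-true p)) (sym (⌊⌋-true q))) (⊕𝟘 𝟘)))
    ; has-neg = λ p → ⌊⌋-intro (trans (gsolve :0 (:- :0) refl []) (cong neg (⌊⌋-true p))) }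

  IsSub? : ∀ K → Dec (IsSub K)
  IsSub? K = map′ (λ (a , b , c) → record { has-𝟘 = a ; has-⊕ = λ {x} {y} → b x y ; has-neg = λ {x} → c x })
    (λ s → IsSub.has-𝟘 s , (λ x y → IsSub.has-⊕ s) , λ x → IsSub.has-neg s)
    ((K 𝟘 ≟ᵇ true) ×-dec (all? (λ x → all? (λ y → (K x ≟ᵇ true) →-dec ((K y ≟ᵇ true) →-dec (K (x ⊕ y) ≟ᵇ true)))) ×-dec
      all? (λ x → (K x ≟ᵇ true) →-dec (K (neg x) ≟ᵇ true))))

  IsSub-cong : ∀ {K L} → (∀ x → K x ≡ L x) → IsSub K → IsSub L
  IsSub-cong h s = record
    { has-𝟘 = trans (sym (h _)) (IsSub.has-𝟘 s)
    ; has-⊕ = λ p q → trans (sym (h _)) (IsSub.has-⊕ s (trans (h _) p) (trans (h _) q))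
    ; has-neg = λ p → trans (sym (h _)) (IsSub.has-neg s (trans (h _) p)) }

  -- A subgroup K maximal with q ∤ |K| is proper, and any x outside has order divisible by q.
  cauchy : ∀ q → Prime q → q ∣ n → ∃[ g ] (g ≢ 𝟘 × q · g ≡ 𝟘)
  cauchy q pr q∣n with argmax {P = λ v → IsSub (lookup v) × ¬ (q ∣ # (lookup v))}
      (λ v → IsSub? (lookup v) ×-dec ¬? (q ∣? # (lookup v))) (λ v → # (lookup v)) n (λ v → #≤n (lookup v))
      (tabulate trivial , IsSub-cong (λ x → sym (lookup∘tabulate trivial x)) trivial-sub ,
        λ d → <⇒≱ (nonTrivial⇒n>1 q {{prime⇒nonTrivial pr}}) (∣⇒≤ (subst (q ∣_) (trans (#-cong (lookup∘tabulate trivial)) (#-singleton 𝟘)) d)))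
  ... | v , (sub , q∤) , maxi = body
    where
    K = lookup v
    x-out : ∃[ x ] ¬ (K ∋∋ x)
    x-out with any? (λ x → ¬? (K x ≟ᵇ true))
    ... | yes r = r
    ... | no ¬r = ⊥-elim (q∤ (subst (q ∣_) (sym (trans (#-cong {A = K} {λ _ → true} (λ x → bool-ext (λ _ → refl) (λ _ → [ id , (λ f → ⊥-elim (¬r (x , λ t → absurd-b t f))) ]′ (bool-cases (K x)))))
        (trans (sum-const n 1) (*-identityʳ n)))) q∣n))
    x = proj₁ x-out
    module X = Ext (extend sub x)
    q∣ord : q ∣ X.ord
    q∣ord with q ∣? # X.ext
    ... | yes d = [ id , (λ e → ⊥-elim (q∤ e)) ]′ (euclidsLemma X.ord (# K) pr (subst (q ∣_) X.ext-size d))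
    ... | no ¬d = ⊥-elim (proj₂ x-out (K⊇ x (X.ext-intro 1 (trans (cong K (trans (cong (x ⊖_) (1· x)) (x⊖x x))) (IsSub.has-𝟘 sub)))))
      where
      K⊑ : K ⊑ X.ext
      K⊑ z p = X.ext-intro 0 (trans (cong K (gsolve (v0 :- :0) v0 refl (z ∷ []))) p)
      K⊇ : X.ext ⊑ K
      K⊇ = ⊑-eq K⊑ (≤-trans (≤-reflexive (#-cong (λ z → sym (lookup∘tabulate X.ext z)))) (maxi (tabulate X.ext)
        (IsSub-cong (λ z → sym (lookup∘tabulate X.ext z)) X.ext-sub , λ d → ¬d (subst (q ∣_) (#-cong (lookup∘tabulate X.ext)) d))))
    body : ∃[ g ] (g ≢ 𝟘 × q · g ≡ 𝟘)
    body = c · x , ne , trans (sym (·-* q c x)) (trans (cong (_· x) (trans (*-comm q c) (sym oe))) (sym (⌊⌋-true o-in)))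
      where
      ro = relative-order trivial-sub x
      o = proj₁ ro
      o≥1 = proj₁ (proj₂ ro)
      o-in = proj₁ (proj₂ (proj₂ ro))
      o-div = proj₂ (proj₂ (proj₂ ro))
      q∣o : q ∣ o
      q∣o = ∣-trans q∣ord (X.ord-div o (trans (cong K (sym (⌊⌋-true o-in))) (IsSub.has-𝟘 sub)))
      c = quotient q∣o
      oe : o ≡ c * q
      oe = _∣_.equality q∣o
      c≥1 : 1 ≤ c
      c≥1 = n≢0⇒n>0 λ c0 → <⇒≱ o≥1 (≤-reflexive (trans oe (cong (_* q) c0)))
      ne : c · x ≢ 𝟘
      ne e = <⇒≱ (subst (c <_) (sym oe) (m<m*n c q {{>-nonZero c≥1}} (nonTrivial⇒n>1 q {{prime⇒nonTrivial pr}}))) (∣⇒≤ {{>-nonZero c≥1}} (o-div c (⌊⌋-intro (sym e))))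

  module Max (q k h : ℕ) (q≡ : q ≡ 3 * k + 2) (n≡ : n ≡ q * h) (q-least : ∀ c → c ∣ n → c % 3 ≡ 2 → q ≤ c) where
    open TypeI q k h q≡ n≡ q-least public

    opaque
      -- Stability applied at full size: the structured set that contains `B` has no room for
      -- further elements.
      max-structure : ∀ B → SF B → # B ≡ N → MaxStr N h B
      max-structure B sf e = record
          { sumfree = sf ; size = e ; period = St.period ; period-sub = St.period-sub ; period-size = St.period-size
          ; periodic = λ x y p r → ⊒ _ (St.periodic x y (B⊑ x p) r)
          ; minimal = λ Y y ys → subst₂ (λ a b → a + # Y ≤ b + h) (trans St.size (sym e)) (#-cong (eq Y)) (St.minimal Y y (subst (_< n) (sym (#-cong (eq Y))) ys)) }
        where
        stab : ∃[ B′ ] (B ⊑ B′ × MaxStr N h B′)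
        stab = stability B sf (subst (λ z → θ * N < θ * z + h) (sym e) (m<m+n (θ * N) h≥1))
        B′ : Pr n
        B′ = proj₁ stab
        B⊑ : B ⊑ B′
        B⊑ = proj₁ (proj₂ stab)
        module St = MaxStr (proj₂ (proj₂ stab))
        ⊒ : B′ ⊑ B
        ⊒ = ⊑-eq B⊑ (≤-reflexive (trans St.size (sym e)))
        eq : ∀ Y z → (Y ⊞ B′) z ≡ (Y ⊞ B) z
        eq Y z = bool-ext (λ p → case ⊞-elim {Y} p of λ (x , a , b) → ⊞-intro′ x a (⊒ _ b))
          (λ p → case ⊞-elim {Y} p of λ (x , a , b) → ⊞-intro′ x a (B⊑ _ b))

    N≥1 : 1 ≤ N
    N≥1 = *-mono-≤ (s≤s (z≤n {k})) h≥1

    -- Mann's inequality gives |B - B| ≥ 2N - h = n - N, so B - B is the whole complement of `B`.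
    -- One representation s = b′ - b then yields h of them, by moving b and b′ together along the
    -- period.
    many-differences : ∀ B → MaxStr N h B → ∀ s → ¬ (B ∋∋ s) → h ≤ # (λ x → B x ∧ B (x ⊕ s))
    many-differences B st s ¬Bs = ≤-trans (≤-reflexive (trans (sym period-size) (sym (#-τ (neg x) H))))
        (#-mono {A = τ (neg x) H} (λ y p → ∧-intro
          (trans (cong B (gsolve v1 (:- v0 :+ (v1 :- :- v0)) refl (x ∷ y ∷ []))) (periodic _ _ (proj₁ (proj₂ rep)) p))
          (trans (cong B (gsolve (v1 :+ v2) (v2 :- v0 :+ (v1 :- :- v0)) refl (x ∷ y ∷ s ∷ []))) (periodic _ _ (proj₂ (proj₂ rep)) p))))
      where
      open MaxStr st
      H W : Pr n
      H = period
      W x = B (neg x)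
      W⊑ : W ⊞ B ⊑ ∁ B
      W⊑ = neg-⊞-SF B sumfree
      ∁B-size : N + # (∁ B) ≡ n
      ∁B-size = trans (cong (_+ # (∁ B)) (sym size)) (#-∁ B)
      W-lower : N + N ≤ # (W ⊞ B) + h
      W-lower = subst (λ z → z + z ≤ # (W ⊞ B) + h) size (subst (λ z → # B + z ≤ # (W ⊞ B) + h) (#-neg B)
        (minimal W (subst (1 ≤_) (trans (sym size) (sym (#-neg B))) N≥1)
        (≤-<-trans (#-mono W⊑) (subst (# (∁ B) <_) ∁B-size (m<n+m _ N≥1)))))
      ∁B⊑ : ∁ B ⊑ W ⊞ B
      ∁B⊑ = ⊑-eq W⊑ (+-cancelʳ-≤ h _ _ (+-cancelˡ-≤ N _ _ (begin
        N + (# (∁ B) + h) ≡⟨ +-assoc N _ h ⟨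
        N + # (∁ B) + h ≡⟨ cong (_+ h) (trans ∁B-size n≡′) ⟩
        (3 * k + 2) * h + h ≡⟨ l k h ⟩
        N + (N + N) ≤⟨ +-monoʳ-≤ N W-lower ⟩
        N + (# (W ⊞ B) + h) ∎)))
        where
        open ≤-Reasoning
        l : ∀ k h → (3 * k + 2) * h + h ≡ suc k * h + (suc k * h + suc k * h)
        l = solve-∀
      rep : ∃[ x ] (W ∋∋ x × B ∋∋ s ⊖ x)
      rep = ⊞-elim {W} {B} (∁B⊑ s (not-intro′ ¬Bs))
      x : Fin n
      x = proj₁ rep

    -- If a, b and a + b lie in W, then W - a - b and W - a nearly miss W, so they overlap substantially,
    -- whereas b is a rare difference.
    removal : ∀ W η → 9 * η ≤ 2 * h → θ * N < θ * # W + h → (∀ a → W ∋∋ a → # (λ x → W x ∧ W (x ⊕ a)) ≤ η) → SF W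
    removal W η 9η≤ big light a b Va Vb Vc = <⇒≱ big (ar (# W) (# (X₁ ∪ X₂)) v-small)
      where
      c = a ⊕ b
      X₁ = τ a W
      X₂ = τ c W
      ov : ∀ d → W ∋∋ d → # (W ∩ τ d W) ≤ η
      ov d Vd = ≤-trans (≤-reflexive (trans (sym (#-shift (W ∩ τ d W) d)) (#-cong (λ x → trans (∧-comm (W (x ⊕ d)) _) (cong (λ z → W z ∧ W (x ⊕ d)) (⊕⊖ x d)))))) (light d Vd)
      ov₁₂ : # (X₁ ∩ X₂) ≤ η
      ov₁₂ = ≤-trans (≤-reflexive (trans (sym (#-shift (X₁ ∩ X₂) c)) (#-cong (λ x → trans (∧-comm (W (x ⊕ c ⊖ a)) _) (cong₂ (λ z w → W z ∧ W w) (⊕⊖ x c)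
        (gsolve (v0 :+ (v1 :+ v2) :- v1) (v0 :+ v2) refl (x ∷ a ∷ b ∷ [])))))) ) (light b Vb)
      e₁₂ : # (X₁ ∪ X₂) + # (X₁ ∩ X₂) ≡ # W + # W
      e₁₂ = trans (#-∪∩ X₁ X₂) (cong₂ _+_ (#-τ a W) (#-τ c W))
      ov₀ : # (W ∩ (X₁ ∪ X₂)) ≤ η + η
      ov₀ = ≤-trans (#-mono {A = W ∩ (X₁ ∪ X₂)} {(W ∩ X₁) ∪ (W ∩ X₂)} (λ x p → let (u , w) = ∧-true {W x} p in
          [ (λ r → ∨-introˡ (∧-intro u r)) , (λ r → ∨-introʳ {(W ∩ X₁) x} (∧-intro u r)) ]′ (∨-true {X₁ x} w)))
        (≤-trans (≤-trans (m≤m+n _ _) (≤-reflexive (#-∪∩ (W ∩ X₁) (W ∩ X₂)))) (+-mono-≤ (ov a Va) (ov c Vc)))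
      v-small : # W + (# W + # W) ≤ n + (η + η + η)
      v-small = begin
        # W + (# W + # W) ≡⟨ cong (# W +_) e₁₂ ⟨
        # W + (# (X₁ ∪ X₂) + # (X₁ ∩ X₂)) ≡⟨ +-assoc (# W) _ _ ⟨
        # W + # (X₁ ∪ X₂) + # (X₁ ∩ X₂) ≡⟨ cong (_+ # (X₁ ∩ X₂)) (#-∪∩ W (X₁ ∪ X₂)) ⟨
        # (W ∪ (X₁ ∪ X₂)) + # (W ∩ (X₁ ∪ X₂)) + # (X₁ ∩ X₂) ≤⟨ +-mono-≤ (+-mono-≤ (#≤n (W ∪ (X₁ ∪ X₂))) ov₀) ov₁₂ ⟩
        n + (η + η) + η ≡⟨ +-assoc n (η + η) η ⟩
        n + (η + η + η) ∎
        where open ≤-Reasoning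
      -- The bound on η comes from here: 3|W| ≤ n + 3η, whereas |W| > N - h/θ gives 3|W| > n + h -
      -- h/(3(k + 1)) ≥ n + 2h/3.
      ar : ∀ v u → v + (v + v) ≤ n + (η + η + η) → θ * v + h ≤ θ * N
      ar v u le = begin
        9 * suc k * v + h ≡⟨ l₁ k v h ⟩
        3 * suc k * (v + (v + v)) + h ≤⟨ +-monoˡ-≤ h (*-monoʳ-≤ (3 * suc k) le) ⟩
        3 * suc k * (n + (η + η + η)) + h ≡⟨ cong (λ z → 3 * suc k * (z + (η + η + η)) + h) n≡′ ⟩
        3 * suc k * ((3 * k + 2) * h + (η + η + η)) + h ≡⟨ l₂ k h η ⟩
        suc k * (9 * η) + (3 * suc k * ((3 * k + 2) * h) + h) ≤⟨ +-monoˡ-≤ _ (*-monoʳ-≤ (suc k) 9η≤) ⟩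
        suc k * (2 * h) + (3 * suc k * ((3 * k + 2) * h) + h) ≤⟨ m≤m+n _ (k * h) ⟩
        suc k * (2 * h) + (3 * suc k * ((3 * k + 2) * h) + h) + k * h ≡⟨ l₃ k h ⟩
        9 * suc k * (suc k * h) ∎
        where
        open ≤-Reasoning
        l₁ : ∀ k v h → 9 * suc k * v + h ≡ 3 * suc k * (v + (v + v)) + h
        l₁ = solve-∀
        l₂ : ∀ k h η → 3 * suc k * ((3 * k + 2) * h + (η + η + η)) + h ≡ suc k * (9 * η) + (3 * suc k * ((3 * k + 2) * h) + h)
        l₂ = solve-∀
        l₃ : ∀ k h → suc k * (2 * h) + (3 * suc k * ((3 * k + 2) * h) + h) + k * h ≡ 9 * suc k * (suc k * h)
        l₃ = solve-∀

-- Sum-free sets of residues modulo a prime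

add-mod : ∀ a b q .{{_ : NonZero q}} → (a % q + b) % q ≡ (a + b) % q
add-mod a b q = trans (%-distribˡ-+ (a % q) b q) (trans (cong (λ z → (z + b % q) % q) (m%n%n≡m%n a q)) (sym (%-distribˡ-+ a b q)))

add-modʳ : ∀ a b q .{{_ : NonZero q}} → (a + b % q) % q ≡ (a + b) % q
add-modʳ a b q = trans (cong (_% q) (+-comm a (b % q))) (trans (add-mod b a q) (cong (_% q) (+-comm b a)))

module Residues (q : ℕ) (nz : NonZero q) where
  private
    instance
      q-nz : NonZero q
      q-nz = nz

  fin : ℕ → Fin q
  fin a = fromℕ< (m%n<n a q)

  toℕ-fin : ∀ a → toℕ (fin a) ≡ a % q
  toℕ-fin a = toℕ-fromℕ< (m%n<n a q)

  fin-cong : ∀ {a b} → a % q ≡ b % q → fin a ≡ fin b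
  fin-cong {a} {b} e = toℕ-injective (trans (toℕ-fin a) (trans e (sym (toℕ-fin b))))

  fin-toℕ : ∀ i → fin (toℕ i) ≡ i
  fin-toℕ i = toℕ-injective (trans (toℕ-fin (toℕ i)) (m<n⇒m%n≡m (toℕ<n i)))

  fin-period : ∀ a b → fin (a + b * q) ≡ fin a
  fin-period a b = fin-cong ([m+kn]%n≡m%n a b q)

  _⊞q_ : Fin q → Fin q → Fin q
  i ⊞q j = fin (toℕ i + toℕ j)

  fin-+ : ∀ a b → fin a ⊞q fin b ≡ fin (a + b)
  fin-+ a b = fin-cong (trans (cong₂ (λ u v → (u + v) % q) (toℕ-fin a) (toℕ-fin b)) (trans (add-mod a (b % q) q) (add-modʳ a b q)))

  ZG : FG q
  ZG = record
    { _⊕_ = _⊞q_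
    ; neg = λ i → fin (q ∸ toℕ i)
    ; 𝟘 = fin 0
    ; ⊕-assoc = λ x y z → trans (cong (fin (toℕ x + toℕ y) ⊞q_) (sym (fin-toℕ z))) (trans (fin-+ _ _) (trans (cong fin (+-assoc (toℕ x) (toℕ y) (toℕ z)))
        (trans (sym (fin-+ (toℕ x) _)) (cong (_⊞q fin (toℕ y + toℕ z)) (fin-toℕ x)))))
    ; ⊕-comm = λ x y → cong fin (+-comm (toℕ x) (toℕ y))
    ; ⊕-identityˡ = λ x → trans (cong (fin 0 ⊞q_) (sym (fin-toℕ x))) (trans (fin-+ 0 (toℕ x)) (fin-toℕ x))
    ; ⊕-inverseˡ = λ x → trans (cong (fin (q ∸ toℕ x) ⊞q_) (sym (fin-toℕ x))) (trans (fin-+ _ _)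
        (trans (cong fin (m∸n+n≡m (<⇒≤ (toℕ<n x)))) (fin-cong (trans (n%n≡0 q) (sym (0%n≡0 q))))))
    }
    where
    0%n≡0 : ∀ q .{{_ : NonZero q}} → 0 % q ≡ 0
    0%n≡0 (suc q) = refl

  open Multiples ZG public

  ·-fin : ∀ a b → a · fin b ≡ fin (a * b)
  ·-fin zero b = refl
  ·-fin (suc a) b = trans (cong (fin b ⊞q_) (·-fin a b)) (fin-+ b (a * b))

  ·-toℕ : ∀ a x → a · x ≡ fin (a * toℕ x)
  ·-toℕ a x = trans (cong (a ·_) (sym (fin-toℕ x))) (·-fin a (toℕ x))

#-interval : ∀ {n} a b → b ≤ n → # (λ (y : Fin n) → (a ≤b toℕ y) ∧ (suc (toℕ y) ≤b b)) ≡ b ∸ a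
#-interval {zero} a .0 z≤n = trans (sum-0 _) (sym (0∸n≡0 a))
#-interval {suc n} a zero b≤ = trans (sum-zero _ (λ i → cong ⟦_⟧ (trans (cong ((a ≤b toℕ i) ∧_) (≤b-false (λ ()))) (∧-zeroʳ _)))) (sym (0∸n≡0 a))
#-interval {suc n} zero (suc b) (s≤s b≤) = trans (sum-suc _) (cong₂ _+_ (cong ⟦_⟧ {(0 ≤b 0) ∧ (suc 0 ≤b suc b)} (∧-intro (≤b-intro z≤n) (≤b-intro (s≤s z≤n))))
  (trans (#-cong (λ i → cong₂ _∧_ (trans (≤b-intro z≤n) (sym (≤b-intro z≤n))) (bool-ext (λ p → ≤b-intro (s≤s⁻¹ (≤b-true p))) (λ p → ≤b-intro (s≤s (≤b-true p)))))) (#-interval {n} 0 b b≤)))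
#-interval {suc n} (suc a) (suc b) (s≤s b≤) = trans (sum-suc _) (cong₂ _+_ (cong (λ z → ⟦ z ∧ (suc 0 ≤b suc b) ⟧) (≤b-false {suc a} {0} λ ()))
  (trans (#-cong (λ i → cong₂ _∧_ (bool-ext (λ p → ≤b-intro (s≤s⁻¹ (≤b-true p))) (λ p → ≤b-intro (s≤s (≤b-true p))))
    (bool-ext (λ p → ≤b-intro (s≤s⁻¹ (≤b-true p))) (λ p → ≤b-intro (s≤s (≤b-true p)))))) (#-interval {n} a b b≤)))

module MiddleThird (q k : ℕ) (q≡ : q ≡ 3 * k + 2) (pr : Prime q) where
  private
    instance
      q-nz : NonZero q
      q-nz = prime⇒nonZero pr

  open Residues q q-nz public

  middle : Pr q
  middle y = (suc k ≤b toℕ y) ∧ (suc (toℕ y) ≤b suc k + suc k)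

  2k+2≤q : suc k + suc k ≤ q
  2k+2≤q = subst (suc k + suc k ≤_) (trans (l k) (sym q≡)) (m≤m+n _ k)
    where
    l : ∀ k → suc k + suc k + k ≡ 3 * k + 2
    l = solve-∀

  #middle : # middle ≡ suc k
  #middle = trans (#-interval (suc k) (suc k + suc k) 2k+2≤q) (m+n∸m≡n (suc k) (suc k))

  middle-intro : ∀ a → suc k ≤ a → a < suc k + suc k → middle ∋∋ fin a
  middle-intro a p r = ∧-intro (≤b-intro (subst (suc k ≤_) (sym e) p)) (≤b-intro (subst (_< suc k + suc k) (sym e) r))
    where
    e : toℕ (fin a) ≡ a
    e = trans (toℕ-fin a) (m<n⇒m%n≡m (<-≤-trans r 2k+2≤q))

  -- Two elements of the middle third add up to at least 2k + 2, and, once the sum wraps past q, to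
  -- at most k.
  middle-SF : SF middle
  middle-SF x y p r s with ∧-true {(suc k ≤b toℕ x)} p | ∧-true {(suc k ≤b toℕ y)} r | ∧-true {(suc k ≤b toℕ (x ⊕ y))} s
  ... | a₁ , b₁ | a₂ , b₂ | a₃ , b₃ with toℕ x + toℕ y <? q
  ... | yes lt = <⇒≱ (subst (_< suc k + suc k) (trans (toℕ-fin _) (m<n⇒m%n≡m lt)) (≤b-true b₃)) (+-mono-≤ (≤b-true a₁) (≤b-true a₂))
  ... | no ≮ = <⇒≱ (begin-strict
      toℕ x + toℕ y ≡⟨ m+[n∸m]≡n (≮⇒≥ ≮) ⟨
      q + (toℕ x + toℕ y ∸ q) <⟨ ub ⟩
      q + suc k ∎) (≤-trans (+-monoʳ-≤ q lb) (≤-reflexive (m+[n∸m]≡n (≮⇒≥ ≮))))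
    where
    open ≤-Reasoning
    w = toℕ x + toℕ y ∸ q
    ub : q + w < q + suc k
    ub = begin-strict
      q + w ≡⟨ m+[n∸m]≡n (≮⇒≥ ≮) ⟩
      toℕ x + toℕ y ≤⟨ +-mono-≤ (s≤s⁻¹ (≤b-true b₁)) (s≤s⁻¹ (≤b-true b₂)) ⟩
      k + suc k + (k + suc k) ≡⟨ l k ⟩
      3 * k + 2 + k ≡⟨ cong (_+ k) q≡ ⟨
      q + k <⟨ +-monoʳ-< q (n<1+n k) ⟩
      q + suc k ∎
      where
      l : ∀ k → k + suc k + (k + suc k) ≡ 3 * k + 2 + k
      l = solve-∀
    w<q : w < q
    w<q = +-cancelˡ-< q _ _ (<-≤-trans ub (+-monoʳ-≤ q (≤-trans (m≤m+n _ _) 2k+2≤q)))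
    lb : suc k ≤ w
    lb = subst (suc k ≤_) (trans (toℕ-fin _) (trans (cong (_% q) (trans (sym (m+[n∸m]≡n (≮⇒≥ ≮))) (+-comm q w))) (trans ([m+n]%n≡m%n w q) (m<n⇒m%n≡m w<q)))) (≤b-true a₃)

  -- Only one element of `T` has its predecessor outside `T`. As 0 is not in `T`, this is the least
  -- element e, and `T` is the run e, ..., e + k without wrapping. If e ≤ k, the run contains 2e; if
  -- e ≥ k + 2, it contains two elements with sum e + q.
  interval : ∀ T → SF T → # T ≡ suc k → k ≤ # (T ∩ τ (fin 1) T) → ∀ y → T y ≡ middle y
  interval T sf size adj = λ y → bool-ext (λ p → ∧-intro (≤b-intro (subst (_≤ toℕ y) e≡ (e-low y p))) (≤b-intro (subst (λ z → toℕ y < z + suc k) e≡ (upper y p))))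
      (λ p → let (a , b) = ∧-true {(suc k ≤b toℕ y)} p in fill y (subst (_≤ toℕ y) (sym e≡) (≤b-true a)) (subst (λ z → toℕ y < z + suc k) (sym e≡) (≤b-true b)))
    where
    t : ℕ → Bool
    t j = T (fin j)
    t-toℕ : ∀ y → T ∋∋ y → t (toℕ y) ≡ true
    t-toℕ y p = trans (cong T (fin-toℕ y)) p
    t0 : ¬ (t 0 ≡ true)
    t0 p = sf (fin 0) (fin 0) p p (trans (cong T (⊕-identityˡ (fin 0))) p)
    inh = #-inhab T (subst (1 ≤_) (sym size) (s≤s z≤n))
    lst = least {λ j → t j ≡ true} (λ j → t j ≟ᵇ true) (toℕ (proj₁ inh)) (t-toℕ _ (proj₂ inh))
    e = proj₁ lst
    te : t e ≡ true
    te = proj₁ (proj₂ lst)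
    e<q : e < q
    e<q = ≤-<-trans (proj₁ (proj₂ (proj₂ lst))) (toℕ<n (proj₁ inh))
    e-least : ∀ i → i < e → ¬ (t i ≡ true)
    e-least = proj₂ (proj₂ (proj₂ lst))
    e-low : ∀ y → T ∋∋ y → e ≤ toℕ y
    e-low y p = ≮⇒≥ λ lt → e-least _ lt (t-toℕ y p)
    e≥1 : 1 ≤ e
    e≥1 = n≢0⇒n>0 λ e0 → t0 (subst (λ z → t z ≡ true) e0 te)
    starts : Pr q
    starts = T ∩ ∁ (τ (fin 1) T)
    #starts : # starts ≤ 1
    #starts = +-cancelˡ-≤ k _ _ (begin
      k + # starts ≤⟨ +-monoˡ-≤ _ adj ⟩
      # (T ∩ τ (fin 1) T) + # starts ≡⟨ #-split T (τ (fin 1) T) ⟩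
      # T ≡⟨ size ⟩
      suc k ≡⟨ +-comm 1 k ⟩
      k + 1 ∎)
      where open ≤-Reasoning
    starts-unique : ∀ x y → starts ∋∋ x → starts ∋∋ y → x ≡ y
    starts-unique x y p r with x FinP.≟ y
    ... | yes eq = eq
    ... | no ne = ⊥-elim (<⇒≱ (s≤s (s≤s z≤n)) (begin
        2 ≡⟨ cong₂ _+_ (#-singleton x) (#-singleton y) ⟨
        # (x ==_) + # (y ==_) ≡⟨ #-∪∩ (x ==_) (y ==_) ⟨
        # ((x ==_) ∪ (y ==_)) + # ((x ==_) ∩ (y ==_)) ≡⟨ cong (# ((x ==_) ∪ (y ==_)) +_) (sum-zero _ (λ i → cong ⟦_⟧ (¬true (λ w → let (u , v) = ∧-true {x == i} w in ne (trans (⌊⌋-true u) (sym (⌊⌋-true v))))))) ⟩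
        # ((x ==_) ∪ (y ==_)) + 0 ≡⟨ +-identityʳ _ ⟩
        # ((x ==_) ∪ (y ==_)) ≤⟨ #-mono {A = (x ==_) ∪ (y ==_)} {starts} (λ i w → [ (λ u → trans (cong starts (sym (⌊⌋-true u))) p) , (λ u → trans (cong starts (sym (⌊⌋-true u))) r) ]′ (∨-true {x == i} w)) ⟩
        # starts ≤⟨ #starts ⟩
        1 ∎))
      where open ≤-Reasoning
    pred-fin : ∀ j → fin (suc j) ⊖ fin 1 ≡ fin j
    pred-fin j = ⊕-cancelʳ (fin 1) _ _ (trans (⊖⊕ (fin (suc j)) (fin 1)) (trans (cong fin (+-comm 1 j)) (sym (fin-+ j 1))))
    e-start : starts ∋∋ fin e
    e-start = ∧-intro te (not-intro′ (go e e≥1 e-least))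
      where
      go : ∀ e → 1 ≤ e → (∀ i → i < e → ¬ (t i ≡ true)) → ¬ (T ∋∋ fin e ⊖ fin 1)
      go (suc e) _ h p = h e (n<1+n e) (trans (cong T (sym (pred-fin e))) p)
    down : ∀ j → suc j < q → e ≤ j → t (suc j) ≡ true → t j ≡ true
    down j lt e≤j p with bool-cases (t j)
    ... | inj₁ r = r
    ... | inj₂ r = ⊥-elim (<⇒≢ (s≤s e≤j) (trans (sym (m<n⇒m%n≡m e<q)) (trans (sym (toℕ-fin e)) (trans (cong toℕ
      (starts-unique (fin e) (fin (suc j)) e-start (∧-intro p (not-intro (trans (cong T (pred-fin j)) r))))) (trans (toℕ-fin (suc j)) (m<n⇒m%n≡m lt))))))
    down* : ∀ i d → i + d < q → e ≤ i → t (i + d) ≡ true → t i ≡ true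
    down* i zero lt le p = subst (λ z → t z ≡ true) (+-identityʳ i) p
    down* i (suc d) lt le p = down* i d (<-trans (n<1+n _) lt′) le (down (i + d) lt′ (≤-trans le (m≤m+n i d)) (subst (λ z → t z ≡ true) (+-suc i d) p))
      where
      lt′ : suc (i + d) < q
      lt′ = subst (_< q) (+-suc i d) lt
    segment : ∀ i j → e ≤ i → i ≤ j → j < q → t j ≡ true → t i ≡ true
    segment i j le ij jq p = down* i (j ∸ i) (subst (_< q) (sym (m+[n∸m]≡n ij)) jq) le (subst (λ z → t z ≡ true) (sym (m+[n∸m]≡n ij)) p)
    upper : ∀ y → T ∋∋ y → toℕ y < e + suc k
    upper y p = ≮⇒≥ λ lt → <⇒≱ (begin-strict
      suc k <⟨ n<1+n _ ⟩
      suc (suc k) ≡⟨ m+n∸m≡n e (suc (suc k)) ⟨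
      e + suc (suc k) ∸ e ≤⟨ ∸-monoˡ-≤ e (subst (_≤ suc (toℕ y)) (sym (+-suc e (suc k))) lt) ⟩
      suc (toℕ y) ∸ e ≡⟨ #-interval e (suc (toℕ y)) (toℕ<n y) ⟨
      # (λ z → (e ≤b toℕ z) ∧ (suc (toℕ z) ≤b suc (toℕ y))) ≤⟨ #-mono {A = λ z → (e ≤b toℕ z) ∧ (suc (toℕ z) ≤b suc (toℕ y))} {T} (λ z w → let (u , v) = ∧-true {(e ≤b toℕ z)} w in
          trans (cong T (sym (fin-toℕ z))) (segment (toℕ z) (toℕ y) (≤b-true u) (s≤s⁻¹ (≤b-true v)) (toℕ<n y) (t-toℕ y p))) ⟩
      # T ∎) (≤-reflexive size)
      where open ≤-Reasoning
    fill : ∀ y → e ≤ toℕ y → toℕ y < e + suc k → T ∋∋ y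
    fill y le lt with bool-cases (T y)
    ... | inj₁ r = r
    ... | inj₂ r = ⊥-elim (<⇒≱ (begin-strict
        # T ≤⟨ #-mono {A = T} {λ z → (e ≤b toℕ z) ∧ (suc (toℕ z) ≤b toℕ y)} (λ z p → ∧-intro (≤b-intro (e-low z p)) (≤b-intro (≰⇒> λ yz →
              absurd-b (trans (cong T (sym (fin-toℕ y))) (segment (toℕ y) (toℕ z) le yz (toℕ<n z) (t-toℕ z p))) r))) ⟩
        # (λ z → (e ≤b toℕ z) ∧ (suc (toℕ z) ≤b toℕ y)) ≡⟨ #-interval e (toℕ y) (<⇒≤ (toℕ<n y)) ⟩
        toℕ y ∸ e <⟨ +-cancelˡ-< e _ _ (subst (_< e + suc k) (sym (m+[n∸m]≡n le)) lt) ⟩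
        suc k ∎) (≤-reflexive (sym size)))
      where open ≤-Reasoning
    e+k<q : e + suc k ≤ q
    e+k<q = ≮⇒≥ λ lt → <⇒≱ (begin-strict
      # T ≤⟨ #-mono {A = T} {λ z → (e ≤b toℕ z) ∧ (suc (toℕ z) ≤b q)} (λ z p → ∧-intro (≤b-intro (e-low z p)) (≤b-intro (toℕ<n z))) ⟩
      # (λ z → (e ≤b toℕ z) ∧ (suc (toℕ z) ≤b q)) ≡⟨ #-interval e q ≤-refl ⟩
      q ∸ e <⟨ +-cancelˡ-< e _ _ (subst (_< e + suc k) (sym (m+[n∸m]≡n (<⇒≤ e<q))) lt) ⟩
      suc k ∎) (≤-reflexive (sym size))
      where open ≤-Reasoning
    t-fill : ∀ j → j ≤ k → t (e + j) ≡ true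
    t-fill j j≤k = fill (fin (e + j)) (subst (e ≤_) (sym eq) (m≤m+n e j)) (subst (_< e + suc k) (sym eq) (+-monoʳ-< e (s≤s j≤k)))
      where
      eq : toℕ (fin (e + j)) ≡ e + j
      eq = trans (toℕ-fin (e + j)) (m<n⇒m%n≡m (<-≤-trans (+-monoʳ-< e (s≤s j≤k)) e+k<q))
    e>k : suc k ≤ e
    e>k = ≮⇒≥ λ { (s≤s e≤k) → sf (fin e) (fin e) te te (trans (cong T (fin-+ e e)) (t-fill e e≤k)) }
    -- With s = q - e ≤ 2k, both s ∸ k and s ⊓ k are at most k and they add up to s; the elements at
    -- these distances from e add up to e + q.
    e≤k+1 : e ≤ suc k
    e≤k+1 = ≮⇒≥ λ lt → sf (fin (e + (s ∸ k))) (fin (e + (s ⊓ k))) (t-fill _ (s∸k≤k lt)) (t-fill _ (m⊓n≤n s k))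
      (trans (cong T (trans (fin-+ _ _) (trans (cong fin (trans (+-interchange e (s ∸ k) e (s ⊓ k)) (trans (cong (e + e +_) (trans (+-comm (s ∸ k) _) (s⊓k s k)))
        (trans (+-assoc e e s) (cong (e +_) (trans (m+[n∸m]≡n (<⇒≤ e<q)) (sym (+-identityʳ q)))))))) (fin-period e 1)))) te)
      where
      s = q ∸ e
      s⊓k : ∀ s k → s ⊓ k + (s ∸ k) ≡ s
      s⊓k s k = trans (cong (_+ (s ∸ k)) (⊓-comm s k)) (m⊓n+n∸m≡n k s)
      s∸k≤k : suc k < e → s ∸ k ≤ k
      s∸k≤k lt = m≤n+o⇒m∸n≤o s k (m≤n+o⇒m∸n≤o q e (begin
        q ≡⟨ q≡ ⟩
        3 * k + 2 ≡⟨ l k ⟩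
        suc (suc k) + (k + k) ≤⟨ +-monoˡ-≤ (k + k) lt ⟩
        e + (k + k) ∎))
        where
        open ≤-Reasoning
        l : ∀ k → 3 * k + 2 ≡ suc (suc k) + (k + k)
        l = solve-∀
    e≡ : e ≡ suc k
    e≡ = ≤-antisym e≤k+1 e>k

  unit-inverse : ∀ d → d ≢ fin 0 → ∃[ a ] ∃[ b ] a * toℕ d ≡ 1 + b * q
  unit-inverse d d≢0 = inverse-mod q (toℕ d) pr λ q∣d → d≢0 (trans (sym (fin-toℕ d)) (fin-cong (trans (n∣m⇒m%n≡0 (toℕ d) q q∣d) (sym (n∣m⇒m%n≡0 0 q (q ∣0))))))

  scale-inverse : ∀ d a b → a * toℕ d ≡ 1 + b * q → ∀ y → toℕ (fin (a * toℕ y)) · d ≡ y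
  scale-inverse d a b e y = trans (·-toℕ (toℕ (fin (a * toℕ y))) d) (trans (fin-cong (begin
    (toℕ (fin (a * toℕ y)) * toℕ d) % q ≡⟨ cong (λ z → (z * toℕ d) % q) (toℕ-fin (a * toℕ y)) ⟩
    ((a * toℕ y) % q * toℕ d) % q ≡⟨ %-distribˡ-* ((a * toℕ y) % q) (toℕ d) q ⟩
    ((a * toℕ y) % q % q * (toℕ d % q)) % q ≡⟨ cong (λ z → (z * (toℕ d % q)) % q) (m%n%n≡m%n (a * toℕ y) q) ⟩
    ((a * toℕ y) % q * (toℕ d % q)) % q ≡⟨ %-distribˡ-* (a * toℕ y) (toℕ d) q ⟨
    (a * toℕ y * toℕ d) % q ≡⟨ cong (_% q) (l a (toℕ y) (toℕ d)) ⟩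
    (a * toℕ d * toℕ y) % q ≡⟨ cong (λ z → (z * toℕ y) % q) e ⟩
    ((1 + b * q) * toℕ y) % q ≡⟨ cong (_% q) (l′ b q (toℕ y)) ⟩
    (toℕ y + b * toℕ y * q) % q ≡⟨ [m+kn]%n≡m%n (toℕ y) (b * toℕ y) q ⟩
    toℕ y % q ∎)) (fin-toℕ y))
    where
    open ≡-Reasoning
    l : ∀ a y d → a * y * d ≡ a * d * y
    l = solve-∀
    l′ : ∀ b q y → (1 + b * q) * y ≡ y + b * y * q
    l′ = solve-∀

  scale-inverse′ : ∀ d a b → a * toℕ d ≡ 1 + b * q → ∀ y → fin (a * toℕ (toℕ y · d)) ≡ y
  scale-inverse′ d a b e y = trans (fin-cong (begin
    (a * toℕ (toℕ y · d)) % q ≡⟨ cong (λ z → (a * toℕ z) % q) (·-toℕ (toℕ y) d) ⟩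
    (a * toℕ (fin (toℕ y * toℕ d))) % q ≡⟨ cong (λ z → (a * z) % q) (toℕ-fin (toℕ y * toℕ d)) ⟩
    (a * ((toℕ y * toℕ d) % q)) % q ≡⟨ %-distribˡ-* a ((toℕ y * toℕ d) % q) q ⟩
    ((a % q) * ((toℕ y * toℕ d) % q % q)) % q ≡⟨ cong (λ z → ((a % q) * z) % q) (m%n%n≡m%n (toℕ y * toℕ d) q) ⟩
    ((a % q) * ((toℕ y * toℕ d) % q)) % q ≡⟨ %-distribˡ-* a (toℕ y * toℕ d) q ⟨
    (a * (toℕ y * toℕ d)) % q ≡⟨ cong (_% q) (l a (toℕ y) (toℕ d)) ⟩
    (a * toℕ d * toℕ y) % q ≡⟨ cong (λ z → (z * toℕ y) % q) e ⟩
    ((1 + b * q) * toℕ y) % q ≡⟨ cong (_% q) (l′ b q (toℕ y)) ⟩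
    (toℕ y + b * toℕ y * q) % q ≡⟨ [m+kn]%n≡m%n (toℕ y) (b * toℕ y) q ⟩
    toℕ y % q ∎)) (fin-toℕ y)
    where
    open ≡-Reasoning
    l : ∀ a y d → a * (y * d) ≡ a * d * y
    l = solve-∀
    l′ : ∀ b q y → (1 + b * q) * y ≡ y + b * y * q
    l′ = solve-∀

  #-scale : ∀ d → d ≢ fin 0 → ∀ T → # (λ y → T (toℕ y · d)) ≡ # T
  #-scale d d≢0 T with unit-inverse d d≢0
  ... | a , b , e = sum-reindex (λ y → ⟦ T y ⟧) (λ y → toℕ y · d) (λ y → fin (a * toℕ y)) (scale-inverse d a b e) (scale-inverse′ d a b e)

#-remove : ∀ {n} (B : Pr n) i → # B ≤ suc (# (B ∩ ∁ (i ==_)))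
#-remove B i = ≤-trans (≤-reflexive (sym (#-split B (i ==_)))) (+-monoˡ-≤ _ (≤-trans (#-mono {A = B ∩ (i ==_)} {i ==_} (λ j p → proj₂ (∧-true {B j} p))) (≤-reflexive (#-singleton i))))

opaque
  two-elements : ∀ {n} (B : Pr n) → 2 ≤ # B → ∃[ x ] ∃[ y ] (x ≢ y × B ∋∋ x × B ∋∋ y)
  two-elements B le with #-inhab B (≤-trans (s≤s z≤n) le)
  ... | x , Bx with #-inhab (B ∩ ∁ (x ==_)) (s≤s⁻¹ (≤-trans le (#-remove B x)))
  ... | y , p with ∧-true {B y} p
  ... | By , ne = x , y , (λ e → absurd-b (⌊⌋-intro e) (not-true ne)) , Bx , By

  three-elements : ∀ {n} (B : Pr n) → 3 ≤ # B → ∃[ x ] ∃[ y ] ∃[ z ] (x ≢ y × x ≢ z × y ≢ z × B ∋∋ x × B ∋∋ y × B ∋∋ z)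
  three-elements B le with #-inhab B (≤-trans (s≤s z≤n) le)
  ... | x , Bx with two-elements (B ∩ ∁ (x ==_)) (s≤s⁻¹ (≤-trans le (#-remove B x)))
  ... | y , z , y≢z , p , r with ∧-true {B y} p | ∧-true {B z} r
  ... | By , ne | Bz , ne′ = x , y , z , (λ e → absurd-b (⌊⌋-intro e) (not-true ne)) , (λ e → absurd-b (⌊⌋-intro e) (not-true ne′)) , y≢z , Bx , By , Bz

-- Scattered sets and Vosper's theorem

module Sidon {n : ℕ} (G : FG n) where
  open Grp G

  ⊞-comm-⊑ : ∀ X Y → X ⊞ Y ⊑ Y ⊞ X
  ⊞-comm-⊑ X Y z p with ⊞-elim {X} {Y} p
  ... | x , a , b = ⊞-intro′ (z ⊖ x) b (trans (cong X (⊖⊖ z x)) a)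

  #-⊞-comm : ∀ X Y → # (X ⊞ Y) ≡ # (Y ⊞ X)
  #-⊞-comm X Y = ≤-antisym (#-mono (⊞-comm-⊑ X Y)) (#-mono (⊞-comm-⊑ Y X))

  τ⊑ : ∀ {A B : Pr n} {b} → B ∋∋ b → τ b A ⊑ A ⊞ B
  τ⊑ {A} {B} {b} Bb z p = ⊞-intro′ (z ⊖ b) p (trans (cong B (⊖⊖ z b)) Bb)

  #-τ∩τ : ∀ A b c → # (τ b A ∩ τ c A) ≡ # (A ∩ τ (c ⊖ b) A)
  #-τ∩τ A b c = trans (sym (#-shift (τ b A ∩ τ c A) b)) (#-cong (λ x → cong₂ (λ u v → A u ∧ A v) (⊕⊖ x b)
    (gsolve (v0 :+ v1 :- v2) (v0 :- (v2 :- v1)) refl (x ∷ b ∷ c ∷ []))))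

  ⊖≢𝟘 : ∀ b c → b ≢ c → c ⊖ b ≢ 𝟘
  ⊖≢𝟘 b c ne e = ne (trans (sym (⊕𝟘 b)) (trans (cong (b ⊕_) (sym e)) (⊕⊕⊖ b c)))
    where
    ⊕⊕⊖ : ∀ b c → b ⊕ (c ⊖ b) ≡ c
    ⊕⊕⊖ b c = gsolve (v0 :+ (v1 :- v0)) v1 refl (b ∷ c ∷ [])

  -- Sidon sets: no nonzero difference occurs twice.
  Scattered : Pr n → Set
  Scattered A = ∀ g → g ≢ 𝟘 → # (A ∩ τ g A) ≤ 1

  sumset-two : ∀ A B b c → B ∋∋ b → B ∋∋ c → # A + # A ≤ # (A ⊞ B) + # (A ∩ τ (c ⊖ b) A)
  sumset-two A B b c Bb Bc = begin
    # A + # A ≡⟨ cong₂ _+_ (#-τ b A) (#-τ c A) ⟨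
    # (τ b A) + # (τ c A) ≡⟨ #-∪∩ (τ b A) (τ c A) ⟨
    # (τ b A ∪ τ c A) + # (τ b A ∩ τ c A) ≤⟨ +-mono-≤ (#-mono {A = τ b A ∪ τ c A} (λ z p → [ τ⊑ {A} {B} Bb z , τ⊑ {A} {B} Bc z ]′ (∨-true {τ b A z} p))) (≤-reflexive (#-τ∩τ A b c)) ⟩
    # (A ⊞ B) + # (A ∩ τ (c ⊖ b) A) ∎
    where open ≤-Reasoning

  -- Three translates of `A` lie in the sumset, and any two of them share at most one element.
  sumset-three : ∀ A B → Scattered A → 3 ≤ # B → # A + (# A + # A) ≤ # (A ⊞ B) + 3
  sumset-three A B sc le with three-elements B le
  ... | b , c , d , bc , bd , cd , Bb , Bc , Bd = begin
    # A + (# A + # A) ≡⟨ cong₂ _+_ (#-τ d A) (cong₂ _+_ (#-τ b A) (#-τ c A)) ⟨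
    # D + (# P + # Q) ≡⟨ cong (# D +_) (#-∪∩ P Q) ⟨
    # D + (# (P ∪ Q) + # (P ∩ Q)) ≡⟨ +-assoc (# D) _ _ ⟨
    # D + # (P ∪ Q) + # (P ∩ Q) ≡⟨ cong (_+ # (P ∩ Q)) (#-∪∩ D (P ∪ Q)) ⟨
    # (D ∪ (P ∪ Q)) + # (D ∩ (P ∪ Q)) + # (P ∩ Q) ≤⟨ +-mono-≤ (+-mono-≤ (#-mono {A = D ∪ (P ∪ Q)} {A ⊞ B} all) i₂) (i b c bc) ⟩
    # (A ⊞ B) + 2 + 1 ≡⟨ +-assoc (# (A ⊞ B)) 2 1 ⟩
    # (A ⊞ B) + 3 ∎
    where
    open ≤-Reasoning
    D = τ d A
    P = τ b A
    Q = τ c A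
    all : D ∪ (P ∪ Q) ⊑ A ⊞ B
    all z p with ∨-true {D z} p
    ... | inj₁ r = τ⊑ {A} {B} Bd z r
    ... | inj₂ r = [ τ⊑ {A} {B} Bb z , τ⊑ {A} {B} Bc z ]′ (∨-true {P z} r)
    i : ∀ b c → b ≢ c → # (τ b A ∩ τ c A) ≤ 1
    i b c ne = subst (_≤ 1) (sym (#-τ∩τ A b c)) (sc (c ⊖ b) (⊖≢𝟘 b c ne))
    i₂ : # (D ∩ (P ∪ Q)) ≤ 2
    i₂ = ≤-trans (#-mono {A = D ∩ (P ∪ Q)} {(P ∩ D) ∪ (Q ∩ D)} (λ x p → let (u , w) = ∧-true {D x} p in
          [ (λ r → ∨-introˡ (∧-intro r u)) , (λ r → ∨-introʳ {(P ∩ D) x} (∧-intro r u)) ]′ (∨-true {P x} w)))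
        (≤-trans (≤-trans (m≤m+n _ _) (≤-reflexive (#-∪∩ (P ∩ D) (Q ∩ D)))) (+-mono-≤ (i b d bd) (i c d cd)))

module Vosper (q k : ℕ) (q≡ : q ≡ 3 * k + 2) (pr : Prime q) where
  open MiddleThird q k q≡ pr public
  open Sidon ZG

  private
    instance
      q-nz : NonZero q
      q-nz = prime⇒nonZero pr

  q-least : ∀ c → c ∣ q → c % 3 ≡ 2 → q ≤ c
  q-least c c∣q c%3 with prime⇒irreducible pr c∣q
  ... | inj₁ refl = ⊥-elim (0≢1 c%3)
    where
    0≢1 : 1 % 3 ≢ 2
    0≢1 ()
  ... | inj₂ refl = ≤-refl

  module Z = Max q k 1 q≡ (sym (*-identityʳ q)) q-least

  -- `X` is closed under subtraction of g, and modulo a prime the multiples of g run through all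
  -- residues.
  closed-full : ∀ X g → g ≢ fin 0 → 1 ≤ # X → X ⊑ τ g X → q ≤ # X
  closed-full X g g≢0 ne st with #-inhab X ne
  ... | x , Xx with unit-inverse g g≢0
  ... | a , b , e = ≤-trans (≤-reflexive (sym (trans (sum-const q 1) (*-identityʳ q)))) (#-mono {A = λ _ → true} {X} (λ y _ →
      trans (cong X (trans (sym (⊖⊖ x y)) (cong (x ⊖_) (sym (scale-inverse g a b e (x ⊖ y)))))) (walk (toℕ (fin (a * toℕ (x ⊖ y)))))))
    where
    walk : ∀ j → X ∋∋ x ⊖ j · g
    walk zero = trans (cong X (gsolve (v0 :- :0) v0 refl (x ∷ []))) Xx
    walk (suc j) = trans (cong X (gsolve (v0 :- (v1 :+ v2)) (v0 :- v2 :- v1) refl (x ∷ g ∷ j · g ∷ []))) (st _ (walk j))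

  -- By `atom-translate`, a 2-atom that meets its translate by g in two elements is invariant under
  -- g, hence everything, although its sumset misses two elements.
  atom-scattered : ∀ {S X} → IsAtom 2 S X → 1 ≤ # S → Scattered X
  atom-scattered {S} {X} at S≥1 g g≢0 = ≮⇒≥ λ lt → <⇒≱ (begin-strict
      # X <⟨ m<m+n (# X) {2} (s≤s z≤n) ⟩
      # X + 2 ≤⟨ +-monoˡ-≤ 2 (≤-trans (#≤#⊞ X S (proj₁ s) (proj₂ s)) ≤-refl) ⟩
      # (X ⊞ S) + 2 ≤⟨ proj₂ adm ⟩
      q ∎) (closed-full X g g≢0 (≤-trans (s≤s z≤n) (proj₁ adm)) (atom-translate at g lt))
    where
    open IsAtom at
    open ≤-Reasoning
    s = #-inhab S S≥1

  module _ (k≥1 : 1 ≤ k) (T : Pr q) (sf : SF T) (size : # T ≡ suc k) where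
    self-sum : # T + # (T ⊞ T) ≤ q
    self-sum = ≤-trans (+-monoʳ-≤ (# T) (#-mono {A = T ⊞ T} {∁ T} λ z p → case ⊞-elim {T} {T} p of λ (x , a , b) → not-intro′ λ c → sf x (z ⊖ x) a b (trans (cong T (⊕⊖′ x z)) c)))
      (≤-reflexive (#-∁ T))

    size≥2 : 2 ≤ # T
    size≥2 = subst (2 ≤_) (sym size) (s≤s k≥1)

    self-adm : Adm 2 T T
    self-adm = size≥2 , ≤-trans (+-monoʳ-≤ (# (T ⊞ T)) size≥2) (≤-trans (≤-reflexive (+-comm (# (T ⊞ T)) _)) self-sum)

  -- A 2-atom X of T has two elements: otherwise X and a 2-atom Y of X are both too scattered
  -- for X + Y to be as small as |X| + |Y| - 1.
  two-atoms : 1 ≤ k → ∀ T → # T ≡ suc k → # T + # (T ⊞ T) ≤ q → Adm 2 T T → ∀ X Y → IsAtom 2 T X → IsAtom 2 X Y →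
    ∃[ d ] (d ≢ fin 0 × k ≤ # (T ∩ τ d T))
  two-atoms k≥1 T size T⊞T T-adm X Y atX atY = conclude
    where
    module AX = IsAtom atX
    module AY = IsAtom atY
    T≥2 : 2 ≤ # T
    T≥2 = proj₁ T-adm
    -- `T` competes with its own atom, and |T + T| ≤ q - |T| = 2|T| - 1 because it is sum-free.
    XT : # (X ⊞ T) ≤ # X + k
    XT = +-cancelʳ-≤ (suc k + suc k) _ _ (begin
      # (X ⊞ T) + (suc k + suc k) ≡⟨ cong₂ (λ a b → # (X ⊞ T) + (a + b)) size size ⟨
      # (X ⊞ T) + (# T + # T) ≡⟨ +-assoc (# (X ⊞ T)) _ _ ⟨
      # (X ⊞ T) + # T + # T ≤⟨ +-monoˡ-≤ (# T) (defi→ {T} {X} {T} (AX.min T T-adm)) ⟩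
      # (T ⊞ T) + # X + # T ≡⟨ l₁ (# (T ⊞ T)) (# X) (# T) ⟩
      # X + (# T + # (T ⊞ T)) ≤⟨ +-monoʳ-≤ (# X) T⊞T ⟩
      # X + q ≡⟨ cong (# X +_) q≡ ⟩
      # X + (3 * k + 2) ≡⟨ l₂ (# X) k ⟩
      # X + k + (suc k + suc k) ∎)
      where
      open ≤-Reasoning
      l₁ : ∀ a x t → a + x + t ≡ x + (t + a)
      l₁ = solve-∀
      l₂ : ∀ x k → x + (3 * k + 2) ≡ x + k + (suc k + suc k)
      l₂ = solve-∀
    -- `T` is admissible for `X` as well, since T + X = X + T; so `XT` also bounds the deficiency of
    -- the second atom.
    YX : # (Y ⊞ X) + 1 ≤ # X + # Y
    YX = +-cancelʳ-≤ k _ _ (begin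
      # (Y ⊞ X) + 1 + k ≡⟨ trans (+-assoc (# (Y ⊞ X)) 1 k) (cong (# (Y ⊞ X) +_) (sym size)) ⟩
      # (Y ⊞ X) + # T ≤⟨ defi→ {X} {Y} {T} (AY.min T (T≥2 , subst (λ z → z + 2 ≤ q) (#-⊞-comm X T) (proj₂ AX.adm))) ⟩
      # (T ⊞ X) + # Y ≡⟨ cong (_+ # Y) (#-⊞-comm T X) ⟩
      # (X ⊞ T) + # Y ≤⟨ +-monoˡ-≤ (# Y) XT ⟩
      # X + k + # Y ≡⟨ l (# X) k (# Y) ⟩
      # X + # Y + k ∎)
      where
      open ≤-Reasoning
      l : ∀ a k y → a + k + y ≡ a + y + k
      l = solve-∀
    XY : # (X ⊞ Y) + 1 ≤ # X + # Y
    XY = subst (λ z → z + 1 ≤ # X + # Y) (#-⊞-comm Y X) YX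
    scX : Scattered X
    scX = atom-scattered atX (≤-trans (s≤s z≤n) T≥2)
    scY : Scattered Y
    scY = atom-scattered atY (≤-trans (s≤s z≤n) (proj₁ AX.adm))
    -- If both atoms had three elements, 3|X| - 3 and 3|Y| - 3 would be at most |X| + |Y| - 1, which
    -- adds up to |X| + |Y| ≤ 4. If |Y| = 2, then 2|X| - 1 ≤ |X| + 1.
    X≤2 : # X ≤ 2
    X≤2 with 3 ≤? # Y | 3 ≤? # X
    ... | _ | no ¬X3 = s≤s⁻¹ (≰⇒> ¬X3)
    ... | no ¬Y3 | yes _ with two-elements Y (proj₁ AY.adm)
    ... | y , z , ne , Yy , Yz = +-cancelˡ-≤ (# X) _ _ (+-cancelʳ-≤ 1 _ _ (begin
        # X + # X + 1 ≤⟨ +-monoˡ-≤ 1 (sumset-two X Y y z Yy Yz) ⟩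
        # (X ⊞ Y) + # (X ∩ τ (z ⊖ y) X) + 1 ≤⟨ +-monoˡ-≤ 1 (+-monoʳ-≤ (# (X ⊞ Y)) (scX _ (⊖≢𝟘 y z ne))) ⟩
        # (X ⊞ Y) + 1 + 1 ≤⟨ +-monoˡ-≤ 1 XY ⟩
        # X + # Y + 1 ≤⟨ +-monoˡ-≤ 1 (+-monoʳ-≤ (# X) (s≤s⁻¹ (≰⇒> ¬Y3))) ⟩
        # X + 2 + 1 ∎))
      where open ≤-Reasoning
    X≤2 | yes Y3 | yes X3 = ⊥-elim (ar (# X) (# Y) (# (X ⊞ Y)) X3 Y3 XY
          (sumset-three X Y scX Y3) (subst (λ z → # Y + (# Y + # Y) ≤ z + 3) (#-⊞-comm Y X) (sumset-three Y X scY X3)))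
      where
      ar : ∀ x y s → 3 ≤ x → 3 ≤ y → s + 1 ≤ x + y → x + (x + x) ≤ s + 3 → y + (y + y) ≤ s + 3 → ⊥
      ar x y s h₁ h₂ h₃ h₄ h₅ = <⇒≱ (begin-strict
        x + (x + x) + (y + (y + y)) + (s + 1) + (s + 1) + 3 + 3 <⟨ +-monoʳ-< (x + (x + x) + (y + (y + y)) + (s + 1) + (s + 1) + 3) (s≤s (s≤s (s≤s (s≤s (z≤n {1}))))) ⟩
        x + (x + x) + (y + (y + y)) + (s + 1) + (s + 1) + 3 + 5 ≡⟨ l₀ x y s ⟩
        x + (x + x) + (y + (y + y)) + (s + 1) + (s + 1) + 3 + 3 + 2 ≤⟨ +-monoˡ-≤ 2 (+-mono-≤ (+-mono-≤ (+-mono-≤ (+-mono-≤ (+-mono-≤ h₄ h₅) h₃) h₃) h₁) h₂) ⟩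
        s + 3 + (s + 3) + (x + y) + (x + y) + x + y + 2 ≡⟨ l x y s ⟩
        x + (x + x) + (y + (y + y)) + (s + 1) + (s + 1) + 3 + 3 ∎) ≤-refl
        where
        open ≤-Reasoning
        l₀ : ∀ x y s → x + (x + x) + (y + (y + y)) + (s + 1) + (s + 1) + 3 + 5 ≡ x + (x + x) + (y + (y + y)) + (s + 1) + (s + 1) + 3 + 3 + 2
        l₀ = solve-∀
        l : ∀ x y s → s + 3 + (s + 3) + (x + y) + (x + y) + x + y + 2 ≡ x + (x + x) + (y + (y + y)) + (s + 1) + (s + 1) + 3 + 3
        l = solve-∀
    -- With two elements in the atom, T + X contains two translates of `T` and has at most k + 2
    -- elements, so these overlap in at least k.
    conclude : ∃[ d ] (d ≢ fin 0 × k ≤ # (T ∩ τ d T))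
    conclude with two-elements X (proj₁ AX.adm)
    ... | x , y , ne , Xx , Xy = y ⊖ x , ⊖≢𝟘 x y ne , +-cancelˡ-≤ (2 + k) _ _ (begin
        2 + k + k ≡⟨ l k ⟩
        suc k + suc k ≡⟨ cong₂ _+_ size size ⟨
        # T + # T ≤⟨ sumset-two T X x y Xx Xy ⟩
        # (T ⊞ X) + # (T ∩ τ (y ⊖ x) T) ≡⟨ cong (_+ # (T ∩ τ (y ⊖ x) T)) (#-⊞-comm T X) ⟩
        # (X ⊞ T) + # (T ∩ τ (y ⊖ x) T) ≤⟨ +-monoˡ-≤ _ (≤-trans XT (+-monoˡ-≤ k X≤2)) ⟩
        2 + k + # (T ∩ τ (y ⊖ x) T) ∎)
      where
      open ≤-Reasoning
      l : ∀ k → 2 + k + k ≡ suc k + suc k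
      l = solve-∀

  opaque
    almost-progression : 1 ≤ k → ∀ T → SF T → # T ≡ suc k → ∃[ d ] (d ≢ fin 0 × k ≤ # (T ∩ τ d T))
    almost-progression k≥1 T sf size = second (proj₁ first) (proj₂ first)
      where
      second : ∀ X → IsAtom 2 T X → ∃[ d ] (d ≢ fin 0 × k ≤ # (T ∩ τ d T))
      second X atX = two-atoms k≥1 T size (self-sum k≥1 T sf size) (self-adm k≥1 T sf size) X (proj₁ e) atX (proj₂ e)
        where
        e : ∃[ Y ] IsAtom 2 X Y
        e = atom-exists 2 X T (size≥2 k≥1 T sf size , subst (λ z → z + 2 ≤ q) (#-⊞-comm X T) (proj₂ (IsAtom.adm atX)))
      first : ∃[ X ] IsAtom 2 T X
      first = atom-exists 2 T T (self-adm k≥1 T sf size)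

  -- Dilation by 1/d turns difference d into 1, and `interval` applies. The case k = 0 is separate
  -- since a 2-atom argument needs two elements in `T`; there the adjacency condition is empty.
  classify : ∀ T → SF T → # T ≡ suc k → ∃[ d ] (d ≢ fin 0 × (∀ y → T (toℕ y · d) ≡ middle y))
  classify T sf size with k ≟ 0
  ... | yes k0 = fin 1 , 1≢0 , interval (λ y → T (toℕ y · fin 1)) sf′ (trans (#-scale (fin 1) 1≢0 T) size) (≤-trans (≤-reflexive k0) z≤n)
    where
    1≢0 : fin 1 ≢ fin 0
    1≢0 e = 1+n≢0 (trans (sym (m<n⇒m%n≡m (nonTrivial⇒n>1 q {{prime⇒nonTrivial pr}}))) (trans (sym (toℕ-fin 1)) (trans (cong toℕ e) (trans (toℕ-fin 0) (n∣m⇒m%n≡0 0 q (q ∣0))))))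
    sf′ : SF (λ y → T (toℕ y · fin 1))
    sf′ x y p r s = sf _ _ p r (trans (cong T (trans (trans (cong₂ _⊕_ (e x) (e y)) refl) (sym (e (x ⊕ y))))) s)
      where
      e : ∀ x → toℕ x · fin 1 ≡ x
      e x = trans (·-fin (toℕ x) 1) (trans (cong fin (*-identityʳ (toℕ x))) (fin-toℕ x))
  ... | no k≢0 with almost-progression (n≢0⇒n>0 k≢0) T sf size
  ... | d , d≢0 , adj = d , d≢0 , interval T′ sf′ (trans (#-scale d d≢0 T) size)
        (subst (k ≤_) (trans (sym (#-scale d d≢0 (T ∩ τ d T))) (#-cong (λ y → cong (T (toℕ y · d) ∧_) (cong T (pred-scale y))))) adj)
    where
    T′ : Pr q
    T′ y = T (toℕ y · d)
    fin-d : ∀ a → toℕ (fin a) · d ≡ a · d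
    fin-d a = trans (·-toℕ (toℕ (fin a)) d) (trans (fin-cong (begin
      (toℕ (fin a) * toℕ d) % q ≡⟨ cong (λ z → (z * toℕ d) % q) (toℕ-fin a) ⟩
      (a % q * toℕ d) % q ≡⟨ %-distribˡ-* (a % q) (toℕ d) q ⟩
      (a % q % q * (toℕ d % q)) % q ≡⟨ cong (λ z → (z * (toℕ d % q)) % q) (m%n%n≡m%n a q) ⟩
      (a % q * (toℕ d % q)) % q ≡⟨ %-distribˡ-* a (toℕ d) q ⟨
      (a * toℕ d) % q ∎)) (sym (·-toℕ a d)))
      where open ≡-Reasoning
    add-scale : ∀ x y → toℕ (x ⊕ y) · d ≡ toℕ x · d ⊕ toℕ y · d
    add-scale x y = trans (fin-d (toℕ x + toℕ y)) (·-+ (toℕ x) (toℕ y) d)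
    pred-scale : ∀ y → toℕ y · d ⊖ d ≡ toℕ (y ⊖ fin 1) · d
    pred-scale y = trans (cong (_⊖ d) (trans (cong (λ z → toℕ z · d) (sym (⊖⊕ y (fin 1)))) (trans (add-scale (y ⊖ fin 1) (fin 1)) (cong (toℕ (y ⊖ fin 1) · d ⊕_) (trans (fin-d 1) (1· d))))))
      (⊕⊖ _ d)
    sf′ : SF T′
    sf′ x y p r s = sf _ _ p r (trans (cong T (sym (add-scale x y))) s)

  middle-small : ∀ a → a ≤ k → ¬ (middle ∋∋ fin a)
  middle-small a a≤k p = <⇒≱ (≤b-true (proj₁ (∧-true {(suc k ≤b toℕ (fin a))} p))) (subst (_≤ k) (sym (trans (toℕ-fin a) (m<n⇒m%n≡m (≤-<-trans a≤k (<-≤-trans (s≤s (m≤m+n k _)) 2k+2≤q))))) a≤k)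

  -- The first multiple of c beyond k exceeds k by at most c, so it cannot jump over the middle
  -- third.
  overshoot : ∀ c → 2 ≤ c → c ≤ k → ∃[ j ] (1 ≤ j × j ≤ k × suc k ≤ j * c × j * c < suc k + suc k)
  overshoot c c≥2 c≤k = suc (k / c) , s≤s z≤n , m/n<m k c {{>-nonZero (≤-trans (s≤s z≤n) (≤-trans c≥2 c≤k))}} {{_}} c≥2 , lo , hi
    where
    instance
      c-nz : NonZero c
      c-nz = >-nonZero (≤-trans (s≤s z≤n) c≥2)
    lo : suc k ≤ suc (k / c) * c
    lo = begin
      suc k ≡⟨ cong suc (m≡m%n+[m/n]*n k c) ⟩
      suc (k % c) + k / c * c ≤⟨ +-monoˡ-≤ (k / c * c) (m%n<n k c) ⟩
      c + k / c * c ∎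
      where open ≤-Reasoning
    hi : suc (k / c) * c < suc k + suc k
    hi = begin-strict
      c + k / c * c ≤⟨ +-mono-≤ c≤k (m/n*n≤m k c) ⟩
      k + k <⟨ +-mono-<-≤ (n<1+n k) (n≤1+n k) ⟩
      suc k + suc k ∎
      where open ≤-Reasoning

  -- The residue r of c is the image of 1 and is thus not in the middle third. If 2 ≤ r ≤ k,
  -- `overshoot` gives j ≤ k with jr in the middle third although j is not; if r is above it, the
  -- same argument applies to q - r with signs changed.
  middle-multiplier : 1 ≤ k → ∀ c → (∀ y → middle y ≡ middle (c · y)) → c % q ≡ 1 ⊎ c % q ≡ q ∸ 1
  middle-multiplier k≥1 c inv = case₃
    where
    r = c % q
    r<q : r < q
    r<q = m%n<n c q
    inv′ : ∀ j → middle (fin j) ≡ middle (fin (j * r))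
    inv′ j = trans (inv (fin j)) (cong middle (trans (·-fin c j) (fin-cong (begin
      (c * j) % q ≡⟨ %-distribˡ-* c j q ⟩
      (r * (j % q)) % q ≡⟨ cong (λ z → (z * (j % q)) % q) (m%n%n≡m%n c q) ⟨
      (r % q * (j % q)) % q ≡⟨ %-distribˡ-* r j q ⟨
      (r * j) % q ≡⟨ cong (_% q) (*-comm r j) ⟩
      (j * r) % q ∎))))
      where open ≡-Reasoning
    r≢0 : r ≢ 0
    r≢0 e = middle-small 0 z≤n (trans (cong (λ z → middle (fin z)) (sym (trans (cong (suc k *_) e) (*-zeroʳ (suc k))))) (trans (sym (inv′ (suc k))) (middle-intro (suc k) ≤-refl (m<m+n (suc k) (s≤s z≤n)))))
    ¬mid-r : ¬ (middle ∋∋ fin r)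
    ¬mid-r p = middle-small 1 k≥1 (trans (inv′ 1) (trans (cong (λ z → middle (fin z)) (+-identityʳ r)) p))
    case₃ : r ≡ 1 ⊎ r ≡ q ∸ 1
    case₃ with r ≤? k
    ... | yes r≤k with 2 ≤? r
    ... | no ¬2 = inj₁ (≤-antisym (s≤s⁻¹ (≰⇒> ¬2)) (n≢0⇒n>0 r≢0))
    ... | yes r≥2 with overshoot r r≥2 r≤k
    ... | j , _ , j≤k , lo , hi = ⊥-elim (middle-small j j≤k (trans (inv′ j) (middle-intro (j * r) lo hi)))
    case₃ | no r≰k with r <? suc k + suc k
    ... | yes lt = ⊥-elim (¬mid-r (middle-intro r (≰⇒> r≰k) lt))
    ... | no r≥ with 2 ≤? q ∸ r
    ... | no ¬2 = inj₂ (trans (sym (m∸[m∸n]≡n (<⇒≤ r<q))) (cong (q ∸_) (≤-antisym (s≤s⁻¹ (≰⇒> ¬2)) (m<n⇒0<n∸m r<q))))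
    ... | yes d≥2 with overshoot (q ∸ r) d≥2 d≤k
      where
      d≤k : q ∸ r ≤ k
      d≤k = m≤n+o⇒m∸n≤o q r (subst (_≤ r + k) (trans (l k) (sym q≡)) (+-monoˡ-≤ k (≮⇒≥ r≥)))
        where
        l : ∀ k → suc k + suc k + k ≡ 3 * k + 2
        l = solve-∀
    ... | suc j , _ , j≤k , lo , hi = ⊥-elim (middle-small (suc j) j≤k (trans (inv′ (suc j)) (trans (cong middle eq) (middle-intro (q ∸ suc j * d) lo′ hi′))))
      where
      d = q ∸ r
      le : suc j * d ≤ q
      le = ≤-trans (<⇒≤ hi) 2k+2≤q
      eq : fin (suc j * r) ≡ fin (q ∸ suc j * d)
      eq = trans (cong fin (+-cancelʳ-≡ (suc j * d) _ _ (begin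
        suc j * r + suc j * d ≡⟨ *-distribˡ-+ (suc j) r d ⟨
        suc j * (r + d) ≡⟨ cong (suc j *_) (m+[n∸m]≡n (<⇒≤ r<q)) ⟩
        q + j * q ≡⟨ cong (_+ j * q) (m∸n+n≡m le) ⟨
        q ∸ suc j * d + suc j * d + j * q ≡⟨ l (q ∸ suc j * d) (suc j * d) (j * q) ⟩
        q ∸ suc j * d + j * q + suc j * d ∎))) (fin-period (q ∸ suc j * d) j)
        where
        open ≡-Reasoning
        l : ∀ a b c → a + b + c ≡ a + c + b
        l = solve-∀
      lo′ : suc k ≤ q ∸ suc j * d
      lo′ = m+n≤o⇒m≤o∸n (suc k) (begin
        suc k + suc j * d ≤⟨ +-monoʳ-≤ (suc k) (s≤s⁻¹ hi) ⟩
        suc k + (k + suc k) ≡⟨ l k ⟩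
        3 * k + 2 ≡⟨ q≡ ⟨
        q ∎)
        where
        open ≤-Reasoning
        l : ∀ k → suc k + (k + suc k) ≡ 3 * k + 2
        l = solve-∀
      hi′ : q ∸ suc j * d < suc k + suc k
      hi′ = s≤s (m≤n+o⇒m∸n≤o q (suc j * d) (begin
        q ≡⟨ q≡ ⟩
        3 * k + 2 ≡⟨ l k ⟩
        suc k + (k + suc k) ≤⟨ +-monoˡ-≤ (k + suc k) lo ⟩
        suc j * d + (k + suc k) ∎))
        where
        open ≤-Reasoning
        l : ∀ k → 3 * k + 2 ≡ suc k + (k + suc k)
        l = solve-∀

-- Characters and duality

ΣL : ∀ {A : Set} → List A → (A → ℕ) → ℕ
ΣL [] f = 0
ΣL (x ∷ xs) f = f x + ΣL xs f

module _ {A : Set} where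
  ΣL-cong : ∀ (L : List A) {f g : A → ℕ} → (∀ x → f x ≡ g x) → ΣL L f ≡ ΣL L g
  ΣL-cong [] h = refl
  ΣL-cong (x ∷ L) h = cong₂ _+_ (h x) (ΣL-cong L h)

  ΣL-mono : ∀ (L : List A) {f g : A → ℕ} → (∀ x → f x ≤ g x) → ΣL L f ≤ ΣL L g
  ΣL-mono [] h = z≤n
  ΣL-mono (x ∷ L) h = +-mono-≤ (h x) (ΣL-mono L h)

  ΣL-+ : ∀ (L : List A) (f g : A → ℕ) → ΣL L (λ x → f x + g x) ≡ ΣL L f + ΣL L g
  ΣL-+ [] f g = refl
  ΣL-+ (x ∷ L) f g = trans (cong (f x + g x +_) (ΣL-+ L f g)) (+-interchange (f x) (g x) _ _)

  ΣL-* : ∀ (L : List A) c (f : A → ℕ) → ΣL L (λ x → c * f x) ≡ c * ΣL L f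
  ΣL-* [] c f = sym (*-zeroʳ c)
  ΣL-* (x ∷ L) c f = trans (cong (c * f x +_) (ΣL-* L c f)) (sym (*-distribˡ-+ c (f x) _))

  ΣL-zero : ∀ (L : List A) {f : A → ℕ} → (∀ x → f x ≡ 0) → ΣL L f ≡ 0
  ΣL-zero [] h = refl
  ΣL-zero (x ∷ L) h = cong₂ _+_ (h x) (ΣL-zero L h)

  ΣL-++ : ∀ (L M : List A) (f : A → ℕ) → ΣL (L ++ M) f ≡ ΣL L f + ΣL M f
  ΣL-++ [] M f = refl
  ΣL-++ (x ∷ L) M f = trans (cong (f x +_) (ΣL-++ L M f)) (sym (+-assoc (f x) _ _))

  ΣL-map : ∀ {B : Set} (g : B → A) (L : List B) (f : A → ℕ) → ΣL (map g L) f ≡ ΣL L (f ∘ g)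
  ΣL-map g [] f = refl
  ΣL-map g (x ∷ L) f = cong (f (g x) +_) (ΣL-map g L f)

  ΣL-sum : ∀ {n} (L : List A) (f : A → Fin n → ℕ) → ΣL L (λ x → sum (f x)) ≡ sum (λ i → ΣL L (λ x → f x i))
  ΣL-sum [] f = sym (sum-zero _ (λ _ → refl))
  ΣL-sum (x ∷ L) f = trans (cong (sum (f x) +_) (ΣL-sum L f)) (sym (∑-distrib-+ (f x) _))

  length-filter : ∀ {P : A → Set} (P? : ∀ x → Dec (P x)) L → length (filter P? L) ≡ ΣL L (λ x → ⟦ ⌊ P? x ⌋ ⟧)
  length-filter P? [] = refl
  length-filter P? (x ∷ L) with P? x
  ... | yes _ = cong suc (length-filter P? L)
  ... | no _ = length-filter P? L

ΣL-ΣL : ∀ {A B : Set} (L : List A) (M : List B) (f : A → B → ℕ) → ΣL L (λ x → ΣL M (f x)) ≡ ΣL M (λ y → ΣL L (λ x → f x y))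
ΣL-ΣL [] M f = sym (ΣL-zero M (λ _ → refl))
ΣL-ΣL (x ∷ L) M f = trans (cong (ΣL M (f x) +_) (ΣL-ΣL L M f)) (sym (ΣL-+ M (f x) _))

ΣL-tabulate : ∀ {A : Set} {n} (g : Fin n → A) (f : A → ℕ) → ΣL (Data.List.tabulate g) f ≡ sum (f ∘ g)
ΣL-tabulate {n = zero} g f = sym (sum-0 _)
ΣL-tabulate {n = suc n} g f = trans (cong (f (g zero) +_) (ΣL-tabulate (g ∘ suc) f)) (sym (sum-suc (f ∘ g)))

-- Families of sets are counted as sums of indicators over the same list that the statement filters.
∑S : ∀ n → (Subset n → ℕ) → ℕ
∑S n = ΣL (allSubsets n)

∑S-suc : ∀ n (f : Subset (suc n) → ℕ) → ∑S (suc n) f ≡ ∑S n (λ v → f (false ∷ v)) + ∑S n (λ v → f (true ∷ v))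
∑S-suc n f = trans (ΣL-++ (map (false ∷_) (allSubsets n)) _ f) (cong₂ _+_ (ΣL-map (false ∷_) (allSubsets n) f) (ΣL-map (true ∷_) (allSubsets n) f))

opaque
  eqS : ∀ {n} → Subset n → Subset n → Bool
  eqS v w = ⌊ ≡-dec _≟ᵇ_ v w ⌋

  eqS-true : ∀ {n} {v w : Subset n} → eqS v w ≡ true → v ≡ w
  eqS-true {v = v} {w} p = ⌊⌋-true {d = ≡-dec _≟ᵇ_ v w} p

  eqS-refl : ∀ {n} (v : Subset n) → eqS v v ≡ true
  eqS-refl v = ⌊⌋-intro {d = ≡-dec _≟ᵇ_ v v} refl

eqS-intro : ∀ {n} {v w : Subset n} → v ≡ w → eqS v w ≡ true
eqS-intro {v = v} refl = eqS-refl v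

eqS-∷ : ∀ {n} b (v w : Subset n) → eqS (b ∷ v) (b ∷ w) ≡ eqS v w
eqS-∷ b v w = bool-ext (λ p → eqS-intro (cong Data.Vec.tail (eqS-true p))) (λ p → eqS-intro (cong (b ∷_) (eqS-true p)))

eqS-≢ : ∀ {n} b c (v w : Subset n) → b ≢ c → eqS (b ∷ v) (c ∷ w) ≡ false
eqS-≢ b c v w ne = ¬true (λ p → ne (cong Data.Vec.head (eqS-true p)))

∑S-δ : ∀ {n} (w : Subset n) (f : Subset n → ℕ) → ∑S n (λ v → ⟦ eqS w v ⟧ * f v) ≡ f w
∑S-δ [] f = trans (+-identityʳ _) (trans (cong (λ b → ⟦ b ⟧ * f []) (eqS-refl [])) (+-identityʳ _))
∑S-δ {suc n} (false ∷ w) f = trans (∑S-suc n _) (trans (cong₂ _+_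
  (trans (ΣL-cong (allSubsets n) (λ v → cong (λ b → ⟦ b ⟧ * f (false ∷ v)) (eqS-∷ false w v))) (∑S-δ w (λ v → f (false ∷ v))))
  (ΣL-zero (allSubsets n) (λ v → cong (λ b → ⟦ b ⟧ * f (true ∷ v)) (eqS-≢ false true w v (λ ()))))) (+-identityʳ _))
∑S-δ {suc n} (true ∷ w) f = trans (∑S-suc n _) (cong₂ _+_
  (ΣL-zero (allSubsets n) (λ v → cong (λ b → ⟦ b ⟧ * f (false ∷ v)) (eqS-≢ true false w v (λ ()))))
  (trans (ΣL-cong (allSubsets n) (λ v → cong (λ b → ⟦ b ⟧ * f (true ∷ v)) (eqS-∷ true w v))) (∑S-δ w (λ v → f (true ∷ v)))))

-- Maps from the group to ℤ/q are vectors, so homomorphisms are counted by an indicator summed over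
-- all vectors.
∑V : ∀ {q} n → (Vec (Fin q) n → ℕ) → ℕ
∑V zero f = f []
∑V (suc n) f = sum (λ c → ∑V n (λ v → f (c ∷ v)))

module _ {q : ℕ} where
  ∑V-cong : ∀ n {f g : Vec (Fin q) n → ℕ} → (∀ v → f v ≡ g v) → ∑V n f ≡ ∑V n g
  ∑V-cong zero h = h []
  ∑V-cong (suc n) h = sum-cong-≗ (λ c → ∑V-cong n (λ v → h (c ∷ v)))

  ∑V-+ : ∀ n (f g : Vec (Fin q) n → ℕ) → ∑V n (λ v → f v + g v) ≡ ∑V n f + ∑V n g
  ∑V-+ zero f g = refl
  ∑V-+ (suc n) f g = trans (sum-cong-≗ (λ c → ∑V-+ n (λ v → f (c ∷ v)) (λ v → g (c ∷ v)))) (∑-distrib-+ _ _)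

  ∑V-* : ∀ n c (f : Vec (Fin q) n → ℕ) → ∑V n (λ v → c * f v) ≡ c * ∑V n f
  ∑V-* zero c f = refl
  ∑V-* (suc n) c f = trans (sum-cong-≗ (λ d → ∑V-* n c (λ v → f (d ∷ v)))) (sum-*ˡ c _)

  ∑V-zero : ∀ n {f : Vec (Fin q) n → ℕ} → (∀ v → f v ≡ 0) → ∑V n f ≡ 0
  ∑V-zero zero h = h []
  ∑V-zero (suc n) h = sum-zero _ (λ c → ∑V-zero n (λ v → h (c ∷ v)))

  ∑V-sum : ∀ n {m} (f : Vec (Fin q) n → Fin m → ℕ) → ∑V n (λ v → sum (f v)) ≡ sum (λ i → ∑V n (λ v → f v i))
  ∑V-sum zero f = refl
  ∑V-sum (suc n) f = trans (sum-cong-≗ (λ c → ∑V-sum n (λ v → f (c ∷ v)))) (∑-comm _)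

  ∑V-ΣL : ∀ n {A : Set} (L : List A) (f : Vec (Fin q) n → A → ℕ) → ∑V n (λ v → ΣL L (f v)) ≡ ΣL L (λ x → ∑V n (λ v → f v x))
  ∑V-ΣL n [] f = ∑V-zero n (λ _ → refl)
  ∑V-ΣL n (x ∷ L) f = trans (∑V-+ n (λ v → f v x) _) (cong (∑V n (λ v → f v x) +_) (∑V-ΣL n L f))

  opaque
    eqV : ∀ {n} → Vec (Fin q) n → Vec (Fin q) n → Bool
    eqV v w = ⌊ ≡-dec FinP._≟_ v w ⌋

    eqV-true : ∀ {n} {v w : Vec (Fin q) n} → eqV v w ≡ true → v ≡ w
    eqV-true {v = v} {w} p = ⌊⌋-true {d = ≡-dec FinP._≟_ v w} p

    eqV-refl : ∀ {n} (v : Vec (Fin q) n) → eqV v v ≡ true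
    eqV-refl v = ⌊⌋-intro {d = ≡-dec FinP._≟_ v v} refl

  eqV-intro : ∀ {n} {v w : Vec (Fin q) n} → v ≡ w → eqV v w ≡ true
  eqV-intro {v = v} refl = eqV-refl v

  eqV-∷ : ∀ {n} c d (v w : Vec (Fin q) n) → ⟦ eqV (c ∷ v) (d ∷ w) ⟧ ≡ ⟦ c == d ⟧ * ⟦ eqV v w ⟧
  eqV-∷ c d v w with bool-cases (c == d)
  ... | inj₁ p = trans (cong ⟦_⟧ {eqV (c ∷ v) (d ∷ w)} {eqV v w} (bool-ext (λ r → eqV-intro (cong Data.Vec.tail (eqV-true r)))
      (λ r → eqV-intro (cong₂ _∷_ (⌊⌋-true p) (eqV-true r)))))
      (trans (sym (+-identityʳ _)) (cong (λ b → ⟦ b ⟧ * ⟦ eqV v w ⟧) (sym p)))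
  ... | inj₂ p = trans (cong ⟦_⟧ {eqV (c ∷ v) (d ∷ w)} {false} (¬true (λ e → absurd-b (⌊⌋-intro (cong Data.Vec.head (eqV-true e))) p))) (cong (λ b → ⟦ b ⟧ * ⟦ eqV v w ⟧) (sym p))

  ∑V-δ : ∀ {n} (w : Vec (Fin q) n) → ∑V n (λ v → ⟦ eqV w v ⟧) ≡ 1
  ∑V-δ {zero} [] = cong ⟦_⟧ (eqV-refl [])
  ∑V-δ {suc n} (c ∷ w) = trans (sum-cong-≗ (λ d → trans (∑V-cong n (λ v → eqV-∷ c d w v)) (trans (∑V-* n ⟦ c == d ⟧ _) (cong (⟦ c == d ⟧ *_) (∑V-δ w)))))
    (sum-δ c (λ _ → 1))

module Duality {n : ℕ} (G : FG n) (q : ℕ) (pr : Prime q) where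
  open Multiples G public
  private
    instance
      q-nz : NonZero q
      q-nz = prime⇒nonZero pr
  module R = Residues q q-nz
  open R using (fin; _⊞q_; toℕ-fin; fin-cong; fin-toℕ; fin-+; fin-period) public

  Hom : Vec (Fin q) n → Set
  Hom χ = ∀ x y → lookup χ (x ⊕ y) ≡ lookup χ x ⊞q lookup χ y

  Hom? : ∀ χ → Dec (Hom χ)
  Hom? χ = all? λ x → all? λ y → lookup χ (x ⊕ y) FinP.≟ (lookup χ x ⊞q lookup χ y)

  opaque
    isHom : Vec (Fin q) n → Bool
    isHom χ = ⌊ Hom? χ ⌋

    isHom-true : ∀ χ → isHom χ ≡ true → Hom χ
    isHom-true χ p = ⌊⌋-true {d = Hom? χ} p

    isHom-intro : ∀ χ → Hom χ → isHom χ ≡ true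
    isHom-intro χ p = ⌊⌋-intro {d = Hom? χ} p

  #Hom : ℕ
  #Hom = ∑V n (λ χ → ⟦ isHom χ ⟧)

  hom-𝟘 : ∀ χ → Hom χ → lookup χ 𝟘 ≡ fin 0
  hom-𝟘 χ hχ = R.⊕-cancelʳ (lookup χ 𝟘) _ _ (trans (sym (hχ 𝟘 𝟘)) (trans (cong (lookup χ) (⊕-identityˡ 𝟘)) (sym (R.⊕-identityˡ _))))

  hom-· : ∀ χ → Hom χ → ∀ j x → lookup χ (j · x) ≡ j R.· lookup χ x
  hom-· χ hχ zero x = hom-𝟘 χ hχ
  hom-· χ hχ (suc j) x = trans (hχ x (j · x)) (cong (lookup χ x ⊞q_) (hom-· χ hχ j x))

  hom-⊖ : ∀ χ → Hom χ → ∀ x y → lookup χ (x ⊖ y) ≡ lookup χ x R.⊖ lookup χ y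
  hom-⊖ χ hχ x y = R.⊕-cancelʳ (lookup χ y) _ _ (trans (sym (hχ _ y)) (trans (cong (lookup χ) (⊖⊕ x y)) (sym (R.⊖⊕ _ _))))

  q·fin : ∀ x → q R.· x ≡ fin 0
  q·fin x = trans (R.·-toℕ q x) (trans (cong fin (trans (*-comm q (toℕ x)) refl)) (fin-period 0 (toℕ x)))

  _⊹_ : Vec (Fin q) n → Vec (Fin q) n → Vec (Fin q) n
  χ ⊹ ψ = Data.Vec.zipWith _⊞q_ χ ψ

  lookup-⊹ : ∀ χ ψ x → lookup (χ ⊹ ψ) x ≡ lookup χ x ⊞q lookup ψ x
  lookup-⊹ χ ψ x = lookup-zipWith _⊞q_ x χ ψ

  ∑V-shift : ∀ {m} (f : Vec (Fin q) m → ℕ) w → ∑V m (λ v → f (Data.Vec.zipWith _⊞q_ v w)) ≡ ∑V m f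
  ∑V-shift f [] = refl
  ∑V-shift f (c ∷ w) = trans (sum-cong-≗ (λ d → ∑V-shift (λ v → f ((d ⊞q c) ∷ v)) w)) (R.sum-shift (λ d → ∑V _ (λ v → f (d ∷ v))) c)

  Hom-⊹ : ∀ χ ψ → Hom χ → Hom ψ → Hom (χ ⊹ ψ)
  Hom-⊹ χ ψ a b x y = trans (lookup-⊹ χ ψ (x ⊕ y)) (trans (cong₂ _⊞q_ (a x y) (b x y)) (trans
    (R.gsolve (R.v0 R.:+ R.v1 R.:+ (R.v2 R.:+ R.v3)) (R.v0 R.:+ R.v2 R.:+ (R.v1 R.:+ R.v3)) refl (lookup χ x ∷ lookup χ y ∷ lookup ψ x ∷ lookup ψ y ∷ []))
    (cong₂ _⊞q_ (sym (lookup-⊹ χ ψ x)) (sym (lookup-⊹ χ ψ y)))))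

  Hom-⊹⁻ : ∀ χ ψ → Hom (χ ⊹ ψ) → Hom ψ → Hom χ
  Hom-⊹⁻ χ ψ a b x y = R.⊕-cancelʳ (lookup ψ x ⊞q lookup ψ y) _ _ (begin
    lookup χ (x ⊕ y) ⊞q (lookup ψ x ⊞q lookup ψ y) ≡⟨ cong (lookup χ (x ⊕ y) ⊞q_) (b x y) ⟨
    lookup χ (x ⊕ y) ⊞q lookup ψ (x ⊕ y) ≡⟨ lookup-⊹ χ ψ (x ⊕ y) ⟨
    lookup (χ ⊹ ψ) (x ⊕ y) ≡⟨ a x y ⟩
    lookup (χ ⊹ ψ) x ⊞q lookup (χ ⊹ ψ) y ≡⟨ cong₂ _⊞q_ (lookup-⊹ χ ψ x) (lookup-⊹ χ ψ y) ⟩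
    (lookup χ x ⊞q lookup ψ x) ⊞q (lookup χ y ⊞q lookup ψ y) ≡⟨ R.gsolve (R.v0 R.:+ R.v1 R.:+ (R.v2 R.:+ R.v3)) (R.v0 R.:+ R.v2 R.:+ (R.v1 R.:+ R.v3)) refl (lookup χ x ∷ lookup ψ x ∷ lookup χ y ∷ lookup ψ y ∷ []) ⟩
    (lookup χ x ⊞q lookup χ y) ⊞q (lookup ψ x ⊞q lookup ψ y) ∎)
    where open ≡-Reasoning

  equidistributed : ∀ (c : ℕ → ℕ) → (∀ j → c (suc j) ≡ c j) → sum {q} (λ j → c (toℕ j)) ≡ q * c 0
  equidistributed c h = trans (sum-cong-≗ (λ j → all (toℕ j))) (sum-const q (c 0))
    where
    all : ∀ j → c j ≡ c 0
    all zero = refl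
    all (suc j) = trans (h j) (all j)

  sum-indicator : ∀ (z : Fin q) → sum {q} (λ j → ⟦ z == fin (toℕ j) ⟧) ≡ 1
  sum-indicator z = trans (sum-cong-≗ (λ j → cong (λ w → ⟦ z == w ⟧) (fin-toℕ j))) (#-singleton z)

  step-indicator : ∀ (z : Fin q) j → ((z ⊞q fin 1) == fin (suc j)) ≡ (z == fin j)
  step-indicator z j = bool-ext
    (λ p → ⌊⌋-intro (R.⊕-cancelʳ (fin 1) _ _ (trans (⌊⌋-true p) e)))
    (λ p → ⌊⌋-intro (trans (cong (_⊞q fin 1) (⌊⌋-true p)) (sym e)))
    where
    e : fin (suc j) ≡ fin j ⊞q fin 1
    e = trans (cong fin (+-comm 1 j)) (sym (fin-+ j 1))

  -- Translation by g raises the value of χ by 1, so all q level sets have the same size.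
  kernel-size : ∀ χ → Hom χ → ∀ g → lookup χ g ≡ fin 1 → ∀ j → q * # (λ x → lookup χ x == fin j) ≡ n
  kernel-size χ hχ g χg j₀ = trans (cong (q *_) (all j₀)) (trans (sym (equidistributed c step)) (trans (∑-comm (λ (j : Fin q) x → ⟦ lookup χ x == fin (toℕ j) ⟧))
      (trans (sum-cong-≗ (λ x → sum-indicator (lookup χ x))) (trans (sum-const n 1) (*-identityʳ n)))))
    where
    c : ℕ → ℕ
    c j = # (λ x → lookup χ x == fin j)
    step : ∀ j → c (suc j) ≡ c j
    step j = trans (sym (#-shift (λ x → lookup χ x == fin (suc j)) g)) (#-cong (λ x → trans (cong (_== fin (suc j)) (trans (hχ x g) (cong (lookup χ x ⊞q_) χg))) (step-indicator (lookup χ x) j)))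
    all : ∀ j → c j ≡ c 0
    all zero = refl
    all (suc j) = trans (step j) (all j)

  -- The dual of `kernel-size`: adding ψ to a homomorphism raises its value at x by 1.
  annihilator-size : ∀ x ψ → Hom ψ → lookup ψ x ≡ fin 1 → q * ∑V n (λ χ → ⟦ isHom χ ⟧ * ⟦ lookup χ x == fin 0 ⟧) ≡ #Hom
  annihilator-size x ψ hψ ψx = trans (sym (equidistributed c step)) (trans (sym (∑V-sum n (λ χ (j : Fin q) → ⟦ isHom χ ⟧ * ⟦ lookup χ x == fin (toℕ j) ⟧)))
      (∑V-cong n (λ χ → trans (sum-*ˡ ⟦ isHom χ ⟧ _) (trans (cong (⟦ isHom χ ⟧ *_) (sum-indicator (lookup χ x))) (*-identityʳ _)))))
    where
    c : ℕ → ℕ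
    c j = ∑V n (λ χ → ⟦ isHom χ ⟧ * ⟦ lookup χ x == fin j ⟧)
    step : ∀ j → c (suc j) ≡ c j
    step j = trans (sym (∑V-shift (λ χ → ⟦ isHom χ ⟧ * ⟦ lookup χ x == fin (suc j) ⟧) ψ)) (∑V-cong n (λ χ → cong₂ (λ u v → ⟦ u ⟧ * ⟦ v ⟧)
      (bool-ext (λ p → isHom-intro χ (Hom-⊹⁻ χ ψ (isHom-true _ p) hψ)) (λ p → isHom-intro _ (Hom-⊹ χ ψ (isHom-true χ p) hψ)))
      (trans (cong (_== fin (suc j)) (trans (lookup-⊹ χ ψ x) (cong (lookup χ x ⊞q_) ψx))) (step-indicator (lookup χ x) j))))

  qG : Pr n
  qG z = anyb (λ x → (q · x) == z)

  qG-intro : ∀ x → qG ∋∋ q · x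
  qG-intro x = anyb-intro (λ y → (q · y) == (q · x)) x (⌊⌋-intro refl)

  qG-elim : ∀ z → qG ∋∋ z → ∃[ x ] q · x ≡ z
  qG-elim z p with anyb-true (λ x → (q · x) == z) p
  ... | x , r = x , ⌊⌋-true r

  qG-sub : IsSub qG
  qG-sub = record
    { has-𝟘 = trans (cong qG (sym (·-𝟘 q))) (qG-intro 𝟘)
    ; has-⊕ = λ {y} {z} p r → let (a , e) = qG-elim y p ; (b , e′) = qG-elim z r in trans (cong qG (trans (cong₂ _⊕_ (sym e) (sym e′)) (sym (·-⊕ q a b)))) (qG-intro (a ⊕ b))
    ; has-neg = λ {z} p → let (a , e) = qG-elim z p in trans (cong qG (trans (cong neg (sym e)) (sym (·-neg q a)))) (qG-intro (neg a)) }

  -- A subgroup M maximal among those avoiding g has G = M + ⟨g⟩.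
  opaque
    separate : ∀ M₀ → IsSub M₀ → qG ⊑ M₀ → ∀ g → ¬ (M₀ ∋∋ g) → ∃[ χ ] (Hom χ × lookup χ g ≡ fin 1 × (∀ x → M₀ ∋∋ x → lookup χ x ≡ fin 0))
    separate M₀ sub₀ qG⊑ g g∉ with argmax {P = λ v → IsSub (lookup v) × (M₀ ⊑ lookup v) × ¬ (lookup v ∋∋ g)}
        (λ v → IsSub? (lookup v) ×-dec (all? (λ i → (M₀ i ≟ᵇ true) →-dec (lookup v i ≟ᵇ true)) ×-dec ¬? (lookup v g ≟ᵇ true)))
        (λ v → # (lookup v)) n (λ v → #≤n (lookup v))
        (tabulate M₀ , IsSub-cong (λ x → sym (lookup∘tabulate M₀ x)) sub₀ , (λ x p → trans (lookup∘tabulate M₀ x) p) ,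
          λ p → g∉ (trans (sym (lookup∘tabulate M₀ g)) p))
    ... | v , (sub , M₀⊑ , g∉M) , maxi = χ , hom , χ-unique g 1 (trans (cong M (trans (cong (g ⊖_) (1· g)) (x⊖x g))) has-𝟘) ,
        λ x p → χ-unique x 0 (trans (cong M (gsolve (v0 :- :0) v0 refl (x ∷ []))) (M₀⊑ x p))
      where
      open IsSub sub
      M : Pr n
      M = lookup v
      M-q : ∀ x → M ∋∋ q · x
      M-q x = M₀⊑ _ (qG⊑ _ (qG-intro x))
      divisible : ∀ d → M ∋∋ d · g → q ∣ d
      divisible d Md with q ∣? d
      ... | yes p = p
      ... | no ∤ with inverse-mod q d pr ∤
      ... | a , b , e = ⊥-elim (g∉M (trans (cong M (begin
          g ≡⟨ ⊕⊖ g _ ⟨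
          g ⊕ (b * q) · g ⊖ (b * q) · g ≡⟨ cong₂ _⊖_ (trans (cong (_· g) (sym e)) (·-* a d g)) (·-* b q g) ⟩
          a · (d · g) ⊖ b · (q · g) ∎)) (has-⊖ sub (has-· sub a Md) (has-· sub b (M-q g)))))
        where open ≡-Reasoning
      mod-unique : ∀ i j → M ∋∋ i · g ⊖ j · g → fin i ≡ fin j
      mod-unique i j p = fin-cong (begin
        i % q ≡⟨ [m+kn]%n≡m%n i j q ⟨
        (i + j * q) % q ≡⟨ cong (λ z → (i + z) % q) (trans (cong (j *_) (sym (suc-pred q))) (trans (*-suc j (q ∸ 1)) (+-comm j _))) ⟩
        (i + (j * (q ∸ 1) + j)) % q ≡⟨ cong (_% q) (+-assoc i _ j) ⟨
        (i + j * (q ∸ 1) + j) % q ≡⟨ %-remove-+ˡ j (divisible (i + j * (q ∸ 1)) M′) ⟩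
        j % q ∎)
        where
        open ≡-Reasoning
        M′ : M ∋∋ (i + j * (q ∸ 1)) · g
        M′ = trans (cong M (trans (·-+ i (j * (q ∸ 1)) g) (trans (gsolve (v0 :+ v1) (v0 :- v2 :+ (v2 :+ v1)) refl (i · g ∷ (j * (q ∸ 1)) · g ∷ j · g ∷ []))
          (cong (i · g ⊖ j · g ⊕_) (trans (sym (·-+ j (j * (q ∸ 1)) g)) (trans (cong (_· g) (trans (sym (*-suc j (q ∸ 1))) (cong (j *_) (suc-pred q)))) (·-* j q g)))))))
          (has-⊕ p (has-· sub j (M-q g)))
      -- For x outside M, maximality puts g into M + ⟨x⟩, say g ≡ jx modulo M. Since qx is in M and
      -- g is not, q does not divide j, and an inverse a of j modulo q gives x ≡ ag.
      rep : ∀ x → ∃[ i ] M ∋∋ x ⊖ i · g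
      rep x with bool-cases (M x)
      ... | inj₁ p = 0 , trans (cong M (gsolve (v0 :- :0) v0 refl (x ∷ []))) p
      ... | inj₂ x∉ with bool-cases (Ext.ext (extend sub x) g)
      ... | inj₂ g∉e = ⊥-elim (absurd-b (⊑-eq M⊑ (≤-trans (≤-reflexive (#-cong (λ z → sym (lookup∘tabulate X.ext z)))) (maxi (tabulate X.ext)
            (IsSub-cong (λ z → sym (lookup∘tabulate X.ext z)) X.ext-sub , (λ z p → trans (lookup∘tabulate X.ext z) (M⊑ z (M₀⊑ z p))) ,
              λ p → absurd-b (trans (sym (lookup∘tabulate X.ext g)) p) g∉e))) x (X.ext-intro 1 (trans (cong M (trans (cong (x ⊖_) (1· x)) (x⊖x x))) has-𝟘))) x∉)
        where
        module X = Ext (extend sub x)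
        M⊑ : M ⊑ X.ext
        M⊑ z p = X.ext-intro 0 (trans (cong M (gsolve (v0 :- :0) v0 refl (z ∷ []))) p)
      ... | inj₁ g∈e with Ext.ext-elim (extend sub x) g∈e
      ... | j , Mj with q ∣? j
      ... | yes (divides c e) = ⊥-elim (g∉M (trans (cong M (sym (⊖⊕ g (j · x)))) (has-⊕ Mj (trans (cong M (trans (cong (_· x) e) (·-* c q x))) (has-· sub c (M-q x))))))
      ... | no ∤ with inverse-mod q j pr ∤
      ... | a , b , e = a , trans (cong M (begin
          x ⊖ a · g ≡⟨ gsolve (v0 :- v1) (:- (v1 :- (v0 :+ v2)) :- v2) refl (x ∷ a · g ∷ (b * q) · x ∷ []) ⟩
          neg (a · g ⊖ (1 + b * q) · x) ⊖ (b * q) · x ≡⟨ cong₂ (λ u w → neg (a · g ⊖ u) ⊖ w) (trans (cong (_· x) (sym e)) (·-* a j x)) (·-* b q x) ⟩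
          neg (a · g ⊖ a · (j · x)) ⊖ b · (q · x) ≡⟨ cong (λ u → neg u ⊖ b · (q · x)) (·-⊖ a g (j · x)) ⟨
          neg (a · (g ⊖ j · x)) ⊖ b · (q · x) ∎)) (has-⊖ sub (has-neg (has-· sub a Mj)) (has-· sub b (M-q x)))
        where open ≡-Reasoning
      χ : Vec (Fin q) n
      χ = tabulate (λ x → fin (proj₁ (rep x)))
      χ-unique : ∀ x i → M ∋∋ x ⊖ i · g → lookup χ x ≡ fin i
      χ-unique x i p = trans (lookup∘tabulate _ x) (mod-unique (proj₁ (rep x)) i
        (trans (cong M (gsolve (v1 :- v2) (v0 :- v2 :- (v0 :- v1)) refl (x ∷ proj₁ (rep x) · g ∷ i · g ∷ []))) (has-⊖ sub p (proj₂ (rep x)))))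
      hom : Hom χ
      hom x y = trans (χ-unique (x ⊕ y) (proj₁ (rep x) + proj₁ (rep y)) (trans (cong M (trans (cong (x ⊕ y ⊖_) (·-+ (proj₁ (rep x)) (proj₁ (rep y)) g))
          (gsolve (v0 :+ v1 :- (v2 :+ v3)) (v0 :- v2 :+ (v1 :- v3)) refl (x ∷ y ∷ proj₁ (rep x) · g ∷ proj₁ (rep y) · g ∷ [])))) (has-⊕ (proj₂ (rep x)) (proj₂ (rep y)))))
        (trans (sym (fin-+ (proj₁ (rep x)) (proj₁ (rep y)))) (cong₂ _⊞q_ (sym (lookup∘tabulate _ x)) (sym (lookup∘tabulate _ y))))

  torsion : Pr n
  torsion x = (q · x) == 𝟘

  qG-torsion : # qG * # torsion ≡ n
  qG-torsion = begin
    # qG * # torsion ≡⟨ *-comm (# qG) _ ⟩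
    # torsion * # qG ≡⟨ sum-*ˡ (# torsion) (λ y → ⟦ qG y ⟧) ⟨
    sum (λ y → # torsion * ⟦ qG y ⟧) ≡⟨ sum-cong-≗ fibre ⟩
    sum (λ y → sum (λ x → ⟦ (q · x) == y ⟧)) ≡⟨ ∑-comm (λ y x → ⟦ (q · x) == y ⟧) ⟩
    sum (λ x → sum (λ y → ⟦ (q · x) == y ⟧)) ≡⟨ sum-cong-≗ (λ x → #-singleton (q · x)) ⟩
    sum {n} (λ _ → 1) ≡⟨ trans (sum-const n 1) (*-identityʳ n) ⟩
    n ∎
    where
    open ≡-Reasoning
    fibre : ∀ y → # torsion * ⟦ qG y ⟧ ≡ # (λ x → (q · x) == y)
    fibre y with bool-cases (qG y)
    ... | inj₂ e = trans (cong (λ b → # torsion * ⟦ b ⟧) e) (trans (*-zeroʳ (# torsion)) (sym (sum-zero _ (λ x → cong ⟦_⟧ (⌊⌋-false (λ e′ → absurd-b (trans (cong qG (sym e′)) (qG-intro x)) e))))))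
    ... | inj₁ e with qG-elim y e
    ... | a , refl = trans (cong (λ b → # torsion * ⟦ b ⟧) e) (trans (*-identityʳ (# torsion)) (trans (sym (#-shift torsion (neg a)))
        (#-cong (λ x → bool-ext (λ p → ⌊⌋-intro (trans (sym (⊖⊕ (q · x) (q · a))) (trans (cong (_⊕ q · a) (trans (sym (·-⊖ q x a)) (⌊⌋-true p))) (⊕-identityˡ _))))
          (λ p → ⌊⌋-intro (trans (·-⊖ q x a) (trans (cong (_⊖ q · a) (⌊⌋-true p)) (x⊖x _))))))))

  0χ : Vec (Fin q) n
  0χ = tabulate (λ _ → fin 0)

  isZero : Vec (Fin q) n → Bool
  isZero χ = eqV 0χ χ

  zero-hom : Hom 0χ
  zero-hom x y = trans (lookup∘tabulate _ (x ⊕ y)) (sym (trans (cong₂ _⊞q_ (lookup∘tabulate _ x) (lookup∘tabulate _ y)) (R.⊕-identityˡ (fin 0))))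

  opaque
    nonzero-hom : ∀ χ → Hom χ → isZero χ ≡ false → ∃[ g ] lookup χ g ≡ fin 1
    nonzero-hom χ hχ nz with any? (λ x → ¬? (lookup χ x FinP.≟ fin 0))
    ... | no ¬p = ⊥-elim (absurd-b (eqV-intro (trans (tabulate-cong (λ x → h x)) (tabulate∘lookup χ))) nz)
      where
      h : ∀ x → fin 0 ≡ lookup χ x
      h x with lookup χ x FinP.≟ fin 0
      ... | yes e = sym e
      ... | no ne = ⊥-elim (¬p (x , ne))
    ... | yes (x , ne) with inverse-mod q (toℕ (lookup χ x)) pr (λ q∣ → ne (trans (sym (fin-toℕ _)) (fin-cong (trans (n∣m⇒m%n≡0 _ q q∣) (sym (n∣m⇒m%n≡0 0 q (q ∣0)))))))
    ... | a , b , e = a · x , trans (hom-· χ hχ a x) (trans (R.·-toℕ a _) (trans (cong fin e) (fin-period 1 b)))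

  nonzero-count : ∑V n (λ χ → ⟦ isHom χ ⟧ * ⟦ not (isZero χ) ⟧) + 1 ≡ #Hom
  nonzero-count = begin
    ∑V n (λ χ → ⟦ isHom χ ⟧ * ⟦ not (isZero χ) ⟧) + 1 ≡⟨ cong (∑V n (λ χ → ⟦ isHom χ ⟧ * ⟦ not (isZero χ) ⟧) +_) (∑V-δ 0χ) ⟨
    ∑V n (λ χ → ⟦ isHom χ ⟧ * ⟦ not (isZero χ) ⟧) + ∑V n (λ χ → ⟦ isZero χ ⟧) ≡⟨ ∑V-+ n _ _ ⟨
    ∑V n (λ χ → ⟦ isHom χ ⟧ * ⟦ not (isZero χ) ⟧ + ⟦ isZero χ ⟧) ≡⟨ ∑V-cong n pt ⟩
    #Hom ∎
    where
    open ≡-Reasoning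
    pt : ∀ χ → ⟦ isHom χ ⟧ * ⟦ not (isZero χ) ⟧ + ⟦ isZero χ ⟧ ≡ ⟦ isHom χ ⟧
    pt χ with bool-cases (isZero χ)
    ... | inj₂ e = trans (cong (λ b → ⟦ isHom χ ⟧ * ⟦ not b ⟧ + ⟦ b ⟧) e) (trans (+-identityʳ _) (*-identityʳ _))
    ... | inj₁ e = trans (cong (λ b → ⟦ isHom χ ⟧ * ⟦ not b ⟧ + ⟦ b ⟧) e) (trans (cong (_+ 1) (*-zeroʳ ⟦ isHom χ ⟧)) (cong ⟦_⟧ {true} {isHom χ} (sym (isHom-intro χ (subst Hom (eqV-true e) zero-hom)))))

  -- Counting the pairs (χ , x) with χ x = 0 in two ways.
  hom-count : # qG * #Hom ≡ n
  hom-count = *-cancelˡ-≡ (# qG * #Hom) n (q ∸ 1) {{>-nonZero (m<n⇒0<n∸m (nonTrivial⇒n>1 q {{prime⇒nonTrivial pr}}))}} (+-cancelʳ-≡ (n * #Hom) _ _ (begin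
      (q ∸ 1) * (# qG * #Hom) + n * #Hom ≡⟨ byElements ⟨
      sum (λ x → q * ∑V n (λ χ → ⟦ isHom χ ⟧ * ⟦ lookup χ x == fin 0 ⟧)) ≡⟨ sum-*ˡ q _ ⟩
      q * sum (λ x → ∑V n (λ χ → ⟦ isHom χ ⟧ * ⟦ lookup χ x == fin 0 ⟧)) ≡⟨ cong (q *_) (∑V-sum n (λ χ x → ⟦ isHom χ ⟧ * ⟦ lookup χ x == fin 0 ⟧)) ⟨
      q * ∑V n (λ χ → sum (λ x → ⟦ isHom χ ⟧ * ⟦ lookup χ x == fin 0 ⟧)) ≡⟨ ∑V-* n q _ ⟨
      ∑V n (λ χ → q * sum (λ x → ⟦ isHom χ ⟧ * ⟦ lookup χ x == fin 0 ⟧)) ≡⟨ byHoms ⟩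
      (q ∸ 1) * n + n * #Hom ∎))
    where
    open ≡-Reasoning
    q≡1+ : q ≡ 1 + (q ∸ 1)
    q≡1+ = sym (suc-pred q)
    -- An x in qG is annihilated by every homomorphism; any other x is sent to 1 by some ψ from
    -- `separate`, and hence annihilated by exactly one q-th of all.
    byElements : sum (λ x → q * ∑V n (λ χ → ⟦ isHom χ ⟧ * ⟦ lookup χ x == fin 0 ⟧)) ≡ (q ∸ 1) * (# qG * #Hom) + n * #Hom
    byElements = trans (sum-cong-≗ pt) (trans (∑-distrib-+ (λ x → ((q ∸ 1) * #Hom) * ⟦ qG x ⟧) (λ _ → #Hom)) (cong₂ _+_ (trans (sum-*ˡ ((q ∸ 1) * #Hom) _) (l (q ∸ 1) #Hom (# qG))) (sum-const n #Hom)))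
      where
      l : ∀ a b c → (a * b) * c ≡ a * (c * b)
      l = solve-∀
      pt : ∀ x → q * ∑V n (λ χ → ⟦ isHom χ ⟧ * ⟦ lookup χ x == fin 0 ⟧) ≡ ((q ∸ 1) * #Hom) * ⟦ qG x ⟧ + #Hom
      pt x with bool-cases (qG x)
      ... | inj₁ e = trans (cong (q *_) (∑V-cong n (λ χ → h χ (bool-cases (isHom χ))))) (trans (cong (_* #Hom) q≡1+) (trans (+-comm #Hom _) (cong (_+ #Hom) (trans (sym (*-identityʳ _)) (cong (λ b → (q ∸ 1) * #Hom * ⟦ b ⟧) (sym e))))))
        where
        h : ∀ χ → isHom χ ≡ true ⊎ isHom χ ≡ false → ⟦ isHom χ ⟧ * ⟦ lookup χ x == fin 0 ⟧ ≡ ⟦ isHom χ ⟧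
        h χ (inj₂ f) = trans (cong (λ b → ⟦ b ⟧ * ⟦ lookup χ x == fin 0 ⟧) f) (cong ⟦_⟧ (sym f))
        h χ (inj₁ t) with qG-elim x e
        ... | y , refl = trans (cong (λ b → ⟦ isHom χ ⟧ * ⟦ b ⟧) (⌊⌋-intro (trans (hom-· χ (isHom-true χ t) q y) (q·fin _)))) (*-identityʳ _)
      ... | inj₂ e with separate qG qG-sub (λ _ p → p) x (λ p → absurd-b p e)
      ... | ψ , hψ , ψx , _ = trans (annihilator-size x ψ hψ ψx) (sym (trans (cong (λ b → (q ∸ 1) * #Hom * ⟦ b ⟧ + #Hom) e) (cong (_+ #Hom) (*-zeroʳ ((q ∸ 1) * #Hom)))))
    -- The zero homomorphism vanishes at all n elements, every other one at n/q.
    byHoms : ∑V n (λ χ → q * sum (λ x → ⟦ isHom χ ⟧ * ⟦ lookup χ x == fin 0 ⟧)) ≡ (q ∸ 1) * n + n * #Hom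
    byHoms = trans (∑V-cong n pt) (trans (∑V-+ n (λ χ → ((q ∸ 1) * n) * ⟦ isZero χ ⟧) (λ χ → n * ⟦ isHom χ ⟧)) (cong₂ _+_
        (trans (∑V-* n ((q ∸ 1) * n) _) (trans (cong ((q ∸ 1) * n *_) (∑V-δ 0χ)) (*-identityʳ _))) (∑V-* n n _)))
      where
      pt : ∀ χ → q * sum (λ x → ⟦ isHom χ ⟧ * ⟦ lookup χ x == fin 0 ⟧) ≡ ((q ∸ 1) * n) * ⟦ isZero χ ⟧ + n * ⟦ isHom χ ⟧
      pt χ with bool-cases (isZero χ) | bool-cases (isHom χ)
      ... | inj₁ z | _ with eqV-true z
      ... | refl = begin
          q * sum (λ x → ⟦ isHom χ ⟧ * ⟦ lookup χ x == fin 0 ⟧) ≡⟨ cong (q *_) (sum-cong-≗ (λ x → cong₂ (λ a b → ⟦ a ⟧ * ⟦ b ⟧) (isHom-intro χ zero-hom) (⌊⌋-intro (lookup∘tabulate _ x)))) ⟩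
          q * sum {n} (λ _ → 1) ≡⟨ cong₂ _*_ q≡1+ (trans (sum-const n 1) (*-identityʳ n)) ⟩
          n + (q ∸ 1) * n ≡⟨ +-comm n _ ⟩
          (q ∸ 1) * n + n ≡⟨ cong₂ _+_ (*-identityʳ ((q ∸ 1) * n)) (*-identityʳ n) ⟨
          ((q ∸ 1) * n) * 1 + n * 1 ≡⟨ cong₂ (λ a b → ((q ∸ 1) * n) * ⟦ a ⟧ + n * ⟦ b ⟧) z (isHom-intro χ zero-hom) ⟨
          ((q ∸ 1) * n) * ⟦ isZero χ ⟧ + n * ⟦ isHom χ ⟧ ∎
      pt χ | inj₂ z | inj₂ f = begin
          q * sum (λ x → ⟦ isHom χ ⟧ * ⟦ lookup χ x == fin 0 ⟧) ≡⟨ cong (q *_) (sum-zero _ (λ x → cong (λ b → ⟦ b ⟧ * ⟦ lookup χ x == fin 0 ⟧) f)) ⟩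
          q * 0 ≡⟨ *-zeroʳ q ⟩
          0 ≡⟨ cong₂ _+_ (*-zeroʳ ((q ∸ 1) * n)) (*-zeroʳ n) ⟨
          ((q ∸ 1) * n) * 0 + n * 0 ≡⟨ cong₂ (λ a b → ((q ∸ 1) * n) * ⟦ a ⟧ + n * ⟦ b ⟧) z f ⟨
          ((q ∸ 1) * n) * ⟦ isZero χ ⟧ + n * ⟦ isHom χ ⟧ ∎
      pt χ | inj₂ z | inj₁ t with nonzero-hom χ (isHom-true χ t) z
      ... | g , χg = begin
          q * sum (λ x → ⟦ isHom χ ⟧ * ⟦ lookup χ x == fin 0 ⟧) ≡⟨ cong (q *_) (sum-cong-≗ (λ x → trans (cong (λ b → ⟦ b ⟧ * ⟦ lookup χ x == fin 0 ⟧) t) (+-identityʳ _))) ⟩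
          q * # (λ x → lookup χ x == fin 0) ≡⟨ kernel-size χ (isHom-true χ t) g χg 0 ⟩
          n ≡⟨ cong₂ _+_ (*-zeroʳ ((q ∸ 1) * n)) (*-identityʳ n) ⟨
          ((q ∸ 1) * n) * 0 + n * 1 ≡⟨ cong₂ (λ a b → ((q ∸ 1) * n) * ⟦ a ⟧ + n * ⟦ b ⟧) z t ⟨
          ((q ∸ 1) * n) * ⟦ isZero χ ⟧ + n * ⟦ isHom χ ⟧ ∎

  #Hom≡#torsion : #Hom ≡ # torsion
  #Hom≡#torsion = *-cancelˡ-≡ #Hom (# torsion) (# qG) {{>-nonZero (#>0 qG 𝟘 (IsSub.has-𝟘 qG-sub))}} (trans hom-count (sym qG-torsion))

-- Powers, binomial coefficients and the exponential series

^-monoˡ : ∀ n {x y} → x ≤ y → x ^ n ≤ y ^ n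
^-monoˡ n le = ^-monoˡ-≤ n le

^-mono-<ˡ : ∀ n {x y} → 1 ≤ n → x < y → x ^ n < y ^ n
^-mono-<ˡ (suc zero) {x} {y} _ lt = subst₂ _<_ (sym (*-identityʳ x)) (sym (*-identityʳ y)) lt
^-mono-<ˡ (suc (suc n)) {x} {y} _ lt = *-mono-< lt (^-mono-<ˡ (suc n) (s≤s z≤n) lt)

root-≤ : ∀ n {x y} → 1 ≤ n → x ^ n ≤ y ^ n → x ≤ y
root-≤ n n≥1 le = ≮⇒≥ λ lt → <⇒≱ (^-mono-<ˡ n n≥1 lt) le

^-distrib-* : ∀ x y n → (x * y) ^ n ≡ x ^ n * y ^ n
^-distrib-* x y zero = refl
^-distrib-* x y (suc n) = trans (cong (x * y *_) (^-distrib-* x y n)) (l x y (x ^ n) (y ^ n))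
  where
  l : ∀ x y a b → x * y * (a * b) ≡ x * a * (y * b)
  l = solve-∀

^-pos : ∀ x n → 1 ≤ x → 1 ≤ x ^ n
^-pos x n h = m^n>0 x {{>-nonZero h}} n

bernoulli-lower : ∀ Q δ v → Q ^ suc v + suc v * δ * Q ^ v ≤ (Q + δ) ^ suc v
bernoulli-lower Q δ zero = ≤-reflexive (l Q δ)
  where
  l : ∀ Q δ → Q * 1 + (δ + 0) * 1 ≡ (Q + δ) * 1
  l = solve-∀
bernoulli-lower Q δ (suc v) = begin
  Q ^ suc (suc v) + suc (suc v) * δ * Q ^ suc v ≤⟨ m≤m+n _ (δ * (suc v * δ * Q ^ v)) ⟩
  Q ^ suc (suc v) + suc (suc v) * δ * Q ^ suc v + δ * (suc v * δ * Q ^ v) ≡⟨ l Q δ v (Q ^ v) ⟩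
  (Q + δ) * (Q ^ suc v + suc v * δ * Q ^ v) ≤⟨ *-monoʳ-≤ (Q + δ) (bernoulli-lower Q δ v) ⟩
  (Q + δ) ^ suc (suc v) ∎
  where
  open ≤-Reasoning
  l : ∀ Q δ v w → Q * (Q * w) + suc (suc v) * δ * (Q * w) + δ * (suc v * δ * w) ≡ (Q + δ) * (Q * w + suc v * δ * w)
  l = solve-∀

bernoulli-upper : ∀ x a s → (x + a) ^ suc s ≤ x ^ suc s + suc s * a * (x + a) ^ s
bernoulli-upper x a zero = ≤-reflexive (l x a)
  where
  l : ∀ x a → (x + a) * 1 ≡ x * 1 + (a + 0) * 1
  l = solve-∀
bernoulli-upper x a (suc s) = begin
  (x + a) * (x + a) ^ suc s ≤⟨ *-monoʳ-≤ (x + a) (bernoulli-upper x a s) ⟩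
  (x + a) * (x ^ suc s + suc s * a * y) ≡⟨ l₁ x a s (x ^ s) y ⟩
  x ^ suc (suc s) + a * x ^ suc s + suc s * a * ((x + a) * y) ≤⟨ +-monoˡ-≤ _ (+-monoʳ-≤ (x ^ suc (suc s)) (*-monoʳ-≤ a (^-monoˡ (suc s) (m≤m+n x a)))) ⟩
  x ^ suc (suc s) + a * ((x + a) * y) + suc s * a * ((x + a) * y) ≡⟨ l₂ x a s (x ^ s) y ⟩
  x ^ suc (suc s) + suc (suc s) * a * (x + a) ^ suc s ∎
  where
  open ≤-Reasoning
  y = (x + a) ^ s
  l₁ : ∀ x a s w y → (x + a) * (x * w + suc s * a * y) ≡ x * (x * w) + a * (x * w) + suc s * a * ((x + a) * y)
  l₁ = solve-∀
  l₂ : ∀ x a s w y → x * (x * w) + a * ((x + a) * y) + suc s * a * ((x + a) * y) ≡ x * (x * w) + suc (suc s) * a * ((x + a) * y)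
  l₂ = solve-∀

-- An integer form of (1 + δ/Q)^K ≥ 2^j. The exponent v = 1 + ⌊Q/δ⌋ is large enough for Bernoulli's
-- inequality to give a doubling and small enough that j blocks of length v fit into K.
power-gap : ∀ j K Q δ → 1 ≤ δ → j * (Q + δ) ≤ K * δ → 2 ^ j * Q ^ K ≤ (Q + δ) ^ K
power-gap j K Q δ δ≥1 h = begin
  2 ^ j * Q ^ K ≡⟨ cong (λ z → 2 ^ j * Q ^ z) (m+[n∸m]≡n vj≤K) ⟨
  2 ^ j * Q ^ (v * j + (K ∸ v * j)) ≡⟨ cong (2 ^ j *_) (trans (^-distribˡ-+-* Q (v * j) _) (cong (_* Q ^ (K ∸ v * j)) (sym (^-*-assoc Q v j)))) ⟩
  2 ^ j * ((Q ^ v) ^ j * Q ^ (K ∸ v * j)) ≡⟨ *-assoc (2 ^ j) _ _ ⟨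
  2 ^ j * (Q ^ v) ^ j * Q ^ (K ∸ v * j) ≡⟨ cong (_* Q ^ (K ∸ v * j)) (^-distrib-* 2 (Q ^ v) j) ⟨
  (2 * Q ^ v) ^ j * Q ^ (K ∸ v * j) ≤⟨ *-mono-≤ (^-monoˡ j double) (^-monoˡ (K ∸ v * j) (m≤m+n Q δ)) ⟩
  ((Q + δ) ^ v) ^ j * (Q + δ) ^ (K ∸ v * j) ≡⟨ cong (_* (Q + δ) ^ (K ∸ v * j)) (^-*-assoc (Q + δ) v j) ⟩
  (Q + δ) ^ (v * j) * (Q + δ) ^ (K ∸ v * j) ≡⟨ ^-distribˡ-+-* (Q + δ) (v * j) _ ⟨
  (Q + δ) ^ (v * j + (K ∸ v * j)) ≡⟨ cong ((Q + δ) ^_) (m+[n∸m]≡n vj≤K) ⟩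
  (Q + δ) ^ K ∎
  where
  open ≤-Reasoning
  instance
    δ-nz : NonZero δ
    δ-nz = >-nonZero δ≥1
  v = suc (Q / δ)
  Q≤vδ : Q ≤ v * δ
  Q≤vδ = ≤-trans (≤-reflexive (m≡m%n+[m/n]*n Q δ)) (+-monoˡ-≤ _ (<⇒≤ (m%n<n Q δ)))
  vδ≤P : v * δ ≤ Q + δ
  vδ≤P = ≤-trans (+-monoʳ-≤ δ (m/n*n≤m Q δ)) (≤-reflexive (+-comm δ Q))
  vj≤K : v * j ≤ K
  vj≤K = *-cancelʳ-≤ (v * j) K δ (≤-trans (≤-reflexive (l v j δ)) (≤-trans (*-monoʳ-≤ j vδ≤P) h))
    where
    l : ∀ v j δ → v * j * δ ≡ j * (v * δ)
    l = solve-∀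
  double : 2 * Q ^ v ≤ (Q + δ) ^ v
  double = ≤-trans (≤-trans (≤-reflexive (l (Q ^ v))) (+-monoʳ-≤ (Q ^ v) (*-monoˡ-≤ (Q ^ (Q / δ)) Q≤vδ))) (bernoulli-lower Q δ (Q / δ))
    where
    l : ∀ a → 2 * a ≡ a + a
    l = solve-∀

double-bound : ∀ x a s → s * (2 * a) ≤ x + a → (x + a) ^ s ≤ 2 * x ^ s
double-bound x a zero _ = s≤s z≤n
double-bound x a (suc s) le = +-cancelʳ-≤ ((x + a) ^ suc s) _ _ (begin
  (x + a) ^ suc s + (x + a) ^ suc s ≡⟨ l₁ ((x + a) ^ suc s) ⟩
  2 * (x + a) ^ suc s ≤⟨ *-monoʳ-≤ 2 (bernoulli-upper x a s) ⟩
  2 * (x ^ suc s + suc s * a * (x + a) ^ s) ≡⟨ l₂ (x ^ suc s) (suc s) a ((x + a) ^ s) ⟩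
  2 * x ^ suc s + suc s * (2 * a) * (x + a) ^ s ≤⟨ +-monoʳ-≤ (2 * x ^ suc s) (*-monoˡ-≤ ((x + a) ^ s) le) ⟩
  2 * x ^ suc s + (x + a) ^ suc s ∎)
  where
  open ≤-Reasoning
  l₁ : ∀ a → a + a ≡ 2 * a
  l₁ = solve-∀
  l₂ : ∀ w s a y → 2 * (w + s * a * y) ≡ 2 * w + s * (2 * a) * y
  l₂ = solve-∀

-- An integer form of (1 + a/x)^n ≤ exp(an/x). A block of length s = ⌊(x + a)/(2a)⌋ at most doubles,
-- and since x ≤ 4as, n is covered by 4j blocks.
exp-bound : ∀ x a n j → 1 ≤ a → a ≤ x → a * n ≤ x * j → (x + a) ^ n ≤ 2 ^ (4 * j) * x ^ n
exp-bound x a n j a≥1 a≤x h = *-cancelʳ-≤ _ _ (x ^ (s * B ∸ n)) {{>-nonZero (^-pos x (s * B ∸ n) (≤-trans a≥1 a≤x))}} (begin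
  (x + a) ^ n * x ^ (s * B ∸ n) ≤⟨ *-monoʳ-≤ ((x + a) ^ n) (^-monoˡ (s * B ∸ n) (m≤m+n x a)) ⟩
  (x + a) ^ n * (x + a) ^ (s * B ∸ n) ≡⟨ ^-distribˡ-+-* (x + a) n _ ⟨
  (x + a) ^ (n + (s * B ∸ n)) ≡⟨ cong ((x + a) ^_) (m+[n∸m]≡n n≤sB) ⟩
  (x + a) ^ (s * B) ≡⟨ ^-*-assoc (x + a) s B ⟨
  ((x + a) ^ s) ^ B ≤⟨ ^-monoˡ B block ⟩
  (2 * x ^ s) ^ B ≡⟨ ^-distrib-* 2 (x ^ s) B ⟩
  2 ^ B * (x ^ s) ^ B ≡⟨ cong (2 ^ B *_) (^-*-assoc x s B) ⟩
  2 ^ B * x ^ (s * B) ≡⟨ cong (λ z → 2 ^ B * x ^ z) (m+[n∸m]≡n n≤sB) ⟨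
  2 ^ B * x ^ (n + (s * B ∸ n)) ≡⟨ cong (2 ^ B *_) (^-distribˡ-+-* x n _) ⟩
  2 ^ B * (x ^ n * x ^ (s * B ∸ n)) ≡⟨ *-assoc (2 ^ B) _ _ ⟨
  2 ^ B * x ^ n * x ^ (s * B ∸ n) ∎)
  where
  open ≤-Reasoning
  instance
    2a-nz : NonZero (2 * a)
    2a-nz = >-nonZero (≤-trans a≥1 (m≤m+n a _))
  B = 4 * j
  s = (x + a) / (2 * a)
  s≥1 : 1 ≤ s
  s≥1 = m≥n⇒m/n>0 (≤-trans (≤-reflexive (l a)) (+-monoˡ-≤ a a≤x))
    where
    l : ∀ a → 2 * a ≡ a + a
    l = solve-∀
  x≤4as : x ≤ a * (4 * s)
  x≤4as = begin
    x ≤⟨ m≤m+n x a ⟩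
    x + a ≡⟨ m≡m%n+[m/n]*n (x + a) (2 * a) ⟩
    (x + a) % (2 * a) + s * (2 * a) ≤⟨ +-monoˡ-≤ _ (≤-trans (<⇒≤ (m%n<n (x + a) (2 * a))) (≤-trans (≤-reflexive (sym (+-identityʳ (2 * a)))) (*-monoˡ-≤ (2 * a) s≥1))) ⟩
    s * (2 * a) + s * (2 * a) ≡⟨ l a s ⟩
    a * (4 * s) ∎
    where
    l : ∀ a s → s * (2 * a) + s * (2 * a) ≡ a * (4 * s)
    l = solve-∀
  n≤sB : n ≤ s * B
  n≤sB = *-cancelˡ-≤ a {{>-nonZero a≥1}} (≤-trans h (≤-trans (*-monoˡ-≤ j x≤4as) (≤-reflexive (l a s j))))
    where
    l : ∀ a s j → a * (4 * s) * j ≡ a * (s * (4 * j))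
    l = solve-∀
  block : (x + a) ^ s ≤ 2 * x ^ s
  block = double-bound x a s (m/n*n≤m (x + a) (2 * a))

factorial-up : ∀ m i → m ! * m ^ i ≤ (m + i) !
factorial-up m zero = ≤-reflexive (trans (*-identityʳ (m !)) (cong _! (sym (+-identityʳ m))))
factorial-up m (suc i) = begin
  m ! * (m * m ^ i) ≡⟨ l (m !) m (m ^ i) ⟩
  m * (m ! * m ^ i) ≤⟨ *-mono-≤ (≤-trans (m≤m+n m i) (n≤1+n (m + i))) (factorial-up m i) ⟩
  suc (m + i) * (m + i) ! ≡⟨ cong _! (+-suc m i) ⟨
  (m + suc i) ! ∎
  where
  open ≤-Reasoning
  l : ∀ f m w → f * (m * w) ≡ m * (f * w)
  l = solve-∀

factorial-down : ∀ j i → (j + i) ! ≤ j ! * (j + i) ^ i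
factorial-down j zero = ≤-reflexive (trans (cong _! (+-identityʳ j)) (sym (*-identityʳ (j !))))
factorial-down j (suc i) = begin
  (j + suc i) ! ≡⟨ cong _! (+-suc j i) ⟩
  suc (j + i) * (j + i) ! ≤⟨ *-monoʳ-≤ (suc (j + i)) (factorial-down j i) ⟩
  suc (j + i) * (j ! * (j + i) ^ i) ≤⟨ *-monoʳ-≤ (suc (j + i)) (*-monoʳ-≤ (j !) (^-monoˡ i (n≤1+n (j + i)))) ⟩
  suc (j + i) * (j ! * suc (j + i) ^ i) ≡⟨ l (suc (j + i)) (j !) (suc (j + i) ^ i) ⟩
  j ! * (suc (j + i) * suc (j + i) ^ i) ≡⟨ cong (λ z → j ! * (z * z ^ i)) (+-suc j i) ⟨
  j ! * (j + suc i) ^ suc i ∎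
  where
  open ≤-Reasoning
  l : ∀ a b c → a * (b * c) ≡ b * (a * c)
  l = solve-∀

C-factorial : ∀ {N j} → j ≤ N → (N C j) * (j ! * (N ∸ j) !) ≡ N !
C-factorial {N} {j} j≤N = trans (cong (_* (j ! * (N ∸ j) !)) (nCk≡n!/k![n-k]! j≤N)) (m/n*n≡m {{j !* (N ∸ j) !≢0}} (k![n∸k]!∣n! j≤N))

mode-right : ∀ m i c → ((m + (i + c)) C (m + i)) * (m ^ (m + i) * (i + c) ^ c) ≤ ((m + (i + c)) C m) * (m ^ m * (i + c) ^ (i + c))
mode-right m i c = *-cancelʳ-≤ _ _ ((m + i) ! * c !) {{m*n≢0 ((m + i) !) (c !) {{(m + i) !≢0}} {{c !≢0}}}} (begin
  (N C (m + i)) * (m ^ (m + i) * b ^ c) * ((m + i) ! * c !) ≡⟨ l₁ (N C (m + i)) _ _ ⟩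
  (N C (m + i)) * ((m + i) ! * c !) * (m ^ (m + i) * b ^ c) ≡⟨ cong (_* (m ^ (m + i) * b ^ c)) (trans (cong (λ z → (N C (m + i)) * ((m + i) ! * z !)) (sym c≡)) (trans (C-factorial mi≤N) (sym (trans (cong (λ z → (N C m) * (m ! * z !)) (sym (m+n∸m≡n m b))) (C-factorial (m≤m+n m b)))))) ⟩
  (N C m) * (m ! * b !) * (m ^ (m + i) * b ^ c) ≡⟨ cong (λ z → (N C m) * (m ! * b !) * (z * b ^ c)) (^-distribˡ-+-* m m i) ⟩
  (N C m) * (m ! * b !) * (m ^ m * m ^ i * b ^ c) ≡⟨ l₂ (N C m) (m !) (b !) (m ^ m) (m ^ i) (b ^ c) ⟩
  (N C m) * (m ^ m * b ^ c) * (m ! * m ^ i * b !) ≤⟨ *-monoʳ-≤ ((N C m) * (m ^ m * b ^ c)) (*-mono-≤ (factorial-up m i) b!≤) ⟩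
  (N C m) * (m ^ m * b ^ c) * ((m + i) ! * (c ! * b ^ i)) ≡⟨ l₃ (N C m) (m ^ m) (b ^ c) ((m + i) !) (c !) (b ^ i) ⟩
  (N C m) * (m ^ m * (b ^ i * b ^ c)) * ((m + i) ! * c !) ≡⟨ cong (λ z → (N C m) * (m ^ m * z) * ((m + i) ! * c !)) (^-distribˡ-+-* b i c) ⟨
  (N C m) * (m ^ m * b ^ b) * ((m + i) ! * c !) ∎)
  where
  open ≤-Reasoning
  b = i + c
  N = m + b
  mi≤N : m + i ≤ N
  mi≤N = +-monoʳ-≤ m (m≤m+n i c)
  c≡ : N ∸ (m + i) ≡ c
  c≡ = trans (cong (_∸ (m + i)) (sym (+-assoc m i c))) (m+n∸m≡n (m + i) c)
  b!≤ : b ! ≤ c ! * b ^ i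
  b!≤ = subst (λ z → z ! ≤ c ! * z ^ i) (+-comm c i) (factorial-down c i)
  l₁ : ∀ a b c → a * b * c ≡ a * c * b
  l₁ = solve-∀
  l₂ : ∀ C f g p r t → C * (f * g) * (p * r * t) ≡ C * (p * t) * (f * r * g)
  l₂ = solve-∀
  l₃ : ∀ C p t f g r → C * (p * t) * (f * (g * r)) ≡ C * (p * (r * t)) * (f * g)
  l₃ = solve-∀

mode-left : ∀ j i b → ((j + i + b) C j) * ((j + i) ^ j * b ^ (i + b)) ≤ ((j + i + b) C (j + i)) * ((j + i) ^ (j + i) * b ^ b)
mode-left j i b = *-cancelʳ-≤ _ _ (j ! * (i + b) !) {{m*n≢0 (j !) ((i + b) !) {{j !≢0}} {{(i + b) !≢0}}}} (begin
  (N C j) * (m ^ j * b ^ (i + b)) * (j ! * (i + b) !) ≡⟨ l₁ (N C j) _ _ ⟩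
  (N C j) * (j ! * (i + b) !) * (m ^ j * b ^ (i + b)) ≡⟨ cong (_* (m ^ j * b ^ (i + b))) (trans (cong (λ z → (N C j) * (j ! * z !)) (sym c≡)) (trans (C-factorial j≤N) (sym (trans (cong (λ z → (N C m) * (m ! * z !)) (sym (m+n∸m≡n m b))) (C-factorial (m≤m+n m b)))))) ⟩
  (N C m) * (m ! * b !) * (m ^ j * b ^ (i + b)) ≡⟨ cong (λ z → (N C m) * (m ! * b !) * (m ^ j * z)) (^-distribˡ-+-* b i b) ⟩
  (N C m) * (m ! * b !) * (m ^ j * (b ^ i * b ^ b)) ≡⟨ l₂ (N C m) (m !) (b !) (m ^ j) (b ^ i) (b ^ b) ⟩
  (N C m) * (m ^ j * b ^ b) * (m ! * (b ! * b ^ i)) ≤⟨ *-monoʳ-≤ ((N C m) * (m ^ j * b ^ b)) (*-mono-≤ (factorial-down j i) (≤-trans (factorial-up b i) (≤-reflexive (cong _! (+-comm b i))))) ⟩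
  (N C m) * (m ^ j * b ^ b) * (j ! * m ^ i * (i + b) !) ≡⟨ l₃ (N C m) (m ^ j) (b ^ b) (j !) (m ^ i) ((i + b) !) ⟩
  (N C m) * (m ^ j * m ^ i * b ^ b) * (j ! * (i + b) !) ≡⟨ cong (λ z → (N C m) * (z * b ^ b) * (j ! * (i + b) !)) (^-distribˡ-+-* m j i) ⟨
  (N C m) * (m ^ m * b ^ b) * (j ! * (i + b) !) ∎)
  where
  open ≤-Reasoning
  m = j + i
  N = m + b
  j≤N : j ≤ N
  j≤N = ≤-trans (m≤m+n j i) (m≤m+n (j + i) b)
  c≡ : N ∸ j ≡ i + b
  c≡ = trans (cong (_∸ j) (+-assoc j i b)) (m+n∸m≡n j (i + b))
  l₁ : ∀ a b c → a * b * c ≡ a * c * b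
  l₁ = solve-∀
  l₂ : ∀ C f g p r t → C * (f * g) * (p * (r * t)) ≡ C * (p * t) * (f * (g * r))
  l₂ = solve-∀
  l₃ : ∀ C p t f r g → C * (p * t) * (f * r * g) ≡ C * (p * r * t) * (f * g)
  l₃ = solve-∀

-- Compares the terms j and m of the expansion of (m + b)^(m + b). Between them lie |m - j| factors,
-- each bounded by an extreme one in `factorial-up` and `factorial-down`.
binomial-mode : ∀ m b j → j ≤ m + b → ((m + b) C j) * (m ^ j * b ^ (m + b ∸ j)) ≤ ((m + b) C m) * (m ^ m * b ^ b)
binomial-mode m b j j≤N with ≤-total m j
... | inj₁ m≤j = subst₂ (λ J B → ((m + B) C J) * (m ^ J * B ^ (m + B ∸ J)) ≤ ((m + B) C m) * (m ^ m * B ^ B)) (m+[n∸m]≡n m≤j) b≡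
      (subst (λ z → ((m + (i + c)) C (m + i)) * (m ^ (m + i) * (i + c) ^ z) ≤ ((m + (i + c)) C m) * (m ^ m * (i + c) ^ (i + c))) (sym c≡) (mode-right m i c))
  where
  i = j ∸ m
  i≤b : i ≤ b
  i≤b = m≤n+o⇒m∸n≤o j m j≤N
  c = b ∸ i
  b≡ : i + c ≡ b
  b≡ = m+[n∸m]≡n i≤b
  c≡ : m + (i + c) ∸ (m + i) ≡ c
  c≡ = trans (cong (_∸ (m + i)) (sym (+-assoc m i c))) (m+n∸m≡n (m + i) c)
... | inj₂ j≤m = subst (λ M → ((M + b) C j) * (M ^ j * b ^ (M + b ∸ j)) ≤ ((M + b) C M) * (M ^ M * b ^ b)) (m+[n∸m]≡n j≤m)
      (subst (λ z → ((j + i + b) C j) * ((j + i) ^ j * b ^ z) ≤ ((j + i + b) C (j + i)) * ((j + i) ^ (j + i) * b ^ b)) (sym c≡) (mode-left j i b))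
  where
  i = m ∸ j
  c≡ : j + i + b ∸ j ≡ i + b
  c≡ = trans (cong (_∸ j) (+-assoc j i b)) (m+n∸m≡n j (i + b))

-- k! 2ᵏ Σ_{i ≤ k} (y/2)ⁱ / i!, compared at consecutive y by the mean value theorem.
halfExp : ℕ → ℕ → ℕ
halfExp y zero = 1
halfExp y (suc k) = 2 * suc k * halfExp y k + y ^ suc k

power-step : ∀ y i → suc y ^ suc i ≤ y ^ suc i + suc i * suc y ^ i
power-step y i = subst₂ (λ a b → a ^ suc i ≤ y ^ suc i + b * a ^ i) (+-comm y 1) (*-identityʳ (suc i)) (bernoulli-upper y 1 i)

halfExp-step : ∀ y k → halfExp (suc y) (suc k) ≤ halfExp y (suc k) + suc k * halfExp (suc y) k
halfExp-step y zero = ≤-reflexive (l y)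
  where
  l : ∀ y → 2 + suc y * 1 ≡ 2 + y * 1 + 1
  l = solve-∀
halfExp-step y (suc k) = begin
  2 * suc (suc k) * halfExp (suc y) (suc k) + suc y ^ suc (suc k) ≤⟨ +-mono-≤ (*-monoʳ-≤ (2 * suc (suc k)) (halfExp-step y k)) (power-step y (suc k)) ⟩
  2 * suc (suc k) * (halfExp y (suc k) + suc k * halfExp (suc y) k) + (y ^ suc (suc k) + suc (suc k) * suc y ^ suc k) ≡⟨ l k (halfExp y (suc k)) (halfExp (suc y) k) (y ^ suc (suc k)) (suc y ^ suc k) ⟩
  2 * suc (suc k) * halfExp y (suc k) + y ^ suc (suc k) + suc (suc k) * (2 * suc k * halfExp (suc y) k + suc y ^ suc k) ∎
  where
  open ≤-Reasoning
  l : ∀ k a b c d → 2 * suc (suc k) * (a + suc k * b) + (c + suc (suc k) * d) ≡ 2 * suc (suc k) * a + c + suc (suc k) * (2 * suc k * b + d)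
  l = solve-∀

-- By `halfExp-step` the increment is at most half of the larger value. For e^y in place of e^(y/2)
-- it would only be bounded by the larger value itself; this is the reason for the halving, and for
-- the base 4 = 2² in `expS-bound`.
halfExp-double : ∀ y k → halfExp (suc y) k ≤ 2 * halfExp y k
halfExp-double y zero = s≤s z≤n
halfExp-double y (suc k) = +-cancelʳ-≤ (halfExp (suc y) (suc k)) _ _ (begin
  halfExp (suc y) (suc k) + halfExp (suc y) (suc k) ≡⟨ l₁ (halfExp (suc y) (suc k)) ⟩
  2 * halfExp (suc y) (suc k) ≤⟨ *-monoʳ-≤ 2 (halfExp-step y k) ⟩
  2 * (halfExp y (suc k) + suc k * halfExp (suc y) k) ≡⟨ l₂ (halfExp y (suc k)) (suc k) (halfExp (suc y) k) ⟩
  2 * halfExp y (suc k) + 2 * suc k * halfExp (suc y) k ≤⟨ +-monoʳ-≤ (2 * halfExp y (suc k)) (m≤m+n _ (suc y ^ suc k)) ⟩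
  2 * halfExp y (suc k) + halfExp (suc y) (suc k) ∎)
  where
  open ≤-Reasoning
  l₁ : ∀ a → a + a ≡ 2 * a
  l₁ = solve-∀
  l₂ : ∀ a s b → 2 * (a + s * b) ≡ 2 * a + 2 * s * b
  l₂ = solve-∀

halfExp-zero : ∀ k → halfExp 0 k ≡ 2 ^ k * k !
halfExp-zero zero = refl
halfExp-zero (suc k) = trans (+-identityʳ _) (trans (cong (2 * suc k *_) (halfExp-zero k)) (l k (2 ^ k) (k !)))
  where
  l : ∀ k a b → 2 * suc k * (a * b) ≡ 2 * a * (suc k * b)
  l = solve-∀

halfExp-bound : ∀ y k → halfExp y k ≤ 2 ^ y * (2 ^ k * k !)
halfExp-bound zero k = ≤-reflexive (trans (halfExp-zero k) (sym (+-identityʳ _)))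
halfExp-bound (suc y) k = ≤-trans (halfExp-double y k) (≤-trans (*-monoʳ-≤ 2 (halfExp-bound y k)) (≤-reflexive (sym (*-assoc 2 (2 ^ y) _))))

halfExp-even : ∀ a k → halfExp (2 * a) k ≡ 2 ^ k * expS a k
halfExp-even a zero = refl
halfExp-even a (suc k) = trans (cong₂ (λ u v → 2 * suc k * u + v) (halfExp-even a k) (^-distrib-* 2 a (suc k))) (l k (2 ^ k) (expS a k) (a ^ suc k))
  where
  l : ∀ k t e p → 2 * suc k * (t * e) + 2 * t * p ≡ 2 * t * (suc k * e + p)
  l = solve-∀

expS-bound : ∀ a k → expS a k ≤ 4 ^ a * k !
expS-bound a k = *-cancelˡ-≤ (2 ^ k) {{>-nonZero (^-pos 2 k (s≤s z≤n))}} (begin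
  2 ^ k * expS a k ≡⟨ halfExp-even a k ⟨
  halfExp (2 * a) k ≤⟨ halfExp-bound (2 * a) k ⟩
  2 ^ (2 * a) * (2 ^ k * k !) ≡⟨ cong (_* (2 ^ k * k !)) (^-*-assoc 2 2 a) ⟨
  4 ^ a * (2 ^ k * k !) ≡⟨ l (4 ^ a) (2 ^ k) (k !) ⟩
  2 ^ k * (4 ^ a * k !) ∎)
  where
  open ≤-Reasoning
  l : ∀ a b c → a * (b * c) ≡ b * (a * c)
  l = solve-∀

-- The logarithmic hypothesis on m enters the proof only in this form. Replacing e by 4 costs a
-- constant factor.
MulLogLe-bound : ∀ b n a → MulLogLe b n a → n ^ b ≤ 4 ^ a
MulLogLe-bound b n a (k , h) = *-cancelʳ-≤ (n ^ b) (4 ^ a) (k !) {{k !≢0}} (≤-trans h (expS-bound a k))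

-- Weighted counts of independent sets

module Weights (a b : ℕ) where
  weight : ∀ {n} → Subset n → ℕ
  weight [] = 1
  weight (true ∷ v) = a * weight v
  weight (false ∷ v) = b * weight v

  weight-size : ∀ {n} (v : Subset n) → weight v ≡ a ^ ∣ v ∣ * b ^ (n ∸ ∣ v ∣)
  weight-size [] = refl
  weight-size (true ∷ v) = trans (cong (a *_) (weight-size v)) (sym (*-assoc a _ _))
  weight-size {suc n} (false ∷ v) = trans (cong (b *_) (weight-size v)) (trans (l b (a ^ ∣ v ∣) (b ^ (n ∸ ∣ v ∣)))
    (cong (λ z → a ^ ∣ v ∣ * b ^ z) (sym (+-∸-assoc 1 (∣v∣≤n v)))))
    where
    ∣v∣≤n : ∀ {n} (v : Subset n) → ∣ v ∣ ≤ n
    ∣v∣≤n v = subst (_≤ _) (#-lookup v) (#≤n (lookup v))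
    l : ∀ b x y → b * (x * y) ≡ x * (b * y)
    l = solve-∀

  -- The total weight of all subsets of `F`, against which `indep` is measured.
  mass : ∀ {n} → Pr n → ℕ
  mass {zero} F = 1
  mass {suc n} F = (if F zero then a + b else b) * mass (F ∘ suc)

  mass-size : ∀ {n} (F : Pr n) → mass F ≡ (a + b) ^ # F * b ^ # (∁ F)
  mass-size {zero} F = sym (cong₂ (λ x y → (a + b) ^ x * b ^ y) (sum-0 _) (sum-0 _))
  mass-size {suc n} F = trans (go (F zero) (mass-size (F ∘ suc))) (sym (cong₂ (λ x y → (a + b) ^ x * b ^ y) (sum-suc (λ i → ⟦ F i ⟧)) (sum-suc (λ i → ⟦ ∁ F i ⟧))))
    where
    x = # (F ∘ suc)
    y = # (∁ (F ∘ suc))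
    go : ∀ t → mass (F ∘ suc) ≡ (a + b) ^ x * b ^ y → (if t then a + b else b) * mass (F ∘ suc) ≡ (a + b) ^ (⟦ t ⟧ + x) * b ^ (⟦ not t ⟧ + y)
    go true e = trans (cong ((a + b) *_) e) (sym (*-assoc (a + b) _ _))
    go false e = trans (cong (b *_) e) (l b ((a + b) ^ x) (b ^ y))
      where
      l : ∀ b x y → b * (x * y) ≡ x * (b * y)
      l = solve-∀

  mass-remove : ∀ {n} (F D : Pr n) → mass (F ∩ ∁ D) * (a + b) ^ # (F ∩ D) ≡ mass F * b ^ # (F ∩ D)
  mass-remove {zero} F D = cong (λ x → 1 * x) (trans (cong ((a + b) ^_) (sum-0 _)) (sym (cong (b ^_) (sum-0 _))))
  mass-remove {suc n} F D = trans (cong (λ z → mass (F ∩ ∁ D) * (a + b) ^ z) (sum-suc _)) (trans (go (F zero) (D zero) (mass-remove (F ∘ suc) (D ∘ suc))) (cong (λ z → mass F * b ^ z) (sym (sum-suc (λ i → ⟦ (F ∩ D) i ⟧)))))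
    where
    x = # ((F ∘ suc) ∩ (D ∘ suc))
    m = mass ((F ∘ suc) ∩ ∁ (D ∘ suc))
    m′ = mass (F ∘ suc)
    l₁ : ∀ s m p → s * m * p ≡ s * (m * p)
    l₁ = solve-∀
    l₂ : ∀ b m s p → b * m * (s * p) ≡ b * s * (m * p)
    l₂ = solve-∀
    go : ∀ f d → m * (a + b) ^ x ≡ m′ * b ^ x → (if f ∧ not d then a + b else b) * m * (a + b) ^ (⟦ f ∧ d ⟧ + x) ≡ (if f then a + b else b) * m′ * b ^ (⟦ f ∧ d ⟧ + x)
    go true true e = trans (l₂ b m (a + b) ((a + b) ^ x)) (trans (cong (b * (a + b) *_) e) (l (a + b) b m′ (b ^ x)))
      where
      l : ∀ s b m p → b * s * (m * p) ≡ s * m * (b * p)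
      l = solve-∀
    go true false e = trans (l₁ (a + b) m _) (trans (cong ((a + b) *_) e) (sym (l₁ (a + b) m′ _)))
    go false d e = trans (l₁ b m _) (trans (cong (b *_) e) (sym (l₁ b m′ _)))

  -- The total weight of the R-independent subsets of F, computed by branching on the first vertex.
  indep : ∀ {n} → (Fin n → Pr n) → Pr n → ℕ
  indep {zero} R F = 1
  indep {suc n} R F = b * indep (λ i j → R (suc i) (suc j)) (F ∘ suc)
    + (if F zero then a * indep (λ i j → R (suc i) (suc j)) ((F ∘ suc) ∩ ∁ (R zero ∘ suc)) else 0)

  indep-bounds : ∀ {n} (R : Fin n → Pr n) (F : Pr n) (P : Subset n → Bool) →
    (∀ v → P v ≡ true → lookup v ⊑ F) → (∀ v → P v ≡ true → ∀ i j → lookup v ∋∋ i → lookup v ∋∋ j → ¬ (R i ∋∋ j)) →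
    ∑S n (λ v → ⟦ P v ⟧ * weight v) ≤ indep R F
  indep-bounds {zero} R F P sub ind = ≤-trans (≤-reflexive (+-identityʳ _)) (≤-trans (≤-reflexive (*-identityʳ _)) (⟦⟧≤1 (P [])))
  indep-bounds {suc n} R F P sub ind = ≤-trans (≤-reflexive (∑S-suc n _)) (+-mono-≤ without (with-head (bool-cases (F zero))))
    where
    R′ : Fin n → Pr n
    R′ i j = R (suc i) (suc j)
    pull : ∀ c (g : Subset n → Bool) → ∑S n (λ v → ⟦ g v ⟧ * (c * weight v)) ≡ c * ∑S n (λ v → ⟦ g v ⟧ * weight v)
    pull c g = trans (ΣL-cong (allSubsets n) (λ v → l ⟦ g v ⟧ c (weight v))) (ΣL-* (allSubsets n) c _)
      where
      l : ∀ x y z → x * (y * z) ≡ y * (x * z)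
      l = solve-∀
    without : ∑S n (λ v → ⟦ P (false ∷ v) ⟧ * (b * weight v)) ≤ b * indep R′ (F ∘ suc)
    without = ≤-trans (≤-reflexive (pull b (λ v → P (false ∷ v)))) (*-monoʳ-≤ b (indep-bounds R′ (F ∘ suc) (λ v → P (false ∷ v))
      (λ v p i → sub (false ∷ v) p (suc i)) (λ v p i j → ind (false ∷ v) p (suc i) (suc j))))
    with-head : F zero ≡ true ⊎ F zero ≡ false → ∑S n (λ v → ⟦ P (true ∷ v) ⟧ * (a * weight v)) ≤ (if F zero then a * indep R′ ((F ∘ suc) ∩ ∁ (R zero ∘ suc)) else 0)
    with-head (inj₂ e) = ≤-trans (≤-reflexive (ΣL-zero (allSubsets n) (λ v → cong (λ t → ⟦ t ⟧ * (a * weight v)) (¬true (λ p → absurd-b (sub (true ∷ v) p zero refl) e))))) z≤n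
    with-head (inj₁ e) = subst (λ t → _ ≤ (if t then a * indep R′ ((F ∘ suc) ∩ ∁ (R zero ∘ suc)) else 0)) (sym e)
      (≤-trans (≤-reflexive (pull a (λ v → P (true ∷ v)))) (*-monoʳ-≤ a (indep-bounds R′ ((F ∘ suc) ∩ ∁ (R zero ∘ suc)) (λ v → P (true ∷ v))
        (λ v p i q → ∧-intro (sub (true ∷ v) p (suc i) q) (not-intro′ (ind (true ∷ v) p zero (suc i) refl q))) (λ v p i j → ind (true ∷ v) p (suc i) (suc j)))))

arcs : ∀ {n} → (Fin n → Pr n) → Pr n → ℕ
arcs R F = sum (λ i → ⟦ F i ⟧ * # (F ∩ R i))

arcs-suc : ∀ {n} (R : Fin (suc n) → Pr (suc n)) (F : Pr (suc n)) → (∀ i j → R i j ≡ R j i) → (∀ i → R i i ≡ false) →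
  arcs R F ≡ ⟦ F zero ⟧ * (2 * # ((F ∘ suc) ∩ (R zero ∘ suc))) + arcs (λ i j → R (suc i) (suc j)) (F ∘ suc)
arcs-suc {n} R F sy irr = begin
  arcs R F ≡⟨ sum-suc _ ⟩
  t * # (F ∩ R zero) + sum (λ i → ⟦ F (suc i) ⟧ * # (F ∩ R (suc i))) ≡⟨ cong₂ _+_ (cong (t *_) (trans (sum-suc _) (cong (λ z → ⟦ z ⟧ + x) (trans (cong (F zero ∧_) (irr zero)) (∧-zeroʳ (F zero)))))) rest ⟩
  t * x + (t * x + e) ≡⟨ l t x e ⟩
  t * (2 * x) + e ∎
  where
  open ≡-Reasoning
  t = ⟦ F zero ⟧
  R′ : Fin n → Pr n
  R′ i j = R (suc i) (suc j)
  x = # ((F ∘ suc) ∩ (R zero ∘ suc))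
  e = arcs R′ (F ∘ suc)
  l : ∀ t x e → t * x + (t * x + e) ≡ t * (2 * x) + e
  l = solve-∀
  pt : ∀ f g r → ⟦ f ⟧ * ⟦ g ∧ r ⟧ ≡ ⟦ g ⟧ * ⟦ f ∧ r ⟧
  pt true true r = refl
  pt true false r = refl
  pt false true r = refl
  pt false false r = refl
  rest : sum (λ i → ⟦ F (suc i) ⟧ * # (F ∩ R (suc i))) ≡ t * x + e
  rest = trans (sum-cong-≗ (λ i → trans (cong (⟦ F (suc i) ⟧ *_) (sum-suc _)) (trans (*-distribˡ-+ ⟦ F (suc i) ⟧ ⟦ F zero ∧ R (suc i) zero ⟧ _)
      (cong (_+ ⟦ F (suc i) ⟧ * # ((F ∘ suc) ∩ R′ i)) (trans (pt (F (suc i)) (F zero) (R (suc i) zero)) (cong (λ z → t * ⟦ F (suc i) ∧ z ⟧) (sy (suc i) zero)))))))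
    (trans (∑-distrib-+ _ _) (cong (_+ e) (sum-*ˡ t _)))

-- A deleted vertex is the source of at most d arcs and the target of at most d.
arcs-remove : ∀ {n} (R : Fin n → Pr n) (F D : Pr n) d → (∀ i → F i ≡ true → # (F ∩ R i) ≤ d) → (∀ j → F j ≡ true → # (λ i → F i ∧ R i j) ≤ d) →
  arcs R F ≤ arcs R (F ∩ ∁ D) + 2 * # (F ∩ D) * d
arcs-remove {n} R F D d outd ind = begin
  arcs R F ≤⟨ sum-mono (λ i → pt i (F i) (D i) refl) ⟩
  sum (λ i → ⟦ (F ∩ ∁ D) i ⟧ * # ((F ∩ ∁ D) ∩ R i) + (⟦ F i ⟧ * # ((F ∩ D) ∩ R i) + d * ⟦ (F ∩ D) i ⟧)) ≡⟨ trans (∑-distrib-+ _ _) (cong (arcs R (F ∩ ∁ D) +_) (trans (∑-distrib-+ _ _) (cong (cross +_) (sum-*ˡ d _)))) ⟩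
  arcs R (F ∩ ∁ D) + (cross + d * # (F ∩ D)) ≤⟨ +-monoʳ-≤ (arcs R (F ∩ ∁ D)) (+-monoˡ-≤ _ cross≤) ⟩
  arcs R (F ∩ ∁ D) + (d * # (F ∩ D) + d * # (F ∩ D)) ≡⟨ cong (arcs R (F ∩ ∁ D) +_) (l d (# (F ∩ D))) ⟩
  arcs R (F ∩ ∁ D) + 2 * # (F ∩ D) * d ∎
  where
  open ≤-Reasoning
  l : ∀ d x → d * x + d * x ≡ 2 * x * d
  l = solve-∀
  cross = sum (λ i → ⟦ F i ⟧ * # ((F ∩ D) ∩ R i))
  pt : ∀ i f e → f ≡ F i → ⟦ f ⟧ * # (F ∩ R i) ≤ ⟦ f ∧ not e ⟧ * # ((F ∩ ∁ D) ∩ R i) + (⟦ f ⟧ * # ((F ∩ D) ∩ R i) + d * ⟦ f ∧ e ⟧)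
  pt i false e _ = z≤n
  pt i true true e = ≤-trans (≤-reflexive (+-identityʳ _)) (≤-trans (outd i (sym e)) (≤-trans (≤-reflexive (sym (*-identityʳ d))) (m≤n+m _ _)))
  pt i true false _ = ≤-reflexive (trans (cong (_+ 0) split) (l′ (# ((F ∩ ∁ D) ∩ R i)) (# ((F ∩ D) ∩ R i)) d))
    where
    l′ : ∀ u w d → u + w + 0 ≡ u + 0 + (w + 0 + d * 0)
    l′ = solve-∀
    b₁ : ∀ f r e → (f ∧ r) ∧ not e ≡ (f ∧ not e) ∧ r
    b₁ true true e = sym (∧-identityʳ (not e))
    b₁ true false e = sym (∧-zeroʳ (not e))
    b₁ false r e = refl
    b₂ : ∀ f r e → (f ∧ r) ∧ not (not e) ≡ (f ∧ e) ∧ r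
    b₂ true true true = refl
    b₂ true true false = refl
    b₂ true false e = sym (∧-zeroʳ e)
    b₂ false r e = refl
    split : # (F ∩ R i) ≡ # ((F ∩ ∁ D) ∩ R i) + # ((F ∩ D) ∩ R i)
    split = trans (sym (#-split (F ∩ R i) (∁ D))) (cong₂ _+_ (#-cong (λ j → b₁ (F j) (R i j) (D j))) (#-cong (λ j → b₂ (F j) (R i j) (D j))))
  cross≤ : cross ≤ d * # (F ∩ D)
  cross≤ = begin
    cross ≡⟨ sum-cong-≗ (λ i → sym (sum-*ˡ ⟦ F i ⟧ _)) ⟩
    sum (λ i → sum (λ j → ⟦ F i ⟧ * ⟦ (F j ∧ D j) ∧ R i j ⟧)) ≡⟨ ∑-comm (λ i j → ⟦ F i ⟧ * ⟦ (F j ∧ D j) ∧ R i j ⟧) ⟩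
    sum (λ j → sum (λ i → ⟦ F i ⟧ * ⟦ (F j ∧ D j) ∧ R i j ⟧)) ≤⟨ sum-mono (λ j → ≤-trans (≤-reflexive (trans (sum-cong-≗ (λ i → q (F i) (F j ∧ D j) (R i j))) (sum-*ˡ ⟦ (F ∩ D) j ⟧ _))) (r j (F j) (D j) refl)) ⟩
    sum (λ j → d * ⟦ (F ∩ D) j ⟧) ≡⟨ sum-*ˡ d _ ⟩
    d * # (F ∩ D) ∎
    where
    q : ∀ f g r → ⟦ f ⟧ * ⟦ g ∧ r ⟧ ≡ ⟦ g ⟧ * ⟦ f ∧ r ⟧
    q true true r = refl
    q true false r = refl
    q false true r = refl
    q false false r = refl
    r : ∀ j f e → f ≡ F j → ⟦ f ∧ e ⟧ * # (λ i → F i ∧ R i j) ≤ d * ⟦ f ∧ e ⟧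
    r j true true e = ≤-trans (≤-reflexive (+-identityʳ _)) (≤-trans (ind j (sym e)) (≤-reflexive (sym (*-identityʳ d))))
    r j true false _ = z≤n
    r j false e _ = z≤n

-- With p = a/s and P = Q + a², the ratio Q/P is 1 - p²/24. This is the saving per arc that the
-- induction in `indep-mass` can sustain for degrees below D ≤ 3/p; here x is the number of
-- neighbours of the vertex branched on.
module Numeric (a b Q D x : ℕ) (s≥1 : 1 ≤ a + b) (Q≡ : Q + a * a ≡ 24 * ((a + b) * (a + b))) (aD : a * D ≤ 3 * (a + b)) (x<D : suc x ≤ D) where
  private
    s P : ℕ
    s = a + b
    P = Q + a * a

  ax≤3s : a * x ≤ 3 * s
  ax≤3s = ≤-trans (*-monoʳ-≤ a (<⇒≤ x<D)) aD

  a≤s : a ≤ s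
  a≤s = m≤m+n a b

  power-upper : ∀ v → P ^ v * P ≤ P * Q ^ v + v * (a * a) * P ^ v
  power-upper zero = ≤-reflexive (l P)
    where
    l : ∀ P → 1 * P ≡ P * 1 + 0
    l = solve-∀
  power-upper (suc v) = ≤-trans (*-monoˡ-≤ P (bernoulli-upper Q (a * a) v)) (≤-reflexive (l P (Q ^ suc v) (suc v) (a * a) (P ^ v)))
    where
    l : ∀ P q v a p → (q + v * a * p) * P ≡ P * q + v * a * (P * p)
    l = solve-∀

  -- Since aD ≤ 3s, the exponent 2D costs at most 2D a²/P ≤ a/(4s), and 1/(1 - a/(4s)) ≤ 1 + a/(4b).
  degree-factor : 4 * b * P ^ (2 * D) ≤ (4 * b + a) * Q ^ (2 * D)
  degree-factor = *-cancelˡ-≤ (s * (18 * a + 24 * b)) {{>-nonZero (*-mono-≤ s≥1 (≤-trans s≥1 (+-mono-≤ (m≤m+n a _) (m≤m+n b _))))}} (begin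
    s * (18 * a + 24 * b) * (4 * b * p) ≡⟨ l₁ s a b p ⟩
    4 * b * (s * (18 * a + 24 * b) * p) ≤⟨ *-monoʳ-≤ (4 * b) step ⟩
    4 * b * (24 * (s * s) * r) ≡⟨ l₂ s b r ⟩
    s * (4 * b * (24 * s)) * r ≤⟨ *-monoˡ-≤ r (*-monoʳ-≤ s (≤-trans (m≤m+n _ (18 * (a * a))) (≤-reflexive (l₃ a b)))) ⟩
    s * ((4 * b + a) * (18 * a + 24 * b)) * r ≡⟨ l₄ s (4 * b + a) (18 * a + 24 * b) r ⟩
    s * (18 * a + 24 * b) * ((4 * b + a) * r) ∎)
    where
    open ≤-Reasoning
    p = P ^ (2 * D)
    r = Q ^ (2 * D)
    l₁ : ∀ s a b p → s * (18 * a + 24 * b) * (4 * b * p) ≡ 4 * b * (s * (18 * a + 24 * b) * p)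
    l₁ = solve-∀
    l₂ : ∀ s b r → 4 * b * (24 * (s * s) * r) ≡ s * (4 * b * (24 * s)) * r
    l₂ = solve-∀
    l₃ : ∀ a b → 4 * b * (24 * (a + b)) + 18 * (a * a) ≡ (4 * b + a) * (18 * a + 24 * b)
    l₃ = solve-∀
    l₄ : ∀ s f g r → s * (f * g) * r ≡ s * g * (f * r)
    l₄ = solve-∀
    step : s * (18 * a + 24 * b) * p ≤ 24 * (s * s) * r
    step = +-cancelʳ-≤ (6 * a * s * p) _ _ (begin
      s * (18 * a + 24 * b) * p + 6 * a * s * p ≡⟨ m₁ a b p ⟩
      p * (24 * (s * s)) ≡⟨ cong (p *_) Q≡ ⟨
      p * P ≤⟨ power-upper (2 * D) ⟩
      P * r + 2 * D * (a * a) * p ≡⟨ cong₂ (λ u w → u * r + w * p) Q≡ (m₂ D a) ⟩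
      24 * (s * s) * r + 2 * a * (a * D) * p ≤⟨ +-monoʳ-≤ (24 * (s * s) * r) (*-monoˡ-≤ p (*-monoʳ-≤ (2 * a) aD)) ⟩
      24 * (s * s) * r + 2 * a * (3 * s) * p ≡⟨ cong (24 * (s * s) * r +_) (m₃ a s p) ⟩
      24 * (s * s) * r + 6 * a * s * p ∎)
      where
      m₁ : ∀ a b p → (a + b) * (18 * a + 24 * b) * p + 6 * a * (a + b) * p ≡ p * (24 * ((a + b) * (a + b)))
      m₁ = solve-∀
      m₂ : ∀ D a → 2 * D * (a * a) ≡ 2 * a * (a * D)
      m₂ = solve-∀
      m₃ : ∀ a s p → 2 * a * (3 * s) * p ≡ 6 * a * s * p
      m₃ = solve-∀

  -- This is (1 - z)^x ≤ 1/(1 + xz) for z = e/(f + e).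
  harmonic : ∀ f e x → f ^ x * (f + e + e * x) ≤ (f + e) ^ suc x
  harmonic f e zero = ≤-reflexive (l f e)
    where
    l : ∀ f e → 1 * (f + e + e * 0) ≡ (f + e) * 1
    l = solve-∀
  harmonic f e (suc x) = begin
    f * f ^ x * (f + e + e * suc x) ≤⟨ m≤m+n _ (f ^ x * (e * e * suc x)) ⟩
    f * f ^ x * (f + e + e * suc x) + f ^ x * (e * e * suc x) ≡⟨ l f e x (f ^ x) ⟩
    (f + e) * (f ^ x * (f + e + e * x)) ≤⟨ *-monoʳ-≤ (f + e) (harmonic f e x) ⟩
    (f + e) ^ suc (suc x) ∎
    where
    open ≤-Reasoning
    l : ∀ f e x w → f * w * (f + e + e * suc x) + w * (e * e * suc x) ≡ (f + e) * (w * (f + e + e * x))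
    l = solve-∀

  T U W : ℕ
  T = s ^ x * Q ^ (2 * D * x)
  U = s ^ x * (P ^ (2 * x) * Q ^ (2 * D * x ∸ 2 * x))
  W = b ^ x * P ^ (2 * D * x)

  2x≤ : 2 * x ≤ 2 * D * x
  2x≤ = *-monoˡ-≤ x (*-monoʳ-≤ 2 (≤-trans (s≤s z≤n) x<D))

  W-bound : W * (4 * s + 3 * a * x) ≤ 4 * s * T
  W-bound = *-cancelʳ-≤ _ _ (4 ^ x) {{>-nonZero (^-pos 4 x (s≤s z≤n))}} (begin
    W * (4 * s + 3 * a * x) * 4 ^ x ≡⟨ l₀ W (4 * s + 3 * a * x) (4 ^ x) ⟩
    4 ^ x * W * (4 * s + 3 * a * x) ≡⟨ cong₂ (λ u w → 4 ^ x * (b ^ x * u) * w) (sym (^-*-assoc P (2 * D) x)) (l₂ a b x) ⟩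
    4 ^ x * (b ^ x * (P ^ (2 * D)) ^ x) * (f + 3 * a + 3 * a * x) ≡⟨ cong (_* (f + 3 * a + 3 * a * x)) (trans (sym (*-assoc (4 ^ x) _ _)) (trans (cong (_* (P ^ (2 * D)) ^ x) (sym (^-distrib-* 4 b x))) (sym (^-distrib-* (4 * b) _ x)))) ⟩
    (4 * b * P ^ (2 * D)) ^ x * (f + 3 * a + 3 * a * x) ≤⟨ *-monoˡ-≤ _ (^-monoˡ x degree-factor) ⟩
    (f * Q ^ (2 * D)) ^ x * (f + 3 * a + 3 * a * x) ≡⟨ trans (cong (_* (f + 3 * a + 3 * a * x)) (^-distrib-* f _ x)) (l₁ (f ^ x) _ _) ⟩
    f ^ x * (f + 3 * a + 3 * a * x) * (Q ^ (2 * D)) ^ x ≤⟨ *-monoˡ-≤ _ (harmonic f (3 * a) x) ⟩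
    (f + 3 * a) ^ suc x * (Q ^ (2 * D)) ^ x ≡⟨ cong₂ (λ u w → u ^ suc x * w) (l₃ a b) (^-*-assoc Q (2 * D) x) ⟩
    (4 * s) ^ suc x * Q ^ (2 * D * x) ≡⟨ cong (λ z → 4 * s * z * Q ^ (2 * D * x)) (^-distrib-* 4 s x) ⟩
    4 * s * (4 ^ x * s ^ x) * Q ^ (2 * D * x) ≡⟨ l₄ (4 * s) (4 ^ x) (s ^ x) _ ⟩
    4 * s * T * 4 ^ x ∎)
    where
    open ≤-Reasoning
    f = 4 * b + a
    l₀ : ∀ w u t → w * u * t ≡ t * w * u
    l₀ = solve-∀
    l₁ : ∀ w u t → w * u * t ≡ w * t * u
    l₁ = solve-∀
    l₂ : ∀ a b x → 4 * (a + b) + 3 * a * x ≡ 4 * b + a + 3 * a + 3 * a * x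
    l₂ = solve-∀
    l₃ : ∀ a b → 4 * b + a + 3 * a ≡ 4 * (a + b)
    l₃ = solve-∀
    l₄ : ∀ c t s q → c * (t * s) * q ≡ c * (s * q) * t
    l₄ = solve-∀

  U-bound : 9 * s * (b * U) ≤ (9 * s * b + x * (a * a)) * T
  U-bound = *-cancelˡ-≤ K {{K-nz}} (begin
    K * (9 * s * (b * U)) ≡⟨ l₁ K s (b * U) ⟩
    9 * s * (K * (b * U)) ≤⟨ *-monoʳ-≤ (9 * s) step ⟩
    9 * s * (24 * (s * s) * (b * T)) ≡⟨ l₂ s b T ⟩
    9 * s * (24 * (s * s) * b) * T ≤⟨ *-monoˡ-≤ T key ⟩
    K * (9 * s * b + x * (a * a)) * T ≡⟨ *-assoc K _ T ⟩
    K * ((9 * s * b + x * (a * a)) * T) ∎)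
    where
    open ≤-Reasoning
    2xaa≤ : 2 * x * (a * a) ≤ 6 * (s * s)
    2xaa≤ = begin
      2 * x * (a * a) ≡⟨ l x a ⟩
      2 * (a * x) * a ≤⟨ *-mono-≤ (*-monoʳ-≤ 2 ax≤3s) a≤s ⟩
      2 * (3 * s) * s ≡⟨ l′ s ⟩
      6 * (s * s) ∎
      where
      l : ∀ x a → 2 * x * (a * a) ≡ 2 * (a * x) * a
      l = solve-∀
      l′ : ∀ s → 2 * (3 * s) * s ≡ 6 * (s * s)
      l′ = solve-∀
    K = 24 * (s * s) ∸ 2 * x * (a * a)
    K+ : K + 2 * x * (a * a) ≡ 24 * (s * s)
    K+ = m∸n+n≡m (≤-trans 2xaa≤ (*-monoˡ-≤ (s * s) (s≤s (s≤s (s≤s (s≤s (s≤s (s≤s (z≤n {18})))))))))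
    K≥ : 18 * (s * s) ≤ K
    K≥ = +-cancelʳ-≤ (2 * x * (a * a)) _ _ (≤-trans (+-monoʳ-≤ (18 * (s * s)) 2xaa≤) (≤-reflexive (trans (l (s * s)) (sym K+))))
      where
      l : ∀ t → 18 * t + 6 * t ≡ 24 * t
      l = solve-∀
    K-nz : NonZero K
    K-nz = >-nonZero (≤-trans (*-mono-≤ (s≤s (z≤n {17})) (*-mono-≤ s≥1 s≥1)) K≥)
    l₁ : ∀ k s u → k * (9 * s * u) ≡ 9 * s * (k * u)
    l₁ = solve-∀
    l₂ : ∀ s b t → 9 * s * (24 * (s * s) * (b * t)) ≡ 9 * s * (24 * (s * s) * b) * t
    l₂ = solve-∀
    PU : U * (24 * (s * s)) ≤ 24 * (s * s) * T + 2 * x * (a * a) * U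
    PU = begin
      U * (24 * (s * s)) ≡⟨ cong (U *_) Q≡ ⟨
      s ^ x * (P ^ (2 * x) * r) * P ≡⟨ m₁ (s ^ x) (P ^ (2 * x)) r P ⟩
      s ^ x * (P ^ (2 * x) * P) * r ≤⟨ *-monoˡ-≤ r (*-monoʳ-≤ (s ^ x) (power-upper (2 * x))) ⟩
      s ^ x * (P * Q ^ (2 * x) + 2 * x * (a * a) * P ^ (2 * x)) * r ≡⟨ m₂ (s ^ x) P (Q ^ (2 * x)) (2 * x * (a * a)) (P ^ (2 * x)) r ⟩
      P * (s ^ x * (Q ^ (2 * x) * r)) + 2 * x * (a * a) * U ≡⟨ cong₂ (λ u w → u * (s ^ x * w) + 2 * x * (a * a) * U) Q≡ (trans (sym (^-distribˡ-+-* Q (2 * x) _)) (cong (Q ^_) (m+[n∸m]≡n 2x≤))) ⟩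
      24 * (s * s) * T + 2 * x * (a * a) * U ∎
      where
      r = Q ^ (2 * D * x ∸ 2 * x)
      m₁ : ∀ s p r P → s * (p * r) * P ≡ s * (p * P) * r
      m₁ = solve-∀
      m₂ : ∀ s P q k p r → s * (P * q + k * p) * r ≡ P * (s * (q * r)) + k * (s * (p * r))
      m₂ = solve-∀
    step : K * (b * U) ≤ 24 * (s * s) * (b * T)
    step = +-cancelʳ-≤ (b * (2 * x * (a * a) * U)) _ _ (begin
      K * (b * U) + b * (2 * x * (a * a) * U) ≡⟨ m₁ K b U (2 * x * (a * a)) ⟩
      b * (U * (K + 2 * x * (a * a))) ≡⟨ cong (λ z → b * (U * z)) K+ ⟩
      b * (U * (24 * (s * s))) ≤⟨ *-monoʳ-≤ b PU ⟩
      b * (24 * (s * s) * T + 2 * x * (a * a) * U) ≡⟨ m₂ b (24 * (s * s)) T (2 * x * (a * a) * U) ⟩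
      24 * (s * s) * (b * T) + b * (2 * x * (a * a) * U) ∎)
      where
      m₁ : ∀ k b u c → k * (b * u) + b * (c * u) ≡ b * (u * (k + c))
      m₁ = solve-∀
      m₂ : ∀ b c t w → b * (c * t + w) ≡ c * (b * t) + b * w
      m₂ = solve-∀
    key : 9 * s * (24 * (s * s) * b) ≤ K * (9 * s * b + x * (a * a))
    key = begin
      9 * s * (24 * (s * s) * b) ≡⟨ cong (λ z → 9 * s * (z * b)) K+ ⟨
      9 * s * ((K + 2 * x * (a * a)) * b) ≡⟨ m₁ s K x a b ⟩
      K * (9 * s * b) + 18 * (s * b) * (x * (a * a)) ≤⟨ +-monoʳ-≤ _ (*-monoˡ-≤ (x * (a * a)) (≤-trans (*-monoʳ-≤ 18 (*-monoʳ-≤ s (m≤n+m b a))) K≥)) ⟩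
      K * (9 * s * b) + K * (x * (a * a)) ≡⟨ *-distribˡ-+ K _ _ ⟨
      K * (9 * s * b + x * (a * a)) ∎
      where
      m₁ : ∀ s K x a b → 9 * s * ((K + 2 * x * (a * a)) * b) ≡ K * (9 * s * b) + 18 * (s * b) * (x * (a * a))
      m₁ = solve-∀

  -- With r = P/Q this is (1 - p) r^(2x) + p (1 - p)^x r^(2Dx) ≤ 1: leaving the vertex out loses 2x
  -- arcs, putting it in forbids x vertices and loses at most 2Dx arcs. `U-bound` and `W-bound`
  -- replace the terms by 1 - p + p²x/9 and p/(1 + 3px/4), and px ≤ 3 leaves room.
  step-bound : b * U + a * W ≤ s * T
  step-bound = *-cancelˡ-≤ (9 * s * (4 * s + 3 * a * x)) {{>-nonZero (*-mono-≤ (*-mono-≤ (s≤s (z≤n {8})) s≥1) (≤-trans (*-mono-≤ (s≤s (z≤n {3})) s≥1) (m≤m+n _ _)))}} (begin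
    9 * s * L * (b * U + a * W) ≡⟨ l₁ s L (b * U) a W ⟩
    9 * s * (b * U) * L + 9 * s * a * (W * L) ≤⟨ +-mono-≤ (*-monoˡ-≤ L U-bound) (*-monoʳ-≤ (9 * s * a) W-bound) ⟩
    (9 * s * b + x * (a * a)) * T * L + 9 * s * a * (4 * s * T) ≡⟨ l₂ a b x T ⟩
    (36 * (s * s * s) + 27 * (s * a * x * b) + x * (a * a) * (4 * s + 3 * (a * x))) * T ≤⟨ *-monoˡ-≤ T (+-monoʳ-≤ (36 * (s * s * s) + 27 * (s * a * x * b)) (*-monoʳ-≤ (x * (a * a)) (≤-trans (+-monoʳ-≤ (4 * s) (*-monoʳ-≤ 3 ax≤3s)) (≤-trans (m≤m+n _ (14 * s)) (≤-reflexive (l₃ s)))))) ⟩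
    (36 * (s * s * s) + 27 * (s * a * x * b) + x * (a * a) * (27 * s)) * T ≡⟨ l₄ a b x T ⟩
    9 * s * L * (s * T) ∎)
    where
    open ≤-Reasoning
    L = 4 * s + 3 * a * x
    l₁ : ∀ s L u a w → 9 * s * L * (u + a * w) ≡ 9 * s * u * L + 9 * s * a * (w * L)
    l₁ = solve-∀
    l₂ : ∀ a b x T → (9 * (a + b) * b + x * (a * a)) * T * (4 * (a + b) + 3 * a * x) + 9 * (a + b) * a * (4 * (a + b) * T)
      ≡ (36 * ((a + b) * (a + b) * (a + b)) + 27 * ((a + b) * a * x * b) + x * (a * a) * (4 * (a + b) + 3 * (a * x))) * T
    l₂ = solve-∀
    l₃ : ∀ s → 4 * s + 3 * (3 * s) + 14 * s ≡ 27 * s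
    l₃ = solve-∀
    l₄ : ∀ a b x T → (36 * ((a + b) * (a + b) * (a + b)) + 27 * ((a + b) * a * x * b) + x * (a * a) * (27 * (a + b))) * T
      ≡ 9 * (a + b) * (4 * (a + b) + 3 * a * x) * ((a + b) * T)
    l₄ = solve-∀

module IndepBound (a b Q D : ℕ) (s≥1 : 1 ≤ a + b) (Q≡ : Q + a * a ≡ 24 * ((a + b) * (a + b))) (aD : a * D ≤ 3 * (a + b)) where
  open Weights a b
  private
    s P : ℕ
    s = a + b
    P = Q + a * a

  Q≥1 : 1 ≤ Q
  Q≥1 = +-cancelʳ-≤ (a * a) 1 Q (begin
    1 + a * a ≤⟨ +-mono-≤ (*-mono-≤ s≥1 s≥1) (*-mono-≤ (m≤m+n a b) (m≤m+n a b)) ⟩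
    s * s + s * s ≤⟨ m≤m+n _ (22 * (s * s)) ⟩
    s * s + s * s + 22 * (s * s) ≡⟨ l (s * s) ⟩
    24 * (s * s) ≡⟨ Q≡ ⟨
    Q + a * a ∎)
    where
    open ≤-Reasoning
    l : ∀ t → t + t + 22 * t ≡ 24 * t
    l = solve-∀

  -- A bound of Janson type: a random subset with density a/(a + b) is independent with probability
  -- at most (Q/P)^arcs. The induction removes the first vertex, and `step-bound` is exactly what it
  -- requires.
  indep-mass : ∀ {n} (R : Fin n → Pr n) F → (∀ i j → R i j ≡ R j i) → (∀ i → R i i ≡ false) → (∀ i → suc (# (R i)) ≤ D) →
    indep R F * P ^ arcs R F ≤ mass F * Q ^ arcs R F
  indep-mass {zero} R F sy irr deg = ≤-reflexive (trans (cong (λ z → 1 * P ^ z) (sum-0 _)) (sym (cong (λ z → 1 * Q ^ z) (sum-0 _))))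
  indep-mass {suc n} R F sy irr deg = subst (λ z → indep R F * P ^ z ≤ mass F * Q ^ z) (sym (arcs-suc R F sy irr)) (head (F zero))
    where
    open ≤-Reasoning
    R′ : Fin n → Pr n
    R′ i j = R (suc i) (suc j)
    F₁ N₀ F₂ : Pr n
    F₁ = F ∘ suc
    N₀ = R zero ∘ suc
    F₂ = F₁ ∩ ∁ N₀
    x e₁ e₂ Z₁ Z₂ M₁ M₂ : ℕ
    x = # (F₁ ∩ N₀)
    e₁ = arcs R′ F₁
    e₂ = arcs R′ F₂
    Z₁ = indep R′ F₁
    Z₂ = indep R′ F₂
    M₁ = mass F₁
    M₂ = mass F₂
    deg′ : ∀ i → # (R′ i) ≤ # (R (suc i))
    deg′ i = ≤-trans (m≤n+m _ ⟦ R (suc i) zero ⟧) (≤-reflexive (sym (sum-suc (λ j → ⟦ R (suc i) j ⟧))))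
    deg-out : ∀ i → # (F₁ ∩ R′ i) ≤ D ∸ 1
    deg-out i = ≤-trans (#-mono {A = F₁ ∩ R′ i} {R′ i} (λ j p → proj₂ (∧-true {F₁ j} p))) (≤-trans (deg′ i) (∸-monoˡ-≤ 1 (deg (suc i))))
    ih₁ : Z₁ * P ^ e₁ ≤ M₁ * Q ^ e₁
    ih₁ = indep-mass R′ F₁ (λ i j → sy (suc i) (suc j)) (λ i → irr (suc i)) (λ i → ≤-trans (s≤s (deg′ i)) (deg (suc i)))
    ih₂ : Z₂ * P ^ e₂ ≤ M₂ * Q ^ e₂
    ih₂ = indep-mass R′ F₂ (λ i j → sy (suc i) (suc j)) (λ i → irr (suc i)) (λ i → ≤-trans (s≤s (deg′ i)) (deg (suc i)))
    x<D : suc x ≤ D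
    x<D = ≤-trans (s≤s (≤-trans (#-mono {A = F₁ ∩ N₀} {N₀} (λ j p → proj₂ (∧-true {F₁ j} p))) (≤-trans (m≤n+m _ ⟦ R zero zero ⟧) (≤-reflexive (sym (sum-suc (λ j → ⟦ R zero j ⟧))))))) (deg zero)
    open Numeric a b Q D x s≥1 Q≡ aD x<D
    e : ℕ
    e = 2 * x + e₁
    D≥1 : 1 ≤ D
    D≥1 = ≤-trans (s≤s z≤n) x<D
    e≤ : e ≤ e₂ + 2 * D * x
    e≤ = begin
      2 * x + e₁ ≤⟨ +-monoʳ-≤ (2 * x) (arcs-remove R′ F₁ N₀ (D ∸ 1) (λ i _ → deg-out i) (λ j _ → ≤-trans (≤-reflexive (#-cong (λ i → cong (F₁ i ∧_) (sy (suc i) (suc j))))) (deg-out j))) ⟩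
      2 * x + (e₂ + 2 * x * (D ∸ 1)) ≡⟨ l x e₂ (D ∸ 1) ⟩
      e₂ + 2 * suc (D ∸ 1) * x ≡⟨ cong (λ z → e₂ + 2 * z * x) (m+[n∸m]≡n D≥1) ⟩
      e₂ + 2 * D * x ∎
      where
      l : ∀ x e d → 2 * x + (e + 2 * x * d) ≡ e + 2 * suc d * x
      l = solve-∀
    e₂≤e : e₂ ≤ e
    e₂≤e = ≤-trans (sum-mono (λ i → *-mono-≤ (⟦⟧-mono {F₂ i} {F₁ i} (λ p → proj₁ (∧-true {F₁ i} p))) (#-mono {A = F₂ ∩ R′ i} {F₁ ∩ R′ i} (λ j p → ∧-intro (proj₁ (∧-true {F₁ j} (proj₁ (∧-true {F₂ j} p)))) (proj₂ (∧-true {F₂ j} p)))))) (m≤n+m e₁ (2 * x))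
    u g : ℕ
    u = e ∸ e₂
    g = 2 * D * x ∸ u
    u≤ : u ≤ 2 * D * x
    u≤ = m≤n+o⇒m∸n≤o e e₂ e≤
    in-term : Z₂ * P ^ e * Q ^ (2 * D * x) ≤ M₂ * Q ^ e * P ^ (2 * D * x)
    in-term = begin
      Z₂ * P ^ e * Q ^ (2 * D * x) ≡⟨ cong₂ (λ p q → Z₂ * p * q) (trans (cong (P ^_) (sym (m+[n∸m]≡n e₂≤e))) (^-distribˡ-+-* P e₂ u)) (trans (cong (Q ^_) (sym (m+[n∸m]≡n u≤))) (^-distribˡ-+-* Q u g)) ⟩
      Z₂ * (P ^ e₂ * P ^ u) * (Q ^ u * Q ^ g) ≡⟨ l₁ Z₂ (P ^ e₂) (P ^ u) (Q ^ u) (Q ^ g) ⟩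
      Z₂ * P ^ e₂ * (Q ^ u * (P ^ u * Q ^ g)) ≤⟨ *-mono-≤ ih₂ (*-monoʳ-≤ (Q ^ u) (*-monoʳ-≤ (P ^ u) (^-monoˡ g (m≤m+n Q (a * a))))) ⟩
      M₂ * Q ^ e₂ * (Q ^ u * (P ^ u * P ^ g)) ≡⟨ l₂ M₂ (Q ^ e₂) (Q ^ u) (P ^ u) (P ^ g) ⟩
      M₂ * (Q ^ e₂ * Q ^ u) * (P ^ u * P ^ g) ≡⟨ cong₂ (λ q p → M₂ * q * p) (trans (sym (^-distribˡ-+-* Q e₂ u)) (cong (Q ^_) (m+[n∸m]≡n e₂≤e))) (trans (sym (^-distribˡ-+-* P u g)) (cong (P ^_) (m+[n∸m]≡n u≤))) ⟩
      M₂ * Q ^ e * P ^ (2 * D * x) ∎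
      where
      l₁ : ∀ z p r q w → z * (p * r) * (q * w) ≡ z * p * (q * (r * w))
      l₁ = solve-∀
      l₂ : ∀ z p r q w → z * p * (r * (q * w)) ≡ z * (p * r) * (q * w)
      l₂ = solve-∀
    out-term : Z₁ * P ^ e * Q ^ (2 * D * x) ≤ M₁ * Q ^ e * (P ^ (2 * x) * Q ^ (2 * D * x ∸ 2 * x))
    out-term = begin
      Z₁ * P ^ e * Q ^ (2 * D * x) ≡⟨ cong₂ (λ p q → Z₁ * p * q) (^-distribˡ-+-* P (2 * x) e₁) (trans (cong (Q ^_) (sym (m+[n∸m]≡n 2x≤))) (^-distribˡ-+-* Q (2 * x) _)) ⟩
      Z₁ * (P ^ (2 * x) * P ^ e₁) * (Q ^ (2 * x) * r) ≡⟨ l₁ Z₁ (P ^ (2 * x)) (P ^ e₁) (Q ^ (2 * x)) r ⟩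
      Z₁ * P ^ e₁ * (Q ^ (2 * x) * (P ^ (2 * x) * r)) ≤⟨ *-monoˡ-≤ _ ih₁ ⟩
      M₁ * Q ^ e₁ * (Q ^ (2 * x) * (P ^ (2 * x) * r)) ≡⟨ l₂ M₁ (Q ^ e₁) (Q ^ (2 * x)) (P ^ (2 * x) * r) ⟩
      M₁ * (Q ^ (2 * x) * Q ^ e₁) * (P ^ (2 * x) * r) ≡⟨ cong (λ q → M₁ * q * (P ^ (2 * x) * r)) (^-distribˡ-+-* Q (2 * x) e₁) ⟨
      M₁ * Q ^ e * (P ^ (2 * x) * r) ∎
      where
      r = Q ^ (2 * D * x ∸ 2 * x)
      l₁ : ∀ z p r q w → z * (p * r) * (q * w) ≡ z * r * (q * (p * w))
      l₁ = solve-∀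
      l₂ : ∀ z p q w → z * p * (q * w) ≡ z * (q * p) * w
      l₂ = solve-∀
    both : (b * Z₁ + a * Z₂) * P ^ e ≤ s * M₁ * Q ^ e
    both = *-cancelʳ-≤ _ _ T {{>-nonZero (*-mono-≤ (^-pos s x s≥1) (^-pos Q (2 * D * x) Q≥1))}} (begin
      (b * Z₁ + a * Z₂) * P ^ e * (s ^ x * Q ^ (2 * D * x)) ≡⟨ l₁ b Z₁ a Z₂ (P ^ e) (s ^ x) (Q ^ (2 * D * x)) ⟩
      b * s ^ x * (Z₁ * P ^ e * Q ^ (2 * D * x)) + a * s ^ x * (Z₂ * P ^ e * Q ^ (2 * D * x)) ≤⟨ +-mono-≤ (*-monoʳ-≤ (b * s ^ x) out-term) (*-monoʳ-≤ (a * s ^ x) in-term) ⟩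
      b * s ^ x * (M₁ * Q ^ e * (P ^ (2 * x) * Q ^ (2 * D * x ∸ 2 * x))) + a * s ^ x * (M₂ * Q ^ e * P ^ (2 * D * x)) ≡⟨ l₂ b (s ^ x) M₁ (Q ^ e) (P ^ (2 * x) * Q ^ (2 * D * x ∸ 2 * x)) a M₂ (P ^ (2 * D * x)) ⟩
      M₁ * Q ^ e * (b * U) + a * (M₂ * s ^ x) * (Q ^ e * P ^ (2 * D * x)) ≡⟨ cong (λ z → M₁ * Q ^ e * (b * U) + a * z * (Q ^ e * P ^ (2 * D * x))) (mass-remove F₁ N₀) ⟩
      M₁ * Q ^ e * (b * U) + a * (M₁ * b ^ x) * (Q ^ e * P ^ (2 * D * x)) ≡⟨ l₃ M₁ (Q ^ e) (b * U) a (b ^ x) (P ^ (2 * D * x)) ⟩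
      M₁ * Q ^ e * (b * U + a * W) ≤⟨ *-monoʳ-≤ (M₁ * Q ^ e) step-bound ⟩
      M₁ * Q ^ e * (s * T) ≡⟨ l₄ M₁ (Q ^ e) s T ⟩
      s * M₁ * Q ^ e * T ∎)
      where
      l₁ : ∀ b z a w p s q → (b * z + a * w) * p * (s * q) ≡ b * s * (z * p * q) + a * s * (w * p * q)
      l₁ = solve-∀
      l₂ : ∀ b s m q p a w r → b * s * (m * q * p) + a * s * (w * q * r) ≡ m * q * (b * (s * p)) + a * (w * s) * (q * r)
      l₂ = solve-∀
      l₃ : ∀ m q u a b p → m * q * u + a * (m * b) * (q * p) ≡ m * q * (u + a * (b * p))
      l₃ = solve-∀
      l₄ : ∀ m q s t → m * q * (s * t) ≡ s * m * q * t
      l₄ = solve-∀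
    head : ∀ t → (b * Z₁ + (if t then a * Z₂ else 0)) * P ^ (⟦ t ⟧ * (2 * x) + e₁) ≤ (if t then s else b) * M₁ * Q ^ (⟦ t ⟧ * (2 * x) + e₁)
    head true = subst (λ z → (b * Z₁ + a * Z₂) * P ^ (z + e₁) ≤ s * M₁ * Q ^ (z + e₁)) (sym (+-identityʳ (2 * x))) both
    head false = begin
      (b * Z₁ + 0) * P ^ e₁ ≡⟨ l b Z₁ (P ^ e₁) ⟩
      b * (Z₁ * P ^ e₁) ≤⟨ *-monoʳ-≤ b ih₁ ⟩
      b * (M₁ * Q ^ e₁) ≡⟨ *-assoc b M₁ _ ⟨
      b * M₁ * Q ^ e₁ ∎
      where
      l : ∀ b z p → (b * z + 0) * p ≡ b * (z * p)
      l = solve-∀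

  indep-mass-weak : ∀ {n} (R : Fin n → Pr n) F e → (∀ i j → R i j ≡ R j i) → (∀ i → R i i ≡ false) → (∀ i → suc (# (R i)) ≤ D) →
    e ≤ arcs R F → indep R F * P ^ e ≤ mass F * Q ^ e
  indep-mass-weak R F e sy irr deg le = *-cancelʳ-≤ _ _ (P ^ f) {{>-nonZero (^-pos P f (≤-trans Q≥1 (m≤m+n Q _)))}} (begin
    indep R F * P ^ e * P ^ f ≡⟨ merge (indep R F) P ⟩
    indep R F * P ^ arcs R F ≤⟨ indep-mass R F sy irr deg ⟩
    mass F * Q ^ arcs R F ≡⟨ merge (mass F) Q ⟨
    mass F * Q ^ e * Q ^ f ≤⟨ *-monoʳ-≤ (mass F * Q ^ e) (^-monoˡ f (m≤m+n Q _)) ⟩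
    mass F * Q ^ e * P ^ f ∎)
    where
    open ≤-Reasoning
    f = arcs R F ∸ e
    merge : ∀ z p → z * p ^ e * p ^ f ≡ z * p ^ arcs R F
    merge z p = trans (*-assoc z _ _) (cong (z *_) (trans (sym (^-distribˡ-+-* p e f)) (cong (p ^_) (m+[n∸m]≡n le))))

-- Sums over subsets of given size, trace or weight

subb : ∀ {n} → Subset n → Pr n → Bool
subb [] F = true
subb (x ∷ v) F = (not x ∨ F zero) ∧ subb v (F ∘ suc)

subb-true : ∀ {n} (v : Subset n) F → subb v F ≡ true → lookup v ⊑ F
subb-true (true ∷ v) F p zero q = proj₁ (∧-true {F zero} p)
subb-true (x ∷ v) F p (suc i) q = subb-true v (F ∘ suc) (proj₂ (∧-true {not x ∨ F zero} p)) i q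

subb-intro : ∀ {n} (v : Subset n) F → lookup v ⊑ F → subb v F ≡ true
subb-intro [] F h = refl
subb-intro (true ∷ v) F h = ∧-intro (h zero refl) (subb-intro v (F ∘ suc) (λ i → h (suc i)))
subb-intro (false ∷ v) F h = subb-intro v (F ∘ suc) (λ i → h (suc i))

≡ᵇ-true : ∀ {a b} → (a ≡ᵇ b) ≡ true → a ≡ b
≡ᵇ-true {zero} {zero} p = refl
≡ᵇ-true {suc a} {suc b} p = cong suc (≡ᵇ-true {a} {b} p)

≡ᵇ-refl : ∀ a → (a ≡ᵇ a) ≡ true
≡ᵇ-refl zero = refl
≡ᵇ-refl (suc a) = ≡ᵇ-refl a

≡ᵇ-intro : ∀ {a b} → a ≡ b → (a ≡ᵇ b) ≡ true
≡ᵇ-intro {a} refl = ≡ᵇ-refl a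

nC0 : ∀ n → n C 0 ≡ 1
nC0 n = trans (nCk≡nC[n∸k] {0} {n} z≤n) (nCn≡1 n)

count-subsets : ∀ {n} (B : Pr n) m → ∑S n (λ v → ⟦ subb v B ∧ (∣ v ∣ ≡ᵇ m) ⟧) ≡ (# B) C m
count-subsets {zero} B zero = sym (trans (cong (_C 0) (sum-0 (λ i → ⟦ B i ⟧))) refl)
count-subsets {zero} B (suc m) = sym (trans (cong (_C suc m) (sum-0 (λ i → ⟦ B i ⟧))) (k>n⇒nCk≡0 (s≤s (z≤n {m}))))
count-subsets {suc n} B m = trans (∑S-suc n _) (trans (go (B zero) m) (cong (_C m) (sym (sum-suc (λ i → ⟦ B i ⟧)))))
  where
  B′ : Pr n
  B′ = B ∘ suc
  go : ∀ t m → ∑S n (λ v → ⟦ subb v B′ ∧ (∣ v ∣ ≡ᵇ m) ⟧) + ∑S n (λ v → ⟦ (t ∧ subb v B′) ∧ (suc ∣ v ∣ ≡ᵇ m) ⟧) ≡ (⟦ t ⟧ + # B′) C m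
  go false m = trans (cong₂ _+_ (count-subsets B′ m) (ΣL-zero (allSubsets n) (λ _ → refl))) (+-identityʳ _)
  go true zero = trans (cong₂ _+_ (count-subsets B′ 0) (ΣL-zero (allSubsets n) (λ v → cong ⟦_⟧ (∧-zeroʳ (subb v B′))))) (trans (+-identityʳ _) (trans (nC0 (# B′)) (sym (nC0 (suc (# B′))))))
  go true (suc m) = trans (cong₂ _+_ (count-subsets B′ (suc m)) (count-subsets B′ m)) (trans (+-comm _ ((# B′) C m)) (nCk+nC[k+1]≡[n+1]C[k+1] (# B′) m))

_∪ᵥ_ : ∀ {n} → Subset n → Subset n → Subset n
[] ∪ᵥ [] = []
(x ∷ v) ∪ᵥ (y ∷ w) = (x ∨ y) ∷ (v ∪ᵥ w)

lookup-∪ᵥ : ∀ {n} (v w : Subset n) i → lookup (v ∪ᵥ w) i ≡ lookup v i ∨ lookup w i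
lookup-∪ᵥ (x ∷ v) (y ∷ w) zero = refl
lookup-∪ᵥ (x ∷ v) (y ∷ w) (suc i) = lookup-∪ᵥ v w i

-- Every subset is, in one way only, the union of its parts outside and inside `B`.
split-sum : ∀ {n} (B : Pr n) (f : Subset n → ℕ) →
  ∑S n f ≡ ∑S n (λ v → ⟦ subb v (∁ B) ⟧ * ∑S n (λ w → ⟦ subb w B ⟧ * f (v ∪ᵥ w)))
split-sum {zero} B f = l (f [])
  where
  l : ∀ x → x + 0 ≡ 1 * (1 * x + 0) + 0
  l = solve-∀
split-sum {suc n} B f = trans (∑S-suc n f) (trans (go (B zero)) (sym (trans (∑S-suc n _) (cong₂ _+_
    (ΣL-cong L (λ v → cong (⟦ subb v (∁ B′) ⟧ *_) (∑S-suc n _))) (ΣL-cong L (λ v → cong (⟦ not (B zero) ∧ subb v (∁ B′) ⟧ *_) (∑S-suc n _)))))))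
  where
  B′ : Pr n
  B′ = B ∘ suc
  L : List (Subset n)
  L = allSubsets n
  inner : Bool → Bool → Subset n → ℕ
  inner t x v = ∑S n (λ w → ⟦ subb w B′ ⟧ * f ((x ∨ false) ∷ (v ∪ᵥ w))) + ∑S n (λ w → ⟦ t ∧ subb w B′ ⟧ * f ((x ∨ true) ∷ (v ∪ᵥ w)))
  dead : ∀ (g : Subset n → ℕ) → ∑S n (λ v → 0 * g v) ≡ 0
  dead g = ΣL-zero L (λ v → refl)
  go : ∀ t → ∑S n (λ v → f (false ∷ v)) + ∑S n (λ v → f (true ∷ v))
    ≡ ∑S n (λ v → ⟦ subb v (∁ B′) ⟧ * inner t false v) + ∑S n (λ v → ⟦ not t ∧ subb v (∁ B′) ⟧ * inner t true v)
  go true = sym (trans (cong₂ _+_ (ΣL-cong L (λ v → *-distribˡ-+ ⟦ subb v (∁ B′) ⟧ _ _)) (dead (inner true true)))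
    (trans (+-identityʳ _) (trans (ΣL-+ L _ _) (sym (cong₂ _+_ (split-sum B′ (λ v → f (false ∷ v))) (split-sum B′ (λ v → f (true ∷ v))))))))
  go false = sym (cong₂ _+_
    (trans (ΣL-cong L (λ v → cong (⟦ subb v (∁ B′) ⟧ *_) (trans (cong₂ _+_ refl (dead (λ w → f (true ∷ (v ∪ᵥ w))))) (+-identityʳ _)))) (sym (split-sum B′ (λ v → f (false ∷ v)))))
    (trans (ΣL-cong L (λ v → cong (⟦ subb v (∁ B′) ⟧ *_) (trans (cong₂ _+_ refl (dead (λ w → f (true ∷ (v ∪ᵥ w))))) (+-identityʳ _)))) (sym (split-sum B′ (λ v → f (true ∷ v))))))

total-weight : ∀ a b n → ∑S n (Weights.weight a b) ≡ (a + b) ^ n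
total-weight a b zero = refl
total-weight a b (suc n) = trans (∑S-suc n (Weights.weight a b)) (trans (cong₂ _+_ (trans (ΣL-* (allSubsets n) b _) (cong (b *_) (total-weight a b n))) (trans (ΣL-* (allSubsets n) a _) (cong (a *_) (total-weight a b n)))) (l a b ((a + b) ^ n)))
  where
  l : ∀ a b x → b * x + a * x ≡ (a + b) * x
  l = solve-∀

-- The largest of the m + b + 1 terms in the binomial expansion of (m + b)^(m + b) is the one for j = m.
mode-bound : ∀ m b → (m + b) ^ (m + b) ≤ suc (m + b) * (((m + b) C m) * (m ^ m * b ^ b))
mode-bound m b = begin
  N ^ N ≡⟨ total-weight m b N ⟨
  ∑S N (Weights.weight m b) ≡⟨ ΣL-cong L (λ v → trans (Weights.weight-size m b v) (spread v)) ⟩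
  ∑S N (λ v → sum {suc N} (λ j → ⟦ ∣ v ∣ ≡ᵇ toℕ j ⟧ * (m ^ toℕ j * b ^ (N ∸ toℕ j)))) ≡⟨ ΣL-sum L _ ⟩
  sum {suc N} (λ j → ∑S N (λ v → ⟦ ∣ v ∣ ≡ᵇ toℕ j ⟧ * (m ^ toℕ j * b ^ (N ∸ toℕ j)))) ≤⟨ sum-mono term ⟩
  sum {suc N} (λ _ → (N C m) * (m ^ m * b ^ b)) ≡⟨ sum-const (suc N) _ ⟩
  suc N * ((N C m) * (m ^ m * b ^ b)) ∎
  where
  open ≤-Reasoning
  N = m + b
  L = allSubsets N
  ∣v∣≤N : ∀ (v : Subset N) → ∣ v ∣ ≤ N
  ∣v∣≤N v = subst (_≤ N) (#-lookup v) (#≤n (lookup v))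
  spread : ∀ v → m ^ ∣ v ∣ * b ^ (N ∸ ∣ v ∣) ≡ sum {suc N} (λ j → ⟦ ∣ v ∣ ≡ᵇ toℕ j ⟧ * (m ^ toℕ j * b ^ (N ∸ toℕ j)))
  spread v = trans (sym (trans (sum-δ i (λ j → m ^ toℕ j * b ^ (N ∸ toℕ j))) (cong (λ z → m ^ z * b ^ (N ∸ z)) i≡)))
    (sum-cong-≗ (λ j → cong (λ t → ⟦ t ⟧ * (m ^ toℕ j * b ^ (N ∸ toℕ j))) (bool-ext
      (λ p → ≡ᵇ-intro (trans (sym i≡) (cong toℕ (⌊⌋-true {d = i FinP.≟ j} p)))) (λ p → ⌊⌋-intro {d = i FinP.≟ j} (toℕ-injective (trans i≡ (≡ᵇ-true p)))))))
    where
    i : Fin (suc N)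
    i = fromℕ< (s≤s (∣v∣≤N v))
    i≡ : toℕ i ≡ ∣ v ∣
    i≡ = toℕ-fromℕ< (s≤s (∣v∣≤N v))
  term : ∀ j → ∑S N (λ v → ⟦ ∣ v ∣ ≡ᵇ toℕ j ⟧ * (m ^ toℕ j * b ^ (N ∸ toℕ j))) ≤ (N C m) * (m ^ m * b ^ b)
  term j = begin
    ∑S N (λ v → ⟦ ∣ v ∣ ≡ᵇ toℕ j ⟧ * c) ≡⟨ trans (ΣL-cong L (λ v → *-comm ⟦ ∣ v ∣ ≡ᵇ toℕ j ⟧ c)) (ΣL-* L c _) ⟩
    c * ∑S N (λ v → ⟦ ∣ v ∣ ≡ᵇ toℕ j ⟧) ≡⟨ cong (c *_) (trans (ΣL-cong L (λ v → cong (λ t → ⟦ t ∧ (∣ v ∣ ≡ᵇ toℕ j) ⟧) (sym (subb-intro v (λ _ → true) (λ _ _ → refl))))) (trans (count-subsets (λ _ → true) (toℕ j)) (cong (_C toℕ j) (trans (sum-const N 1) (*-identityʳ N))))) ⟩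
    c * (N C toℕ j) ≡⟨ *-comm c _ ⟩
    (N C toℕ j) * c ≤⟨ binomial-mode m b (toℕ j) (s≤s⁻¹ (toℕ<n j)) ⟩
    (N C m) * (m ^ m * b ^ b) ∎
    where
    c = m ^ toℕ j * b ^ (N ∸ toℕ j)

ΣL-*ʳ : ∀ {A : Set} (L : List A) c (f : A → ℕ) → ΣL L (λ x → f x * c) ≡ ΣL L f * c
ΣL-*ʳ [] c f = refl
ΣL-*ʳ (x ∷ L) c f = trans (cong (f x * c +_) (ΣL-*ʳ L c f)) (sym (*-distribʳ-+ c (f x) (ΣL L f)))

∪ᵥ-size : ∀ {n} (B : Pr n) (v w : Subset n) → lookup v ⊑ ∁ B → lookup w ⊑ B → ∣ v ∪ᵥ w ∣ ≡ ∣ v ∣ + ∣ w ∣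
∪ᵥ-size B [] [] p r = refl
∪ᵥ-size B (true ∷ v) (true ∷ w) p r = absurd-b (r zero refl) (not-true (p zero refl))
∪ᵥ-size B (true ∷ v) (false ∷ w) p r = cong suc (∪ᵥ-size (B ∘ suc) v w (λ i → p (suc i)) (λ i → r (suc i)))
∪ᵥ-size B (false ∷ v) (true ∷ w) p r = trans (cong suc (∪ᵥ-size (B ∘ suc) v w (λ i → p (suc i)) (λ i → r (suc i)))) (sym (+-suc ∣ v ∣ ∣ w ∣))
∪ᵥ-size B (false ∷ v) (false ∷ w) p r = ∪ᵥ-size (B ∘ suc) v w (λ i → p (suc i)) (λ i → r (suc i))

subset-of-size : ∀ {n} (v : Subset n) k → k ≤ ∣ v ∣ → ∃[ w ] (lookup w ⊑ lookup v × ∣ w ∣ ≡ k)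
subset-of-size [] zero _ = [] , (λ i p → p) , refl
subset-of-size (false ∷ v) k le with subset-of-size v k le
... | w , s , e = false ∷ w , (λ { zero () ; (suc i) p → s i p }) , e
subset-of-size (true ∷ v) zero le with subset-of-size v zero z≤n
... | w , s , e = false ∷ w , (λ { zero () ; (suc i) p → s i p }) , e
subset-of-size (true ∷ v) (suc k) (s≤s le) with subset-of-size v k le
... | w , s , e = true ∷ w , (λ { zero p → refl ; (suc i) p → s i p }) , cong suc e

module Partial (a b : ℕ) where
  coordinate : Bool → Bool → Bool → ℕ
  coordinate t true x = if x then a else b
  coordinate t false x = if x then ⟦ t ⟧ else ⟦ not t ⟧

  -- Product weight of a subset whose trace outside V is prescribed to be T, and 0 for all others.
  pw : ∀ {n} → Pr n → Pr n → Subset n → ℕ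
  pw T V [] = 1
  pw T V (x ∷ v) = coordinate (T zero) (V zero) x * pw (T ∘ suc) (V ∘ suc) v

  pw-cong : ∀ {n} {T T′ V V′ : Pr n} → (∀ i → T i ≡ T′ i) → (∀ i → V i ≡ V′ i) → ∀ v → pw T V v ≡ pw T′ V′ v
  pw-cong h g [] = refl
  pw-cong h g (x ∷ v) = cong₂ _*_ (cong₂ (λ t w → coordinate t w x) (h zero) (g zero)) (pw-cong (h ∘ suc) (g ∘ suc) v)

  pw-total : ∀ {n} (T V : Pr n) → ∑S n (pw T V) ≡ (a + b) ^ # V
  pw-total {zero} T V = sym (cong ((a + b) ^_) (sum-0 _))
  pw-total {suc n} T V = trans (∑S-suc n (pw T V)) (trans (cong₂ _+_ (ΣL-* (allSubsets n) (coordinate (T zero) (V zero) false) _) (ΣL-* (allSubsets n) (coordinate (T zero) (V zero) true) _))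
      (trans (cong (λ z → coordinate (T zero) (V zero) false * z + coordinate (T zero) (V zero) true * z) (pw-total (T ∘ suc) (V ∘ suc)))
        (trans (go (T zero) (V zero)) (cong ((a + b) ^_) (sym (sum-suc (λ i → ⟦ V i ⟧)))))))
    where
    e = (a + b) ^ # (V ∘ suc)
    l : ∀ a b e → b * e + a * e ≡ (a + b) * e
    l = solve-∀
    go : ∀ t w → coordinate t w false * e + coordinate t w true * e ≡ (a + b) ^ (⟦ w ⟧ + # (V ∘ suc))
    go t true = l a b e
    go true false = +-identityʳ e
    go false false = trans (+-identityʳ _) (+-identityʳ e)

  pw-consistent : ∀ {n} (T V : Pr n) v → 1 ≤ pw T V v → ∀ i → V i ≡ false → lookup v i ≡ T i
  pw-consistent T V (x ∷ v) pos zero e = go (T zero) (V zero) x e pos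
    where
    go : ∀ t w x → w ≡ false → 1 ≤ coordinate t w x * pw (T ∘ suc) (V ∘ suc) v → x ≡ t
    go true false true _ _ = refl
    go false false false _ _ = refl
    go true false false _ ()
    go false false true _ ()
  pw-consistent T V (x ∷ v) pos (suc i) e = pw-consistent (T ∘ suc) (V ∘ suc) v (n≢0⇒n>0 λ z → <⇒≱ pos (≤-reflexive (trans (cong (coordinate (T zero) (V zero) x *_) z) (*-zeroʳ (coordinate (T zero) (V zero) x))))) i e

  pw-branch : ∀ {n} (T V : Pr n) i → V i ≡ true → ∀ v →
    pw T V v ≡ a * pw (T ∪ (i ==_)) (V ∩ ∁ (i ==_)) v + b * pw (T ∩ ∁ (i ==_)) (V ∩ ∁ (i ==_)) v
  pw-branch {suc n} T V zero Vi (x ∷ v) = trans (cong (λ t → coordinate (T zero) t x * p) Vi) (trans (go x (T zero)) (cong₂ (λ y z → a * (coordinate (T zero ∨ true) (V zero ∧ false) x * y) + b * (coordinate (T zero ∧ false) (V zero ∧ false) x * z))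
      (pw-cong (λ i → sym (trans (cong (T (suc i) ∨_) (z≢s {i})) (∨-false (T (suc i))))) (λ i → sym (∧-identityʳ (V (suc i)))) v)
      (pw-cong (λ i → sym (∧-identityʳ (T (suc i)))) (λ i → sym (∧-identityʳ (V (suc i)))) v)))
    where
    p = pw (T ∘ suc) (V ∘ suc) v
    z≢s : ∀ {i : Fin n} → (Fin.zero == suc i) ≡ false
    z≢s = refl
    ∨-false : ∀ t → t ∨ false ≡ t
    ∨-false true = refl
    ∨-false false = refl
    go : ∀ x t → coordinate t true x * p ≡ a * (coordinate (t ∨ true) (V zero ∧ false) x * p) + b * (coordinate (t ∧ false) (V zero ∧ false) x * p)
    go x t = subst (λ w → coordinate t true x * p ≡ a * (coordinate (t ∨ true) w x * p) + b * (coordinate (t ∧ false) w x * p)) (sym (∧-zeroʳ (V zero)))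
      (subst₂ (λ w z → coordinate t true x * p ≡ a * (coordinate w false x * p) + b * (coordinate z false x * p)) (sym (∨-true′ t)) (sym (∧-zeroʳ t)) (h x))
      where
      ∨-true′ : ∀ t → t ∨ true ≡ true
      ∨-true′ true = refl
      ∨-true′ false = refl
      l₁ : ∀ a b p → a * p ≡ a * (1 * p) + b * (0 * p)
      l₁ = solve-∀
      l₂ : ∀ a b p → b * p ≡ a * (0 * p) + b * (1 * p)
      l₂ = solve-∀
      h : ∀ x → coordinate t true x * p ≡ a * (coordinate true false x * p) + b * (coordinate false false x * p)
      h true = l₁ a b p
      h false = l₂ a b p
  pw-branch {suc n} T V (suc i) Vi (x ∷ v) = trans (cong (c *_) (pw-branch (T ∘ suc) (V ∘ suc) i Vi v)) (trans (l c a _ b _) (cong₂ (λ y z → a * y + b * z)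
      (cong₂ _*_ (cong₂ (λ t w → coordinate t w x) (sym (∨-f (T zero))) (sym (∧-identityʳ (V zero)))) (pw-cong (λ j → cong (T (suc j) ∨_) (sym (==-suc i j))) (λ j → cong (λ t → V (suc j) ∧ not t) (sym (==-suc i j))) v))
      (cong₂ _*_ (cong₂ (λ t w → coordinate t w x) (sym (∧-identityʳ (T zero))) (sym (∧-identityʳ (V zero)))) (pw-cong (λ j → cong (λ t → T (suc j) ∧ not t) (sym (==-suc i j))) (λ j → cong (λ t → V (suc j) ∧ not t) (sym (==-suc i j))) v))))
    where
    c = coordinate (T zero) (V zero) x
    ∨-f : ∀ t → t ∨ false ≡ t
    ∨-f true = refl
    ∨-f false = refl
    l : ∀ c a y b z → c * (a * y + b * z) ≡ a * (c * y) + b * (c * z)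
    l = solve-∀

  -- An element of D still undecided contributes b, being absent. Elsewhere D can only meet the
  -- prescribed part, and a set that avoids D but should contain such an element has weight 0; hence
  -- an inequality.
  pw-exclude : ∀ {n} (T V D : Pr n) v → (∀ i → D i ≡ true → lookup v i ≡ false) → pw T V v ≤ b ^ # (V ∩ D) * pw (T ∩ ∁ D) (V ∩ ∁ D) v
  pw-exclude {zero} T V D [] h = ≤-reflexive (sym (cong (λ z → b ^ z * 1) (sum-0 _)))
  pw-exclude {suc n} T V D (x ∷ v) h = ≤-trans (*-monoʳ-≤ (coordinate (T zero) (V zero) x) (pw-exclude (T ∘ suc) (V ∘ suc) (D ∘ suc) v (λ i → h (suc i))))
      (≤-trans (go (T zero) (V zero) (D zero) (h zero)) (≤-reflexive (cong (λ z → b ^ z * (coordinate (T zero ∧ not (D zero)) (V zero ∧ not (D zero)) x * p)) (sym (sum-suc (λ i → ⟦ (V ∩ D) i ⟧))))))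
    where
    p = pw ((T ∘ suc) ∩ ∁ (D ∘ suc)) ((V ∘ suc) ∩ ∁ (D ∘ suc)) v
    e = # ((V ∘ suc) ∩ (D ∘ suc))
    l₁ : ∀ c u p → c * (u * p) ≡ u * (c * p)
    l₁ = solve-∀
    l₂ : ∀ b u p → b * (u * p) ≡ b * u * (1 * p)
    l₂ = solve-∀
    go : ∀ t w d → (d ≡ true → x ≡ false) → coordinate t w x * (b ^ e * p) ≤ b ^ (⟦ w ∧ d ⟧ + e) * (coordinate (t ∧ not d) (w ∧ not d) x * p)
    go t w true hx with hx refl
    go t true true hx | refl = ≤-reflexive (trans (l₂ b (b ^ e) p) (cong (λ z → b * b ^ e * (⟦ not z ⟧ * p)) (sym (∧-zeroʳ t))))
    go t false true hx | refl = ≤-trans (*-monoˡ-≤ (b ^ e * p) (⟦⟧≤1 (not t))) (≤-reflexive (trans (l₁ 1 (b ^ e) p) (cong (λ z → b ^ e * (⟦ not z ⟧ * p)) (sym (∧-zeroʳ t)))))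
    go t true false hx = ≤-reflexive (trans (l₁ (coordinate t true x) (b ^ e) p) refl)
    go t false false hx = ≤-reflexive (trans (l₁ (coordinate t false x) (b ^ e) p) (cong (λ z → b ^ e * (coordinate z false x * p)) (sym (∧-identityʳ t))))

-- Numerical parameters

module Constants (q k : ℕ) where
  θ₀ : ℕ
  θ₀ = 9 * suc k

  opaque
    -- `c₁` is the ratio of m to the exponent j saved and covers the factors 48(k + 1), 2(k + 1)θ
    -- and 24(k + 1) of the three gains. `Y₀` is what makes mn ≤ 2^Y₀ b j₁ hold. `W₀` makes j so
    -- large compared with √n that the cost of all choices takes at most half of 2^j.
    c₁ Y₀ W₀ : ℕ
    c₁ = 48 * suc k * θ₀
    Y₀ = 64 * (c₁ * q * θ₀)
    W₀ = c₁ * (80 * (Y₀ * q) + 64)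

    c₁-def : c₁ ≡ 48 * suc k * θ₀
    c₁-def = refl

    Y₀-def : Y₀ ≡ 64 * (c₁ * q * θ₀)
    Y₀-def = refl

    W₀-def : W₀ ≡ c₁ * (80 * (Y₀ * q) + 64)
    W₀-def = refl

  c₁≥1 : 1 ≤ c₁
  c₁≥1 = subst (1 ≤_) (sym c₁-def) (*-mono-≤ (*-mono-≤ (s≤s (z≤n {47})) (s≤s (z≤n {k}))) (*-mono-≤ (s≤s (z≤n {8})) (s≤s (z≤n {k}))))

  W₀≥64c : 64 * c₁ ≤ W₀
  W₀≥64c = subst (64 * c₁ ≤_) (sym W₀-def) (≤-trans (≤-reflexive (*-comm 64 c₁)) (*-monoʳ-≤ c₁ (m≤n+m 64 _)))

  W₀≥64 : 64 ≤ W₀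
  W₀≥64 = ≤-trans (*-monoʳ-≤ 64 c₁≥1) W₀≥64c

n≤2^n : ∀ n → n ≤ 2 ^ n
n≤2^n zero = z≤n
n≤2^n (suc n) = ≤-trans (+-mono-≤ (^-pos 2 n (s≤s z≤n)) (n≤2^n n)) (≤-reflexive (cong (2 ^ n +_) (sym (+-identityʳ (2 ^ n)))))

square-between : ∀ n → 1 ≤ n → ∃[ d ] (1 ≤ d × n ≤ d * d × d * d ≤ 4 * n)
square-between (suc zero) _ = 1 , ≤-refl , ≤-refl , s≤s z≤n
square-between (suc (suc n)) _ with square-between (suc n) (s≤s z≤n)
... | d , d≥1 , lo , hi with suc (suc n) ≤? d * d
... | yes le = d , d≥1 , le , ≤-trans hi (*-monoʳ-≤ 4 (n≤1+n (suc n)))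
... | no ¬le = suc d , s≤s z≤n , ≤-trans (s≤s lo) (≤-trans (s≤s (m≤m+n (d * d) (d + d))) (≤-reflexive (l d))) ,
      ≤-trans (≤-trans (≤-reflexive (sym (l d))) (s≤s (+-mono-≤ dd (+-mono-≤ d≤ d≤)))) (≤-trans (m≤m+n _ (n + 4)) (≤-reflexive (l′ n)))
  where
  dd : d * d ≤ suc n
  dd = s≤s⁻¹ (≰⇒> ¬le)
  d≤ : d ≤ suc n
  d≤ = ≤-trans (≤-trans (≤-reflexive (sym (*-identityʳ d))) (*-monoʳ-≤ d d≥1)) dd
  l : ∀ d → suc (d * d + (d + d)) ≡ suc d * suc d
  l = solve-∀
  l′ : ∀ n → suc (suc n + (suc n + suc n)) + (n + 4) ≡ 4 * suc (suc n)
  l′ = solve-∀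

-- What remains of the hypothesis m ≥ C √(n log n): a lower bound for m, and 2^e ≥ n⁸ for e ≈ m² / n.
record Regime (q k h n m : ℕ) : Set where
  open Constants q k
  field
    d w : ℕ
    d≥1 : 1 ≤ d
    n≤dd : n ≤ d * d
    m-large : W₀ * d ≤ m
    wn≤mm : w * n ≤ m * m
    e : ℕ
    c₁e≤w : c₁ * e ≤ w
    n⁸≤2^e : n ^ 8 ≤ 2 ^ e
    θ≤h : θ₀ ≤ h
    n≥4 : 4 ≤ n

-- The constant C(q) is 4 `W₀`. The n-th root of the hypothesis is n^(C²) ≤ 4^(1 + w) with w =
-- ⌊m²/n⌋. Using only n ≥ 2 in the base, it gives w ≥ 4 `W₀`², hence m ≥ `W₀` d because d² ≤ 4n; a
-- further root gives n⁸ ≤ 2^e.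
regime : ∀ q k h n m → n ≡ q * h → 2 ≤ q → Constants.θ₀ q k ≤ h → 4 ≤ n →
  n ^ (4 * Constants.W₀ q k * (4 * Constants.W₀ q k) * n) ≤ 4 ^ (m * m) → Regime q k h n m
regime q k h n m n≡ q≥2 θ≤h n≥4 hyp = record
  { d = d ; w = w ; d≥1 = proj₁ (proj₂ sq) ; n≤dd = proj₁ (proj₂ (proj₂ sq)) ; m-large = m-large ; wn≤mm = m/n*n≤m (m * m) n
  ; e = e ; c₁e≤w = ≤-trans (≤-reflexive (*-comm c₁ e)) (m/n*n≤m w c₁) ; n⁸≤2^e = n⁸ ; θ≤h = θ≤h ; n≥4 = n≥4 }
  where
  open ≤-Reasoning
  open Constants q k
  n≥1 : 1 ≤ n
  n≥1 = ≤-trans (s≤s z≤n) n≥4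
  instance
    n-nz : NonZero n
    n-nz = >-nonZero n≥1
    c-nz : NonZero c₁
    c-nz = >-nonZero c₁≥1
  sq : ∃[ d ] (1 ≤ d × n ≤ d * d × d * d ≤ 4 * n)
  sq = square-between n n≥1
  d w e Csq : ℕ
  d = proj₁ sq
  w = m * m / n
  e = w / c₁
  Csq = 4 * W₀ * (4 * W₀)
  mm< : m * m ≤ (1 + w) * n
  mm< = ≤-trans (≤-reflexive (m≡m%n+[m/n]*n (m * m) n)) (+-monoˡ-≤ (w * n) (<⇒≤ (m%n<n (m * m) n)))
  n^C≤ : n ^ Csq ≤ 4 ^ (1 + w)
  n^C≤ = root-≤ n n≥1 (begin
    (n ^ Csq) ^ n ≡⟨ ^-*-assoc n Csq n ⟩
    n ^ (Csq * n) ≤⟨ hyp ⟩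
    4 ^ (m * m) ≤⟨ ^-monoʳ-≤ 4 mm< ⟩
    4 ^ ((1 + w) * n) ≡⟨ ^-*-assoc 4 (1 + w) n ⟨
    (4 ^ (1 + w)) ^ n ∎)
  2^-cancel : ∀ a b → 2 ^ a ≤ 2 ^ b → a ≤ b
  2^-cancel a b le = ≮⇒≥ λ lt → <⇒≱ (^-monoʳ-< 2 (s≤s (s≤s z≤n)) lt) le
  C≤ : Csq ≤ 2 * (1 + w)
  C≤ = 2^-cancel Csq (2 * (1 + w)) (begin
    2 ^ Csq ≤⟨ ^-monoˡ Csq (≤-trans (s≤s (s≤s z≤n)) n≥4) ⟩
    n ^ Csq ≤⟨ n^C≤ ⟩
    4 ^ (1 + w) ≡⟨ ^-*-assoc 2 2 (1 + w) ⟩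
    2 ^ (2 * (1 + w)) ∎)
  w-large : 4 * (W₀ * W₀) ≤ w
  w-large = *-cancelˡ-≤ 2 (+-cancelˡ-≤ 2 _ _ (begin
    2 + 2 * (4 * (W₀ * W₀)) ≤⟨ +-monoˡ-≤ _ (*-mono-≤ (s≤s (s≤s (z≤n {6}))) (*-mono-≤ (≤-trans (s≤s (z≤n {63})) W₀≥64) (≤-trans (s≤s (z≤n {63})) W₀≥64))) ⟩
    8 * (W₀ * W₀) + 2 * (4 * (W₀ * W₀)) ≡⟨ l W₀ ⟩
    Csq ≤⟨ C≤ ⟩
    2 * (1 + w) ≡⟨ *-distribˡ-+ 2 1 w ⟩
    2 + 2 * w ∎))
    where
    l : ∀ W → 8 * (W * W) + 2 * (4 * (W * W)) ≡ 4 * W * (4 * W)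
    l = solve-∀
  m-large : W₀ * d ≤ m
  m-large = ≮⇒≥ λ lt → <⇒≱ (*-mono-< lt lt) (*-cancelˡ-≤ 4 (begin
    4 * (W₀ * d * (W₀ * d)) ≡⟨ l W₀ d ⟩
    4 * (W₀ * W₀) * (d * d) ≤⟨ *-mono-≤ w-large (proj₂ (proj₂ (proj₂ sq))) ⟩
    w * (4 * n) ≡⟨ l′ w n ⟩
    4 * (w * n) ≤⟨ *-monoʳ-≤ 4 (m/n*n≤m (m * m) n) ⟩
    4 * (m * m) ∎))
    where
    l : ∀ W d → 4 * (W * d * (W * d)) ≡ 4 * (W * W) * (d * d)
    l = solve-∀
    l′ : ∀ w n → w * (4 * n) ≡ 4 * (w * n)
    l′ = solve-∀
  w≤ : 1 + w ≤ 4 * (c₁ * e)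
  w≤ = begin
    1 + w ≡⟨ cong suc (m≡m%n+[m/n]*n w c₁) ⟩
    suc (w % c₁) + e * c₁ ≤⟨ +-monoˡ-≤ (e * c₁) (m%n<n w c₁) ⟩
    c₁ + e * c₁ ≤⟨ +-monoˡ-≤ (e * c₁) (≤-trans (≤-reflexive (sym (+-identityʳ c₁))) (*-monoˡ-≤ c₁ e≥1)) ⟩
    e * c₁ + e * c₁ ≤⟨ m≤m+n _ (2 * (e * c₁)) ⟩
    e * c₁ + e * c₁ + 2 * (e * c₁) ≡⟨ l e c₁ ⟩
    4 * (c₁ * e) ∎
    where
    e≥1 : 1 ≤ e
    e≥1 = m≥n⇒m/n>0 (≤-trans (≤-trans (m≤m+n c₁ _) W₀≥64c) (≤-trans (≤-trans (≤-reflexive (sym (*-identityʳ W₀))) (*-monoʳ-≤ W₀ (≤-trans (s≤s z≤n) W₀≥64))) (≤-trans (m≤m+n (W₀ * W₀) _) w-large)))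
    l : ∀ e c → e * c + e * c + 2 * (e * c) ≡ 4 * (c * e)
    l = solve-∀
  n⁸ : n ^ 8 ≤ 2 ^ e
  n⁸ = root-≤ (8 * c₁) (*-mono-≤ (s≤s (z≤n {7})) c₁≥1) (begin
    (n ^ 8) ^ (8 * c₁) ≡⟨ ^-*-assoc n 8 (8 * c₁) ⟩
    n ^ (8 * (8 * c₁)) ≤⟨ ^-monoʳ-≤ n C-big ⟩
    n ^ Csq ≤⟨ n^C≤ ⟩
    4 ^ (1 + w) ≤⟨ ^-monoʳ-≤ 4 w≤ ⟩
    4 ^ (4 * (c₁ * e)) ≡⟨ ^-*-assoc 2 2 (4 * (c₁ * e)) ⟩
    2 ^ (2 * (4 * (c₁ * e))) ≡⟨ cong (2 ^_) (l c₁ e) ⟩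
    2 ^ (e * (8 * c₁)) ≡⟨ ^-*-assoc 2 e (8 * c₁) ⟨
    (2 ^ e) ^ (8 * c₁) ∎)
    where
    l : ∀ c e → 2 * (4 * (c * e)) ≡ e * (8 * c)
    l = solve-∀
    C-big : 8 * (8 * c₁) ≤ Csq
    C-big = begin
      8 * (8 * c₁) ≡⟨ *-assoc 8 8 c₁ ⟨
      64 * c₁ ≤⟨ W₀≥64c ⟩
      W₀ ≤⟨ m≤m+n W₀ _ ⟩
      4 * W₀ ≡⟨ *-identityʳ _ ⟨
      4 * W₀ * 1 ≤⟨ *-monoʳ-≤ (4 * W₀) (≤-trans (s≤s z≤n) (≤-trans W₀≥64 (m≤m+n W₀ _))) ⟩
      4 * W₀ * (4 * W₀) ∎

module Parameters (q k h n m b : ℕ) (q≡ : q ≡ 3 * k + 2) (n≡ : n ≡ q * h) (N≡ : suc k * h ≡ m + b)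
    (h≤θb : h ≤ 9 * suc k * b) (reg : Regime q k h n m) where
  open Regime reg
  open Constants q k
  open ≤-Reasoning

  -- A bad configuration saves 2^j, and the choices leading to it cost 2^E. Each chosen element is
  -- discounted by y = 2^Y. Near and far sets are separated by t elements outside a maximum set. D
  -- is the reciprocal of the density m/N, rounded down: the number of outside elements whose Cayley
  -- graph still respects the degree bound.
  N θ j j₁ Y y t E g D : ℕ
  N = suc k * h
  θ = 9 * suc k
  Y = Y₀
  y = 2 ^ Y
  t = 20 * (q * d)

  θ≥1 : 1 ≤ θ
  θ≥1 = *-mono-≤ (s≤s (z≤n {8})) (s≤s (z≤n {k}))
  m≥1 : 1 ≤ m
  m≥1 = ≤-trans (*-mono-≤ (≤-trans (s≤s (z≤n {63})) W₀≥64) d≥1) m-large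
  q≥1+k : suc k ≤ q
  q≥1+k = subst (suc k ≤_) (sym q≡) (≤-trans (m≤m+n (suc k) (2 * k + 1)) (≤-reflexive (l k)))
    where
    l : ∀ k → suc k + (2 * k + 1) ≡ 3 * k + 2
    l = solve-∀
  instance
    c-nz : NonZero c₁
    c-nz = >-nonZero c₁≥1
    m-nz : NonZero m
    m-nz = >-nonZero m≥1
    θ-nz : NonZero θ
    θ-nz = >-nonZero θ≥1
  j = m / c₁
  j₁ = suc (j / 32)
  E = 4 * j₁ + Y * t
  g = h / θ
  D = N / m

  b≥1 : 1 ≤ b
  b≥1 = n≢0⇒n>0 λ e0 → <⇒≱ (≤-trans θ≥1 θ≤h) (≤-trans h≤θb (≤-reflexive (trans (cong (θ *_) e0) (*-zeroʳ θ))))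

  m≤N : m ≤ N
  m≤N = subst (m ≤_) (sym N≡) (m≤m+n m b)

  N<n : suc N ≤ n
  N<n = subst (suc N ≤_) (trans (l k h) (sym (trans n≡ (cong (_* h) q≡)))) (≤-trans (s≤s (m≤m+n N ((2 * k) * h))) (+-monoˡ-≤ _ (≤-trans θ≥1 θ≤h)))
    where
    l : ∀ k h → h + (suc k * h + 2 * k * h) ≡ (3 * k + 2) * h
    l = solve-∀

  m≤n : m ≤ n
  m≤n = ≤-trans m≤N (≤-trans (n≤1+n N) N<n)

  j-large : (80 * (Y * q) + 64) * d ≤ j
  j-large = subst (_≤ m / c₁) (m*n/n≡m ((80 * (Y * q) + 64) * d) c₁) (/-monoˡ-≤ c₁ (subst (_≤ m) (trans (cong (_* d) W₀-def) (l c₁ (80 * (Y * q) + 64) d)) m-large))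
    where
    l : ∀ c u d → c * u * d ≡ u * d * c
    l = solve-∀

  j≥1 : 1 ≤ j
  j≥1 = ≤-trans (*-mono-≤ (≤-trans (s≤s (z≤n {63})) (m≤n+m 64 (80 * (Y * q)))) d≥1) j-large

  c₁j≤m : c₁ * j ≤ m
  c₁j≤m = ≤-trans (≤-reflexive (*-comm c₁ j)) (m/n*n≤m m c₁)

  m≤2c₁j : m ≤ 2 * (c₁ * j)
  m≤2c₁j = begin
    m ≡⟨ m≡m%n+[m/n]*n m c₁ ⟩
    m % c₁ + j * c₁ ≤⟨ +-monoˡ-≤ _ (≤-trans (<⇒≤ (m%n<n m c₁)) (≤-trans (≤-reflexive (sym (+-identityʳ c₁))) (*-monoˡ-≤ c₁ j≥1))) ⟩
    j * c₁ + j * c₁ ≡⟨ l j c₁ ⟩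
    2 * (c₁ * j) ∎
    where
    l : ∀ j c → j * c + j * c ≡ 2 * (c * j)
    l = solve-∀

  j≤32j₁ : j ≤ 32 * j₁
  j≤32j₁ = begin
    j ≡⟨ m≡m%n+[m/n]*n j 32 ⟩
    j % 32 + j / 32 * 32 ≤⟨ +-monoˡ-≤ _ (<⇒≤ (m%n<n j 32)) ⟩
    32 + j / 32 * 32 ≡⟨ *-comm j₁ 32 ⟩
    32 * j₁ ∎

  2E≤j : 2 * E ≤ j
  2E≤j = *-cancelˡ-≤ 4 (begin
    4 * (2 * (4 * j₁ + Y * t)) ≡⟨ l₁ j₁ Y q d ⟩
    32 * j₁ + 160 * (Y * q) * d ≤⟨ +-monoˡ-≤ _ 32j₁≤ ⟩
    j + 32 + 160 * (Y * q) * d ≤⟨ +-monoˡ-≤ _ (+-monoʳ-≤ j (≤-trans (*-monoʳ-≤ 32 d≥1) (≤-trans (m≤m+n (32 * d) (96 * d)) (≤-reflexive (l₃ d))))) ⟩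
    j + 128 * d + 160 * (Y * q) * d ≡⟨ l₂ j (Y * q) d ⟩
    j + 2 * ((80 * (Y * q) + 64) * d) ≤⟨ +-monoʳ-≤ j (*-monoʳ-≤ 2 j-large) ⟩
    j + 2 * j ≤⟨ m≤m+n _ j ⟩
    j + 2 * j + j ≡⟨ l₄ j ⟩
    4 * j ∎)
    where
    32j₁≤ : 32 * j₁ ≤ j + 32
    32j₁≤ = ≤-trans (≤-reflexive (*-comm 32 j₁)) (≤-trans (+-monoʳ-≤ 32 (m/n*n≤m j 32)) (≤-reflexive (+-comm 32 j)))
    l₁ : ∀ j Y q d → 4 * (2 * (4 * j + Y * (20 * (q * d)))) ≡ 32 * j + 160 * (Y * q) * d
    l₁ = solve-∀
    l₂ : ∀ j u d → j + 128 * d + 160 * u * d ≡ j + 2 * ((80 * u + 64) * d)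
    l₂ = solve-∀
    l₃ : ∀ d → 32 * d + 96 * d ≡ 128 * d
    l₃ = solve-∀
    l₄ : ∀ j → j + 2 * j + j ≡ 4 * j
    l₄ = solve-∀

  n≤qθb : n ≤ q * θ * b
  n≤qθb = ≤-trans (≤-reflexive n≡) (≤-trans (*-monoʳ-≤ q h≤θb) (≤-reflexive (sym (*-assoc q θ b))))

  -- The hypothesis of `exp-bound` for (1 + m/(yb))^n, the discounted sum over all choices, which is
  -- then at most 2^(4 j₁).
  spread : m * n ≤ y * b * j₁
  spread = begin
    m * n ≤⟨ *-mono-≤ m≤2c₁j n≤qθb ⟩
    2 * (c₁ * j) * (q * θ * b) ≤⟨ *-monoˡ-≤ (q * θ * b) (*-monoʳ-≤ 2 (*-monoʳ-≤ c₁ j≤32j₁)) ⟩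
    2 * (c₁ * (32 * j₁)) * (q * θ * b) ≡⟨ trans (l c₁ j₁ q θ b) (cong (λ z → z * b * j₁) (sym Y₀-def)) ⟩
    Y * b * j₁ ≤⟨ *-monoˡ-≤ j₁ (*-monoˡ-≤ b (n≤2^n Y)) ⟩
    y * b * j₁ ∎
    where
    l : ∀ c j q t b → 2 * (c * (32 * j)) * (q * t * b) ≡ 64 * (c * q * t) * b * j
    l = solve-∀

  y≥1 : 1 ≤ y
  y≥1 = ^-pos 2 Y (s≤s z≤n)

  m≤yb : m ≤ y * b
  m≤yb = ≤-trans m≤n (≤-trans n≤qθb (*-monoˡ-≤ b (≤-trans (≤-trans (≤-reflexive (sym (+-identityʳ _))) (≤-trans (*-monoˡ-≤ (q * θ) c₁≥1) (≤-trans (≤-reflexive (sym (*-assoc c₁ q θ))) (≤-trans (m≤m+n (c₁ * q * θ) (63 * (c₁ * q * θ))) (≤-reflexive (sym Y₀-def)))))) (n≤2^n Y))))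

  -- The degree condition of `indep-mass` for D generators, each of which gives two neighbours.
  mD : m * suc (2 * D) ≤ 3 * (m + b)
  mD = subst (λ z → m * suc (2 * D) ≤ 3 * z) N≡ (begin
    m * suc (2 * D) ≡⟨ l m D ⟩
    m + 2 * (D * m) ≤⟨ +-mono-≤ m≤N (*-monoʳ-≤ 2 (m/n*n≤m N m)) ⟩
    N + 2 * N ≡⟨⟩
    3 * N ∎)
    where
    l : ∀ m D → m * suc (2 * D) ≡ m + 2 * (D * m)
    l = solve-∀

  N≤2Dm : N ≤ 2 * (D * m)
  N≤2Dm = begin
    N ≡⟨ m≡m%n+[m/n]*n N m ⟩
    N % m + D * m ≤⟨ +-monoˡ-≤ _ (≤-trans (<⇒≤ (m%n<n N m)) (≤-trans (≤-reflexive (sym (+-identityʳ m))) (*-monoˡ-≤ m (m≥n⇒m/n>0 m≤N)))) ⟩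
    D * m + D * m ≡⟨ cong (D * m +_) (+-identityʳ _) ⟨
    2 * (D * m) ∎

  48≤c₁ : 48 * suc k ≤ c₁
  48≤c₁ = subst (48 * suc k ≤_) (sym c₁-def) (≤-trans (≤-reflexive (sym (*-identityʳ _))) (*-monoʳ-≤ (48 * suc k) θ≥1))

  48j≤m : 48 * suc k * j ≤ m
  48j≤m = ≤-trans (*-monoˡ-≤ j 48≤c₁) c₁j≤m

  -- For D outside elements, with Dh arcs: Dh (m/N)² is about hm/N = m/(k + 1). The rounding in D =
  -- N / m costs a factor 2, so 24 becomes 48.
  gain-large : j * (24 * ((m + b) * (m + b))) ≤ D * h * (m * m)
  gain-large = subst (λ z → j * (24 * (z * z)) ≤ D * h * (m * m)) N≡ (begin
    j * (24 * (N * N)) ≤⟨ *-monoʳ-≤ j (*-monoʳ-≤ 24 (*-monoʳ-≤ N N≤2Dm)) ⟩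
    j * (24 * (N * (2 * (D * m)))) ≡⟨ l j k h D m ⟩
    48 * suc k * j * (D * h * m) ≤⟨ *-monoˡ-≤ (D * h * m) 48j≤m ⟩
    m * (D * h * m) ≡⟨ l′ m (D * h) ⟩
    D * h * (m * m) ∎)
    where
    l : ∀ j k h D m → j * (24 * (suc k * h * (2 * (D * m)))) ≡ 48 * suc k * j * (D * h * m)
    l = solve-∀
    l′ : ∀ m u → m * (u * m) ≡ u * (m * m)
    l′ = solve-∀

  -- For one outside element, with h arcs; h (m/N)² is only of order m²/n.
  gain-small : e * (24 * ((m + b) * (m + b))) ≤ h * (m * m)
  gain-small = subst (λ z → e * (24 * (z * z)) ≤ h * (m * m)) N≡ (begin
    e * (24 * (N * N)) ≡⟨ l e k h ⟩
    24 * suc k * e * (suc k * h * h) ≤⟨ *-mono-≤ (*-monoˡ-≤ e (≤-trans (*-monoˡ-≤ (suc k) (m≤m+n 24 24)) 48≤c₁)) (*-monoˡ-≤ h (*-monoˡ-≤ h q≥1+k)) ⟩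
    c₁ * e * (q * h * h) ≤⟨ *-monoˡ-≤ (q * h * h) c₁e≤w ⟩
    w * (q * h * h) ≡⟨ l′ w (q * h) h ⟩
    h * (w * (q * h)) ≡⟨ cong (λ z → h * (w * z)) n≡ ⟨
    h * (w * n) ≤⟨ *-monoʳ-≤ h wn≤mm ⟩
    h * (m * m) ∎)
    where
    l : ∀ e k h → e * (24 * (suc k * h * (suc k * h))) ≡ 24 * suc k * e * (suc k * h * h)
    l = solve-∀
    l′ : ∀ w u h → w * (u * h) ≡ h * (w * u)
    l′ = solve-∀

  gθ≤h : g * θ ≤ h
  gθ≤h = m/n*n≤m h θ

  g≤N : g ≤ N
  g≤N = ≤-trans (≤-trans (≤-trans (≤-reflexive (sym (*-identityʳ g))) (*-monoʳ-≤ g θ≥1)) gθ≤h) (m≤m+n h _)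

  -- For g elements fewer than N to choose from: the saving is (1 + m/b)^g.
  gain-far : j * (b + m) ≤ g * m
  gain-far = subst (λ z → j * z ≤ g * m) (trans N≡ (+-comm m b)) (begin
    j * (suc k * h) ≤⟨ *-monoʳ-≤ j (*-monoʳ-≤ (suc k) h≤) ⟩
    j * (suc k * (2 * (g * θ))) ≡⟨ l j k g θ ⟩
    g * (2 * suc k * θ * j) ≤⟨ *-monoʳ-≤ g (≤-trans (*-monoˡ-≤ j (≤-trans (*-monoˡ-≤ θ (*-monoˡ-≤ (suc k) (m≤m+n 2 46))) (≤-reflexive (sym c₁-def)))) c₁j≤m) ⟩
    g * m ∎)
    where
    h≤ : h ≤ 2 * (g * θ)
    h≤ = begin
      h ≡⟨ m≡m%n+[m/n]*n h θ ⟩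
      h % θ + g * θ ≤⟨ +-monoˡ-≤ _ (≤-trans (<⇒≤ (m%n<n h θ)) (≤-trans (≤-reflexive (sym (+-identityʳ θ))) (*-monoˡ-≤ θ (m≥n⇒m/n>0 θ≤h)))) ⟩
      g * θ + g * θ ≡⟨ cong (g * θ +_) (+-identityʳ _) ⟨
      2 * (g * θ) ∎
    l : ∀ j k g θ → j * (suc k * (2 * (g * θ))) ≡ g * (2 * suc k * θ * j)
    l = solve-∀

  e≤j : e ≤ j
  e≤j = subst (_≤ j) (m*n/n≡m e c₁) (/-monoˡ-≤ c₁ (≤-trans (≤-reflexive (*-comm e c₁)) (≤-trans c₁e≤w w≤m)))
    where
    w≤m : w ≤ m
    w≤m = *-cancelʳ-≤ w m m (≤-trans (*-monoʳ-≤ w m≤n) wn≤mm)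

  n⁴≤ : n ^ 4 ≤ 2 ^ (j ∸ E)
  n⁴≤ = root-≤ 2 (s≤s z≤n) (begin
    (n ^ 4) ^ 2 ≡⟨ ^-*-assoc n 4 2 ⟩
    n ^ 8 ≤⟨ n⁸≤2^e ⟩
    2 ^ e ≤⟨ ^-monoʳ-≤ 2 e≤j ⟩
    2 ^ j ≤⟨ ^-monoʳ-≤ 2 (m+n≤o⇒m≤o∸n′) ⟩
    2 ^ ((j ∸ E) * 2) ≡⟨ ^-*-assoc 2 (j ∸ E) 2 ⟨
    (2 ^ (j ∸ E)) ^ 2 ∎)
    where
    E≤j : E ≤ j
    E≤j = ≤-trans (m≤m+n E _) 2E≤j
    m+n≤o⇒m≤o∸n′ : j ≤ (j ∸ E) * 2
    m+n≤o⇒m≤o∸n′ = +-cancelʳ-≤ (2 * E) _ _ (begin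
      j + 2 * E ≤⟨ +-monoʳ-≤ j 2E≤j ⟩
      j + j ≡⟨ cong (λ z → z + z) (m∸n+n≡m E≤j) ⟨
      j ∸ E + E + (j ∸ E + E) ≡⟨ l (j ∸ E) E ⟩
      (j ∸ E) * 2 + 2 * E ∎)
      where
      l : ∀ u E → u + E + (u + E) ≡ u * 2 + 2 * E
      l = solve-∀

  -- Absorbing the factor y^t 2^(4 j₁) = 2^E into half of 2^j.
  absorb : ∀ f X → f * 2 ^ j ≤ X * y ^ t * 2 ^ (4 * j₁) → f * n ^ 4 ≤ X
  absorb f X le = ≤-trans (*-monoʳ-≤ f n⁴≤) (*-cancelʳ-≤ _ _ (2 ^ E) {{>-nonZero (^-pos 2 E (s≤s z≤n))}} (begin
    f * 2 ^ (j ∸ E) * 2 ^ E ≡⟨ trans (*-assoc f _ _) (cong (f *_) (trans (sym (^-distribˡ-+-* 2 (j ∸ E) E)) (cong (2 ^_) (m∸n+n≡m (≤-trans (m≤m+n E _) 2E≤j))))) ⟩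
    f * 2 ^ j ≤⟨ le ⟩
    X * y ^ t * 2 ^ (4 * j₁) ≡⟨ trans (*-assoc X _ _) (cong (X *_) (trans (*-comm (y ^ t) _) (trans (cong (2 ^ (4 * j₁) *_) (^-*-assoc 2 Y t)) (sym (^-distribˡ-+-* 2 (4 * j₁) (Y * t)))))) ⟩
    X * 2 ^ E ∎))

pw-all : ∀ a b {n} (T : Pr n) v → Partial.pw a b T (λ _ → true) v ≡ Weights.weight a b v
pw-all a b T [] = refl
pw-all a b T (true ∷ v) = cong (a *_) (pw-all a b (T ∘ suc) v)
pw-all a b T (false ∷ v) = cong (b *_) (pw-all a b (T ∘ suc) v)

opaque
  anyS : ∀ {n} → (Subset n → Bool) → Bool
  anyS P = ⌊ anySubset? (λ w → P w ≟ᵇ true) ⌋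

  anyS-true : ∀ {n} (P : Subset n → Bool) → anyS P ≡ true → ∃[ w ] P w ≡ true
  anyS-true P p = ⌊⌋-true {d = anySubset? (λ w → P w ≟ᵇ true)} p

  anyS-intro : ∀ {n} (P : Subset n → Bool) w → P w ≡ true → anyS P ≡ true
  anyS-intro P w p = ⌊⌋-intro {d = anySubset? (λ w → P w ≟ᵇ true)} (w , p)

  anyF : ∀ {n} → Pr n → Bool
  anyF = anyb

  anyF-true : ∀ {n} (A : Pr n) → anyF A ≡ true → ∃[ i ] A i ≡ true
  anyF-true = anyb-true

  anyF-intro : ∀ {n} (A : Pr n) i → A i ≡ true → anyF A ≡ true
  anyF-intro = anyb-intro

term≤∑S : ∀ {n} (f : Subset n → ℕ) w → f w ≤ ∑S n f
term≤∑S {n} f w = ≤-trans (≤-reflexive (sym (∑S-δ w f))) (ΣL-mono (allSubsets n) (λ v → ≤-trans (*-monoˡ-≤ (f v) (⟦⟧≤1 (eqS w v))) (≤-reflexive (+-identityʳ (f v)))))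

⟦⟧-elim : ∀ {c} b → (b ≡ true → 1 ≤ c) → ⟦ b ⟧ ≤ c
⟦⟧-elim true h = h refl
⟦⟧-elim false h = z≤n

-- The number of maximum sum-free sets

module Counting {n : ℕ} (G : FG n) (q k h : ℕ) (q≡ : q ≡ 3 * k + 2) (n≡ : n ≡ q * h) (pr : Prime q)
    (q-least : ∀ c → c ∣ n → c % 3 ≡ 2 → q ≤ c) where
  open Duality G q pr public
  open Max q k h q≡ n≡ q-least public
  module Vo = Vosper q k q≡ pr
  open Vo using (middle; #middle; middle-intro; middle-small; middle-SF; middle-multiplier) public
  private
    instance
      q-nz : NonZero q
      q-nz = prime⇒nonZero pr

  preimage : Vec (Fin q) n → Pr n
  preimage χ x = middle (lookup χ x)

  level-size : ∀ χ → Hom χ → ∀ g → lookup χ g ≡ fin 1 → ∀ j → # (λ x → lookup χ x == fin j) ≡ h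
  level-size χ hχ g χg j = *-cancelˡ-≡ _ h q (trans (kernel-size χ hχ g χg j) n≡)

  pullback-size : ∀ χ → Hom χ → ∀ g → lookup χ g ≡ fin 1 → ∀ T → # (λ x → T (lookup χ x)) ≡ # T * h
  pullback-size χ hχ g χg T = begin
    # (λ x → T (lookup χ x)) ≡⟨ sum-cong-≗ (λ x → sym (sum-δ (lookup χ x) (λ j → ⟦ T j ⟧))) ⟩
    sum (λ x → sum (λ j → ⟦ lookup χ x == j ⟧ * ⟦ T j ⟧)) ≡⟨ ∑-comm (λ x j → ⟦ lookup χ x == j ⟧ * ⟦ T j ⟧) ⟩
    sum (λ j → sum (λ x → ⟦ lookup χ x == j ⟧ * ⟦ T j ⟧)) ≡⟨ sum-cong-≗ (λ j → trans (sum-cong-≗ (λ x → *-comm ⟦ lookup χ x == j ⟧ ⟦ T j ⟧)) (trans (sum-*ˡ ⟦ T j ⟧ _)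
        (trans (cong (⟦ T j ⟧ *_) (trans (#-cong (λ x → cong (lookup χ x ==_) (sym (fin-toℕ j)))) (level-size χ hχ g χg (toℕ j)))) (*-comm ⟦ T j ⟧ h)))) ⟩
    sum (λ j → h * ⟦ T j ⟧) ≡⟨ sum-*ˡ h (λ j → ⟦ T j ⟧) ⟩
    h * # T ≡⟨ *-comm h (# T) ⟩
    # T * h ∎
    where open ≡-Reasoning

  preimage-SF : ∀ χ → Hom χ → SF (preimage χ)
  preimage-SF χ hχ x y p r s = middle-SF _ _ p r (trans (cong middle (sym (hχ x y))) s)

  preimage-size : ∀ χ → Hom χ → ∀ g → lookup χ g ≡ fin 1 → # (preimage χ) ≡ N
  preimage-size χ hχ g χg = trans (pullback-size χ hχ g χg middle) (cong (_* h) #middle)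

  q≥2 : 2 ≤ q
  q≥2 = subst (2 ≤_) (sym q≡) (m≤n+m 2 (3 * k))

  -- The order of x modulo `H` divides the index of `H`, which is q, so qx lies in `H`. This is what
  -- `separate` needs to produce a homomorphism that is trivial on the period.
  period-qG : ∀ H → IsSub H → # H ≡ h → qG ⊑ H
  period-qG H sub size z p = trans (cong H (trans (sym (proj₂ e)) (trans (cong (_· x) (_∣_.equality ord∣q)) (·-* (quotient ord∣q) X.ord x)))) (has-· sub (quotient ord∣q) X.ord-in)
    where
    e : ∃[ x ] q · x ≡ z
    e = qG-elim z p
    x : Fin n
    x = proj₁ e
    module X = Ext (extend sub x)
    ord∣q : X.ord ∣ q
    ord∣q = *-cancelʳ-∣ h {{>-nonZero h≥1}} (subst₂ _∣_ (trans X.ext-size (cong (X.ord *_) size)) n≡ (lagrange-group X.ext-sub))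

  outside : ∀ H → # H ≡ h → ∃[ g ] ¬ (H ∋∋ g)
  outside H size with any? (λ g → ¬? (H g ≟ᵇ true))
  ... | yes r = r
  ... | no ¬r = ⊥-elim (<⇒≢ (m<n*m h q h≥1 q≥2) (trans (sym size) (trans (#-cong {A = H} {λ _ → true} (λ g → bool-ext (λ _ → refl) (λ _ → [ id , (λ f → ⊥-elim (¬r (g , λ t → absurd-b t f))) ]′ (bool-cases (H g)))))
        (trans (sum-const n 1) (trans (*-identityʳ n) n≡)))))
    where
    m<n*m : ∀ m n → 1 ≤ m → 2 ≤ n → m < n * m
    m<n*m m n a b = <-≤-trans (m<m+n m (≤-trans a (≤-reflexive (sym (+-identityʳ m))))) (*-monoˡ-≤ m b)

  -- S is the pullback of T ⊆ ℤ/q along a homomorphism whose kernel is the period of S.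
  descend : ∀ S → SF S → # S ≡ N → ∀ χ → Hom χ → ∀ g → lookup χ g ≡ fin 1 → (∀ x y → lookup χ x ≡ lookup χ y → S x ≡ S y) →
    ∃[ ψ ] (Hom ψ × (∀ x → S x ≡ preimage ψ x))
  descend S sf size χ hχ g χg inv = ψ , hψ , λ x → trans (ST x) (trans (cong T (sym (trans (cong (λ z → toℕ z R.· d) (trans (lookup∘tabulate _ x) (R.·-toℕ a (lookup χ x)))) (Vo.scale-inverse d a b eab (lookup χ x)))))
        (proj₂ (proj₂ cl) (lookup ψ x)))
    where
    T : Pr q
    T j = S (toℕ j · g)
    χ-mult : ∀ j → lookup χ (toℕ j · g) ≡ j
    χ-mult j = trans (hom-· χ hχ (toℕ j) g) (trans (cong (toℕ j R.·_) χg) (trans (R.·-fin (toℕ j) 1) (trans (cong fin (*-identityʳ (toℕ j))) (fin-toℕ j))))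
    ST : ∀ x → S x ≡ T (lookup χ x)
    ST x = inv x _ (sym (χ-mult (lookup χ x)))
    T-SF : Vo.SF T
    T-SF i j p r s = sf _ _ p r (trans (inv _ _ (trans (hχ _ _) (trans (cong₂ _⊞q_ (χ-mult i) (χ-mult j)) (sym (χ-mult (i ⊞q j)))))) s)
    T-size : # T ≡ suc k
    T-size = *-cancelʳ-≡ (# T) (suc k) h {{>-nonZero h≥1}} (trans (sym (pullback-size χ hχ g χg T)) (trans (#-cong (λ x → sym (ST x))) size))
    cl : ∃[ d ] (d ≢ fin 0 × (∀ y → T (toℕ y R.· d) ≡ middle y))
    cl = Vo.classify T T-SF T-size
    d : Fin q
    d = proj₁ cl
    inverse : ∃[ a ] ∃[ b ] a * toℕ d ≡ 1 + b * q
    inverse = Vo.unit-inverse d (proj₁ (proj₂ cl))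
    a b : ℕ
    a = proj₁ inverse
    b = proj₁ (proj₂ inverse)
    eab : a * toℕ d ≡ 1 + b * q
    eab = proj₂ (proj₂ inverse)
    ψ : Vec (Fin q) n
    ψ = tabulate (λ x → a R.· lookup χ x)
    hψ : Hom ψ
    hψ x y = trans (lookup∘tabulate _ (x ⊕ y)) (trans (cong (a R.·_) (hχ x y)) (trans (R.·-⊕ a (lookup χ x) (lookup χ y)) (cong₂ _⊞q_ (sym (lookup∘tabulate _ x)) (sym (lookup∘tabulate _ y)))))

  opaque
    -- A homomorphism trivial on the period and equal to 1 at some g outside has kernel of size h,
    -- hence exactly the period, and so `S` is a union of its level sets.
    realise : ∀ S → SF S → # S ≡ N → ∃[ ψ ] (Hom ψ × (∀ x → S x ≡ preimage ψ x))
    realise S sf size = descend S sf size χ hχ g χg inv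
      where
      st : MaxStr N h S
      st = max-structure S sf size
      open MaxStr st using (period; period-sub; period-size; periodic)
      out : ∃[ g ] ¬ (period ∋∋ g)
      out = outside period period-size
      g : Fin n
      g = proj₁ out
      sep : ∃[ χ ] (Hom χ × lookup χ g ≡ fin 1 × (∀ x → period ∋∋ x → lookup χ x ≡ fin 0))
      sep = separate period period-sub (period-qG period period-sub period-size) g (proj₂ out)
      χ : Vec (Fin q) n
      χ = proj₁ sep
      hχ : Hom χ
      hχ = proj₁ (proj₂ sep)
      χg : lookup χ g ≡ fin 1
      χg = proj₁ (proj₂ (proj₂ sep))
      kernel⊑ : (λ x → lookup χ x == fin 0) ⊑ period
      kernel⊑ = ⊑-eq {A = period} (λ x p → ⌊⌋-intro (proj₂ (proj₂ (proj₂ sep)) x p)) (≤-reflexive (trans (level-size χ hχ g χg 0) (sym period-size)))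
      inv′ : ∀ x y → lookup χ x ≡ lookup χ y → S ∋∋ x → S ∋∋ y
      inv′ x y e p = trans (cong S (sym (⊕⊖′ x y))) (periodic x (y ⊖ x) p (kernel⊑ _ (⌊⌋-intro (trans (hom-⊖ χ hχ y x) (trans (cong (λ z → lookup χ y R.⊖ z) e) (R.x⊖x _))))))
      inv : ∀ x y → lookup χ x ≡ lookup χ y → S x ≡ S y
      inv x y e = bool-ext (inv′ x y e) (inv′ y x (sym e))

  opaque
    -- If χ x = 0 but ψ x ≠ 0, translation by x would show the middle third invariant under a
    -- nonzero residue. So ψ vanishes on the kernel of χ and is a multiple of it.
    proportional : ∀ χ ψ → Hom χ → Hom ψ → ∀ g₀ g₁ → lookup χ g₀ ≡ fin 1 → lookup ψ g₁ ≡ fin 1 → (∀ x → preimage χ x ≡ preimage ψ x) →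
      ∃[ c ] ((∀ x → lookup ψ x ≡ c R.· lookup χ x) × (∀ y → middle y ≡ middle (c R.· y)))
    proportional χ ψ hχ hψ g₀ g₁ χg ψg same = c , prop , mult
      where
      χ-mult : ∀ j → lookup χ (toℕ j · g₀) ≡ j
      χ-mult j = trans (hom-· χ hχ (toℕ j) g₀) (trans (cong (toℕ j R.·_) χg) (trans (R.·-fin (toℕ j) 1) (trans (cong fin (*-identityʳ (toℕ j))) (fin-toℕ j))))
      ψ-mult : ∀ j → lookup ψ (toℕ j · g₁) ≡ j
      ψ-mult j = trans (hom-· ψ hψ (toℕ j) g₁) (trans (cong (toℕ j R.·_) ψg) (trans (R.·-fin (toℕ j) 1) (trans (cong fin (*-identityʳ (toℕ j))) (fin-toℕ j))))
      c : ℕ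
      c = toℕ (lookup ψ g₀)
      kernel : ∀ x → lookup χ x ≡ fin 0 → lookup ψ x ≡ fin 0
      kernel x χx with lookup ψ x FinP.≟ fin 0
      ... | yes e = e
      ... | no ne = ⊥-elim (<⇒≱ lt (Vo.closed-full middle (lookup ψ x) ne (subst (1 ≤_) (sym #middle) (s≤s z≤n)) closed))
        where
        lt : # middle < q
        lt = subst (_< q) (sym #middle) (<-≤-trans (m<m+n (suc k) (s≤s z≤n)) Vo.2k+2≤q)
        closed : middle ⊑ R.τ (lookup ψ x) middle
        closed w p = trans (cong middle (trans (cong (R._⊖ lookup ψ x) (sym (ψ-mult w))) (sym (hom-⊖ ψ hψ z x)))) (trans (sym (same (z ⊖ x))) (trans (cong middle (trans (hom-⊖ χ hχ z x)
            (trans (cong (lookup χ z R.⊖_) χx) (R.gsolve (R.v0 R.:- R.:0) R.v0 refl (lookup χ z ∷ []))))) (trans (same z) (trans (cong middle (ψ-mult w)) p))))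
          where
          z : Fin n
          z = toℕ w · g₁
      prop : ∀ x → lookup ψ x ≡ c R.· lookup χ x
      prop x = trans (R.⊕-cancelʳ (R.neg (lookup ψ y)) _ _ (trans (sym (hom-⊖ ψ hψ x y)) (trans (kernel (x ⊖ y) (trans (hom-⊖ χ hχ x y) (trans (cong (lookup χ x R.⊖_) (χ-mult (lookup χ x))) (R.x⊖x _)))) (sym (R.x⊖x _)))))
          (trans (hom-· ψ hψ (toℕ (lookup χ x)) g₀) (trans (R.·-toℕ (toℕ (lookup χ x)) (lookup ψ g₀)) (trans (cong fin (*-comm (toℕ (lookup χ x)) c)) (sym (R.·-toℕ c (lookup χ x))))))
        where
        y : Fin n
        y = toℕ (lookup χ x) · g₀
      mult : ∀ y → middle y ≡ middle (c R.· y)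
      mult y = trans (cong middle (sym (χ-mult y))) (trans (same (toℕ y · g₀)) (cong middle (trans (prop (toℕ y · g₀)) (cong (c R.·_) (χ-mult y)))))

  middle-neg : ∀ y → middle (R.neg y) ≡ middle y
  middle-neg y = bool-ext (λ p → trans (cong middle (sym (R.neg-neg y))) (f (R.neg y) p)) (f y)
    where
    f : ∀ y → middle ∋∋ y → middle ∋∋ R.neg y
    f y p with ∧-true {suc k ≤b toℕ y} p
    ... | lo , hi = middle-intro (q ∸ toℕ y) (m+n≤o⇒m≤o∸n (suc k) (begin
            suc k + toℕ y ≤⟨ +-monoʳ-≤ (suc k) (s≤s⁻¹ (≤b-true hi)) ⟩
            suc k + (k + suc k) ≡⟨ l k ⟩
            3 * k + 2 ≡⟨ q≡ ⟨
            q ∎)) (s≤s (m≤n+o⇒m∸n≤o q (toℕ y) (begin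
            q ≡⟨ q≡ ⟩
            3 * k + 2 ≡⟨ l k ⟨
            suc k + (k + suc k) ≤⟨ +-monoˡ-≤ (k + suc k) (≤b-true lo) ⟩
            toℕ y + (k + suc k) ∎)))
      where
      open ≤-Reasoning
      l : ∀ k → suc k + (k + suc k) ≡ 3 * k + 2
      l = solve-∀

  mult-one : ∀ c y → c % q ≡ 1 → c R.· y ≡ y
  mult-one c y e = trans (R.·-toℕ c y) (trans (fin-cong (trans (%-distribˡ-* c (toℕ y) q) (trans (cong (λ z → (z * (toℕ y % q)) % q) e) (trans (cong (_% q) (+-identityʳ (toℕ y % q))) (m%n%n≡m%n (toℕ y) q))))) (fin-toℕ y))

  mult-minus-one : ∀ c y → c % q ≡ q ∸ 1 → c R.· y ≡ R.neg y
  mult-minus-one c y e = R.⊕-cancelʳ y _ _ (begin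
      (c R.· y) R.⊕ y ≡⟨ R.⊕-comm (c R.· y) y ⟩
      suc c R.· y ≡⟨ R.·-toℕ (suc c) y ⟩
      fin (suc c * toℕ y) ≡⟨ fin-cong (trans (%-distribˡ-* (suc c) (toℕ y) q) (cong (λ z → (z * (toℕ y % q)) % q) z0)) ⟩
      fin 0 ≡⟨ R.⊕-inverseˡ y ⟨
      R.neg y R.⊕ y ∎)
    where
    open ≡-Reasoning
    z0 : suc c % q ≡ 0
    z0 = trans (%-distribˡ-+ 1 c q) (trans (cong (λ z → (1 % q + z) % q) e) (trans (add-mod 1 (q ∸ 1) q) (trans (cong (_% q) (suc-pred q)) (n%n≡0 q))))

  SF? : ∀ A → Dec (SF A)
  SF? A = all? λ x → all? λ y → (A x ≟ᵇ true) →-dec ((A y ≟ᵇ true) →-dec ¬? (A (x ⊕ y) ≟ᵇ true))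

  opaque
    isMax : Subset n → Bool
    isMax v = ⌊ SF? (lookup v) ×-dec (# (lookup v) ≟ N) ⌋

    isMax-true : ∀ v → isMax v ≡ true → SF (lookup v) × # (lookup v) ≡ N
    isMax-true v p = ⌊⌋-true {d = SF? (lookup v) ×-dec (# (lookup v) ≟ N)} p

    isMax-intro : ∀ v → SF (lookup v) → # (lookup v) ≡ N → isMax v ≡ true
    isMax-intro v a b = ⌊⌋-intro {d = SF? (lookup v) ×-dec (# (lookup v) ≟ N)} (a , b)

  isMax-tabulate : ∀ A → SF A → # A ≡ N → isMax (tabulate A) ≡ true
  isMax-tabulate A sf e = isMax-intro (tabulate A)
    (λ x y p r s → sf x y (trans (sym (lookup∘tabulate A x)) p) (trans (sym (lookup∘tabulate A y)) r) (trans (sym (lookup∘tabulate A (x ⊕ y))) s))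
    (trans (#-cong (lookup∘tabulate A)) e)

  #max : ℕ
  #max = ∑S n (λ v → ⟦ isMax v ⟧)

  good : Vec (Fin q) n → Bool
  good χ = isHom χ ∧ not (isZero χ)

  good-unit : ∀ χ → good χ ≡ true → Hom χ × ∃[ g ] lookup χ g ≡ fin 1
  good-unit χ p = isHom-true χ (proj₁ (∧-true {isHom χ} p)) , nonzero-hom χ (isHom-true χ (proj₁ (∧-true {isHom χ} p))) (not-true (proj₂ (∧-true {isHom χ} p)))

  1≢0 : fin 1 ≢ fin 0
  1≢0 e = 1+n≢0 (trans (sym (m<n⇒m%n≡m q≥2)) (trans (sym (toℕ-fin 1)) (trans (cong toℕ e) (trans (toℕ-fin 0) (n∣m⇒m%n≡0 0 q (q ∣0))))))

  good-intro : ∀ χ g → Hom χ → lookup χ g ≢ fin 0 → good χ ≡ true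
  good-intro χ g hχ ne = ∧-intro (isHom-intro χ hχ) (not-intro′ λ z → ne (trans (cong (λ v → lookup v g) (sym (eqV-true z))) (lookup∘tabulate _ g)))

  zero-not-max : ∀ χ v → isMax v ≡ true → (∀ x → lookup v x ≡ preimage χ x) → ∃[ g ] lookup χ g ≢ fin 0
  zero-not-max χ v mv e with #-inhab (lookup v) (subst (1 ≤_) (sym (proj₂ (isMax-true v mv))) N≥1)
  ... | g , p = g , λ z → middle-small 0 z≤n (trans (cong middle (sym z)) (trans (sym (e g)) p))

  preimage-max : ∀ χ → good χ ≡ true → isMax (tabulate (preimage χ)) ≡ true
  preimage-max χ p = isMax-tabulate (preimage χ) (preimage-SF χ (proj₁ u)) (preimage-size χ (proj₁ u) (proj₁ (proj₂ u)) (proj₂ (proj₂ u)))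
    where
    u : Hom χ × ∃[ g ] lookup χ g ≡ fin 1
    u = good-unit χ p

  negate : Vec (Fin q) n → Vec (Fin q) n
  negate χ = tabulate (λ x → R.neg (lookup χ x))

  negate-hom : ∀ χ → Hom χ → Hom (negate χ)
  negate-hom χ hχ x y = trans (lookup∘tabulate _ (x ⊕ y)) (trans (cong R.neg (hχ x y)) (trans (R.gsolve (R.:- (R.v0 R.:+ R.v1)) (R.:- R.v0 R.:+ R.:- R.v1) refl (lookup χ x ∷ lookup χ y ∷ []))
    (cong₂ _⊞q_ (sym (lookup∘tabulate _ x)) (sym (lookup∘tabulate _ y)))))

  lookup-ext : ∀ {A : Set} {m} (v w : Vec A m) → (∀ x → lookup v x ≡ lookup w x) → v ≡ w
  lookup-ext v w h = trans (sym (tabulate∘lookup v)) (trans (tabulate-cong h) (tabulate∘lookup w))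

  tabulate-ext : ∀ {m} (A : Pr m) (v : Subset m) → (∀ x → lookup v x ≡ A x) → tabulate A ≡ v
  tabulate-ext A v h = lookup-ext (tabulate A) v (λ x → trans (lookup∘tabulate A x) (sym (h x)))

  fibre : Subset n → Vec (Fin q) n → Bool
  fibre v χ = good χ ∧ eqS (tabulate (preimage χ)) v

  fibre-true : ∀ v χ → fibre v χ ≡ true → good χ ≡ true × (∀ x → lookup v x ≡ preimage χ x)
  fibre-true v χ p = proj₁ (∧-true {good χ} p) , λ x → trans (cong (λ w → lookup w x) (sym (eqS-true (proj₂ (∧-true {good χ} p))))) (lookup∘tabulate (preimage χ) x)

  fibre-intro : ∀ v χ → isMax v ≡ true → Hom χ → (∀ x → lookup v x ≡ preimage χ x) → fibre v χ ≡ true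
  fibre-intro v χ mv hχ e = ∧-intro (good-intro χ (proj₁ (zero-not-max χ v mv e)) hχ (proj₂ (zero-not-max χ v mv e))) (eqS-intro (tabulate-ext (preimage χ) v e))

  same-fibre : ∀ v χ ψ → fibre v χ ≡ true → fibre v ψ ≡ true → ∃[ c ] ((∀ x → lookup ψ x ≡ c R.· lookup χ x) × (∀ y → middle y ≡ middle (c R.· y)))
  same-fibre v χ ψ p r = proportional χ ψ (proj₁ u) (proj₁ w) _ _ (proj₂ (proj₂ u)) (proj₂ (proj₂ w)) (λ x → trans (sym (proj₂ (fibre-true v χ p) x)) (proj₂ (fibre-true v ψ r) x))
    where
    u : Hom χ × ∃[ g ] lookup χ g ≡ fin 1
    u = good-unit χ (proj₁ (fibre-true v χ p))
    w : Hom ψ × ∃[ g ] lookup ψ g ≡ fin 1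
    w = good-unit ψ (proj₁ (fibre-true v ψ r))

  -- The fibre over a maximum sum-free set is {χ , -χ}, a single point if q = 2.
  multiplicity : ℕ
  multiplicity = if 1 ≤b k then 2 else 1

  fibre-size : ∀ v → isMax v ≡ true → ∑V n (λ χ → ⟦ fibre v χ ⟧) ≡ multiplicity
  fibre-size v mv = go (realise (lookup v) (proj₁ (isMax-true v mv)) (proj₂ (isMax-true v mv)))
    where
    go : ∃[ ψ ] (Hom ψ × (∀ x → lookup v x ≡ preimage ψ x)) → ∑V n (λ χ → ⟦ fibre v χ ⟧) ≡ multiplicity
    go (χ₀ , hχ₀ , e₀) with bool-cases (1 ≤b k)
    ... | inj₂ k0 = trans (∑V-cong n (λ χ → cong ⟦_⟧ (bool-ext (λ p → eqV-intro (sym (lookup-ext χ χ₀ (λ x → one χ p x)))) (λ p → trans (cong (fibre v) (sym (eqV-true p))) f₀)))) (trans (∑V-δ χ₀) (cong (λ b → if b then 2 else 1) (sym k0)))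
      where
      f₀ : fibre v χ₀ ≡ true
      f₀ = fibre-intro v χ₀ mv hχ₀ e₀
      k≡0 : k ≡ 0
      k≡0 = n<1⇒n≡0 (≰⇒> (λ le → absurd-b (≤b-intro le) k0))
      q≡2 : q ≡ 2
      q≡2 = trans q≡ (cong (λ z → 3 * z + 2) k≡0)
      one : ∀ χ → fibre v χ ≡ true → ∀ x → lookup χ x ≡ lookup χ₀ x
      one χ p x = trans (proj₁ (proj₂ sf) x) (mult-one c _ (r1 (c % q) refl (subst (c % q <_) q≡2 (m%n<n c q))))
        where
        sf : ∃[ c ] ((∀ x → lookup χ x ≡ c R.· lookup χ₀ x) × (∀ y → middle y ≡ middle (c R.· y)))
        sf = same-fibre v χ₀ χ f₀ p
        c : ℕ
        c = proj₁ sf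
        mid1 : middle ∋∋ fin 1
        mid1 = middle-intro 1 (≤-reflexive (cong suc k≡0)) (≤-reflexive (cong (λ z → suc z + suc z) (sym k≡0)))
        r1 : ∀ r → c % q ≡ r → r < 2 → c % q ≡ 1
        r1 0 e _ = ⊥-elim (middle-small 0 z≤n (trans (cong middle (sym (trans (R.·-fin c 1) (fin-cong (trans (cong (_% q) (*-identityʳ c)) (trans e (sym (n∣m⇒m%n≡0 0 q (q ∣0))))))))) (trans (sym (proj₂ (proj₂ sf) (fin 1))) mid1)))
        r1 1 e _ = e
        r1 (suc (suc r)) e (s≤s (s≤s ()))
    ... | inj₁ k1 = trans (∑V-cong n (λ χ → pt χ)) (trans (∑V-+ n _ _) (trans (cong₂ _+_ (∑V-δ χ₀) (∑V-δ (negate χ₀))) (cong (λ b → if b then 2 else 1) (sym k1))))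
      where
      f₀ : fibre v χ₀ ≡ true
      f₀ = fibre-intro v χ₀ mv hχ₀ e₀
      f₁ : fibre v (negate χ₀) ≡ true
      f₁ = fibre-intro v (negate χ₀) mv (negate-hom χ₀ hχ₀) (λ x → trans (e₀ x) (trans (sym (middle-neg (lookup χ₀ x))) (cong middle (sym (lookup∘tabulate _ x)))))
      k≥1 : 1 ≤ k
      k≥1 = ≤b-true k1
      u : Hom χ₀ × ∃[ g ] lookup χ₀ g ≡ fin 1
      u = good-unit χ₀ (proj₁ (fibre-true v χ₀ f₀))
      q>2 : 2 < q
      q>2 = subst (2 <_) (sym q≡) (m<n+m 2 (*-mono-≤ (s≤s (z≤n {2})) k≥1))
      distinct : negate χ₀ ≢ χ₀
      distinct e = 1+n≢0 (trans (sym (m<n⇒m%n≡m q>2)) (trans (sym (toℕ-fin 2)) (trans (cong toℕ 2≡0) (trans (toℕ-fin 0) (n∣m⇒m%n≡0 0 q (q ∣0))))))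
        where
        g : Fin n
        g = proj₁ (proj₂ u)
        neg1 : R.neg (fin 1) ≡ fin 1
        neg1 = trans (cong R.neg (sym (proj₂ (proj₂ u)))) (trans (sym (lookup∘tabulate _ g)) (trans (cong (λ w → lookup w g) e) (proj₂ (proj₂ u))))
        2≡0 : fin 2 ≡ fin 0
        2≡0 = trans (sym (fin-+ 1 1)) (trans (cong (_⊞q fin 1) (sym neg1)) (R.⊕-inverseˡ (fin 1)))
      two : ∀ χ → fibre v χ ≡ true → χ₀ ≡ χ ⊎ negate χ₀ ≡ χ
      two χ p = [ (λ e → inj₁ (lookup-ext χ₀ χ (λ x → sym (trans (proj₁ (proj₂ sf) x) (mult-one c _ e))))) ,
                  (λ e → inj₂ (lookup-ext (negate χ₀) χ (λ x → sym (trans (proj₁ (proj₂ sf) x) (trans (mult-minus-one c _ e) (sym (lookup∘tabulate _ x))))))) ]′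
                (middle-multiplier k≥1 c (proj₂ (proj₂ sf)))
        where
        sf : ∃[ c ] ((∀ x → lookup χ x ≡ c R.· lookup χ₀ x) × (∀ y → middle y ≡ middle (c R.· y)))
        sf = same-fibre v χ₀ χ f₀ p
        c : ℕ
        c = proj₁ sf
      pt : ∀ χ → ⟦ fibre v χ ⟧ ≡ ⟦ eqV χ₀ χ ⟧ + ⟦ eqV (negate χ₀) χ ⟧
      pt χ with bool-cases (eqV χ₀ χ) | bool-cases (eqV (negate χ₀) χ)
      ... | inj₁ a | inj₁ b = ⊥-elim (distinct (trans (eqV-true b) (sym (eqV-true a))))
      ... | inj₁ a | inj₂ b = trans (cong ⟦_⟧ (trans (cong (fibre v) (sym (eqV-true a))) f₀)) (sym (cong₂ (λ x y → ⟦ x ⟧ + ⟦ y ⟧) a b))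
      ... | inj₂ a | inj₁ b = trans (cong ⟦_⟧ (trans (cong (fibre v) (sym (eqV-true b))) f₁)) (sym (cong₂ (λ x y → ⟦ x ⟧ + ⟦ y ⟧) a b))
      ... | inj₂ a | inj₂ b = trans (cong ⟦_⟧ (¬true (λ p → [ (λ e → absurd-b (eqV-intro e) a) , (λ e → absurd-b (eqV-intro e) b) ]′ (two χ p)))) (sym (cong₂ (λ x y → ⟦ x ⟧ + ⟦ y ⟧) a b))

  ⟦∧⟧ : ∀ a b → ⟦ a ∧ b ⟧ ≡ ⟦ a ⟧ * ⟦ b ⟧
  ⟦∧⟧ true b = sym (+-identityʳ _)
  ⟦∧⟧ false b = refl

  -- The nonzero homomorphisms are sorted by the maximum sum-free set that they define; `fibre-size`
  -- says how many share one.
  good-count : ∑V n (λ χ → ⟦ good χ ⟧) ≡ multiplicity * #max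
  good-count = begin
    ∑V n (λ χ → ⟦ good χ ⟧) ≡⟨ ∑V-cong n (λ χ → sym (pt χ (bool-cases (good χ)))) ⟩
    ∑V n (λ χ → ∑S n (λ v → ⟦ isMax v ⟧ * ⟦ fibre v χ ⟧)) ≡⟨ ∑V-ΣL n (allSubsets n) (λ χ v → ⟦ isMax v ⟧ * ⟦ fibre v χ ⟧) ⟩
    ∑S n (λ v → ∑V n (λ χ → ⟦ isMax v ⟧ * ⟦ fibre v χ ⟧)) ≡⟨ ΣL-cong (allSubsets n) (λ v → trans (∑V-* n ⟦ isMax v ⟧ _) (size v (bool-cases (isMax v)))) ⟩
    ∑S n (λ v → multiplicity * ⟦ isMax v ⟧) ≡⟨ ΣL-* (allSubsets n) multiplicity _ ⟩
    multiplicity * #max ∎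
    where
    open ≡-Reasoning
    size : ∀ v → isMax v ≡ true ⊎ isMax v ≡ false → ⟦ isMax v ⟧ * ∑V n (λ χ → ⟦ fibre v χ ⟧) ≡ multiplicity * ⟦ isMax v ⟧
    size v (inj₁ p) = trans (cong₂ (λ b z → ⟦ b ⟧ * z) p (fibre-size v p)) (trans (*-comm 1 multiplicity) (cong (λ b → multiplicity * ⟦ b ⟧) (sym p)))
    size v (inj₂ p) = trans (cong (λ b → ⟦ b ⟧ * ∑V n (λ χ → ⟦ fibre v χ ⟧)) p) (trans (sym (*-zeroʳ multiplicity)) (cong (λ b → multiplicity * ⟦ b ⟧) (sym p)))
    pt : ∀ χ → good χ ≡ true ⊎ good χ ≡ false → ∑S n (λ v → ⟦ isMax v ⟧ * ⟦ fibre v χ ⟧) ≡ ⟦ good χ ⟧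
    pt χ (inj₁ p) = trans (ΣL-cong (allSubsets n) (λ v → trans (*-comm ⟦ isMax v ⟧ _) (cong (λ b → ⟦ b ∧ eqS (tabulate (preimage χ)) v ⟧ * ⟦ isMax v ⟧) p)))
      (trans (∑S-δ (tabulate (preimage χ)) (λ v → ⟦ isMax v ⟧)) (cong ⟦_⟧ (trans (preimage-max χ p) (sym p))))
    pt χ (inj₂ p) = trans (ΣL-zero (allSubsets n) (λ v → trans (cong (λ b → ⟦ isMax v ⟧ * ⟦ b ∧ eqS (tabulate (preimage χ)) v ⟧) p) (*-zeroʳ ⟦ isMax v ⟧))) (sym (cong ⟦_⟧ p))

  order-q : Pr n
  order-q x = torsion x ∧ not (𝟘 == x)

  torsion-split : # order-q + 1 ≡ # torsion
  torsion-split = trans (+-comm (# order-q) 1) (trans (cong (_+ # order-q) (trans (sym (#-singleton 𝟘)) (#-cong (λ x → bool-ext (λ p → ∧-intro (trans (cong torsion (sym (⌊⌋-true p))) t0) p) (λ p → proj₂ (∧-true {torsion x} p))))))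
    (#-split torsion (𝟘 ==_)))
    where
    t0 : torsion ∋∋ 𝟘
    t0 = ⌊⌋-intro (·-𝟘 q)

  -- Homomorphisms and q-torsion elements are equally many, both being n/|qG|; the zero of each is
  -- left out.
  max-count : # order-q ≡ multiplicity * #max
  max-count = +-cancelʳ-≡ 1 _ _ (trans torsion-split (trans (sym #Hom≡#torsion) (trans (sym nonzero-count) (cong (_+ 1) (trans (∑V-cong n (λ χ → sym (⟦∧⟧ (isHom χ) (not (isZero χ))))) good-count)))))

  -- By Cauchy's theorem the q-torsion is not trivial, so qG is proper and a nonzero homomorphism
  -- exists.
  max-exists : ∃[ B ] (SF B × # B ≡ N)
  max-exists = go (cauchy q pr (divides h (trans n≡ (*-comm q h))))
    where
    go : ∃[ g ] (g ≢ 𝟘 × q · g ≡ 𝟘) → ∃[ B ] (SF B × # B ≡ N)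
    go (g , g≢0 , qg) = preimage (proj₁ s) , preimage-SF (proj₁ s) (proj₁ (proj₂ s)) , preimage-size (proj₁ s) (proj₁ (proj₂ s)) x (proj₁ (proj₂ (proj₂ s)))
      where
      torsion≥2 : 2 ≤ # torsion
      torsion≥2 = subst (2 ≤_) (trans (+-comm 1 _) torsion-split) (s≤s (#>0 order-q g (∧-intro {torsion g} (⌊⌋-intro qg) (not-intro′ {𝟘 == g} λ p → g≢0 (sym (⌊⌋-true p))))))
      qG-proper : # qG < n
      qG-proper = subst (# qG <_) qG-torsion (<-≤-trans (m<m+n (# qG) (≤-trans (#>0 qG 𝟘 (IsSub.has-𝟘 qG-sub)) (≤-reflexive (sym (+-identityʳ _))))) (≤-trans (*-monoˡ-≤ (# qG) torsion≥2) (≤-reflexive (*-comm (# torsion) (# qG)))))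
      out : ∃[ x ] ∁ qG ∋∋ x
      out = #-inhab (∁ qG) (+-cancelˡ-≤ (# qG) 1 _ (≤-trans (≤-reflexive (+-comm (# qG) 1)) (≤-trans qG-proper (≤-reflexive (sym (#-∁ qG))))))
      x : Fin n
      x = proj₁ out
      s : ∃[ χ ] (Hom χ × lookup χ x ≡ fin 1 × (∀ y → qG ∋∋ y → lookup χ y ≡ fin 0))
      s = separate qG qG-sub (λ _ p → p) x (λ p → absurd-b p (not-true (proj₂ out)))

  -- Sets close to a maximum sum-free set

  module Near (m b : ℕ) (m≥1 : 1 ≤ m) (b≥1 : 1 ≤ b) (N≡ : suc k * h ≡ m + b) where
    open Weights m b

    -- Q/P = 1 - p²/24 with p = m/N is the factor per arc from `indep-mass`, and `X` is the binomial
    -- coefficient with the loss of `mode-bound`.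
    P Q X : ℕ
    P = 24 * ((m + b) * (m + b))
    Q = P ∸ m * m
    X = suc N * (N C m)

    s≥1 : 1 ≤ m + b
    s≥1 = ≤-trans m≥1 (m≤m+n m b)

    Q≡ : Q + m * m ≡ P
    Q≡ = m∸n+n≡m (≤-trans (*-mono-≤ (m≤m+n m b) (m≤m+n m b)) (m≤m+n _ _))

    module _ (B : Pr n) (st : MaxStr N h B) (S : Pr n) (S⊑ : S ⊑ ∁ B) (S0 : ¬ (S ∋∋ 𝟘)) where
      open MaxStr st using (size)

      cayley : Fin n → Pr n
      cayley x y = S (y ⊖ x) ∨ S (x ⊖ y)

      cayley-degree : ∀ x → # (cayley x) ≤ 2 * # S
      cayley-degree x = begin
        # (cayley x) ≤⟨ ≤-trans (m≤m+n _ _) (≤-reflexive (#-∪∩ (τ x S) (λ y → S (x ⊖ y)))) ⟩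
        # (τ x S) + # (λ y → S (x ⊖ y)) ≡⟨ cong₂ _+_ (#-τ x S) (#-reflect S x) ⟩
        # S + # S ≡⟨ cong (# S +_) (+-identityʳ (# S)) ⟨
        2 * # S ∎
        where open ≤-Reasoning

      -- Each s in `S` contributes the pairs (x, x + s) of `many-differences`, and different s give
      -- different arcs.
      cayley-arcs : # S * h ≤ arcs cayley B
      cayley-arcs = begin
        # S * h ≡⟨ *-comm (# S) h ⟩
        h * # S ≡⟨ sum-*ˡ h (λ s → ⟦ S s ⟧) ⟨
        sum (λ s → h * ⟦ S s ⟧) ≤⟨ sum-mono (λ s → perS s (bool-cases (S s))) ⟩
        sum (λ s → sum (λ x → ⟦ B x ⟧ * ⟦ B (s ⊕ x) ∧ S s ⟧)) ≡⟨ ∑-comm (λ s x → ⟦ B x ⟧ * ⟦ B (s ⊕ x) ∧ S s ⟧) ⟩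
        sum (λ x → sum (λ s → ⟦ B x ⟧ * ⟦ B (s ⊕ x) ∧ S s ⟧)) ≤⟨ sum-mono (λ x → ≤-trans (≤-reflexive (sum-*ˡ ⟦ B x ⟧ _)) (*-monoʳ-≤ ⟦ B x ⟧ (perX x))) ⟩
        arcs cayley B ∎
        where
        open ≤-Reasoning
        perS : ∀ s → S s ≡ true ⊎ S s ≡ false → h * ⟦ S s ⟧ ≤ sum (λ x → ⟦ B x ⟧ * ⟦ B (s ⊕ x) ∧ S s ⟧)
        perS s (inj₂ e) = ≤-trans (≤-reflexive (trans (cong (λ t → h * ⟦ t ⟧) e) (*-zeroʳ h))) z≤n
        perS s (inj₁ e) = ≤-trans (≤-reflexive (trans (cong (λ t → h * ⟦ t ⟧) e) (*-identityʳ h))) (≤-trans (many-differences B st s (λ Bs → absurd-b Bs (not-true (S⊑ s e))))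
          (≤-reflexive (sum-cong-≗ (λ x → trans (⟦∧⟧ (B x) (B (x ⊕ s))) (cong (λ t → ⟦ B x ⟧ * ⟦ t ⟧) (trans (cong B (⊕-comm x s)) (trans (sym (∧-identityʳ _)) (cong (B (s ⊕ x) ∧_) (sym e)))))))))
        perX : ∀ x → sum (λ s → ⟦ B (s ⊕ x) ∧ S s ⟧) ≤ # (B ∩ cayley x)
        perX x = ≤-trans (≤-reflexive (trans (sum-cong-≗ (λ s → cong (λ z → ⟦ B (s ⊕ x) ∧ S z ⟧) (sym (⊕⊖ s x)))) (sum-shift (λ y → ⟦ B y ∧ S (y ⊖ x) ⟧) x)))
          (#-mono {A = λ y → B y ∧ S (y ⊖ x)} {B ∩ cayley x} (λ y p → ∧-intro (proj₁ (∧-true {B y} p)) (∨-introˡ (proj₂ (∧-true {B y} p)))))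

      -- Each set counted weighs m^j b^(n - j), so the weight of independent sets bounds their
      -- number, and `mode-bound` replaces (m + b)^N by `X` m^m b^b. The k elements that a set lacks
      -- from size m account for the factor (m/b)^k.
      free-count : ∀ j k → k + j ≡ m → m * suc (2 * # S) ≤ 3 * (m + b) → (Φ : Subset n → Bool) →
        (∀ v → Φ v ≡ true → lookup v ⊑ B × ∣ v ∣ ≡ j × (∀ x s → lookup v ∋∋ x → S ∋∋ s → ¬ (lookup v ∋∋ x ⊕ s))) →
        ∑S n (λ v → ⟦ Φ v ⟧) * b ^ k * P ^ (# S * h) ≤ X * m ^ k * Q ^ (# S * h)
      free-count j k kj mD Φ Φ-spec = *-cancelʳ-≤ _ _ (m ^ j * (b ^ b * b ^ c)) {{>-nonZero (*-mono-≤ (^-pos m j m≥1) (*-mono-≤ (^-pos b b b≥1) (^-pos b c b≥1)))}} (begin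
        #Φ * b ^ k * P ^ e * (m ^ j * (b ^ b * b ^ c)) ≡⟨ l₁ #Φ (b ^ k) (P ^ e) (m ^ j) (b ^ b) (b ^ c) ⟩
        m ^ j * (b ^ k * (b ^ b * b ^ c)) * #Φ * P ^ e ≡⟨ cong (λ z → m ^ j * z * #Φ * P ^ e) (trans (cong (b ^ k *_) (sym (^-distribˡ-+-* b b c))) (trans (sym (^-distribˡ-+-* b k (b + c))) (cong (b ^_) (sym n∸j)))) ⟩
        m ^ j * b ^ (n ∸ j) * #Φ * P ^ e ≡⟨ cong (_* P ^ e) (trans (sym (ΣL-* (allSubsets n) (m ^ j * b ^ (n ∸ j)) _)) (ΣL-cong (allSubsets n) (λ v → wt v (bool-cases (Φ v))))) ⟩
        ∑S n (λ v → ⟦ Φ v ⟧ * weight v) * P ^ e ≤⟨ *-monoˡ-≤ (P ^ e) (indep-bounds cayley B Φ (λ v p → proj₁ (Φ-spec v p)) indep-spec) ⟩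
        indep cayley B * P ^ e ≡⟨ cong (λ z → indep cayley B * z ^ e) Q≡ ⟨
        indep cayley B * (Q + m * m) ^ e ≤⟨ IB.indep-mass-weak cayley B e (λ x y → ∨-comm (S (y ⊖ x)) _) irr (λ x → s≤s (cayley-degree x)) cayley-arcs ⟩
        mass B * Q ^ e ≡⟨ cong (_* Q ^ e) (trans (mass-size B) (cong (λ u → (m + b) ^ u * b ^ c) (trans size N≡))) ⟩
        (m + b) ^ (m + b) * b ^ c * Q ^ e ≤⟨ *-monoˡ-≤ (Q ^ e) (*-monoˡ-≤ (b ^ c) (mode-bound m b)) ⟩
        suc (m + b) * (((m + b) C m) * (m ^ m * b ^ b)) * b ^ c * Q ^ e ≡⟨ cong₂ (λ u w → suc u * ((u C m) * (w * b ^ b)) * b ^ c * Q ^ e) (sym N≡) (trans (cong (m ^_) (sym kj)) (^-distribˡ-+-* m k j)) ⟩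
        suc N * ((N C m) * (m ^ k * m ^ j * b ^ b)) * b ^ c * Q ^ e ≡⟨ l₂ (suc N) (N C m) (m ^ k) (m ^ j) (b ^ b) (b ^ c) (Q ^ e) ⟩
        X * m ^ k * Q ^ e * (m ^ j * (b ^ b * b ^ c)) ∎)
        where
        open ≤-Reasoning
        module IB = IndepBound m b Q (suc (2 * # S)) s≥1 Q≡ mD
        #Φ = ∑S n (λ v → ⟦ Φ v ⟧)
        e = # S * h
        c = # (∁ B)
        n∸j : n ∸ j ≡ k + (b + c)
        n∸j = trans (cong (_∸ j) (trans (sym (#-∁ B)) (trans (cong (_+ c) (trans size (trans N≡ (cong (_+ b) (sym kj))))) (l k j b c)))) (m+n∸m≡n j _)
          where
          l : ∀ k j b c → k + j + b + c ≡ j + (k + (b + c))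
          l = solve-∀
        l₁ : ∀ f bk p mj bb bc → f * bk * p * (mj * (bb * bc)) ≡ mj * (bk * (bb * bc)) * f * p
        l₁ = solve-∀
        l₂ : ∀ sN C mk mj bb bc q → sN * (C * (mk * mj * bb)) * bc * q ≡ sN * C * mk * q * (mj * (bb * bc))
        l₂ = solve-∀
        wt : ∀ v → Φ v ≡ true ⊎ Φ v ≡ false → m ^ j * b ^ (n ∸ j) * ⟦ Φ v ⟧ ≡ ⟦ Φ v ⟧ * weight v
        wt v (inj₁ p) = trans (*-comm _ ⟦ Φ v ⟧) (cong (⟦ Φ v ⟧ *_) (trans (cong (λ z → m ^ z * b ^ (n ∸ z)) (sym (proj₁ (proj₂ (Φ-spec v p))))) (sym (weight-size v))))
        wt v (inj₂ p) = trans (cong (λ t → m ^ j * b ^ (n ∸ j) * ⟦ t ⟧) p) (trans (*-zeroʳ (m ^ j * b ^ (n ∸ j))) (cong (λ t → ⟦ t ⟧ * weight v) (sym p)))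
        indep-spec : ∀ v → Φ v ≡ true → ∀ x y → lookup v ∋∋ x → lookup v ∋∋ y → ¬ (cayley x ∋∋ y)
        indep-spec v p x y vx vy r = [ (λ s → proj₂ (proj₂ (Φ-spec v p)) x (y ⊖ x) vx s (trans (cong (lookup v) (⊕⊖′ x y)) vy)) ,
          (λ s → proj₂ (proj₂ (Φ-spec v p)) y (x ⊖ y) vy s (trans (cong (lookup v) (⊕⊖′ y x)) vx)) ]′ (∨-true {S (y ⊖ x)} r)
        irr : ∀ x → cayley x x ≡ false
        irr x = ¬true (λ r → S0 (trans (cong S (sym (x⊖x x))) ([ id , id ]′ (∨-true {S (x ⊖ x)} r))))

    -- Cancelling the factor Q^e after a gain u Q^e ≤ P^e.
    gain : ∀ f c x e u → 1 ≤ c → u * Q ^ e ≤ P ^ e → f * c * P ^ e ≤ x * Q ^ e → f * c * u ≤ x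
    gain f c x e u c≥1 g h₁ = *-cancelʳ-≤ _ _ (Q ^ e) {{>-nonZero (^-pos Q e Q≥1)}} (begin
      f * c * u * Q ^ e ≡⟨ *-assoc (f * c) u _ ⟩
      f * c * (u * Q ^ e) ≤⟨ *-monoʳ-≤ (f * c) g ⟩
      f * c * P ^ e ≤⟨ h₁ ⟩
      x * Q ^ e ∎)
      where
      open ≤-Reasoning
      Q≥1 : 1 ≤ Q
      Q≥1 = IndepBound.Q≥1 m b Q 0 s≥1 Q≡ (≤-trans (≤-reflexive (*-zeroʳ m)) z≤n)

    gain-power : ∀ u k → u * Q ^ h ≤ P ^ h → u ^ k * Q ^ (k * h) ≤ P ^ (k * h)
    gain-power u k g = begin
      u ^ k * Q ^ (k * h) ≡⟨ cong (λ z → u ^ k * Q ^ z) (*-comm k h) ⟩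
      u ^ k * Q ^ (h * k) ≡⟨ cong (u ^ k *_) (^-*-assoc Q h k) ⟨
      u ^ k * (Q ^ h) ^ k ≡⟨ ^-distrib-* u (Q ^ h) k ⟨
      (u * Q ^ h) ^ k ≤⟨ ^-monoˡ k g ⟩
      (P ^ h) ^ k ≡⟨ ^-*-assoc P h k ⟩
      P ^ (h * k) ≡⟨ cong (P ^_) (*-comm h k) ⟩
      P ^ (k * h) ∎
      where open ≤-Reasoning

    module _ (B : Pr n) (st : MaxStr N h B) (t D : ℕ) (mD : m * suc (2 * D) ≤ 3 * (m + b)) (Ψ : Subset n → Bool)
        (Ψ-spec : ∀ v → Ψ v ≡ true → SF (lookup v) × ∣ v ∣ ≡ m × 1 ≤ # (lookup v ∩ ∁ B) × # (lookup v ∩ ∁ B) ≤ t) where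

      fibre-count : Subset n → ℕ
      fibre-count v = ∑S n (λ w → ⟦ subb w B ⟧ * ⟦ Ψ (v ∪ᵥ w) ⟧)

      private
        Φ : Subset n → Subset n → Bool
        Φ v w = subb w B ∧ Ψ (v ∪ᵥ w)

      outer-part : ∀ v w → subb v (∁ B) ≡ true → subb w B ≡ true → # (lookup (v ∪ᵥ w) ∩ ∁ B) ≡ ∣ v ∣
      outer-part v w p r = trans (#-cong (λ i → bool-ext (f i) (g i))) (#-lookup v)
        where
        f : ∀ i → lookup (v ∪ᵥ w) i ∧ not (B i) ≡ true → lookup v i ≡ true
        f i x with ∧-true {lookup (v ∪ᵥ w) i} x
        ... | y , z with ∨-true {lookup v i} (trans (sym (lookup-∪ᵥ v w i)) y)
        ... | inj₁ a = a
        ... | inj₂ a = absurd-b (subb-true w B r i a) (not-true z)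
        g : ∀ i → lookup v i ≡ true → lookup (v ∪ᵥ w) i ∧ not (B i) ≡ true
        g i x = ∧-intro (trans (lookup-∪ᵥ v w i) (∨-introˡ x)) (subb-true v (∁ B) p i x)

      fibre-size-range : ∀ v → subb v (∁ B) ≡ true → 1 ≤ fibre-count v → 1 ≤ ∣ v ∣ × ∣ v ∣ ≤ t × ∣ v ∣ ≤ m × ¬ (lookup v ∋∋ 𝟘)
      fibre-size-range v p pos with anySubset? (λ w → Φ v w ≟ᵇ true)
      ... | no ¬w = ⊥-elim (<⇒≱ pos (≤-reflexive (ΣL-zero (allSubsets n) (λ w → trans (sym (⟦∧⟧ (subb w B) (Ψ (v ∪ᵥ w)))) (cong ⟦_⟧ (¬true (λ r → ¬w (w , r))))))))
      ... | yes (w , r) with ∧-true {subb w B} r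
      ... | wB , Ψw with Ψ-spec (v ∪ᵥ w) Ψw
      ... | sf , sz , lo , hi = subst (1 ≤_) (outer-part v w p wB) lo , subst (_≤ t) (outer-part v w p wB) hi ,
            ≤-trans (m≤m+n ∣ v ∣ ∣ w ∣) (≤-reflexive (trans (sym (∪ᵥ-size B v w (subb-true v (∁ B) p) (subb-true w B wB))) sz)) ,
            λ z → sf 𝟘 𝟘 (up z) (up z) (trans (cong (lookup (v ∪ᵥ w)) (⊕𝟘 𝟘)) (up z))
        where
        up : lookup v ∋∋ 𝟘 → lookup (v ∪ᵥ w) ∋∋ 𝟘
        up z = trans (lookup-∪ᵥ v w 𝟘) (∨-introˡ z)

      -- Only a part `w` of the outer set serves as generators, which keeps the degree bound valid
      -- however large `v` is.
      fibre-bound : ∀ v → subb v (∁ B) ≡ true → ∣ v ∣ ≤ m → ¬ (lookup v ∋∋ 𝟘) → ∀ w → lookup w ⊑ lookup v → ∣ w ∣ ≤ D →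
        fibre-count v * b ^ ∣ v ∣ * P ^ (∣ w ∣ * h) ≤ X * m ^ ∣ v ∣ * Q ^ (∣ w ∣ * h)
      fibre-bound v p v≤m v∌0 w w⊑v w≤D = subst₂ (λ f e → f * b ^ ∣ v ∣ * P ^ (e * h) ≤ X * m ^ ∣ v ∣ * Q ^ (e * h)) (ΣL-cong (allSubsets n) (λ u → ⟦∧⟧ (subb u B) (Ψ (v ∪ᵥ u)))) (#-lookup w)
        (free-count B st (lookup w) (λ i x → subb-true v (∁ B) p i (w⊑v i x)) (λ z → v∌0 (w⊑v 𝟘 z)) (m ∸ ∣ v ∣) ∣ v ∣ (m+[n∸m]≡n v≤m)
          (≤-trans (*-monoʳ-≤ m (s≤s (*-monoʳ-≤ 2 (subst (_≤ D) (sym (#-lookup w)) w≤D)))) mD) (Φ v) spec)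
        where
        spec : ∀ u → Φ v u ≡ true → lookup u ⊑ B × ∣ u ∣ ≡ m ∸ ∣ v ∣ × (∀ x s → lookup u ∋∋ x → lookup w ∋∋ s → ¬ (lookup u ∋∋ x ⊕ s))
        spec u r with ∧-true {subb u B} r
        ... | uB , Ψu with Ψ-spec (v ∪ᵥ u) Ψu
        ... | sf , sz , _ , _ = subb-true u B uB , sym (m+n≡k⇒ (trans (sym (∪ᵥ-size B v u (subb-true v (∁ B) p) (subb-true u B uB))) sz)) ,
            λ x s ux ws uxs → sf x s (right x ux) (trans (lookup-∪ᵥ v u s) (∨-introˡ (w⊑v s ws))) (right (x ⊕ s) uxs)
          where
          right : ∀ x → lookup u ∋∋ x → lookup (v ∪ᵥ u) ∋∋ x
          right x ux = trans (lookup-∪ᵥ v u x) (∨-introʳ {lookup v x} ux)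
          m+n≡k⇒ : ∀ {a c d} → a + c ≡ d → d ∸ a ≡ c
          m+n≡k⇒ {a} {c} refl = m+n∸m≡n a c

      total-split : ∑S n (λ v → ⟦ Ψ v ⟧) ≡ ∑S n (λ v → ⟦ subb v (∁ B) ⟧ * fibre-count v)
      total-split = split-sum B (λ v → ⟦ Ψ v ⟧)

      -- Up to D outer elements, all of them can be generators and the saving is 2^(e|v|). Beyond D,
      -- only D of them are used; the saving 2^j is then fixed and has to pay for the choice of up
      -- to t outer elements.
      small-part large-part : Subset n → ℕ
      small-part v = if ∣ v ∣ ≤b D then ⟦ subb v (∁ B) ⟧ * fibre-count v else 0
      large-part v = if ∣ v ∣ ≤b D then 0 else ⟦ subb v (∁ B) ⟧ * fibre-count v

      parts : ∑S n (λ v → ⟦ Ψ v ⟧) ≡ ∑S n small-part + ∑S n large-part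
      parts = trans total-split (trans (ΣL-cong (allSubsets n) (λ v → pt (∣ v ∣ ≤b D))) (ΣL-+ (allSubsets n) small-part large-part))
        where
        pt : ∀ {z} t → z ≡ (if t then z else 0) + (if t then 0 else z)
        pt true = sym (+-identityʳ _)
        pt false = refl

      module _ (u : ℕ) (g : u * Q ^ h ≤ P ^ h) (n≥2 : 2 ≤ n) (u-large : n ^ 8 ≤ u) (m≤n : m ≤ n) where
        -- The saving u^|v| with u ≥ n⁸ beats (m/b)^|v| ≤ n^|v| and leaves n^(7|v|) ≥ n⁵ (n²)^|v|.
        -- Summed over v, the factors n^(-2|v|) give (1 + 1/n²)^n ≤ 2.
        small-fibre : ∀ v → small-part v * (n ^ 5 * (n * n) ^ n) ≤ X * Weights.weight 1 (n * n) v
        small-fibre v with ∣ v ∣ ≤b D in eD | subb v (∁ B) in p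
        ... | false | _ = z≤n
        ... | true | false = z≤n
        ... | true | true with fibre-count v in eF
        ... | zero = z≤n
        ... | suc f with fibre-size-range v p (subst (1 ≤_) (sym eF) (s≤s z≤n))
        ... | v≥1 , v≤t , v≤m , v∌0 = begin
            (suc f + 0) * (n ^ 5 * (n * n) ^ n) ≡⟨ cong (λ z → z * (n ^ 5 * (n * n) ^ n)) (trans (+-identityʳ (suc f)) (sym eF)) ⟩
            F * (n ^ 5 * (n * n) ^ n) ≡⟨ cong (λ z → F * (n ^ 5 * z)) (trans (cong ((n * n) ^_) (sym (m+[n∸m]≡n v≤n))) (^-distribˡ-+-* (n * n) j (n ∸ j))) ⟩
            F * (n ^ 5 * ((n * n) ^ j * (n * n) ^ (n ∸ j))) ≡⟨ l₁ F (n ^ 5) ((n * n) ^ j) ((n * n) ^ (n ∸ j)) ⟩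
            F * (n ^ 5 * (n * n) ^ j) * (n * n) ^ (n ∸ j) ≤⟨ *-monoˡ-≤ ((n * n) ^ (n ∸ j)) key ⟩
            X * (n * n) ^ (n ∸ j) ≡⟨ cong (X *_) (trans (sym (+-identityʳ _)) (trans (cong (_* (n * n) ^ (n ∸ j)) (sym (^-zeroˡ j))) (sym (Weights.weight-size 1 (n * n) v)))) ⟩
            X * Weights.weight 1 (n * n) v ∎
          where
          open ≤-Reasoning
          F = fibre-count v
          j = ∣ v ∣
          v≤n : j ≤ n
          v≤n = ≤-trans v≤m m≤n
          l₁ : ∀ f a c d → f * (a * (c * d)) ≡ f * (a * c) * d
          l₁ = solve-∀
          g₁ : F * b ^ j * u ^ j ≤ X * m ^ j
          g₁ = gain F (b ^ j) (X * m ^ j) (j * h) (u ^ j) (^-pos b j b≥1) (gain-power u j g) (fibre-bound v p v≤m v∌0 v (λ _ x → x) (≤b-true eD))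
          key : F * (n ^ 5 * (n * n) ^ j) ≤ X
          key = *-cancelʳ-≤ _ _ (n ^ j) {{>-nonZero (^-pos n j n≥1)}} (begin
            F * (n ^ 5 * (n * n) ^ j) * n ^ j ≡⟨ cong (λ z → F * (n ^ 5 * z) * n ^ j) (^-distrib-* n n j) ⟩
            F * (n ^ 5 * (n ^ j * n ^ j)) * n ^ j ≡⟨ *-assoc F _ _ ⟩
            F * (n ^ 5 * (n ^ j * n ^ j) * n ^ j) ≡⟨ cong (F *_) (trans (cong₂ _*_ (trans (cong (n ^ 5 *_) (sym (^-distribˡ-+-* n j j))) (sym (^-distribˡ-+-* n 5 (j + j)))) refl) (sym (^-distribˡ-+-* n (5 + (j + j)) j))) ⟩
            F * n ^ (5 + (j + j) + j) ≤⟨ *-monoʳ-≤ F (^-monoʳ-≤ n {{>-nonZero n≥1}} (≤-trans (+-monoˡ-≤ j (+-monoˡ-≤ (j + j) (≤-trans (≤-reflexive refl) (*-monoʳ-≤ 5 v≥1)))) (≤-reflexive (l₂ j)))) ⟩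
            F * n ^ (8 * j) ≡⟨ cong (F *_) (^-*-assoc n 8 j) ⟨
            F * (n ^ 8) ^ j ≤⟨ *-monoʳ-≤ F (^-monoˡ j u-large) ⟩
            F * u ^ j ≤⟨ *-monoˡ-≤ (u ^ j) (≤-trans (≤-reflexive (sym (*-identityʳ F))) (*-monoʳ-≤ F (^-pos b j b≥1))) ⟩
            F * b ^ j * u ^ j ≤⟨ g₁ ⟩
            X * m ^ j ≤⟨ *-monoʳ-≤ X (^-monoˡ j m≤n) ⟩
            X * n ^ j ∎)
            where
            l₂ : ∀ j → 5 * j + (j + j) + j ≡ 8 * j
            l₂ = solve-∀

        small-total : ∑S n small-part * n ^ 5 ≤ 2 * X
        small-total = *-cancelʳ-≤ _ _ ((n * n) ^ n) {{>-nonZero (^-pos (n * n) n (*-mono-≤ n≥1 n≥1))}} (begin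
          ∑S n small-part * n ^ 5 * (n * n) ^ n ≡⟨ trans (*-assoc (∑S n small-part) _ _) (sym (ΣL-*ʳ (allSubsets n) _ small-part)) ⟩
          ∑S n (λ v → small-part v * (n ^ 5 * (n * n) ^ n)) ≤⟨ ΣL-mono (allSubsets n) small-fibre ⟩
          ∑S n (λ v → X * Weights.weight 1 (n * n) v) ≡⟨ trans (ΣL-* (allSubsets n) X _) (cong (X *_) (total-weight 1 (n * n) n)) ⟩
          X * (1 + n * n) ^ n ≤⟨ *-monoʳ-≤ X (≤-trans (≤-reflexive (cong (_^ n) (+-comm 1 (n * n)))) (double-bound (n * n) 1 n (≤-trans (≤-reflexive (*-comm n 2)) (≤-trans (*-monoˡ-≤ n n≥2) (m≤m+n _ 1))))) ⟩
          X * (2 * (n * n) ^ n) ≡⟨ l X ((n * n) ^ n) ⟩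
          2 * X * (n * n) ^ n ∎)
          where
          open ≤-Reasoning
          l : ∀ x w → x * (2 * w) ≡ 2 * x * w
          l = solve-∀

      module _ (u y j₁ : ℕ) (y≥1 : 1 ≤ y) (g : u * Q ^ (D * h) ≤ P ^ (D * h)) (m≤n : m ≤ n) (m≤yb : m ≤ y * b) (spread : m * n ≤ y * b * j₁) where
        -- The sum of (m/b)^|v| over sets with at most t elements is bounded by y^t times that of
        -- (m/(yb))^|v| over all sets, which is a product.
        large-fibre : ∀ v → large-part v * (u * (y * b) ^ n) ≤ X * y ^ t * Weights.weight m (y * b) v
        large-fibre v with ∣ v ∣ ≤b D in eD | subb v (∁ B) in p
        ... | true | _ = z≤n
        ... | false | false = z≤n
        ... | false | true with fibre-count v in eF
        ... | zero = z≤n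
        ... | suc f with fibre-size-range v p (subst (1 ≤_) (sym eF) (s≤s z≤n))
        ... | v≥1 , v≤t , v≤m , v∌0 = begin
            (suc f + 0) * (u * (y * b) ^ n) ≡⟨ cong (λ z → z * (u * (y * b) ^ n)) (trans (+-identityʳ (suc f)) (sym eF)) ⟩
            F * (u * (y * b) ^ n) ≡⟨ cong (λ z → F * (u * z)) (trans (cong ((y * b) ^_) (sym (m+[n∸m]≡n v≤n))) (trans (^-distribˡ-+-* (y * b) j (n ∸ j)) (cong (_* r) (^-distrib-* y b j)))) ⟩
            F * (u * (y ^ j * b ^ j * r)) ≡⟨ l₁ F u (y ^ j) (b ^ j) r ⟩
            F * b ^ j * u * (y ^ j * r) ≤⟨ *-mono-≤ g₁ (*-monoˡ-≤ r (^-monoʳ-≤ y {{>-nonZero y≥1}} v≤t)) ⟩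
            X * m ^ j * (y ^ t * r) ≡⟨ l₂ X (m ^ j) (y ^ t) r ⟩
            X * y ^ t * (m ^ j * r) ≡⟨ cong (X * y ^ t *_) (Weights.weight-size m (y * b) v) ⟨
            X * y ^ t * Weights.weight m (y * b) v ∎
          where
          open ≤-Reasoning
          F = fibre-count v
          j = ∣ v ∣
          v≤n : j ≤ n
          v≤n = ≤-trans v≤m m≤n
          r = (y * b) ^ (n ∸ j)
          l₁ : ∀ f u a c r → f * (u * (a * c * r)) ≡ f * c * u * (a * r)
          l₁ = solve-∀
          l₂ : ∀ x a c r → x * a * (c * r) ≡ x * c * (a * r)
          l₂ = solve-∀
          D≤v : D ≤ j
          D≤v = <⇒≤ (≰⇒> (λ le → absurd-b (≤b-intro le) eD))
          sub : ∃[ w ] (lookup w ⊑ lookup v × ∣ w ∣ ≡ D)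
          sub = subset-of-size v D D≤v
          g₁ : F * b ^ j * u ≤ X * m ^ j
          g₁ = gain F (b ^ j) (X * m ^ j) (D * h) u (^-pos b j b≥1) g (subst (λ z → F * b ^ j * P ^ (z * h) ≤ X * m ^ j * Q ^ (z * h)) (proj₂ (proj₂ sub))
            (fibre-bound v p v≤m v∌0 (proj₁ sub) (proj₁ (proj₂ sub)) (≤-reflexive (proj₂ (proj₂ sub)))))

        large-total : ∑S n large-part * u ≤ X * y ^ t * 2 ^ (4 * j₁)
        large-total = *-cancelʳ-≤ _ _ ((y * b) ^ n) {{>-nonZero (^-pos (y * b) n (*-mono-≤ y≥1 b≥1))}} (begin
          ∑S n large-part * u * (y * b) ^ n ≡⟨ trans (*-assoc (∑S n large-part) _ _) (sym (ΣL-*ʳ (allSubsets n) _ large-part)) ⟩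
          ∑S n (λ v → large-part v * (u * (y * b) ^ n)) ≤⟨ ΣL-mono (allSubsets n) large-fibre ⟩
          ∑S n (λ v → X * y ^ t * Weights.weight m (y * b) v) ≡⟨ trans (ΣL-* (allSubsets n) (X * y ^ t) _) (cong (X * y ^ t *_) (total-weight m (y * b) n)) ⟩
          X * y ^ t * (m + y * b) ^ n ≤⟨ *-monoʳ-≤ (X * y ^ t) (≤-trans (≤-reflexive (cong (_^ n) (+-comm m (y * b)))) (exp-bound (y * b) m n j₁ m≥1 m≤yb spread)) ⟩
          X * y ^ t * (2 ^ (4 * j₁) * (y * b) ^ n) ≡⟨ *-assoc (X * y ^ t) _ _ ⟨
          X * y ^ t * 2 ^ (4 * j₁) * (y * b) ^ n ∎)
          where open ≤-Reasoning

    -- The case of one generator and of sets entirely inside `B`; applied to sets shared by two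
    -- maximum sum-free sets.
    single-count : ∀ B → MaxStr N h B → ∀ s → ¬ (B ∋∋ s) → s ≢ 𝟘 → ∀ u → u * Q ^ h ≤ P ^ h → (Φ : Subset n → Bool) →
      (∀ v → Φ v ≡ true → lookup v ⊑ B × ∣ v ∣ ≡ m × (∀ x → lookup v ∋∋ x → ¬ (lookup v ∋∋ x ⊕ s))) → ∑S n (λ v → ⟦ Φ v ⟧) * u ≤ X
    single-count B st s s∉ s≢0 u g Φ spec = subst₂ _≤_ (cong (_* u) (*-identityʳ (∑S n (λ v → ⟦ Φ v ⟧)))) (*-identityʳ X)
      (gain (∑S n (λ v → ⟦ Φ v ⟧)) 1 (X * 1) (1 * h) u ≤-refl (subst (λ z → u * Q ^ z ≤ P ^ z) (sym (+-identityʳ h)) g) (subst (λ z → ∑S n (λ v → ⟦ Φ v ⟧) * 1 * P ^ (z * h) ≤ X * 1 * Q ^ (z * h)) (#-singleton s)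
        (free-count B st (s ==_) (λ x p → not-intro′ (λ Bx → s∉ (trans (cong B (⌊⌋-true {d = s FinP.≟ x} p)) Bx))) (λ p → s≢0 (⌊⌋-true {d = s FinP.≟ 𝟘} p)) m 0 refl
          (≤-trans (≤-reflexive (trans (cong (λ z → m * suc (2 * z)) (#-singleton s)) (*-comm m 3))) (*-monoʳ-≤ 3 (m≤m+n m b))) Φ
          (λ v p → proj₁ (spec v p) , proj₁ (proj₂ (spec v p)) , λ x s′ vx e vxs → proj₂ (proj₂ (spec v p)) x vx (trans (cong (λ z → lookup v (x ⊕ z)) (⌊⌋-true {d = s FinP.≟ s′} e)) vxs)))))

  -- Containers

  module Tree (a b y L t d α η : ℕ) (y≥1 : 1 ≤ y) (b≥1 : 1 ≤ b) where
    open Partial a b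

    M Z : ℕ
    M = suc η
    Z = (a + b) ^ L

    R : Pr n → Fin n → Pr n
    R T₂ x z = T₂ (z ⊖ x)

    module _ (Φ : Subset n → Bool) where
      W : Pr n → Pr n → ℕ
      W T U = ∑S n (λ v → ⟦ Φ v ⟧ * pw T U v)

      -- Divided by b^|U|, the weight is at most y^r (1 + a/(yb))^|U| (1 + a/b)^L. The last factor
      -- comes from a leaf with at most `L` available elements. The others bound the sum over all
      -- ways to choose up to r elements, each with weight a/b, discounted by y.
      Bound : Pr n → Pr n → ℕ → Set
      Bound T U r = W T U * (y ^ # U * b ^ L) ≤ (y * b + a) ^ # U * (y ^ r * Z)

      branch : ∀ T U x D r → U x ≡ true → Bound (T ∩ ∁ (x ==_)) (U ∩ ∁ (x ==_)) (suc r) → Bound ((T ∪ (x ==_)) ∩ ∁ D) ((U ∩ ∁ (x ==_)) ∩ ∁ D) r →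
        (∀ v → Φ v ≡ true → 1 ≤ pw (T ∪ (x ==_)) (U ∩ ∁ (x ==_)) v → ∀ i → D i ≡ true → lookup v i ≡ false) → Bound T U (suc r)
      branch T U x D r Vx ih₀ ih₁ excl = begin
        W T U * (y ^ # U * b ^ L) ≤⟨ *-monoˡ-≤ (y ^ # U * b ^ L) W≤ ⟩
        (a * (b ^ e * W₁) + b * W₀) * (y ^ # U * b ^ L) ≡⟨ cong (λ z → (a * (b ^ e * W₁) + b * W₀) * (y ^ z * b ^ L)) #U ⟩
        (a * (b ^ e * W₁) + b * W₀) * (y * y ^ # V₁ * b ^ L) ≡⟨ l₁ a (b ^ e) W₁ b W₀ y (y ^ # V₁) (b ^ L) ⟩
        a * y * (b ^ e * (W₁ * (y ^ # V₁ * b ^ L))) + y * b * (W₀ * (y ^ # V₁ * b ^ L)) ≤⟨ +-mono-≤ (*-monoʳ-≤ (a * y) in-bound) (*-monoʳ-≤ (y * b) ih₀) ⟩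
        a * y * ((y * b + a) ^ # V₁ * (y ^ r * Z)) + y * b * ((y * b + a) ^ # V₁ * (y ^ suc r * Z)) ≡⟨ l₂ a y b ((y * b + a) ^ # V₁) (y ^ r) Z ⟩
        (y * b + a) * (y * b + a) ^ # V₁ * (y * y ^ r * Z) ≡⟨ cong (λ z → (y * b + a) ^ z * (y ^ suc r * Z)) #U ⟨
        (y * b + a) ^ # U * (y ^ suc r * Z) ∎
        where
        open ≤-Reasoning
        V₁ V₂ T₀ T₁ : Pr n
        V₁ = U ∩ ∁ (x ==_)
        V₂ = V₁ ∩ ∁ D
        T₀ = T ∩ ∁ (x ==_)
        T₁ = (T ∪ (x ==_)) ∩ ∁ D
        W₀ W₁ e : ℕ
        W₀ = W T₀ V₁
        W₁ = W T₁ V₂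
        e = # (V₁ ∩ D)
        #U : # U ≡ suc (# V₁)
        #U = trans (sym (#-split U (x ==_))) (cong (_+ # V₁) (trans (#-cong (λ i → bool-ext (λ p → proj₂ (∧-true {U i} p)) (λ p → ∧-intro (trans (cong U (sym (⌊⌋-true {d = x FinP.≟ i} p))) Vx) p))) (#-singleton x)))
        W≤ : W T U ≤ a * (b ^ e * W₁) + b * W₀
        W≤ = begin
          W T U ≤⟨ ΣL-mono (allSubsets n) (λ v → pt v (bool-cases (Φ v))) ⟩
          ∑S n (λ v → a * (b ^ e * (⟦ Φ v ⟧ * pw T₁ V₂ v)) + b * (⟦ Φ v ⟧ * pw T₀ V₁ v)) ≡⟨ trans (ΣL-+ (allSubsets n) _ _) (cong₂ _+_ (trans (ΣL-* (allSubsets n) a _) (cong (a *_) (ΣL-* (allSubsets n) (b ^ e) _))) (ΣL-* (allSubsets n) b _)) ⟩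
          a * (b ^ e * W₁) + b * W₀ ∎
          where
          m₁ : ∀ a u w b z → 1 * (a * (u * w) + b * z) ≡ a * (u * (1 * w)) + b * (1 * z)
          m₁ = solve-∀
          excluded : ∀ v → Φ v ≡ true → pw (T ∪ (x ==_)) V₁ v ≤ b ^ e * pw T₁ V₂ v
          excluded v p with pw (T ∪ (x ==_)) V₁ v in eq
          ... | zero = z≤n
          ... | suc z = ≤-trans (≤-reflexive (sym eq)) (pw-exclude (T ∪ (x ==_)) V₁ D v (excl v p (≤-trans (s≤s z≤n) (≤-reflexive (sym eq)))))
          pt : ∀ v → Φ v ≡ true ⊎ Φ v ≡ false → ⟦ Φ v ⟧ * pw T U v ≤ a * (b ^ e * (⟦ Φ v ⟧ * pw T₁ V₂ v)) + b * (⟦ Φ v ⟧ * pw T₀ V₁ v)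
          pt v (inj₂ p) = ≤-trans (≤-reflexive (cong (λ z → ⟦ z ⟧ * pw T U v) p)) z≤n
          pt v (inj₁ p) = subst (λ c → ⟦ c ⟧ * pw T U v ≤ a * (b ^ e * (⟦ c ⟧ * pw T₁ V₂ v)) + b * (⟦ c ⟧ * pw T₀ V₁ v)) (sym p)
            (≤-trans (*-monoʳ-≤ 1 (≤-trans (≤-reflexive (pw-branch T U x Vx v)) (+-monoˡ-≤ _ (*-monoʳ-≤ a (excluded v p))))) (≤-reflexive (m₁ a (b ^ e) (pw T₁ V₂ v) b (pw T₀ V₁ v))))
        in-bound : b ^ e * (W₁ * (y ^ # V₁ * b ^ L)) ≤ (y * b + a) ^ # V₁ * (y ^ r * Z)
        in-bound = begin
          b ^ e * (W₁ * (y ^ # V₁ * b ^ L)) ≡⟨ cong (λ z → b ^ e * (W₁ * (z * b ^ L))) (trans (cong (y ^_) (sym (#-split V₁ D))) (^-distribˡ-+-* y e (# V₂))) ⟩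
          b ^ e * (W₁ * (y ^ e * y ^ # V₂ * b ^ L)) ≡⟨ m₁ (b ^ e) W₁ (y ^ e) (y ^ # V₂) (b ^ L) ⟩
          y ^ e * b ^ e * (W₁ * (y ^ # V₂ * b ^ L)) ≤⟨ *-mono-≤ (≤-trans (≤-reflexive (sym (^-distrib-* y b e))) (^-monoˡ e (m≤m+n (y * b) a))) ih₁ ⟩
          (y * b + a) ^ e * ((y * b + a) ^ # V₂ * (y ^ r * Z)) ≡⟨ *-assoc ((y * b + a) ^ e) _ _ ⟨
          (y * b + a) ^ e * (y * b + a) ^ # V₂ * (y ^ r * Z) ≡⟨ cong (_* (y ^ r * Z)) (trans (sym (^-distribˡ-+-* (y * b + a) e (# V₂))) (cong ((y * b + a) ^_) (#-split V₁ D))) ⟩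
          (y * b + a) ^ # V₁ * (y ^ r * Z) ∎
          where
          m₁ : ∀ b w y z c → b * (w * (y * z * c)) ≡ y * b * (w * (z * c))
          m₁ = solve-∀
        l₁ : ∀ a u w b z y p c → (a * (u * w) + b * z) * (y * p * c) ≡ a * y * (u * (w * (p * c))) + y * b * (z * (p * c))
        l₁ = solve-∀
        l₂ : ∀ a y b p w z → a * y * (p * (w * z)) + y * b * (p * (y * w * z)) ≡ (y * b + a) * p * (y * w * z)
        l₂ = solve-∀

      leaf-small : ∀ T U r → # U ≤ L → Bound T U r
      leaf-small T U r le = begin
        W T U * (y ^ f * b ^ L) ≤⟨ *-monoˡ-≤ _ (≤-trans (ΣL-mono (allSubsets n) (λ v → ≤-trans (*-monoˡ-≤ (pw T U v) (⟦⟧≤1 (Φ v))) (≤-reflexive (+-identityʳ _)))) (≤-reflexive (pw-total T U))) ⟩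
        (a + b) ^ f * (y ^ f * b ^ L) ≡⟨ cong (λ z → (a + b) ^ f * (y ^ f * z)) (trans (cong (b ^_) (sym (m+[n∸m]≡n le))) (^-distribˡ-+-* b f (L ∸ f))) ⟩
        (a + b) ^ f * (y ^ f * (b ^ f * b ^ (L ∸ f))) ≡⟨ l₁ ((a + b) ^ f) (y ^ f) (b ^ f) (b ^ (L ∸ f)) ⟩
        y ^ f * b ^ f * ((a + b) ^ f * b ^ (L ∸ f)) ≤⟨ *-mono-≤ (≤-trans (≤-reflexive (sym (^-distrib-* y b f))) (^-monoˡ f (m≤m+n (y * b) a))) (*-monoʳ-≤ ((a + b) ^ f) (^-monoˡ (L ∸ f) (m≤n+m b a))) ⟩
        (y * b + a) ^ f * ((a + b) ^ f * (a + b) ^ (L ∸ f)) ≡⟨ cong ((y * b + a) ^ f *_) (trans (sym (^-distribˡ-+-* (a + b) f (L ∸ f))) (cong ((a + b) ^_) (m+[n∸m]≡n le))) ⟩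
        (y * b + a) ^ f * Z ≤⟨ *-monoʳ-≤ ((y * b + a) ^ f) (≤-trans (≤-reflexive (sym (+-identityʳ Z))) (*-monoˡ-≤ Z (^-pos y r y≥1))) ⟩
        (y * b + a) ^ f * (y ^ r * Z) ∎
        where
        open ≤-Reasoning
        f = # U
        l₁ : ∀ s y b c → s * (y * (b * c)) ≡ y * b * (s * c)
        l₁ = solve-∀

      -- T has been chosen, U is still available, and r more elements may be chosen. Elements joined by an arc of T₂ ⊆ T
      -- cannot both be chosen, so an available element of degree d is worth a branching.
      record Inv (T U T₂ : Pr n) (r : ℕ) : Set where
        field
          chosen : T₂ ⊑ T
          fresh : ∀ i → T₂ i ≡ true → U i ≡ false
          U∌0 : ¬ (U ∋∋ 𝟘)
          T₂∌0 : ¬ (T₂ ∋∋ 𝟘)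
          budget : # T + r ≤ t
          outdeg : ∀ x → U x ≡ true → # (U ∩ R T₂ x) ≤ d
          indeg : ∀ z → U z ≡ true → # (λ x → U x ∧ R T₂ x z) ≤ d
          measure : (α + 2 * d) * # U ≤ arcs (R T₂) U + M * r

      -- A removed element takes along at most 2d arcs, which its share α + 2d of the measure covers
      -- with α to spare.
      remove : ∀ U X T₂ c e → (∀ x → U x ≡ true → # (U ∩ R T₂ x) ≤ d) → (∀ z → U z ≡ true → # (λ x → U x ∧ R T₂ x z) ≤ d) →
        (α + 2 * d) * # U + c ≤ arcs (R T₂) U + e → (α + 2 * d) * # (U ∩ ∁ X) + (c + α * # (U ∩ X)) ≤ arcs (R T₂) (U ∩ ∁ X) + e
      remove U X T₂ c e o i le = +-cancelʳ-≤ (2 * # (U ∩ X) * d) _ _ (begin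
        (α + 2 * d) * # (U ∩ ∁ X) + (c + α * # (U ∩ X)) + 2 * # (U ∩ X) * d ≡⟨ l₁ α d (# (U ∩ ∁ X)) c (# (U ∩ X)) ⟩
        (α + 2 * d) * (# (U ∩ X) + # (U ∩ ∁ X)) + c ≡⟨ cong (λ z → (α + 2 * d) * z + c) (#-split U X) ⟩
        (α + 2 * d) * # U + c ≤⟨ le ⟩
        arcs (R T₂) U + e ≤⟨ +-monoˡ-≤ e (arcs-remove (R T₂) U X d o i) ⟩
        arcs (R T₂) (U ∩ ∁ X) + 2 * # (U ∩ X) * d + e ≡⟨ l₂ (arcs (R T₂) (U ∩ ∁ X)) (2 * # (U ∩ X) * d) e ⟩
        arcs (R T₂) (U ∩ ∁ X) + e + 2 * # (U ∩ X) * d ∎)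
        where
        open ≤-Reasoning
        l₁ : ∀ α d v c x → (α + 2 * d) * v + (c + α * x) + 2 * x * d ≡ (α + 2 * d) * (x + v) + c
        l₁ = solve-∀
        l₂ : ∀ a b c → a + b + c ≡ a + c + b
        l₂ = solve-∀

      outdeg-mono : ∀ {U U′ T₂} → U′ ⊑ U → (∀ x → U x ≡ true → # (U ∩ R T₂ x) ≤ d) → ∀ x → U′ x ≡ true → # (U′ ∩ R T₂ x) ≤ d
      outdeg-mono {U} {U′} {T₂} h o x p = ≤-trans (#-mono {A = U′ ∩ R T₂ x} {U ∩ R T₂ x} (λ i r → ∧-intro (h i (proj₁ (∧-true {U′ i} r))) (proj₂ (∧-true {U′ i} r)))) (o x (h x p))

      indeg-mono : ∀ {U U′ T₂} → U′ ⊑ U → (∀ z → U z ≡ true → # (λ x → U x ∧ R T₂ x z) ≤ d) → ∀ z → U′ z ≡ true → # (λ x → U′ x ∧ R T₂ x z) ≤ d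
      indeg-mono {U} {U′} {T₂} h o z p = ≤-trans (#-mono {A = λ x → U′ x ∧ R T₂ x z} {λ x → U x ∧ R T₂ x z} (λ i r → ∧-intro (h i (proj₁ (∧-true {U′ i} r))) (proj₂ (∧-true {U′ i} r)))) (o z (h z p))

      ∩-⊑ : ∀ (U X : Pr n) → U ∩ X ⊑ U
      ∩-⊑ U X i p = proj₁ (∧-true {U i} p)

      skip : ∀ {T U T₂ r} x → U x ≡ true → Inv T U T₂ r → Inv (T ∩ ∁ (x ==_)) (U ∩ ∁ (x ==_)) T₂ r
      skip {T} {U} {T₂} {r} x Vx inv = record
        { chosen = λ i p → ∧-intro (chosen i p) (not-intro′ λ e → absurd-b (trans (cong U (sym (⌊⌋-true {d = x FinP.≟ i} e))) Vx) (fresh i p))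
        ; fresh = λ i p → cong (_∧ not (x == i)) (fresh i p)
        ; U∌0 = λ p → U∌0 (∩-⊑ U (∁ (x ==_)) 𝟘 p)
        ; T₂∌0 = T₂∌0
        ; budget = ≤-trans (+-monoˡ-≤ r (#-mono (∩-⊑ T _))) budget
        ; outdeg = outdeg-mono {U} {U′} {T₂} (∩-⊑ U _) outdeg
        ; indeg = indeg-mono {U} {U′} {T₂} (∩-⊑ U _) indeg
        ; measure = ≤-trans (m≤m+n _ _) (remove U (x ==_) T₂ 0 (M * r) outdeg indeg (subst (_≤ arcs (R T₂) U + M * r) (sym (+-identityʳ _)) measure)) }
        where
        open Inv inv
        U′ : Pr n
        U′ = U ∩ ∁ (x ==_)

      -- The budget cannot be exhausted before a choice that earns M: with r = 0 the measure would
      -- force more than dv arcs among v elements.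
      spend : ∀ c E v r → M ≤ c → E ≤ d * v → (α + 2 * d) * v + c ≤ E + M * r → ∃[ r′ ] (r ≡ suc r′ × (α + 2 * d) * v ≤ E + M * r′)
      spend c E v zero Mc Ed le = ⊥-elim (<⇒≱ (begin-strict
        d * v <⟨ m<m+n (d * v) (s≤s z≤n) ⟩
        d * v + M ≤⟨ +-mono-≤ (*-monoˡ-≤ v (≤-trans (m≤m+n d (d + 0)) (m≤n+m (2 * d) α))) Mc ⟩
        (α + 2 * d) * v + c ≤⟨ le ⟩
        E + M * 0 ≡⟨ trans (cong (E +_) (*-zeroʳ M)) (+-identityʳ E) ⟩
        E ∎) Ed)
        where open ≤-Reasoning
      spend c E v (suc r′) Mc Ed le = r′ , refl , +-cancelʳ-≤ M _ _ (≤-trans (+-monoʳ-≤ _ Mc) (≤-trans le (≤-reflexive (trans (cong (E +_) (trans (*-suc M r′) (+-comm M _))) (sym (+-assoc E _ M))))))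

      arcs≤ : ∀ U T₂ → (∀ x → U x ≡ true → # (U ∩ R T₂ x) ≤ d) → arcs (R T₂) U ≤ d * # U
      arcs≤ U T₂ o = ≤-trans (sum-mono (λ x → pt x (bool-cases (U x)))) (≤-reflexive (sum-*ˡ d (λ x → ⟦ U x ⟧)))
        where
        pt : ∀ x → U x ≡ true ⊎ U x ≡ false → ⟦ U x ⟧ * # (U ∩ R T₂ x) ≤ d * ⟦ U x ⟧
        pt x (inj₁ p) = subst (λ c → ⟦ c ⟧ * # (U ∩ R T₂ x) ≤ d * ⟦ c ⟧) (sym p) (≤-trans (≤-reflexive (+-identityʳ _)) (≤-trans (o x p) (≤-reflexive (sym (*-identityʳ d)))))
        pt x (inj₂ p) = subst (λ c → ⟦ c ⟧ * # (U ∩ R T₂ x) ≤ d * ⟦ c ⟧) (sym p) z≤n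

      #T₁ : ∀ T x D → # ((T ∪ (x ==_)) ∩ ∁ D) ≤ suc (# T)
      #T₁ T x D = ≤-trans (#-mono {A = (T ∪ (x ==_)) ∩ ∁ D} {T ∪ (x ==_)} (∩-⊑ (T ∪ (x ==_)) (∁ D))) (≤-trans (≤-trans (m≤m+n _ _) (≤-reflexive (#-∪∩ T (x ==_)))) (≤-reflexive (trans (cong (# T +_) (#-singleton x)) (+-comm (# T) 1))))

      take : ∀ {T U T₂ r} x D → U x ≡ true → D ⊑ U → M ≤ α * # ((U ∩ ∁ (x ==_)) ∩ D) → Inv T U T₂ r →
        ∃[ r′ ] (r ≡ suc r′ × Inv ((T ∪ (x ==_)) ∩ ∁ D) ((U ∩ ∁ (x ==_)) ∩ ∁ D) T₂ r′)
      take {T} {U} {T₂} {r} x D Vx D⊑U big inv = go (spend (α * # (U ∩ (x ==_)) + α * # (V₁ ∩ D)) (arcs (R T₂) V₂) (# V₂) r (≤-trans big (m≤n+m _ _)) (arcs≤ V₂ T₂ o₂)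
          (remove V₁ D T₂ (α * # (U ∩ (x ==_))) (M * r) o₁ i₁ (remove U (x ==_) T₂ 0 (M * r) outdeg indeg (subst (_≤ arcs (R T₂) U + M * r) (sym (+-identityʳ _)) measure))))
        where
        open Inv inv
        V₁ V₂ T₁ : Pr n
        V₁ = U ∩ ∁ (x ==_)
        V₂ = V₁ ∩ ∁ D
        T₁ = (T ∪ (x ==_)) ∩ ∁ D
        o₁ : ∀ z → V₁ z ≡ true → # (V₁ ∩ R T₂ z) ≤ d
        o₁ = outdeg-mono {U} {V₁} {T₂} (∩-⊑ U _) outdeg
        i₁ : ∀ z → V₁ z ≡ true → # (λ w → V₁ w ∧ R T₂ w z) ≤ d
        i₁ = indeg-mono {U} {V₁} {T₂} (∩-⊑ U _) indeg
        o₂ : ∀ z → V₂ z ≡ true → # (V₂ ∩ R T₂ z) ≤ d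
        o₂ = outdeg-mono {V₁} {V₂} {T₂} (∩-⊑ V₁ _) o₁
        go : ∃[ r′ ] (r ≡ suc r′ × (α + 2 * d) * # V₂ ≤ arcs (R T₂) V₂ + M * r′) → ∃[ r′ ] (r ≡ suc r′ × Inv T₁ V₂ T₂ r′)
        go (r′ , e , me) = r′ , e , record
          { chosen = λ i p → ∧-intro (∨-introˡ (chosen i p)) (not-intro′ λ Di → absurd-b (D⊑U i Di) (fresh i p))
          ; fresh = λ i p → cong (λ z → (z ∧ not (x == i)) ∧ not (D i)) (fresh i p)
          ; U∌0 = λ p → U∌0 (∩-⊑ U (∁ (x ==_)) 𝟘 (∩-⊑ V₁ (∁ D) 𝟘 p))
          ; T₂∌0 = T₂∌0
          ; budget = ≤-trans (+-monoˡ-≤ r′ (#T₁ T x D)) (≤-trans (≤-reflexive (sym (+-suc (# T) r′))) (≤-trans (≤-reflexive (cong (# T +_) (sym e))) budget))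
          ; outdeg = o₂
          ; indeg = indeg-mono {V₁} {V₂} {T₂} (∩-⊑ V₁ _) i₁
          ; measure = me }

      consistent-in : ∀ {T U T₂ r} x → Inv T U T₂ r → ∀ v → 1 ≤ pw (T ∪ (x ==_)) (U ∩ ∁ (x ==_)) v → lookup v ∋∋ x × (∀ s → T₂ ∋∋ s → lookup v ∋∋ s)
      consistent-in {T} {U} {T₂} x inv v pos =
        trans (pw-consistent (T ∪ (x ==_)) (U ∩ ∁ (x ==_)) v pos x (trans (cong (λ c → U x ∧ not c) x==x) (∧-zeroʳ (U x)))) (∨-introʳ {T x} x==x) ,
        λ s p → trans (pw-consistent (T ∪ (x ==_)) (U ∩ ∁ (x ==_)) v pos s (cong (_∧ not (x == s)) (fresh s p))) (∨-introˡ (chosen s p))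
        where
        open Inv inv
        x==x : (x == x) ≡ true
        x==x = ⌊⌋-intro {d = x FinP.≟ x} refl

      -- The measure pays for a heavy element x: each z with z and z + x available is a new arc of T₂.
      take-heavy : ∀ {T U T₂ r} x → U x ≡ true → (∀ z → U z ≡ true → suc (# (U ∩ R T₂ z)) ≤ d) → (∀ z → U z ≡ true → suc (# (λ w → U w ∧ R T₂ w z)) ≤ d) →
        M ≤ # (λ z → U z ∧ U (z ⊕ x)) → Inv T U T₂ r → ∃[ r′ ] (r ≡ suc r′ × Inv ((T ∪ (x ==_)) ∩ ∁ (λ _ → false)) ((U ∩ ∁ (x ==_)) ∩ ∁ (λ _ → false)) (T₂ ∪ (x ==_)) r′)
      take-heavy {T} {U} {T₂} {r} x Vx out< in< heavy inv = go (spend (M + α * # (U ∩ (x ==_)) + α * # (V₁ ∩ ∅)) (arcs (R T₂′) V₂) (# V₂) r (≤-trans (m≤m+n M _) (m≤m+n _ _)) (arcs≤ V₂ T₂′ o₂)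
          (remove V₁ ∅ T₂′ (M + α * # (U ∩ (x ==_))) (M * r) o₁ i₁ (remove U (x ==_) T₂′ M (M * r) o i gained)))
        where
        open Inv inv
        ∅ V₁ V₂ T₁ T₂′ : Pr n
        ∅ = λ _ → false
        V₁ = U ∩ ∁ (x ==_)
        V₂ = V₁ ∩ ∁ ∅
        T₁ = (T ∪ (x ==_)) ∩ ∁ ∅
        T₂′ = T₂ ∪ (x ==_)
        new-out : ∀ z → # (λ w → U w ∧ (x == (w ⊖ z))) ≡ ⟦ U (x ⊕ z) ⟧
        new-out z = trans (sym (sum-shift (λ w → ⟦ U w ∧ (x == (w ⊖ z)) ⟧) z)) (trans (sum-cong-≗ (λ w → trans (⟦∧⟧ (U (w ⊕ z)) _) (trans (*-comm ⟦ U (w ⊕ z) ⟧ _) (cong (λ u → ⟦ x == u ⟧ * ⟦ U (w ⊕ z) ⟧) (⊕⊖ w z))))) (sum-δ x (λ w → ⟦ U (w ⊕ z) ⟧)))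
        new-in : ∀ z → # (λ w → U w ∧ (x == (z ⊖ w))) ≤ 1
        new-in z = ≤-trans (#-mono {A = λ w → U w ∧ (x == (z ⊖ w))} {(z ⊖ x) ==_} (λ w p → ⌊⌋-intro {d = (z ⊖ x) FinP.≟ w} (trans (cong (z ⊖_) (⌊⌋-true {d = x FinP.≟ (z ⊖ w)} (proj₂ (∧-true {U w} p)))) (⊖⊖ z w)))) (≤-reflexive (#-singleton (z ⊖ x)))
        ∨-split : ∀ (f g h : Pr n) → # (λ w → f w ∧ (g w ∨ h w)) ≤ # (λ w → f w ∧ g w) + # (λ w → f w ∧ h w)
        ∨-split f g h = ≤-trans (≤-reflexive (#-cong (λ w → dist (f w) (g w) (h w)))) (≤-trans (m≤m+n _ _) (≤-reflexive (#-∪∩ (λ w → f w ∧ g w) (λ w → f w ∧ h w))))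
          where
          dist : ∀ a b c → a ∧ (b ∨ c) ≡ (a ∧ b) ∨ (a ∧ c)
          dist true b c = refl
          dist false b c = refl
        o : ∀ z → U z ≡ true → # (U ∩ R T₂′ z) ≤ d
        o z p = ≤-trans (∨-split U (R T₂ z) (λ w → x == (w ⊖ z))) (≤-trans (+-monoʳ-≤ _ (≤-trans (≤-reflexive (new-out z)) (⟦⟧≤1 (U (x ⊕ z))))) (≤-trans (≤-reflexive (+-comm _ 1)) (out< z p)))
        i : ∀ z → U z ≡ true → # (λ w → U w ∧ R T₂′ w z) ≤ d
        i z p = ≤-trans (∨-split U (λ w → R T₂ w z) (λ w → x == (z ⊖ w))) (≤-trans (+-monoʳ-≤ _ (new-in z)) (≤-trans (≤-reflexive (+-comm _ 1)) (in< z p)))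
        o₁ : ∀ z → V₁ z ≡ true → # (V₁ ∩ R T₂′ z) ≤ d
        o₁ = outdeg-mono {U} {V₁} {T₂′} (∩-⊑ U _) o
        i₁ : ∀ z → V₁ z ≡ true → # (λ w → V₁ w ∧ R T₂′ w z) ≤ d
        i₁ = indeg-mono {U} {V₁} {T₂′} (∩-⊑ U _) i
        o₂ : ∀ z → V₂ z ≡ true → # (V₂ ∩ R T₂′ z) ≤ d
        o₂ = outdeg-mono {V₁} {V₂} {T₂′} (∩-⊑ V₁ _) o₁
        x∉T₂ : T₂ x ≡ false
        x∉T₂ = ¬true (λ p → absurd-b Vx (fresh x p))
        arcs-grow : arcs (R T₂) U + M ≤ arcs (R T₂′) U
        arcs-grow = begin
          arcs (R T₂) U + M ≤⟨ +-monoʳ-≤ (arcs (R T₂) U) heavy ⟩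
          arcs (R T₂) U + # (λ z → U z ∧ U (z ⊕ x)) ≡⟨ cong (arcs (R T₂) U +_) (sum-cong-≗ (λ z → trans (⟦∧⟧ (U z) _) (cong (λ w → ⟦ U z ⟧ * ⟦ U w ⟧) (⊕-comm z x)))) ⟩
          arcs (R T₂) U + sum (λ z → ⟦ U z ⟧ * ⟦ U (x ⊕ z) ⟧) ≡⟨ ∑-distrib-+ _ _ ⟨
          sum (λ z → ⟦ U z ⟧ * # (U ∩ R T₂ z) + ⟦ U z ⟧ * ⟦ U (x ⊕ z) ⟧) ≡⟨ sum-cong-≗ (λ z → trans (sym (*-distribˡ-+ ⟦ U z ⟧ _ _)) (cong (⟦ U z ⟧ *_) (cup z))) ⟩
          arcs (R T₂′) U ∎
          where
          open ≤-Reasoning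
          cup : ∀ z → # (U ∩ R T₂ z) + ⟦ U (x ⊕ z) ⟧ ≡ # (U ∩ R T₂′ z)
          cup z = trans (cong (# (U ∩ R T₂ z) +_) (sym (new-out z))) (trans (sym (∑-distrib-+ _ _)) (sum-cong-≗ (λ w → pt (U w) (T₂ (w ⊖ z)) (x == (w ⊖ z))
              (λ p → trans (cong T₂ (sym (⌊⌋-true {d = x FinP.≟ (w ⊖ z)} p))) x∉T₂))))
            where
            pt : ∀ f g h → (h ≡ true → g ≡ false) → ⟦ f ∧ g ⟧ + ⟦ f ∧ h ⟧ ≡ ⟦ f ∧ (g ∨ h) ⟧
            pt false g h e = refl
            pt true g true e = trans (cong (λ z → ⟦ z ⟧ + 1) (e refl)) (sym (cong (λ z → ⟦ z ∨ true ⟧) (e refl)))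
            pt true true false e = refl
            pt true false false e = refl
        gained : (α + 2 * d) * # U + M ≤ arcs (R T₂′) U + M * r
        gained = ≤-trans (+-monoˡ-≤ M measure) (≤-trans (≤-reflexive (l (arcs (R T₂) U) (M * r) M)) (+-monoˡ-≤ (M * r) arcs-grow))
          where
          l : ∀ a b c → a + b + c ≡ a + c + b
          l = solve-∀
        go : ∃[ r′ ] (r ≡ suc r′ × (α + 2 * d) * # V₂ ≤ arcs (R T₂′) V₂ + M * r′) → ∃[ r′ ] (r ≡ suc r′ × Inv T₁ V₂ T₂′ r′)
        go (r′ , e , me) = r′ , e , record
          { chosen = λ j p → ∧-intro ([ (λ w → ∨-introˡ (chosen j w)) , (λ w → ∨-introʳ {T j} w) ]′ (∨-true {T₂ j} p)) refl
          ; fresh = λ j p → [ (λ w → cong (λ z → (z ∧ not (x == j)) ∧ true) (fresh j w)) , (λ w → trans (cong (λ z → (U j ∧ not z) ∧ true) w) (trans (cong (_∧ true) (∧-zeroʳ (U j))) refl)) ]′ (∨-true {T₂ j} p)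
          ; U∌0 = λ p → U∌0 (∩-⊑ U (∁ (x ==_)) 𝟘 (∩-⊑ V₁ (∁ ∅) 𝟘 p))
          ; T₂∌0 = λ p → [ T₂∌0 , (λ w → U∌0 (trans (cong U (sym (⌊⌋-true {d = x FinP.≟ 𝟘} w))) Vx)) ]′ (∨-true {T₂ 𝟘} p)
          ; budget = ≤-trans (+-monoˡ-≤ r′ (#T₁ T x ∅)) (≤-trans (≤-reflexive (sym (+-suc (# T) r′))) (≤-trans (≤-reflexive (cong (# T +_) (sym e))) budget))
          ; outdeg = o₂
          ; indeg = indeg-mono {V₁} {V₂} {T₂′} (∩-⊑ V₁ _) i₁
          ; measure = me }

      module _ (9η≤2h : 9 * η ≤ 2 * h) (M≤αd : M ≤ α * d) (L-large : ∀ f → L < f → θ * N < θ * f + h)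
          (Φ-SF : ∀ v → Φ v ≡ true → SF (lookup v)) (Φ-far : ∀ v → Φ v ≡ true → ∀ B → MaxStr N h B → t < # (lookup v ∩ ∁ B)) where

        -- A set consistent with the leaf has all its elements outside `B` among the at most t
        -- chosen ones, so it is not far from `B`.
        leaf-max : ∀ {T U T₂ r} → Inv T U T₂ r → (∃[ B ] (U ⊑ B × MaxStr N h B)) → Bound T U r
        leaf-max {T} {U} {T₂} {r} inv (B , U⊑B , st) = ≤-trans (≤-reflexive (cong (_* (y ^ # U * b ^ L)) (ΣL-zero (allSubsets n) dead))) z≤n
          where
          open Inv inv
          dead : ∀ v → ⟦ Φ v ⟧ * pw T U v ≡ 0
          dead v with bool-cases (Φ v)
          ... | inj₂ p = cong (λ c → ⟦ c ⟧ * pw T U v) p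
          ... | inj₁ p with pw T U v in eq
          ... | zero = *-zeroʳ ⟦ Φ v ⟧
          ... | suc z = ⊥-elim (<⇒≱ (Φ-far v p B st) (≤-trans (#-mono {A = lookup v ∩ ∁ B} {T} f) (≤-trans (m≤m+n (# T) r) budget)))
            where
            f : lookup v ∩ ∁ B ⊑ T
            f i w with ∧-true {lookup v i} w
            ... | vi , nB = trans (sym (pw-consistent T U v (≤-trans (s≤s z≤n) (≤-reflexive (sym eq))) i (¬true (λ Vi → absurd-b (U⊑B i Vi) (not-true nB))))) vi

        -- An element with d neighbours is branched on at once, since accepting it excludes them
        -- all, and M ≤ αd makes this pay as much as a heavy element. Heavy elements become
        -- generators only when all degrees are below d, so one more arc per vertex keeps the degree
        -- bounds.
        tree : ∀ f T U T₂ r → # U ≤ f → Inv T U T₂ r → Bound T U r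
        tree zero T U T₂ r le inv = leaf-small T U r (≤-trans le z≤n)
        tree (suc f) T U T₂ r le inv
          with any? (λ x → (U x ≟ᵇ true) ×-dec (d ≤? # (U ∩ R T₂ x)))
             | any? (λ x → (U x ≟ᵇ true) ×-dec (d ≤? # (λ w → U w ∧ R T₂ w x)))
             | any? (λ x → (U x ≟ᵇ true) ×-dec (M ≤? # (λ z → U z ∧ U (z ⊕ x))))
        ... | yes (x , Vx , big) | _ | _ = step (take x D Vx (∩-⊑ U _) (≤-trans M≤αd (*-monoʳ-≤ α (≤-trans big (#-mono {A = U ∩ R T₂ x} {(U ∩ ∁ (x ==_)) ∩ D} sub)))) inv)
          where
          D : Pr n
          D = U ∩ R T₂ x
          sub : U ∩ R T₂ x ⊑ (U ∩ ∁ (x ==_)) ∩ D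
          sub z p = ∧-intro (∧-intro (∩-⊑ U (R T₂ x) z p) (not-intro′ λ e → Inv.T₂∌0 inv (trans (cong T₂ (trans (sym (x⊖x x)) (cong (_⊖ x) (⌊⌋-true {d = x FinP.≟ z} e)))) (proj₂ (∧-true {U z} p))))) p
          V₁< : # (U ∩ ∁ (x ==_)) ≤ f
          V₁< = s≤s⁻¹ (≤-trans (s≤s (#-mono {A = U ∩ ∁ (x ==_)} (λ _ p → p))) (≤-trans (shrink U x Vx) le))
            where
            shrink : ∀ U x → U x ≡ true → suc (# (U ∩ ∁ (x ==_))) ≤ # U
            shrink U x Vx = ≤-trans (+-monoˡ-≤ _ (#>0 (U ∩ (x ==_)) x (∧-intro Vx (⌊⌋-intro {d = x FinP.≟ x} refl)))) (≤-reflexive (#-split U (x ==_)))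
          step : ∃[ r′ ] (r ≡ suc r′ × Inv ((T ∪ (x ==_)) ∩ ∁ D) ((U ∩ ∁ (x ==_)) ∩ ∁ D) T₂ r′) → Bound T U r
          step (r′ , refl , inv′) = branch T U x D r′ Vx (tree f _ _ T₂ (suc r′) V₁< (skip x Vx inv)) (tree f _ _ T₂ r′ (≤-trans (#-mono (∩-⊑ (U ∩ ∁ (x ==_)) (∁ D))) V₁<) inv′)
            (λ v p pos i Di → ¬true (λ vi → let (vx , vT) = consistent-in x inv v pos in
              Φ-SF v p x (i ⊖ x) vx (vT _ (proj₂ (∧-true {U i} Di))) (trans (cong (lookup v) (⊕⊖′ x i)) vi)))
        ... | no _ | yes (x , Vx , big) | _ = step (take x D Vx (∩-⊑ U _) (≤-trans M≤αd (*-monoʳ-≤ α (≤-trans big (#-mono {A = D} {(U ∩ ∁ (x ==_)) ∩ D} sub)))) inv)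
          where
          D : Pr n
          D = λ w → U w ∧ R T₂ w x
          sub : D ⊑ (U ∩ ∁ (x ==_)) ∩ D
          sub z p = ∧-intro (∧-intro (∩-⊑ U (λ w → R T₂ w x) z p) (not-intro′ λ e → Inv.T₂∌0 inv (trans (cong T₂ (trans (sym (x⊖x x)) (cong (x ⊖_) (⌊⌋-true {d = x FinP.≟ z} e)))) (proj₂ (∧-true {U z} p))))) p
          V₁< : # (U ∩ ∁ (x ==_)) ≤ f
          V₁< = s≤s⁻¹ (≤-trans (≤-trans (+-monoˡ-≤ _ (#>0 (U ∩ (x ==_)) x (∧-intro Vx (⌊⌋-intro {d = x FinP.≟ x} refl)))) (≤-reflexive (#-split U (x ==_)))) le)
          step : ∃[ r′ ] (r ≡ suc r′ × Inv ((T ∪ (x ==_)) ∩ ∁ D) ((U ∩ ∁ (x ==_)) ∩ ∁ D) T₂ r′) → Bound T U r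
          step (r′ , refl , inv′) = branch T U x D r′ Vx (tree f _ _ T₂ (suc r′) V₁< (skip x Vx inv)) (tree f _ _ T₂ r′ (≤-trans (#-mono (∩-⊑ (U ∩ ∁ (x ==_)) (∁ D))) V₁<) inv′)
            (λ v p pos i Di → ¬true (λ vi → let (vx , vT) = consistent-in x inv v pos in
              Φ-SF v p i (x ⊖ i) vi (vT _ (proj₂ (∧-true {U i} Di))) (trans (cong (lookup v) (⊕⊖′ i x)) vx)))
        ... | no ¬o | no ¬i | yes (x , Vx , heavy) = step (take-heavy x Vx (λ z p → ≰⇒> (λ le′ → ¬o (z , p , le′))) (λ z p → ≰⇒> (λ le′ → ¬i (z , p , le′))) heavy inv)
          where
          ∅ : Pr n
          ∅ = λ _ → false
          V₁< : # (U ∩ ∁ (x ==_)) ≤ f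
          V₁< = s≤s⁻¹ (≤-trans (≤-trans (+-monoˡ-≤ _ (#>0 (U ∩ (x ==_)) x (∧-intro Vx (⌊⌋-intro {d = x FinP.≟ x} refl)))) (≤-reflexive (#-split U (x ==_)))) le)
          step : ∃[ r′ ] (r ≡ suc r′ × Inv ((T ∪ (x ==_)) ∩ ∁ ∅) ((U ∩ ∁ (x ==_)) ∩ ∁ ∅) (T₂ ∪ (x ==_)) r′) → Bound T U r
          step (r′ , refl , inv′) = branch T U x ∅ r′ Vx (tree f _ _ T₂ (suc r′) V₁< (skip x Vx inv)) (tree f _ _ (T₂ ∪ (x ==_)) r′ (≤-trans (#-mono (∩-⊑ (U ∩ ∁ (x ==_)) (∁ ∅))) V₁<) inv′)
            (λ v p pos i ())
        -- Now every available x is the difference of at most η available pairs. A set of more than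
        -- `L` such elements is sum-free by `removal`, and `stability` puts it into a maximum set.
        ... | no _ | no _ | no light with # U ≤? L
        ... | yes small = leaf-small T U r small
        ... | no large = leaf-max inv (stability U (removal U η 9η≤2h (L-large _ (≰⇒> large)) (λ x p → s≤s⁻¹ (≰⇒> (λ le′ → light (x , p , le′))))) (L-large _ (≰⇒> large)))

  -- Bounds for the near, the doubly covered and the far sets

  module Estimates (m b : ℕ) (N≡ : suc k * h ≡ m + b) (h≤θb : h ≤ 9 * suc k * b) (reg : Regime q k h n m) where
    module Pm = Parameters q k h n m b q≡ n≡ N≡ h≤θb reg
    open Pm using (y; t; j; j₁; g; D; Y; m≥1; b≥1; y≥1; m≤N; m≤n; N<n; g≤N; gθ≤h) public
    open Regime reg
    open Near m b m≥1 b≥1 N≡ public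

    mm≥1 : 1 ≤ m * m
    mm≥1 = *-mono-≤ m≥1 m≥1

    C₀ : ℕ
    C₀ = N C m

    n≥1′ : 1 ≤ n
    n≥1′ = ≤-trans (s≤s (z≤n {3})) n≥4

    X≤nC : X ≤ n * C₀
    X≤nC = *-monoˡ-≤ C₀ N<n

    gain-e : 2 ^ e * Q ^ h ≤ P ^ h
    gain-e = subst (λ z → 2 ^ e * Q ^ h ≤ z ^ h) Q≡ (power-gap e h Q (m * m) mm≥1 (subst (λ z → e * z ≤ h * (m * m)) (sym Q≡) Pm.gain-small))

    gain-j : 2 ^ j * Q ^ (D * h) ≤ P ^ (D * h)
    gain-j = subst (λ z → 2 ^ j * Q ^ (D * h) ≤ z ^ (D * h)) Q≡ (power-gap j (D * h) Q (m * m) mm≥1 (subst (λ z → j * z ≤ D * h * (m * m)) (sym Q≡) Pm.gain-large))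

    near-bound : ∀ B → MaxStr N h B → (Ψ : Subset n → Bool) →
      (∀ v → Ψ v ≡ true → SF (lookup v) × ∣ v ∣ ≡ m × 1 ≤ # (lookup v ∩ ∁ B) × # (lookup v ∩ ∁ B) ≤ t) →
      ∑S n (λ v → ⟦ Ψ v ⟧) * n ^ 4 ≤ 3 * X
    near-bound B st Ψ spec = begin
      ∑S n (λ v → ⟦ Ψ v ⟧) * n ^ 4 ≡⟨ cong (_* n ^ 4) (parts B st t D Pm.mD Ψ spec) ⟩
      (∑S n sm + ∑S n lg) * n ^ 4 ≡⟨ *-distribʳ-+ (n ^ 4) (∑S n sm) (∑S n lg) ⟩
      ∑S n sm * n ^ 4 + ∑S n lg * n ^ 4 ≤⟨ +-mono-≤ s-bound l-bound ⟩
      2 * X + X ≡⟨ l X ⟩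
      3 * X ∎
      where
      open ≤-Reasoning
      sm lg : Subset n → ℕ
      sm = small-part B st t D Pm.mD Ψ spec
      lg = large-part B st t D Pm.mD Ψ spec
      s-bound : ∑S n sm * n ^ 4 ≤ 2 * X
      s-bound = ≤-trans (*-monoʳ-≤ (∑S n sm) (^-monoʳ-≤ n {{>-nonZero n≥1′}} (n≤1+n 4)))
        (small-total B st t D Pm.mD Ψ spec (2 ^ e) gain-e (≤-trans (s≤s (s≤s z≤n)) n≥4) n⁸≤2^e m≤n)
      l-bound : ∑S n lg * n ^ 4 ≤ X
      l-bound = Pm.absorb (∑S n lg) X (large-total B st t D Pm.mD Ψ spec (2 ^ j) y j₁ y≥1 gain-j m≤n Pm.m≤yb Pm.spread)
      l : ∀ x → 2 * x + x ≡ 3 * x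
      l = solve-∀

    -- The sum over s costs a factor n, which leaves n⁷ of the saving 2^e ≥ n⁸; n⁴ is all that is
    -- claimed.
    dup-bound : ∀ B → MaxStr N h B → (Φ : Fin n → Subset n → Bool) →
      (∀ s v → Φ s v ≡ true → (¬ (B ∋∋ s)) × s ≢ 𝟘 × lookup v ⊑ B × ∣ v ∣ ≡ m × (∀ x → lookup v ∋∋ x → ¬ (lookup v ∋∋ x ⊕ s))) →
      sum (λ s → ∑S n (λ v → ⟦ Φ s v ⟧)) * n ^ 4 ≤ X
    dup-bound B st Φ spec = *-cancelʳ-≤ _ _ n {{>-nonZero n≥1′}} (begin
      sum f * n ^ 4 * n ≡⟨ l (sum f) (n ^ 4) n ⟩
      sum f * (n * n ^ 4) ≤⟨ *-monoʳ-≤ (sum f) (^-monoʳ-≤ n {{>-nonZero n≥1′}} (m≤m+n 5 3)) ⟩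
      sum f * n ^ 8 ≤⟨ *-monoʳ-≤ (sum f) n⁸≤2^e ⟩
      sum f * 2 ^ e ≡⟨ trans (*-comm (sum f) (2 ^ e)) (sym (sum-*ˡ (2 ^ e) f)) ⟩
      sum (λ s → 2 ^ e * f s) ≤⟨ sum-mono each ⟩
      sum {n} (λ _ → X) ≡⟨ trans (sum-const n X) (*-comm n X) ⟩
      X * n ∎)
      where
      open ≤-Reasoning
      f : Fin n → ℕ
      f s = ∑S n (λ v → ⟦ Φ s v ⟧)
      l : ∀ a b c → a * b * c ≡ a * (c * b)
      l = solve-∀
      each : ∀ s → 2 ^ e * f s ≤ X
      each s with B s ≟ᵇ true | s FinP.≟ 𝟘
      ... | yes Bs | _ = ≤-trans (≤-reflexive (trans (cong (2 ^ e *_) (ΣL-zero (allSubsets n) (λ v → cong ⟦_⟧ (¬true (λ p → proj₁ (spec s v p) Bs))))) (*-zeroʳ (2 ^ e)))) z≤n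
      ... | no _ | yes s0 = ≤-trans (≤-reflexive (trans (cong (2 ^ e *_) (ΣL-zero (allSubsets n) (λ v → cong ⟦_⟧ (¬true (λ p → proj₁ (proj₂ (spec s v p)) s0))))) (*-zeroʳ (2 ^ e)))) z≤n
      ... | no ¬Bs | no s≢0 = ≤-trans (≤-reflexive (*-comm (2 ^ e) (f s))) (single-count B st s ¬Bs s≢0 (2 ^ e) gain-e (Φ s) (λ v p → proj₂ (proj₂ (spec s v p))))

    -- Above `L` elements the hypothesis of `stability` holds; η is the largest number that
    -- `removal` admits.
    L η : ℕ
    L = N ∸ g
    η = 2 * h / 9

    module PW = Partial m b
    module T = Tree m b y L t d d η y≥1 b≥1

    2h<9M : 2 * h ≤ 9 * suc η
    2h<9M = ≤-trans (≤-reflexive (m≡m%n+[m/n]*n (2 * h) 9)) (≤-trans (+-monoˡ-≤ (η * 9) (<⇒≤ (m%n<n (2 * h) 9))) (≤-reflexive (*-comm (suc η) 9)))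

    η<h : suc η ≤ h
    η<h = *-cancelˡ-< 9 η h (begin-strict
      9 * η ≡⟨ *-comm 9 η ⟩
      η * 9 ≤⟨ m/n*n≤m (2 * h) 9 ⟩
      2 * h <⟨ *-monoˡ-< h {{>-nonZero h≥1}} (s≤s (s≤s (s≤s (z≤n {6})))) ⟩
      9 * h ∎)
      where open ≤-Reasoning

    L-large : ∀ f → L < f → θ * N < θ * f + h
    L-large f lt = begin-strict
      θ * N <⟨ m<m+n (θ * N) Pm.θ≥1 ⟩
      θ * N + θ ≡⟨ trans (+-comm (θ * N) θ) (sym (*-suc θ N)) ⟩
      θ * suc N ≤⟨ *-monoʳ-≤ θ (≤-trans (≤-reflexive (cong suc (sym (m∸n+n≡m g≤N)))) (+-monoˡ-≤ g lt)) ⟩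
      θ * (f + g) ≡⟨ *-distribˡ-+ θ f g ⟩
      θ * f + θ * g ≤⟨ +-monoʳ-≤ (θ * f) (≤-trans (≤-reflexive (*-comm θ g)) gθ≤h) ⟩
      θ * f + h ∎
      where open ≤-Reasoning

    -- A leaf of N - g elements weighs (m + b)^(N - g) instead of (m + b)^N, which saves (1 + m/b)^g
    -- ≥ 2^j. The path to the leaf costs y^t 2^(4 j₁), and `absorb` balances the two.
    far-bound : (Φ : Subset n → Bool) → (∀ v → Φ v ≡ true → SF (lookup v) × ∣ v ∣ ≡ m) →
      (∀ v → Φ v ≡ true → ∀ B → MaxStr N h B → t < # (lookup v ∩ ∁ B)) → ∑S n (λ v → ⟦ Φ v ⟧) * n ^ 4 ≤ X
    far-bound Φ spec far = Pm.absorb F X (*-cancelʳ-≤ _ _ (b ^ g) {{>-nonZero (^-pos b g b≥1)}} step₃)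
      where
      open ≤-Reasoning
      F : ℕ
      F = ∑S n (λ v → ⟦ Φ v ⟧)
      ∅ D₀ T₀ V₀ : Pr n
      ∅ = λ _ → false
      D₀ = 𝟘 ==_
      -- A sum-free set does not contain 0. It is discarded at the start, at the price of one factor
      -- b, so that no element becomes its own neighbour. The sets have the form that `pw-exclude`
      -- returns.
      T₀ = ∅ ∩ ∁ D₀
      V₀ = (λ _ → true) ∩ ∁ D₀
      #V₀ : suc (# V₀) ≡ n
      #V₀ = trans (cong (_+ # V₀) (sym (#-singleton 𝟘))) (#-∁ D₀)
      initial : T.Inv Φ T₀ V₀ ∅ t
      initial = record
        { chosen = λ i () ; fresh = λ i ()
        ; U∌0 = λ p → absurd-b (⌊⌋-intro {d = 𝟘 FinP.≟ 𝟘} refl) (not-true p)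
        ; T₂∌0 = λ ()
        ; budget = ≤-reflexive (cong (_+ t) (sum-zero _ (λ _ → refl)))
        ; outdeg = λ x _ → ≤-trans (≤-reflexive (sum-zero _ (λ z → cong ⟦_⟧ (∧-zeroʳ (V₀ z))))) z≤n
        ; indeg = λ x _ → ≤-trans (≤-reflexive (sum-zero _ (λ z → cong ⟦_⟧ (∧-zeroʳ (V₀ z))))) z≤n
        ; measure = ≤-trans (≤-trans (*-monoʳ-≤ (d + 2 * d) (≤-trans (n≤1+n _) (≤-reflexive #V₀))) meas) (m≤n+m (suc η * t) (sum (λ i → ⟦ V₀ i ⟧ * # (V₀ ∩ (λ z → ∅ (z ⊖ i)))))) }
        where
        -- The value t = 20qd is chosen for this: with α = d the measure starts at 3dn, and M t ≥
        -- (2h/9) 20qd exceeds it.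
        meas : (d + 2 * d) * n ≤ suc η * t
        meas = *-cancelˡ-≤ 9 (begin
          9 * ((d + 2 * d) * n) ≡⟨ cong (λ z → 9 * ((d + 2 * d) * z)) n≡ ⟩
          9 * ((d + 2 * d) * (q * h)) ≤⟨ m≤m+n _ (13 * (d * (q * h))) ⟩
          9 * ((d + 2 * d) * (q * h)) + 13 * (d * (q * h)) ≡⟨ l₁ d q h ⟩
          2 * h * (20 * (q * d)) ≤⟨ *-monoˡ-≤ t 2h<9M ⟩
          9 * suc η * t ≡⟨ *-assoc 9 (suc η) t ⟩
          9 * (suc η * t) ∎)
          where
          l₁ : ∀ d q h → 9 * ((d + 2 * d) * (q * h)) + 13 * (d * (q * h)) ≡ 2 * h * (20 * (q * d))
          l₁ = solve-∀
      tb : T.W Φ T₀ V₀ * (y ^ # V₀ * b ^ L) ≤ (y * b + m) ^ # V₀ * (y ^ t * (m + b) ^ L)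
      tb = T.tree Φ (≤-trans (≤-reflexive (*-comm 9 η)) (m/n*n≤m (2 * h) 9)) (≤-trans η<h (≤-trans (≤-trans (m≤m*n h q {{prime⇒nonZero pr}}) (≤-reflexive (trans (*-comm h q) (sym n≡)))) n≤dd)) L-large
        (λ v p → proj₁ (spec v p)) far n T₀ V₀ ∅ t (≤-trans (n≤1+n _) (≤-reflexive #V₀)) initial
      sumwt : F * (m ^ m * b ^ (n ∸ m)) ≤ b * T.W Φ T₀ V₀
      sumwt = begin
        F * (m ^ m * b ^ (n ∸ m)) ≡⟨ ΣL-*ʳ (allSubsets n) _ (λ v → ⟦ Φ v ⟧) ⟨
        ∑S n (λ v → ⟦ Φ v ⟧ * (m ^ m * b ^ (n ∸ m))) ≤⟨ ΣL-mono (allSubsets n) (λ v → pt v (bool-cases (Φ v))) ⟩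
        ∑S n (λ v → b * (⟦ Φ v ⟧ * PW.pw T₀ V₀ v)) ≡⟨ ΣL-* (allSubsets n) b _ ⟩
        b * T.W Φ T₀ V₀ ∎
        where
        b¹ : b ^ # ((λ _ → true) ∩ D₀) ≡ b
        b¹ = trans (cong (b ^_) (#-singleton 𝟘)) (*-identityʳ b)
        l : ∀ b w → 1 * (b * w) ≡ b * (1 * w)
        l = solve-∀
        pt : ∀ v → Φ v ≡ true ⊎ Φ v ≡ false → ⟦ Φ v ⟧ * (m ^ m * b ^ (n ∸ m)) ≤ b * (⟦ Φ v ⟧ * PW.pw T₀ V₀ v)
        pt v (inj₂ p) = subst (λ c → ⟦ c ⟧ * (m ^ m * b ^ (n ∸ m)) ≤ b * (⟦ c ⟧ * PW.pw T₀ V₀ v)) (sym p) z≤n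
        pt v (inj₁ p) = subst (λ c → ⟦ c ⟧ * (m ^ m * b ^ (n ∸ m)) ≤ b * (⟦ c ⟧ * PW.pw T₀ V₀ v)) (sym p) (≤-trans (*-monoʳ-≤ 1 (begin
          m ^ m * b ^ (n ∸ m) ≡⟨ cong (λ z → m ^ z * b ^ (n ∸ z)) (proj₂ (spec v p)) ⟨
          m ^ ∣ v ∣ * b ^ (n ∸ ∣ v ∣) ≡⟨ Weights.weight-size m b v ⟨
          Weights.weight m b v ≡⟨ pw-all m b ∅ v ⟨
          PW.pw ∅ (λ _ → true) v ≤⟨ PW.pw-exclude ∅ (λ _ → true) D₀ v (λ i e → ¬true (λ vi → proj₁ (spec v p) 𝟘 𝟘 (zero-in i e vi) (zero-in i e vi) (trans (cong (lookup v) (⊕𝟘 𝟘)) (zero-in i e vi)))) ⟩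
          b ^ # ((λ _ → true) ∩ D₀) * PW.pw T₀ V₀ v ≡⟨ cong (_* PW.pw T₀ V₀ v) b¹ ⟩
          b * PW.pw T₀ V₀ v ∎)) (≤-reflexive (l b (PW.pw T₀ V₀ v))))
          where
          zero-in : ∀ i → D₀ i ≡ true → lookup v ∋∋ i → lookup v ∋∋ 𝟘
          zero-in i e vi = trans (cong (lookup v) (⌊⌋-true {d = 𝟘 FinP.≟ i} e)) vi
      step₁ : F * (m ^ m * b ^ (n ∸ m)) * b ^ L ≤ 2 ^ (4 * j₁) * b ^ n * (y ^ t * (m + b) ^ L)
      step₁ = *-cancelʳ-≤ _ _ (y ^ n) {{>-nonZero (^-pos y n y≥1)}} (begin
        F * (m ^ m * b ^ (n ∸ m)) * b ^ L * y ^ n ≤⟨ *-monoˡ-≤ (y ^ n) (*-monoˡ-≤ (b ^ L) sumwt) ⟩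
        b * W₀ * b ^ L * y ^ n ≡⟨ cong (λ z → b * W₀ * b ^ L * y ^ z) (sym #V₀) ⟩
        b * W₀ * b ^ L * (y * y ^ # V₀) ≡⟨ l₁ b W₀ (b ^ L) y (y ^ # V₀) ⟩
        y * b * (W₀ * (y ^ # V₀ * b ^ L)) ≤⟨ *-mono-≤ (m≤m+n (y * b) m) tb ⟩
        (y * b + m) * ((y * b + m) ^ # V₀ * (y ^ t * (m + b) ^ L)) ≡⟨ *-assoc (y * b + m) _ _ ⟨
        (y * b + m) ^ suc (# V₀) * (y ^ t * (m + b) ^ L) ≡⟨ cong (λ z → (y * b + m) ^ z * (y ^ t * (m + b) ^ L)) #V₀ ⟩
        (y * b + m) ^ n * (y ^ t * (m + b) ^ L) ≤⟨ *-monoˡ-≤ _ (exp-bound (y * b) m n j₁ m≥1 Pm.m≤yb Pm.spread) ⟩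
        2 ^ (4 * j₁) * (y * b) ^ n * (y ^ t * (m + b) ^ L) ≡⟨ cong (λ z → 2 ^ (4 * j₁) * z * (y ^ t * (m + b) ^ L)) (^-distrib-* y b n) ⟩
        2 ^ (4 * j₁) * (y ^ n * b ^ n) * (y ^ t * (m + b) ^ L) ≡⟨ l₂ (2 ^ (4 * j₁)) (y ^ n) (b ^ n) (y ^ t * (m + b) ^ L) ⟩
        2 ^ (4 * j₁) * b ^ n * (y ^ t * (m + b) ^ L) * y ^ n ∎)
        where
        W₀ = T.W Φ T₀ V₀
        l₁ : ∀ b w c y p → b * w * c * (y * p) ≡ y * b * (w * (p * c))
        l₁ = solve-∀
        l₂ : ∀ a y b z → a * (y * b) * z ≡ a * b * z * y
        l₂ = solve-∀
      step₂ : F * m ^ m * b ^ L ≤ 2 ^ (4 * j₁) * b ^ m * (y ^ t * (m + b) ^ L)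
      step₂ = *-cancelʳ-≤ _ _ (b ^ (n ∸ m)) {{>-nonZero (^-pos b (n ∸ m) b≥1)}} (begin
        F * m ^ m * b ^ L * b ^ (n ∸ m) ≡⟨ l₁ F (m ^ m) (b ^ L) (b ^ (n ∸ m)) ⟩
        F * (m ^ m * b ^ (n ∸ m)) * b ^ L ≤⟨ step₁ ⟩
        2 ^ (4 * j₁) * b ^ n * (y ^ t * (m + b) ^ L) ≡⟨ cong (λ z → 2 ^ (4 * j₁) * z * (y ^ t * (m + b) ^ L)) (trans (cong (b ^_) (sym (m+[n∸m]≡n m≤n))) (^-distribˡ-+-* b m (n ∸ m))) ⟩
        2 ^ (4 * j₁) * (b ^ m * b ^ (n ∸ m)) * (y ^ t * (m + b) ^ L) ≡⟨ l₂ (2 ^ (4 * j₁)) (b ^ m) (b ^ (n ∸ m)) (y ^ t * (m + b) ^ L) ⟩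
        2 ^ (4 * j₁) * b ^ m * (y ^ t * (m + b) ^ L) * b ^ (n ∸ m) ∎)
        where
        l₁ : ∀ f m l c → f * m * l * c ≡ f * (m * c) * l
        l₁ = solve-∀
        l₂ : ∀ a b c z → a * (b * c) * z ≡ a * b * z * c
        l₂ = solve-∀
      L+g : L + g ≡ m + b
      L+g = trans (m∸n+n≡m g≤N) N≡
      step₃ : F * 2 ^ j * b ^ g ≤ X * y ^ t * 2 ^ (4 * j₁) * b ^ g
      step₃ = *-cancelʳ-≤ _ _ (m ^ m * b ^ L) {{>-nonZero (*-mono-≤ (^-pos m m m≥1) (^-pos b L b≥1))}} (begin
        F * 2 ^ j * b ^ g * (m ^ m * b ^ L) ≡⟨ l₁ F (2 ^ j) (b ^ g) (m ^ m) (b ^ L) ⟩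
        F * m ^ m * b ^ L * (2 ^ j * b ^ g) ≤⟨ *-mono-≤ step₂ (subst (λ z → 2 ^ j * b ^ g ≤ z ^ g) (+-comm b m) (power-gap j g b m m≥1 Pm.gain-far)) ⟩
        2 ^ (4 * j₁) * b ^ m * (y ^ t * (m + b) ^ L) * (m + b) ^ g ≡⟨ l₂ (2 ^ (4 * j₁)) (b ^ m) (y ^ t) ((m + b) ^ L) ((m + b) ^ g) ⟩
        2 ^ (4 * j₁) * b ^ m * y ^ t * ((m + b) ^ L * (m + b) ^ g) ≡⟨ cong (2 ^ (4 * j₁) * b ^ m * y ^ t *_) (trans (sym (^-distribˡ-+-* (m + b) L g)) (cong ((m + b) ^_) L+g)) ⟩
        2 ^ (4 * j₁) * b ^ m * y ^ t * (m + b) ^ (m + b) ≤⟨ *-monoʳ-≤ (2 ^ (4 * j₁) * b ^ m * y ^ t) (≤-trans (mode-bound m b) (≤-reflexive (cong (λ z → suc z * ((z C m) * (m ^ m * b ^ b))) (sym N≡)))) ⟩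
        2 ^ (4 * j₁) * b ^ m * y ^ t * (suc N * (C₀ * (m ^ m * b ^ b))) ≡⟨ l₃ (2 ^ (4 * j₁)) (b ^ m) (y ^ t) (suc N) C₀ (m ^ m) (b ^ b) ⟩
        X * y ^ t * 2 ^ (4 * j₁) * (m ^ m * (b ^ m * b ^ b)) ≡⟨ cong (λ z → X * y ^ t * 2 ^ (4 * j₁) * (m ^ m * z)) (trans (sym (^-distribˡ-+-* b m b)) (trans (cong (b ^_) (trans (sym L+g) (+-comm L g))) (^-distribˡ-+-* b g L))) ⟩
        X * y ^ t * 2 ^ (4 * j₁) * (m ^ m * (b ^ g * b ^ L)) ≡⟨ l₄ (X * y ^ t * 2 ^ (4 * j₁)) (m ^ m) (b ^ g) (b ^ L) ⟩
        X * y ^ t * 2 ^ (4 * j₁) * b ^ g * (m ^ m * b ^ L) ∎)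
        where
        l₁ : ∀ f p g m l → f * p * g * (m * l) ≡ f * m * l * (p * g)
        l₁ = solve-∀
        l₂ : ∀ a b y l g → a * b * (y * l) * g ≡ a * b * y * (l * g)
        l₂ = solve-∀
        l₃ : ∀ a b y s c m d → a * b * y * (s * (c * (m * d))) ≡ s * c * y * a * (m * (b * d))
        l₃ = solve-∀
        l₄ : ∀ x m g l → x * (m * (g * l)) ≡ x * g * (m * l)
        l₄ = solve-∀

  -- The exceptional families

  module Families (m : ℕ) where

    C₁ : ℕ
    C₁ = N C m

    opaque
      member : Subset n → Bool
      member v = ⌊ SF? (lookup v) ×-dec (∣ v ∣ ≟ m) ⌋

      member-true : ∀ v → member v ≡ true → SF (lookup v) × ∣ v ∣ ≡ m
      member-true v p = ⌊⌋-true {d = SF? (lookup v) ×-dec (∣ v ∣ ≟ m)} p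

      member-intro : ∀ v → SF (lookup v) → ∣ v ∣ ≡ m → member v ≡ true
      member-intro v a b = ⌊⌋-intro {d = SF? (lookup v) ×-dec (∣ v ∣ ≟ m)} (a , b)

    covered contained stray : Subset n → Bool
    covered v = anyS (λ w → isMax w ∧ subb v (lookup w))
    contained v = member v ∧ covered v
    stray v = member v ∧ not (covered v)

    fits : Subset n → Subset n → Bool
    fits w v = subb v (lookup w) ∧ (∣ v ∣ ≡ᵇ m)

    fits-true : ∀ w v → fits w v ≡ true → lookup v ⊑ lookup w × ∣ v ∣ ≡ m
    fits-true w v p = subb-true v (lookup w) (proj₁ (∧-true {subb v (lookup w)} p)) , ≡ᵇ-true (proj₂ (∧-true {subb v (lookup w)} p))

    split : Subset n → Fin n → Subset n → Bool
    split w s v = (not (lookup w s) ∧ not (𝟘 == s)) ∧ (fits w v ∧ not (anyF (λ x → lookup v x ∧ lookup v (x ⊕ s))))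

    split-true : ∀ w s v → split w s v ≡ true →
      (¬ (lookup w ∋∋ s)) × s ≢ 𝟘 × lookup v ⊑ lookup w × ∣ v ∣ ≡ m × (∀ x → lookup v ∋∋ x → ¬ (lookup v ∋∋ x ⊕ s))
    split-true w s v p = (λ ws → absurd-b ws (not-true (proj₁ (∧-true {not (lookup w s)} p₁)))) ,
        (λ s0 → absurd-b (⌊⌋-intro {d = 𝟘 FinP.≟ s} (sym s0)) (not-true (proj₂ (∧-true {not (lookup w s)} p₁)))) ,
        proj₁ (fits-true w v (proj₁ (∧-true {fits w v} p₂))) , proj₂ (fits-true w v (proj₁ (∧-true {fits w v} p₂))) ,
        λ x a b → absurd-b (anyF-intro (λ x → lookup v x ∧ lookup v (x ⊕ s)) x (∧-intro a b)) (not-true (proj₂ (∧-true {fits w v} p₂)))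
      where
      p₁ : not (lookup w s) ∧ not (𝟘 == s) ≡ true
      p₁ = proj₁ (∧-true {not (lookup w s) ∧ not (𝟘 == s)} p)
      p₂ : fits w v ∧ not (anyF (λ x → lookup v x ∧ lookup v (x ⊕ s))) ≡ true
      p₂ = proj₂ (∧-true {not (lookup w s) ∧ not (𝟘 == s)} p)

    -- Every set lying in w and in another maximum sum-free set is ambiguous for w.
    ambiguous : Subset n → Subset n → Bool
    ambiguous w v = anyF (λ s → split w s v)

    #contained #stray #ambiguous : ℕ
    #contained = ∑S n (λ v → ⟦ contained v ⟧)
    #stray = ∑S n (λ v → ⟦ stray v ⟧)
    #ambiguous = ∑S n (λ w → ⟦ isMax w ⟧ * ∑S n (λ v → ⟦ ambiguous w v ⟧))

    SF-⊑ : ∀ {A B : Pr n} → A ⊑ B → SF B → SF A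
    SF-⊑ AB sf x y p r s = sf x y (AB x p) (AB y r) (AB (x ⊕ y) s)

    fits-contained : ∀ w v → isMax w ≡ true → fits w v ≡ true → contained v ≡ true
    fits-contained w v mw f = ∧-intro (member-intro v (SF-⊑ (proj₁ (fits-true w v f)) (proj₁ (isMax-true w mw))) (proj₂ (fits-true w v f)))
      (anyS-intro (λ w → isMax w ∧ subb v (lookup w)) w (∧-intro mw (proj₁ (∧-true {subb v (lookup w)} f))))

    contained-fits : ∀ v → contained v ≡ true → ∃[ w ] (isMax w ≡ true × fits w v ≡ true)
    contained-fits v p = go (anyS-true (λ w → isMax w ∧ subb v (lookup w)) (proj₂ (∧-true {member v} p)))
      where
      go : ∃[ w ] isMax w ∧ subb v (lookup w) ≡ true → ∃[ w ] (isMax w ≡ true × fits w v ≡ true)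
      go (w , r) = w , proj₁ (∧-true {isMax w} r) , ∧-intro (proj₂ (∧-true {isMax w} r)) (≡ᵇ-intro (proj₂ (member-true v (proj₁ (∧-true {member v} p)))))

    fits-count : ∀ w → isMax w ≡ true → ∑S n (λ v → ⟦ fits w v ⟧) ≡ C₁
    fits-count w mw = trans (count-subsets (lookup w) m) (cong (_C m) (proj₂ (isMax-true w mw)))

    incidences : ∑S n (λ v → ∑S n (λ w → ⟦ isMax w ⟧ * ⟦ fits w v ⟧)) ≡ #max * C₁
    incidences = trans (ΣL-ΣL (allSubsets n) (allSubsets n) (λ v w → ⟦ isMax w ⟧ * ⟦ fits w v ⟧))
        (trans (ΣL-cong (allSubsets n) (λ w → trans (ΣL-* (allSubsets n) ⟦ isMax w ⟧ (λ v → ⟦ fits w v ⟧)) (pt w (bool-cases (isMax w))))) (ΣL-*ʳ (allSubsets n) C₁ (λ w → ⟦ isMax w ⟧)))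
      where
      pt : ∀ w → isMax w ≡ true ⊎ isMax w ≡ false → ⟦ isMax w ⟧ * ∑S n (λ v → ⟦ fits w v ⟧) ≡ ⟦ isMax w ⟧ * C₁
      pt w (inj₁ p) = cong (⟦ isMax w ⟧ *_) (fits-count w p)
      pt w (inj₂ p) = trans (cong (λ b → ⟦ b ⟧ * ∑S n (λ v → ⟦ fits w v ⟧)) p) (cong (λ b → ⟦ b ⟧ * C₁) (sym p))

    contained≤ : #contained ≤ #max * C₁
    contained≤ = ≤-trans (ΣL-mono (allSubsets n) (λ v → ⟦⟧-elim (contained v) (λ p → go v (contained-fits v p)))) (≤-reflexive incidences)
      where
      go : ∀ v → ∃[ w ] (isMax w ≡ true × fits w v ≡ true) → 1 ≤ ∑S n (λ w → ⟦ isMax w ⟧ * ⟦ fits w v ⟧)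
      go v (w , mw , f) = ≤-trans (≤-reflexive (sym (cong₂ (λ a b → ⟦ a ⟧ * ⟦ b ⟧) mw f))) (term≤∑S (λ w → ⟦ isMax w ⟧ * ⟦ fits w v ⟧) w)

    C≤contained : C₁ ≤ #contained
    C≤contained = ≤-trans (≤-reflexive (sym (fits-count w mw))) (ΣL-mono (allSubsets n) (λ v → ⟦⟧-mono (fits-contained w v mw)))
      where
      w : Subset n
      w = tabulate (proj₁ max-exists)
      mw : isMax w ≡ true
      mw = isMax-tabulate (proj₁ max-exists) (proj₁ (proj₂ max-exists)) (proj₂ (proj₂ max-exists))

    -- Two different maximum sets have the same size, so some s lies in `w₀` but not in `w`. As `w₀`
    -- is sum-free, no two elements of v differ by s.
    fits-two : ∀ w₀ w v → isMax w₀ ≡ true → isMax w ≡ true → fits w₀ v ≡ true → fits w v ≡ true → eqS w₀ w ≡ true ⊎ ambiguous w v ≡ true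
    fits-two w₀ w v m₀ mw f₀ f = go (bool-cases (anyF (lookup w₀ ∩ ∁ (lookup w))))
      where
      go : anyF (lookup w₀ ∩ ∁ (lookup w)) ≡ true ⊎ anyF (lookup w₀ ∩ ∁ (lookup w)) ≡ false → eqS w₀ w ≡ true ⊎ ambiguous w v ≡ true
      go (inj₂ e) = inj₁ (eqS-intro (lookup-ext w₀ w (λ x → bool-ext (sub x) (⊑-eq {A = lookup w₀} {lookup w} sub (≤-reflexive (trans (proj₂ (isMax-true w mw)) (sym (proj₂ (isMax-true w₀ m₀))))) x))))
        where
        sub : lookup w₀ ⊑ lookup w
        sub x p = [ id , (λ r → absurd-b (anyF-intro (lookup w₀ ∩ ∁ (lookup w)) x (∧-intro p (not-intro r))) e) ]′ (bool-cases (lookup w x))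
      go (inj₁ e) = inj₂ (found (anyF-true (lookup w₀ ∩ ∁ (lookup w)) e))
        where
        sf₀ : SF (lookup w₀)
        sf₀ = proj₁ (isMax-true w₀ m₀)
        v⊑ : lookup v ⊑ lookup w₀
        v⊑ = proj₁ (fits-true w₀ v f₀)
        found : ∃[ s ] (lookup w₀ ∩ ∁ (lookup w)) s ≡ true → ambiguous w v ≡ true
        found (s , r) = anyF-intro (λ s → split w s v) s (∧-intro (∧-intro (proj₂ (∧-true {lookup w₀ s} r)) (not-intro′ s≢0)) (∧-intro f (not-intro′ avoid)))
          where
          ws : lookup w₀ ∋∋ s
          ws = proj₁ (∧-true {lookup w₀ s} r)
          s≢0 : ¬ ((𝟘 == s) ≡ true)
          s≢0 z = sf₀ s s ws ws (trans (cong (lookup w₀) (trans (cong (_⊕ s) (sym (⌊⌋-true {d = 𝟘 FinP.≟ s} z))) (⊕-identityˡ s))) ws)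
          avoid : ¬ (anyF (λ x → lookup v x ∧ lookup v (x ⊕ s)) ≡ true)
          avoid a = bad (anyF-true (λ x → lookup v x ∧ lookup v (x ⊕ s)) a)
            where
            bad : ∃[ x ] lookup v x ∧ lookup v (x ⊕ s) ≡ true → ⊥
            bad (x , c) = sf₀ x s (v⊑ x (proj₁ (∧-true {lookup v x} c))) ws (v⊑ (x ⊕ s) (proj₂ (∧-true {lookup v x} c)))

    -- For each contained v one maximum set is fixed; by `fits-two` all others that contain v are
    -- paid for by `#ambiguous`.
    max*C≤ : #max * C₁ ≤ #contained + #ambiguous
    max*C≤ = begin
      #max * C₁ ≡⟨ incidences ⟨
      ∑S n (λ v → ∑S n (λ w → ⟦ isMax w ⟧ * ⟦ fits w v ⟧)) ≤⟨ ΣL-mono (allSubsets n) (λ v → pt v (bool-cases (contained v))) ⟩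
      ∑S n (λ v → ⟦ contained v ⟧ + ∑S n (λ w → ⟦ isMax w ⟧ * ⟦ ambiguous w v ⟧)) ≡⟨ ΣL-+ (allSubsets n) (λ v → ⟦ contained v ⟧) _ ⟩
      #contained + ∑S n (λ v → ∑S n (λ w → ⟦ isMax w ⟧ * ⟦ ambiguous w v ⟧)) ≡⟨ cong (#contained +_) (trans (ΣL-ΣL (allSubsets n) (allSubsets n) (λ v w → ⟦ isMax w ⟧ * ⟦ ambiguous w v ⟧)) (ΣL-cong (allSubsets n) (λ w → ΣL-* (allSubsets n) ⟦ isMax w ⟧ (λ v → ⟦ ambiguous w v ⟧)))) ⟩
      #contained + #ambiguous ∎
      where
      open ≤-Reasoning
      product≤ : ∀ a b {c} → (a ≡ true → b ≡ true → 1 ≤ c) → ⟦ a ⟧ * ⟦ b ⟧ ≤ c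
      product≤ true true h = h refl refl
      product≤ true false h = z≤n
      product≤ false b h = z≤n
      pt : ∀ v → contained v ≡ true ⊎ contained v ≡ false → ∑S n (λ w → ⟦ isMax w ⟧ * ⟦ fits w v ⟧) ≤ ⟦ contained v ⟧ + ∑S n (λ w → ⟦ isMax w ⟧ * ⟦ ambiguous w v ⟧)
      pt v (inj₂ e) = ≤-trans (≤-reflexive (ΣL-zero (allSubsets n) (λ w → n≤0⇒n≡0 (product≤ (isMax w) (fits w v) (λ mw f → absurd-b (fits-contained w v mw f) e))))) z≤n
      pt v (inj₁ e) = go (contained-fits v e)
        where
        go : ∃[ w ] (isMax w ≡ true × fits w v ≡ true) → ∑S n (λ w → ⟦ isMax w ⟧ * ⟦ fits w v ⟧) ≤ ⟦ contained v ⟧ + ∑S n (λ w → ⟦ isMax w ⟧ * ⟦ ambiguous w v ⟧)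
        go (w₀ , m₀ , f₀) = begin
          ∑S n (λ w → ⟦ isMax w ⟧ * ⟦ fits w v ⟧) ≤⟨ ΣL-mono (allSubsets n) (λ w → product≤ (isMax w) (fits w v) (λ mw f → each w mw (fits-two w₀ w v m₀ mw f₀ f))) ⟩
          ∑S n (λ w → ⟦ eqS w₀ w ⟧ * 1 + ⟦ isMax w ⟧ * ⟦ ambiguous w v ⟧) ≡⟨ ΣL-+ (allSubsets n) (λ w → ⟦ eqS w₀ w ⟧ * 1) _ ⟩
          ∑S n (λ w → ⟦ eqS w₀ w ⟧ * 1) + ∑S n (λ w → ⟦ isMax w ⟧ * ⟦ ambiguous w v ⟧) ≡⟨ cong (_+ ∑S n (λ w → ⟦ isMax w ⟧ * ⟦ ambiguous w v ⟧)) (trans (∑S-δ w₀ (λ _ → 1)) (cong ⟦_⟧ (sym e))) ⟩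
          ⟦ contained v ⟧ + ∑S n (λ w → ⟦ isMax w ⟧ * ⟦ ambiguous w v ⟧) ∎
          where
          each : ∀ w → isMax w ≡ true → eqS w₀ w ≡ true ⊎ ambiguous w v ≡ true → 1 ≤ ⟦ eqS w₀ w ⟧ * 1 + ⟦ isMax w ⟧ * ⟦ ambiguous w v ⟧
          each w mw (inj₁ r) = ≤-trans (≤-reflexive (cong (λ z → ⟦ z ⟧ * 1) (sym r))) (m≤m+n _ _)
          each w mw (inj₂ r) = ≤-trans (≤-reflexive (cong₂ (λ y z → ⟦ y ⟧ * ⟦ z ⟧) (sym mw) (sym r))) (m≤n+m _ _)

    #max≤n : #max ≤ n
    #max≤n = ≤-trans (≤-trans (≤-reflexive (sym (+-identityʳ #max))) (*-monoˡ-≤ #max (mult≥1 (1 ≤b k)))) (≤-trans (≤-reflexive (sym max-count)) (#≤n order-q))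
      where
      mult≥1 : ∀ c → 1 ≤ (if c then 2 else 1)
      mult≥1 true = s≤s z≤n
      mult≥1 false = s≤s z≤n

    sum-max≤ : ∀ (f : Subset n → ℕ) c z → (∀ w → isMax w ≡ true → f w * c ≤ z) → ∑S n (λ w → ⟦ isMax w ⟧ * f w) * c ≤ n * z
    sum-max≤ f c z h = begin
      ∑S n (λ w → ⟦ isMax w ⟧ * f w) * c ≡⟨ ΣL-*ʳ (allSubsets n) c (λ w → ⟦ isMax w ⟧ * f w) ⟨
      ∑S n (λ w → ⟦ isMax w ⟧ * f w * c) ≤⟨ ΣL-mono (allSubsets n) (λ w → ≤-trans (≤-reflexive (*-assoc ⟦ isMax w ⟧ (f w) c)) (pt w (bool-cases (isMax w)))) ⟩
      ∑S n (λ w → ⟦ isMax w ⟧ * z) ≡⟨ ΣL-*ʳ (allSubsets n) z (λ w → ⟦ isMax w ⟧) ⟩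
      #max * z ≤⟨ *-monoˡ-≤ z #max≤n ⟩
      n * z ∎
      where
      open ≤-Reasoning
      pt : ∀ w → isMax w ≡ true ⊎ isMax w ≡ false → ⟦ isMax w ⟧ * (f w * c) ≤ ⟦ isMax w ⟧ * z
      pt w (inj₁ p) = *-monoʳ-≤ ⟦ isMax w ⟧ (h w p)
      pt w (inj₂ p) = subst (λ b → ⟦ b ⟧ * (f w * c) ≤ ⟦ b ⟧ * z) (sym p) z≤n

    isMax-structure : ∀ w → isMax w ≡ true → MaxStr N h (lookup w)
    isMax-structure w p = max-structure (lookup w) (proj₁ (isMax-true w p)) (proj₂ (isMax-true w p))

    Conclusion : Set
    Conclusion = #stray * n ≤ C₁ × #ambiguous * n ≤ C₁

    module Sparse (b : ℕ) (N≡ : suc k * h ≡ m + b) (h≤θb : h ≤ 9 * suc k * b) (reg : Regime q k h n m) where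
      module Est = Estimates m b N≡ h≤θb reg
      open Est using (X; t)
      open Regime reg using (n≥4)

      reduce : ∀ f → f * n ^ 4 ≤ n * (n * X) → f * n ≤ C₁
      reduce f le = *-cancelʳ-≤ (f * n) C₁ (n ^ 3) {{>-nonZero (^-pos n 3 Est.n≥1′)}} (begin
        f * n * n ^ 3 ≡⟨ *-assoc f n (n ^ 3) ⟩
        f * n ^ 4 ≤⟨ le ⟩
        n * (n * X) ≤⟨ *-monoʳ-≤ n (*-monoʳ-≤ n Est.X≤nC) ⟩
        n * (n * (n * C₁)) ≡⟨ l n C₁ ⟩
        C₁ * n ^ 3 ∎)
        where
        open ≤-Reasoning
        l : ∀ n c → n * (n * (n * c)) ≡ c * (n * (n * (n * 1)))
        l = solve-∀

      X≤nX : X ≤ n * X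
      X≤nX = ≤-trans (≤-reflexive (sym (+-identityʳ X))) (*-monoˡ-≤ X Est.n≥1′)

      ambiguous-few : #ambiguous * n ≤ C₁
      ambiguous-few = reduce #ambiguous (≤-trans (sum-max≤ (λ w → ∑S n (λ v → ⟦ ambiguous w v ⟧)) (n ^ 4) X each) (*-monoʳ-≤ n X≤nX))
        where
        each : ∀ w → isMax w ≡ true → ∑S n (λ v → ⟦ ambiguous w v ⟧) * n ^ 4 ≤ X
        each w mw = ≤-trans (*-monoˡ-≤ (n ^ 4) (≤-trans (ΣL-mono (allSubsets n) (λ v → ⟦⟧-elim (ambiguous w v) (λ p → some v (anyF-true (λ s → split w s v) p))))
            (≤-reflexive (ΣL-sum (allSubsets n) (λ v s → ⟦ split w s v ⟧))))) (Est.dup-bound (lookup w) (isMax-structure w mw) (split w) (λ s v → split-true w s v))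
          where
          some : ∀ v → ∃[ s ] split w s v ≡ true → 1 ≤ sum (λ s → ⟦ split w s v ⟧)
          some v (s , p) = #>0 (λ s → split w s v) s p

      near : Subset n → Subset n → Bool
      near w v = stray v ∧ (# (lookup v ∩ ∁ (lookup w)) ≤b t)

      far : Subset n → Bool
      far v = stray v ∧ not (anyS (λ w → isMax w ∧ (# (lookup v ∩ ∁ (lookup w)) ≤b t)))

      stray-member : ∀ v → stray v ≡ true → SF (lookup v) × ∣ v ∣ ≡ m
      stray-member v p = member-true v (proj₁ (∧-true {member v} p))

      near-few : ∀ w → isMax w ≡ true → ∑S n (λ v → ⟦ near w v ⟧) * n ^ 4 ≤ 3 * X
      near-few w mw = Est.near-bound (lookup w) (isMax-structure w mw) (near w) (λ v p → spec v (∧-true {stray v} p))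
        where
        spec : ∀ v → stray v ≡ true × (# (lookup v ∩ ∁ (lookup w)) ≤b t) ≡ true →
          SF (lookup v) × ∣ v ∣ ≡ m × 1 ≤ # (lookup v ∩ ∁ (lookup w)) × # (lookup v ∩ ∁ (lookup w)) ≤ t
        spec v (p , r) = proj₁ (stray-member v p) , proj₂ (stray-member v p) , n≢0⇒n>0 (λ e → out (sub e)) , ≤b-true r
          where
          sub : # (lookup v ∩ ∁ (lookup w)) ≡ 0 → lookup v ⊑ lookup w
          sub e x vx = [ id , (λ wx → ⊥-elim (<⇒≱ (#>0 (lookup v ∩ ∁ (lookup w)) x (∧-intro vx (not-intro wx))) (≤-reflexive e))) ]′ (bool-cases (lookup w x))
          out : ¬ (lookup v ⊑ lookup w)
          out s = absurd-b (anyS-intro (λ w → isMax w ∧ subb v (lookup w)) w (∧-intro mw (subb-intro v (lookup w) s))) (not-true (proj₂ (∧-true {member v} p)))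

      far-few : ∑S n (λ v → ⟦ far v ⟧) * n ^ 4 ≤ X
      far-few = Est.far-bound far (λ v p → stray-member v (proj₁ (∧-true {stray v} p))) (λ v p B st → ≰⇒> (λ le → apart v (proj₂ (∧-true {stray v} p)) B st le))
        where
        apart : ∀ v → not (anyS (λ w → isMax w ∧ (# (lookup v ∩ ∁ (lookup w)) ≤b t))) ≡ true → ∀ B → MaxStr N h B → ¬ (# (lookup v ∩ ∁ B) ≤ t)
        apart v p B st le = absurd-b (anyS-intro (λ w → isMax w ∧ (# (lookup v ∩ ∁ (lookup w)) ≤b t)) (tabulate B)
          (∧-intro (isMax-tabulate B (MaxStr.sumfree st) (MaxStr.size st))
            (≤b-intro (≤-trans (≤-reflexive (#-cong (λ x → cong (λ z → lookup v x ∧ not z) (lookup∘tabulate B x)))) le)))) (not-true p)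

      stray-few : #stray * n ≤ C₁
      stray-few = reduce #stray (begin
        #stray * n ^ 4 ≤⟨ *-monoˡ-≤ (n ^ 4) cover ⟩
        (F + K) * n ^ 4 ≡⟨ *-distribʳ-+ (n ^ 4) F K ⟩
        F * n ^ 4 + K * n ^ 4 ≤⟨ +-mono-≤ far-few (sum-max≤ (λ w → ∑S n (λ v → ⟦ near w v ⟧)) (n ^ 4) (3 * X) near-few) ⟩
        X + n * (3 * X) ≤⟨ +-monoˡ-≤ (n * (3 * X)) X≤nX ⟩
        n * X + n * (3 * X) ≡⟨ l n X ⟩
        n * (4 * X) ≤⟨ *-monoʳ-≤ n (*-monoˡ-≤ X n≥4) ⟩
        n * (n * X) ∎)
        where
        open ≤-Reasoning
        l : ∀ n x → n * x + n * (3 * x) ≡ n * (4 * x)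
        l = solve-∀
        F K : ℕ
        F = ∑S n (λ v → ⟦ far v ⟧)
        K = ∑S n (λ w → ⟦ isMax w ⟧ * ∑S n (λ v → ⟦ near w v ⟧))
        cover : #stray ≤ F + K
        cover = begin
          #stray ≤⟨ ΣL-mono (allSubsets n) (λ v → ⟦⟧-elim (stray v) (λ p → pt v p (bool-cases (anyS (λ w → isMax w ∧ (# (lookup v ∩ ∁ (lookup w)) ≤b t)))))) ⟩
          ∑S n (λ v → ⟦ far v ⟧ + ∑S n (λ w → ⟦ isMax w ⟧ * ⟦ near w v ⟧)) ≡⟨ ΣL-+ (allSubsets n) (λ v → ⟦ far v ⟧) _ ⟩
          F + ∑S n (λ v → ∑S n (λ w → ⟦ isMax w ⟧ * ⟦ near w v ⟧)) ≡⟨ cong (F +_) (trans (ΣL-ΣL (allSubsets n) (allSubsets n) (λ v w → ⟦ isMax w ⟧ * ⟦ near w v ⟧)) (ΣL-cong (allSubsets n) (λ w → ΣL-* (allSubsets n) ⟦ isMax w ⟧ (λ v → ⟦ near w v ⟧)))) ⟩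
          F + K ∎
          where
          pt : ∀ v → stray v ≡ true → anyS (λ w → isMax w ∧ (# (lookup v ∩ ∁ (lookup w)) ≤b t)) ≡ true ⊎ anyS (λ w → isMax w ∧ (# (lookup v ∩ ∁ (lookup w)) ≤b t)) ≡ false →
            1 ≤ ⟦ far v ⟧ + ∑S n (λ w → ⟦ isMax w ⟧ * ⟦ near w v ⟧)
          pt v p (inj₂ e) = ≤-trans (≤-reflexive (cong ⟦_⟧ (sym (∧-intro {stray v} p (not-intro e))))) (m≤m+n _ _)
          pt v p (inj₁ e) = found (anyS-true (λ w → isMax w ∧ (# (lookup v ∩ ∁ (lookup w)) ≤b t)) e)
            where
            found : ∃[ w ] isMax w ∧ (# (lookup v ∩ ∁ (lookup w)) ≤b t) ≡ true → 1 ≤ ⟦ far v ⟧ + ∑S n (λ w → ⟦ isMax w ⟧ * ⟦ near w v ⟧)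
            found (w , r) = ≤-trans (≤-trans (≤-reflexive (cong₂ (λ y z → ⟦ y ⟧ * ⟦ z ⟧) (sym (proj₁ (∧-true {isMax w} r))) (sym (∧-intro {stray v} p (proj₂ (∧-true {isMax w} r))))))
              (term≤∑S (λ w → ⟦ isMax w ⟧ * ⟦ near w v ⟧) w)) (m≤n+m _ ⟦ far v ⟧)

    -- For m this close to N the weights degenerate, but both exceptional families are empty:
    -- stability applies to each m-set, and no m-set fits into two maximum sets.
    module Dense (big : θ * N < θ * m + h) where
      no-stray : #stray ≡ 0
      no-stray = ΣL-zero (allSubsets n) (λ v → cong ⟦_⟧ (¬true (λ p → out v (member-true v (proj₁ (∧-true {member v} p))) (not-true (proj₂ (∧-true {member v} p))))))
        where
        out : ∀ v → SF (lookup v) × ∣ v ∣ ≡ m → covered v ≡ false → ⊥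
        out v (sf , e) nc = go (stability (lookup v) sf (subst (λ z → θ * N < θ * z + h) (trans (sym e) (sym (#-lookup v))) big))
          where
          go : ∃[ B ] (lookup v ⊑ B × MaxStr N h B) → ⊥
          go (B , vB , st) = absurd-b (anyS-intro (λ w → isMax w ∧ subb v (lookup w)) (tabulate B) (∧-intro (isMax-tabulate B (MaxStr.sumfree st) (MaxStr.size st))
            (subb-intro v (lookup (tabulate B)) (λ x p → trans (lookup∘tabulate B x) (vB x p))))) nc

      -- Each of the at least h pairs (x, x + s) of `w` must have an end in the gap between v and
      -- `w`, so h ≤ 2(N - m), against m > N - h/θ.
      no-split : ∀ w s v → isMax w ≡ true → split w s v ≡ true → ⊥
      no-split w s v mw p = <⇒≱ big (begin
          θ * m + h ≤⟨ +-monoʳ-≤ (θ * m) h≤ ⟩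
          θ * m + (r + r) ≤⟨ +-monoʳ-≤ (θ * m) (≤-trans (≤-reflexive (cong (r +_) (sym (+-identityʳ r)))) (*-monoˡ-≤ r (≤-trans (s≤s (s≤s (z≤n {7}))) (m≤m*n 9 (suc k))))) ⟩
          θ * m + θ * r ≡⟨ *-distribˡ-+ θ m r ⟨
          θ * (m + r) ≡⟨ cong (θ *_) m+r ⟩
          θ * N ∎)
        where
        open ≤-Reasoning
        sp : (¬ (lookup w ∋∋ s)) × s ≢ 𝟘 × lookup v ⊑ lookup w × ∣ v ∣ ≡ m × (∀ x → lookup v ∋∋ x → ¬ (lookup v ∋∋ x ⊕ s))
        sp = split-true w s v p
        v⊑ : lookup v ⊑ lookup w
        v⊑ = proj₁ (proj₂ (proj₂ sp))
        gap : Pr n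
        gap = lookup w ∩ ∁ (lookup v)
        r : ℕ
        r = # gap
        m+r : m + r ≡ N
        m+r = trans (cong (_+ r) (trans (sym (proj₁ (proj₂ (proj₂ (proj₂ sp))))) (trans (sym (#-lookup v)) (#-cong (λ x → bool-ext (λ a → ∧-intro (v⊑ x a) a) (λ a → proj₂ (∧-true {lookup w x} a)))))))
          (trans (#-split (lookup w) (lookup v)) (proj₂ (isMax-true w mw)))
        missed : (λ x → lookup w x ∧ lookup w (x ⊕ s)) ⊑ gap ∪ (λ x → gap (x ⊕ s))
        missed x a with bool-cases (lookup v x) | bool-cases (lookup v (x ⊕ s))
        ... | inj₂ e | _ = ∨-introˡ (∧-intro (proj₁ (∧-true {lookup w x} a)) (not-intro e))
        ... | inj₁ _ | inj₂ e = ∨-introʳ {gap x} (∧-intro (proj₂ (∧-true {lookup w x} a)) (not-intro e))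
        ... | inj₁ e | inj₁ e′ = ⊥-elim (proj₂ (proj₂ (proj₂ (proj₂ sp))) x e e′)
        h≤ : h ≤ r + r
        h≤ = begin
          h ≤⟨ many-differences (lookup w) (isMax-structure w mw) s (proj₁ sp) ⟩
          # (λ x → lookup w x ∧ lookup w (x ⊕ s)) ≤⟨ #-mono missed ⟩
          # (gap ∪ (λ x → gap (x ⊕ s))) ≤⟨ m≤m+n _ _ ⟩
          # (gap ∪ (λ x → gap (x ⊕ s))) + # (gap ∩ (λ x → gap (x ⊕ s))) ≡⟨ #-∪∩ gap (λ x → gap (x ⊕ s)) ⟩
          r + # (λ x → gap (x ⊕ s)) ≡⟨ cong (r +_) (sum-reindex (λ x → ⟦ gap x ⟧) (_⊕ s) (_⊕ neg s)
              (λ x → gsolve (v0 :+ :- v1 :+ v1) v0 refl (x ∷ s ∷ [])) (λ x → gsolve (v0 :+ v1 :+ :- v1) v0 refl (x ∷ s ∷ []))) ⟩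
          r + r ∎

      no-ambiguous : #ambiguous ≡ 0
      no-ambiguous = ΣL-zero (allSubsets n) (λ w → pt w (bool-cases (isMax w)))
        where
        pt : ∀ w → isMax w ≡ true ⊎ isMax w ≡ false → ⟦ isMax w ⟧ * ∑S n (λ v → ⟦ ambiguous w v ⟧) ≡ 0
        pt w (inj₂ p) = cong (λ b → ⟦ b ⟧ * ∑S n (λ v → ⟦ ambiguous w v ⟧)) p
        pt w (inj₁ p) = trans (cong (⟦ isMax w ⟧ *_) (ΣL-zero (allSubsets n) (λ v → cong ⟦_⟧ (¬true (λ a → none v (anyF-true (λ s → split w s v) a)))))) (*-zeroʳ ⟦ isMax w ⟧)
          where
          none : ∀ v → ∃[ s ] split w s v ≡ true → ⊥
          none v (s , a) = no-split w s v p a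

    conclusion : Regime q k h n m → Conclusion
    conclusion reg with θ * N <? θ * m + h
    ... | yes big = ≤-trans (≤-reflexive (cong (_* n) (Dense.no-stray big))) z≤n , ≤-trans (≤-reflexive (cong (_* n) (Dense.no-ambiguous big))) z≤n
    ... | no ¬big = Sparse.stray-few (N ∸ m) N≡ h≤ reg , Sparse.ambiguous-few (N ∸ m) N≡ h≤ reg
      where
      open ≤-Reasoning
      le : θ * m + h ≤ θ * N
      le = ≮⇒≥ ¬big
      m≤N : m ≤ N
      m≤N = *-cancelˡ-≤ θ (≤-trans (m≤m+n _ h) le)
      N≡ : N ≡ m + (N ∸ m)
      N≡ = sym (m+[n∸m]≡n m≤N)
      h≤ : h ≤ θ * (N ∸ m)
      h≤ = +-cancelˡ-≤ (θ * m) h _ (begin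
        θ * m + h ≤⟨ le ⟩
        θ * N ≡⟨ cong (θ *_) N≡ ⟩
        θ * (m + (N ∸ m)) ≡⟨ *-distribˡ-+ θ m (N ∸ m) ⟩
        θ * m + θ * (N ∸ m) ∎)

-- Rational estimates

toℚᵘ-ℕtoℚ : ∀ k → toℚᵘ (ℕtoℚ k) ℚᵘ.≃ mkℚᵘ (ℤ.+ k) 0
toℚᵘ-ℕtoℚ k = ℚP.toℚᵘ-fromℚᵘ (mkℚᵘ (ℤ.+ k) 0)

ℕtoℚ-mono : ∀ {a b} → a ≤ b → ℕtoℚ a ≤ℚ ℕtoℚ b
ℕtoℚ-mono {a} {b} h = ℚP.toℚᵘ-cancel-≤ (ℚᵘP.≤-respˡ-≃ (ℚᵘP.≃-sym (toℚᵘ-ℕtoℚ a)) (ℚᵘP.≤-respʳ-≃ (ℚᵘP.≃-sym (toℚᵘ-ℕtoℚ b)) (*≤* (ℤP.*-monoʳ-≤-nonNeg (ℤ.+ 1) (ℤ.+≤+ h)))))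

ℕtoℚ-+ : ∀ a b → ℕtoℚ (a + b) ≡ ℕtoℚ a ℚ.+ ℕtoℚ b
ℕtoℚ-+ a b = ℚP.toℚᵘ-injective (ℚᵘP.≃-trans (toℚᵘ-ℕtoℚ (a + b)) (ℚᵘP.≃-trans
    (*≡* (cong (ℤ._* ℤ.+ 1) (sym (cong₂ ℤ._+_ (ℤP.*-identityʳ (ℤ.+ a)) (ℤP.*-identityʳ (ℤ.+ b))))))
    (ℚᵘP.≃-sym (ℚᵘP.≃-trans (ℚP.toℚᵘ-homo-+ (ℕtoℚ a) (ℕtoℚ b)) (ℚᵘP.+-cong (toℚᵘ-ℕtoℚ a) (toℚᵘ-ℕtoℚ b))))))

ℕtoℚ-* : ∀ a b → ℕtoℚ (a * b) ≡ ℕtoℚ a *ℚ ℕtoℚ b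
ℕtoℚ-* a b = ℚP.toℚᵘ-injective (ℚᵘP.≃-trans (toℚᵘ-ℕtoℚ (a * b)) (ℚᵘP.≃-trans
    (*≡* (cong (ℤ._* ℤ.+ 1) (ℤP.pos-* a b)))
    (ℚᵘP.≃-sym (ℚᵘP.≃-trans (ℚP.toℚᵘ-homo-* (ℕtoℚ a) (ℕtoℚ b)) (ℚᵘP.*-cong (toℚᵘ-ℕtoℚ a) (toℚᵘ-ℕtoℚ b))))))

-- A positive rational is at least the reciprocal of its denominator, so this denominator tells how
-- large n must be. The factor ½ leaves room for λ_q = ½.
small-error : ∀ ε → 0ℚ <ℚ ε → ∀ n s c → 2 * ↧ₙ ε ≤ n → s * n ≤ c → ℕtoℚ s ≤ℚ ε *ℚ ½ *ℚ ℕtoℚ c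
small-error (mkℚ (ℤ.+ zero) _ _) (*<* (ℤ.+<+ ()))
small-error (mkℚ ℤ.-[1+ _ ] _ _) (*<* ())
small-error ε@(mkℚ (ℤ.+ suc p) d-1 _) _ n s c n≥ sn≤c = ℚP.toℚᵘ-cancel-≤ (ℚᵘP.≤-respˡ-≃ (ℚᵘP.≃-sym (toℚᵘ-ℕtoℚ s)) (ℚᵘP.≤-respʳ-≃
    (ℚᵘP.≃-sym (ℚᵘP.≃-trans (ℚP.toℚᵘ-homo-* (ε *ℚ ½) (ℕtoℚ c)) (ℚᵘP.*-cong (ℚP.toℚᵘ-homo-* ε ½) (toℚᵘ-ℕtoℚ c))))
    (*≤* (subst₂ ℤ._≤_ (ℤP.pos-* s (suc d-1 * 2 * 1)) (trans (ℤP.pos-* (suc p * 1 * c) 1) (cong (ℤ._* ℤ.+ 1) (trans (ℤP.pos-* (suc p * 1) c) (cong (ℤ._* ℤ.+ c) (ℤP.pos-* (suc p) 1)))))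
      (ℤ.+≤+ bound)))))
  where
  open ≤-Reasoning
  l : ∀ s d → s * (d * 2 * 1) ≡ s * (2 * d)
  l = solve-∀
  l′ : ∀ p c → p * 1 * c * 1 ≡ p * c
  l′ = solve-∀
  bound : s * (suc d-1 * 2 * 1) ≤ suc p * 1 * c * 1
  bound = begin
    s * (suc d-1 * 2 * 1) ≡⟨ l s (suc d-1) ⟩
    s * (2 * suc d-1) ≤⟨ *-monoʳ-≤ s n≥ ⟩
    s * n ≤⟨ sn≤c ⟩
    c ≤⟨ m≤m+n c (p * c) ⟩
    suc p * c ≡⟨ l′ (suc p) c ⟨
    suc p * 1 * c * 1 ∎

difference≤ : ∀ x y z → x ≤ z + y → ℕtoℚ x -ℚ ℕtoℚ y ≤ℚ ℕtoℚ z
difference≤ x y z h = begin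
  ℕtoℚ x -ℚ ℕtoℚ y ≤⟨ ℚP.+-monoˡ-≤ (ℚ.- ℕtoℚ y) (ℕtoℚ-mono h) ⟩
  ℕtoℚ (z + y) -ℚ ℕtoℚ y ≡⟨ cong (_-ℚ ℕtoℚ y) (ℕtoℚ-+ z y) ⟩
  ℕtoℚ z ℚ.+ ℕtoℚ y -ℚ ℕtoℚ y ≡⟨ ℚP.+-assoc (ℕtoℚ z) (ℕtoℚ y) (ℚ.- ℕtoℚ y) ⟩
  ℕtoℚ z ℚ.+ (ℕtoℚ y -ℚ ℕtoℚ y) ≡⟨ cong (ℕtoℚ z ℚ.+_) (ℚP.+-inverseʳ (ℕtoℚ y)) ⟩
  ℕtoℚ z ℚ.+ 0ℚ ≡⟨ ℚP.+-identityʳ (ℕtoℚ z) ⟩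
  ℕtoℚ z ∎
  where open ℚP.≤-Reasoning

module Asymptotics (ε : ℚ) (ε>0 : 0ℚ <ℚ ε) (n inner stray extra total c : ℕ) (n≥ : 2 * ↧ₙ ε ≤ n)
    (stray≤ : stray * n ≤ c) (extra≤ : extra * n ≤ c) (c≤ : c ≤ inner) (inner≤ : inner ≤ total) (total≤ : total ≤ inner + extra) where
  open ℚP.≤-Reasoning
  instance
    ε-nonNeg : ℚ.NonNegative ε
    ε-nonNeg = ℚ.nonNegative (ℚP.<⇒≤ ε>0)

  most-inner : (1ℚ -ℚ ε) *ℚ ℕtoℚ (inner + stray) ≤ℚ ℕtoℚ inner
  most-inner = begin
    (1ℚ -ℚ ε) *ℚ s ≡⟨ ℚP.*-distribʳ-+ s 1ℚ (ℚ.- ε) ⟩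
    1ℚ *ℚ s ℚ.+ (ℚ.- ε) *ℚ s ≡⟨ cong₂ ℚ._+_ (ℚP.*-identityˡ s) (sym (ℚP.neg-distribˡ-* ε s)) ⟩
    s -ℚ ε *ℚ s ≤⟨ ℚP.+-monoʳ-≤ s (ℚP.neg-antimono-≤ stray-ε) ⟩
    s -ℚ ℕtoℚ stray ≤⟨ difference≤ (inner + stray) stray inner ≤-refl ⟩
    ℕtoℚ inner ∎
    where
    s : ℚ
    s = ℕtoℚ (inner + stray)
    ½≤1 : ½ ≤ℚ 1ℚ
    ½≤1 = ℚ.*≤* (ℤ.+≤+ (s≤s z≤n))
    stray-ε : ℕtoℚ stray ≤ℚ ε *ℚ s
    stray-ε = begin
      ℕtoℚ stray ≤⟨ small-error ε ε>0 n stray (inner + stray) n≥ (≤-trans stray≤ (≤-trans c≤ (m≤m+n inner stray))) ⟩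
      ε *ℚ ½ *ℚ s ≤⟨ ℚP.*-monoʳ-≤-nonNeg s {{ℚP.normalize-nonNeg (inner + stray) 1}} (ℚP.*-monoˡ-≤-nonNeg ε ½≤1) ⟩
      ε *ℚ 1ℚ *ℚ s ≡⟨ cong (_*ℚ s) (ℚP.*-identityʳ ε) ⟩
      ε *ℚ s ∎

  weaken : ∀ r x → ½ ≤ℚ r → x * n ≤ c → ℕtoℚ x ≤ℚ ε *ℚ r *ℚ ℕtoℚ c
  weaken r x ½≤r x≤ = ℚP.≤-trans (small-error ε ε>0 n x c n≥ x≤) (ℚP.*-monoʳ-≤-nonNeg (ℕtoℚ c) {{ℚP.normalize-nonNeg c 1}} (ℚP.*-monoˡ-≤-nonNeg ε ½≤r))

  upper : ∀ r → ½ ≤ℚ r → ℕtoℚ (inner + stray) -ℚ ℕtoℚ total ≤ℚ ε *ℚ r *ℚ ℕtoℚ c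
  upper r ½≤r = ℚP.≤-trans (difference≤ (inner + stray) total stray (≤-trans (≤-reflexive (+-comm inner stray)) (+-monoʳ-≤ stray inner≤))) (weaken r stray ½≤r stray≤)

  lower : ∀ r → ½ ≤ℚ r → ℕtoℚ total -ℚ ℕtoℚ (inner + stray) ≤ℚ ε *ℚ r *ℚ ℕtoℚ c
  lower r ½≤r = ℚP.≤-trans (difference≤ total (inner + stray) extra (≤-trans total≤ (≤-trans (≤-reflexive (+-comm inner extra)) (+-monoʳ-≤ extra (m≤m+n inner stray))))) (weaken r extra ½≤r extra≤)

lambdaQ-≢2 : ∀ q → q ≢ 2 → lambdaQ q ≡ ½
lambdaQ-≢2 0 _ = refl
lambdaQ-≢2 1 _ = refl
lambdaQ-≢2 2 ne = ⊥-elim (ne refl)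
lambdaQ-≢2 (suc (suc (suc q))) _ = refl

-- λ_q is the reciprocal of the number of homomorphisms per maximum set, because k = 0 just when q =
-- 2.
lambdaQ-multiplicity : ∀ q k → q ≡ 3 * k + 2 → ∀ x → lambdaQ q *ℚ ℕtoℚ ((if 1 ≤b k then 2 else 1) * x) ≡ ℕtoℚ x
lambdaQ-multiplicity q k q≡ x with bool-cases (1 ≤b k)
... | inj₁ p = trans (cong₂ (λ r b → r *ℚ ℕtoℚ ((if b then 2 else 1) * x)) (lambdaQ-≢2 q λ q2 → <⇒≱ (≤b-true {1} {k} p) (k≤0 q2)) p)
    (trans (cong (½ *ℚ_) (ℕtoℚ-* 2 x)) (trans (sym (ℚP.*-assoc ½ (ℕtoℚ 2) (ℕtoℚ x))) (ℚP.*-identityˡ (ℕtoℚ x))))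
  where
  k≤0 : q ≡ 2 → k ≤ 0
  k≤0 q2 = *-cancelˡ-≤ 3 (+-cancelʳ-≤ 2 (3 * k) 0 (≤-reflexive (trans (sym q≡) q2)))
... | inj₂ p = trans (cong₂ (λ r b → lambdaQ r *ℚ ℕtoℚ ((if b then 2 else 1) * x)) q≡2 p) (trans (ℚP.*-identityˡ _) (cong ℕtoℚ (+-identityʳ x)))
  where
  q≡2 : q ≡ 2
  q≡2 = trans q≡ (cong (λ z → 3 * z + 2) (n<1⇒n≡0 (≰⇒> (λ le → absurd-b (≤b-intro le) p))))

½≤lambdaQ : ∀ q → ½ ≤ℚ lambdaQ q
½≤lambdaQ q with q ≟ 2
... | yes refl = ℚ.*≤* (ℤ.+≤+ (s≤s z≤n))
... | no ne = ℚP.≤-reflexive (sym (lambdaQ-≢2 q ne))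

-- Transfer to abstract groups

maximum-≤ : ∀ {n} {P : Subset n → Set} (P? : ∀ v → Dec (P v)) L b → (∀ v → P v → ∣ v ∣ ≤ b) → foldr _⊔_ 0 (map ∣_∣ (filter P? L)) ≤ b
maximum-≤ P? [] b h = z≤n
maximum-≤ P? (v ∷ L) b h with P? v
... | yes p = ⊔-lub (h v p) (maximum-≤ P? L b h)
... | no _ = maximum-≤ P? L b h

-- That `w` occurs in the list is expressed by counting its equal entries, which `∑S-δ` evaluates
-- for the list of all subsets.
≤-maximum : ∀ {n} {P : Subset n → Set} (P? : ∀ v → Dec (P v)) L w → P w → 1 ≤ ΣL L (λ v → ⟦ eqS w v ⟧ * 1) → ∣ w ∣ ≤ foldr _⊔_ 0 (map ∣_∣ (filter P? L))
≤-maximum P? [] w Pw ()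
≤-maximum {P = P} P? (v ∷ L) w Pw le with P? v | bool-cases (eqS w v)
... | yes _ | inj₁ e = ≤-trans (≤-reflexive (cong ∣_∣ (eqS-true e))) (m≤m⊔n ∣ v ∣ _)
... | no ¬p | inj₁ e = ⊥-elim (¬p (subst P (eqS-true e) Pw))
... | yes _ | inj₂ e = ≤-trans (≤-maximum P? L w Pw (subst (λ b → 1 ≤ ⟦ b ⟧ * 1 + ΣL L (λ v → ⟦ eqS w v ⟧ * 1)) e le)) (m≤n⊔m ∣ v ∣ _)
... | no _ | inj₂ e = ≤-maximum P? L w Pw (subst (λ b → 1 ≤ ⟦ b ⟧ * 1 + ΣL L (λ v → ⟦ eqS w v ⟧ * 1)) e le)

-- Elements are replaced by their indices; `elem-inj` turns setoid equations into equations between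
-- indices.
module Transfer (G : FiniteAbelianGroup) where
  module A = FiniteAbelianGroup G
  open A using (size; elem)

  index : A.Carrier → Fin size
  index x = proj₁ (A.elem-surj x)

  elem-index : ∀ x → elem (index x) A.≈ x
  elem-index x = proj₂ (A.elem-surj x)

  index-unique : ∀ i x → elem i A.≈ x → index x ≡ i
  index-unique i x e = A.elem-inj (index x) i (A.trans (elem-index x) (A.sym e))

  index-cong : ∀ {x y} → x A.≈ y → index x ≡ index y
  index-cong {x} {y} e = index-unique (index y) x (A.trans (elem-index y) (A.sym e))

  index-elem : ∀ i → index (elem i) ≡ i
  index-elem i = index-unique i (elem i) A.refl

  group : FG size
  group = record
    { _⊕_ = λ i j → index (elem i A.∙ elem j)
    ; neg = λ i → index (elem i A.⁻¹)
    ; 𝟘 = index A.ε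
    ; ⊕-assoc = λ i j k → index-cong (A.trans (A.∙-congʳ (elem-index _)) (A.trans (A.assoc (elem i) (elem j) (elem k)) (A.∙-congˡ (A.sym (elem-index _)))))
    ; ⊕-comm = λ i j → index-cong (A.comm (elem i) (elem j))
    ; ⊕-identityˡ = λ i → trans (index-cong (A.trans (A.∙-congʳ (elem-index A.ε)) (A.identityˡ (elem i)))) (index-elem i)
    ; ⊕-inverseˡ = λ i → index-cong (A.trans (A.∙-congʳ (elem-index _)) (A.inverseˡ (elem i))) }

module Counts (G : FiniteAbelianGroup) (q k h : ℕ) (q≡ : q ≡ 3 * k + 2) (n≡ : FiniteAbelianGroup.size G ≡ q * h) (pr : Prime q)
    (q-least : ∀ c → c ∣ FiniteAbelianGroup.size G → c % 3 ≡ 2 → q ≤ c) (m : ℕ) where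
  open Transfer G
  open Counting group q k h q≡ n≡ pr q-least
  open Families m
  private
    n : ℕ
    n = FiniteAbelianGroup.size G
  open A using (elem)

  SumFree⇒SF : ∀ v → SumFree G v → SF (lookup v)
  SumFree⇒SF v sf x y p r s = sf x y (x ⊕ y) (lookup⇒[]= x v p) (lookup⇒[]= y v r) (lookup⇒[]= (x ⊕ y) v s) (A.sym (elem-index (elem x A.∙ elem y)))

  SF⇒SumFree : ∀ v → SF (lookup v) → SumFree G v
  SF⇒SumFree v sf i j l i∈ j∈ l∈ e = sf i j ([]=⇒lookup i∈) ([]=⇒lookup j∈) (trans (cong (lookup v) (index-unique l (elem i A.∙ elem j) (A.sym e))) ([]=⇒lookup l∈))

  -- A larger set would satisfy the hypothesis of `stability`, and so lie in a set of size N.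
  SF-size : ∀ B → SF B → # B ≤ N
  SF-size B sf = ≮⇒≥ λ lt → <⇒≱ lt (go (stability B sf (≤-<-trans (*-monoʳ-≤ θ (<⇒≤ lt)) (m<m+n (θ * # B) h≥1))))
    where
    go : ∃[ B′ ] (B ⊑ B′ × MaxStr N h B′) → # B ≤ N
    go (B′ , sub , st) = ≤-trans (#-mono {A = B} {B′} sub) (≤-reflexive (MaxStr.size st))

  maximum-size : maxSumFreeSize G ≡ N
  maximum-size = ≤-antisym
      (maximum-≤ (sumFree? G) (allSubsets n) N (λ v sf → ≤-trans (≤-reflexive (sym (#-lookup v))) (SF-size (lookup v) (SumFree⇒SF v sf))))
      (≤-trans (≤-reflexive (trans (sym (proj₂ mw)) (#-lookup w))) (≤-maximum (sumFree? G) (allSubsets n) w (SF⇒SumFree w (proj₁ mw)) (≤-reflexive (sym (∑S-δ w (λ _ → 1))))))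
    where
    w : Subset n
    w = tabulate (proj₁ max-exists)
    mw : SF (lookup w) × # (lookup w) ≡ N
    mw = isMax-true w (isMax-tabulate (proj₁ max-exists) (proj₁ (proj₂ max-exists)) (proj₂ (proj₂ max-exists)))

  member-InSF : ∀ v → ⌊ inSF? G m v ⌋ ≡ member v
  member-InSF v = bool-ext (λ p → member-intro v (SumFree⇒SF v (proj₁ (⌊⌋-true {d = inSF? G m v} p))) (proj₂ (⌊⌋-true {d = inSF? G m v} p)))
    (λ p → ⌊⌋-intro {d = inSF? G m v} (SF⇒SumFree v (proj₁ (member-true v p)) , proj₂ (member-true v p)))

  #SF≡ : #SF G m ≡ #contained + #stray
  #SF≡ = trans (length-filter (inSF? G m) (allSubsets n)) (trans (ΣL-cong (allSubsets n) (λ v → trans (cong ⟦_⟧ (member-InSF v)) (split-by (member v) (covered v)))) (ΣL-+ (allSubsets n) _ _))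
    where
    split-by : ∀ a b → ⟦ a ⟧ ≡ ⟦ a ∧ b ⟧ + ⟦ a ∧ not b ⟧
    split-by true true = refl
    split-by true false = refl
    split-by false b = refl

  covered-InMaximumSF : ∀ v → covered v ≡ true → InMaximumSF G v
  covered-InMaximumSF v p = go (anyS-true (λ w → isMax w ∧ subb v (lookup w)) p)
    where
    go : ∃[ w ] isMax w ∧ subb v (lookup w) ≡ true → InMaximumSF G v
    go (w , r) = w , SF⇒SumFree w (proj₁ mw) , trans (sym (#-lookup w)) (trans (proj₂ mw) (sym maximum-size)) ,
        λ {x} x∈ → lookup⇒[]= x w (subb-true v (lookup w) (proj₂ (∧-true {isMax w} r)) x ([]=⇒lookup x∈))
      where
      mw : SF (lookup w) × # (lookup w) ≡ N
      mw = isMax-true w (proj₁ (∧-true {isMax w} r))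

  InMaximumSF-covered : ∀ v → InMaximumSF G v → covered v ≡ true
  InMaximumSF-covered v (w , sf , e , sub) = anyS-intro (λ w → isMax w ∧ subb v (lookup w)) w
    (∧-intro (isMax-intro w (SumFree⇒SF w sf) (trans (#-lookup w) (trans e maximum-size))) (subb-intro v (lookup w) (λ x p → []=⇒lookup (sub (lookup⇒[]= x v p)))))

  #SFinMaximum≡ : #SFinMaximum G m ≡ #contained
  #SFinMaximum≡ = trans (length-filter P? (allSubsets n)) (ΣL-cong (allSubsets n) (λ v → cong ⟦_⟧ (same v)))
    where
    P? : ∀ v → Dec (InSF G m v × InMaximumSF G v)
    P? v = inSF? G m v ×-dec inMaximumSF? G v
    same : ∀ v → ⌊ P? v ⌋ ≡ contained v
    same v = bool-ext (λ p → ∧-intro (trans (sym (member-InSF v)) (⌊⌋-intro {d = inSF? G m v} (proj₁ (⌊⌋-true {d = P? v} p)))) (InMaximumSF-covered v (proj₂ (⌊⌋-true {d = P? v} p))))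
      (λ p → ⌊⌋-intro {d = P? v} (⌊⌋-true {d = inSF? G m v} (trans (member-InSF v) (proj₁ (∧-true {member v} p))) , covered-InMaximumSF v (proj₂ (∧-true {member v} p))))

  mul-elem : ∀ j i → mul G j (elem i) A.≈ elem (j · i)
  mul-elem zero i = A.sym (elem-index A.ε)
  mul-elem (suc j) i = A.trans (A.∙-congˡ (mul-elem j i)) (A.sym (elem-index _))

  mul-zero : ∀ j i → mul G j (elem i) A.≈ A.ε → j · i ≡ 𝟘
  mul-zero j i e = A.elem-inj (j · i) 𝟘 (A.trans (A.sym (mul-elem j i)) (A.trans e (A.sym (elem-index A.ε))))

  zero-mul : ∀ j i → j · i ≡ 𝟘 → mul G j (elem i) A.≈ A.ε
  zero-mul j i e = A.trans (mul-elem j i) (A.trans (A.reflexive (cong elem e)) (elem-index A.ε))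

  -- j is invertible modulo the prime q, so i is a multiple of ji up to multiples of qi. Hence
  -- nonzero q-torsion elements are those of order q.
  no-smaller-order : ∀ i → q · i ≡ 𝟘 → ∀ j → 0 < j → j < q → j · i ≡ 𝟘 → i ≡ 𝟘
  no-smaller-order i qi j j>0 j<q ji = go (inverse-mod q j pr (λ q∣j → <⇒≱ j<q (∣⇒≤ {{>-nonZero j>0}} q∣j)))
    where
    open ≡-Reasoning
    go : ∃[ a ] ∃[ b ] a * j ≡ 1 + b * q → i ≡ 𝟘
    go (a , b , e) = begin
      i ≡⟨ ⊕𝟘 i ⟨
      i ⊕ 𝟘 ≡⟨ cong (i ⊕_) (trans (·-* b q i) (trans (cong (b ·_) qi) (·-𝟘 b))) ⟨
      (1 + b * q) · i ≡⟨ cong (_· i) e ⟨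
      (a * j) · i ≡⟨ trans (·-* a j i) (trans (cong (a ·_) ji) (·-𝟘 a)) ⟩
      𝟘 ∎

  #elementsOfOrder≡ : #elementsOfOrder G q ≡ # order-q
  #elementsOfOrder≡ = trans (length-filter (λ i → hasOrder? G q (elem i)) (allFin n)) (trans (ΣL-tabulate id (λ i → ⟦ ⌊ hasOrder? G q (elem i) ⌋ ⟧)) (#-cong same))
    where
    to : ∀ i → HasOrder G q (elem i) → order-q i ≡ true
    to i (_ , e , least) = ∧-intro (⌊⌋-intro {d = q · i FinP.≟ 𝟘} (mul-zero q i e)) (not-intro′ {𝟘 == i} λ z →
      least (fromℕ< q≥2) (≤-reflexive (sym (toℕ-fromℕ< q≥2))) (subst (λ j → mul G j (elem i) A.≈ A.ε) (sym (toℕ-fromℕ< q≥2))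
        (zero-mul 1 i (trans (cong (1 ·_) (sym (⌊⌋-true {d = 𝟘 FinP.≟ i} z))) (·-𝟘 1)))))
    from : ∀ i → order-q i ≡ true → HasOrder G q (elem i)
    from i p = <⇒≤ q≥2 , zero-mul q i qi , λ j j>0 e → absurd-b (⌊⌋-intro {d = 𝟘 FinP.≟ i} (sym (no-smaller-order i qi (toℕ j) j>0 (toℕ<n j) (mul-zero (toℕ j) i e)))) (not-true (proj₂ (∧-true {torsion i} p)))
      where
      qi : q · i ≡ 𝟘
      qi = ⌊⌋-true {d = q · i FinP.≟ 𝟘} (proj₁ (∧-true {torsion i} p))
    same : ∀ i → ⌊ hasOrder? G q (elem i) ⌋ ≡ order-q i
    same i = bool-ext (λ p → to i (⌊⌋-true {d = hasOrder? G q (elem i)} p)) (λ p → ⌊⌋-intro {d = hasOrder? G q (elem i)} (from i p))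

  expected-count : lambdaQ q *ℚ ℕtoℚ (#elementsOfOrder G q) *ℚ ℕtoℚ (maxSumFreeSize G C m) ≡ ℕtoℚ (#max * C₁)
  expected-count = begin
    lambdaQ q *ℚ ℕtoℚ (#elementsOfOrder G q) *ℚ ℕtoℚ (maxSumFreeSize G C m) ≡⟨ cong₂ (λ x y → lambdaQ q *ℚ ℕtoℚ x *ℚ ℕtoℚ (y C m)) (trans #elementsOfOrder≡ max-count) maximum-size ⟩
    lambdaQ q *ℚ ℕtoℚ (multiplicity * #max) *ℚ ℕtoℚ C₁ ≡⟨ cong (_*ℚ ℕtoℚ C₁) (lambdaQ-multiplicity q k q≡ #max) ⟩
    ℕtoℚ #max *ℚ ℕtoℚ C₁ ≡⟨ ℕtoℚ-* #max C₁ ⟨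
    ℕtoℚ (#max * C₁) ∎
    where open ≡-Reasoning

  bounds : Regime q k h n m → ∀ ε → 0ℚ <ℚ ε → 2 * ↧ₙ ε ≤ n →
    ((1ℚ -ℚ ε) *ℚ ℕtoℚ (#SF G m) ≤ℚ ℕtoℚ (#SFinMaximum G m))
    × (ℕtoℚ (#SF G m) -ℚ lambdaQ q *ℚ ℕtoℚ (#elementsOfOrder G q) *ℚ ℕtoℚ (maxSumFreeSize G C m) ≤ℚ ε *ℚ lambdaQ q *ℚ ℕtoℚ (maxSumFreeSize G C m))
    × (lambdaQ q *ℚ ℕtoℚ (#elementsOfOrder G q) *ℚ ℕtoℚ (maxSumFreeSize G C m) -ℚ ℕtoℚ (#SF G m) ≤ℚ ε *ℚ lambdaQ q *ℚ ℕtoℚ (maxSumFreeSize G C m))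
  bounds reg ε ε>0 n≥ =
      subst₂ (λ x y → (1ℚ -ℚ ε) *ℚ ℕtoℚ x ≤ℚ ℕtoℚ y) (sym #SF≡) (sym #SFinMaximum≡) As.most-inner ,
      subst₂ _≤ℚ_ (cong₂ (λ x y → ℕtoℚ x -ℚ y) (sym #SF≡) (sym expected-count)) bound (As.upper (lambdaQ q) (½≤lambdaQ q)) ,
      subst₂ _≤ℚ_ (cong₂ (λ x y → y -ℚ ℕtoℚ x) (sym #SF≡) (sym expected-count)) bound (As.lower (lambdaQ q) (½≤lambdaQ q))
    where
    con : Conclusion
    con = conclusion reg
    module As = Asymptotics ε ε>0 n #contained #stray #ambiguous (#max * C₁) C₁ n≥ (proj₁ con) (proj₂ con) C≤contained contained≤ max*C≤
    bound : ε *ℚ lambdaQ q *ℚ ℕtoℚ C₁ ≡ ε *ℚ lambdaQ q *ℚ ℕtoℚ (maxSumFreeSize G C m)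
    bound = cong (λ z → ε *ℚ lambdaQ q *ℚ ℕtoℚ (z C m)) (sym maximum-size)

theorem1p1 : ∀ (q : ℕ) → Prime q → q % 3 ≡ 2 →
  ∃[ Cq ] (0 < Cq ×
    (∀ (ε : ℚ) → 0ℚ <ℚ ε → ∃[ N ] (∀ (G : FiniteAbelianGroup) → TypeI G q →
      N ≤ FiniteAbelianGroup.size G → ∀ (m : ℕ) →
      MulLogLe (Cq * Cq * FiniteAbelianGroup.size G) (FiniteAbelianGroup.size G) (m * m) →
      let n = FiniteAbelianGroup.size G
          λq = lambdaQ q
          B = ℕtoℚ ((maxSumFreeSize G) C m)
          sf = ℕtoℚ (#SF G m)
          main = λq *ℚ ℕtoℚ (#elementsOfOrder G q) *ℚ B
      in ((1ℚ -ℚ ε) *ℚ sf ≤ℚ ℕtoℚ (#SFinMaximum G m))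
         × (sf -ℚ main ≤ℚ ε *ℚ λq *ℚ B)
         × (main -ℚ sf ≤ℚ ε *ℚ λq *ℚ B))))
theorem1p1 q pr q%3 = 4 * W₀ , *-mono-≤ (s≤s (z≤n {3})) (≤-trans (s≤s z≤n) W₀≥64) , λ ε ε>0 → q * θ₀ + (4 + 2 * ↧ₙ ε) , main ε ε>0
  where
  k : ℕ
  k = q / 3
  q≡ : q ≡ 3 * k + 2
  q≡ = trans (m≡m%n+[m/n]*n q 3) (trans (+-comm (q % 3) _) (cong₂ _+_ (*-comm k 3) q%3))
  open Constants q k
  main : ∀ ε → 0ℚ <ℚ ε → ∀ G → TypeI G q → q * θ₀ + (4 + 2 * ↧ₙ ε) ≤ FiniteAbelianGroup.size G → ∀ m →
    MulLogLe (4 * W₀ * (4 * W₀) * FiniteAbelianGroup.size G) (FiniteAbelianGroup.size G) (m * m) →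
    ((1ℚ -ℚ ε) *ℚ ℕtoℚ (#SF G m) ≤ℚ ℕtoℚ (#SFinMaximum G m))
    × (ℕtoℚ (#SF G m) -ℚ lambdaQ q *ℚ ℕtoℚ (#elementsOfOrder G q) *ℚ ℕtoℚ (maxSumFreeSize G C m) ≤ℚ ε *ℚ lambdaQ q *ℚ ℕtoℚ (maxSumFreeSize G C m))
    × (lambdaQ q *ℚ ℕtoℚ (#elementsOfOrder G q) *ℚ ℕtoℚ (maxSumFreeSize G C m) -ℚ ℕtoℚ (#SF G m) ≤ℚ ε *ℚ lambdaQ q *ℚ ℕtoℚ (maxSumFreeSize G C m))
  -- The size threshold provides three things: qθ₀ ≤ n gives θ₀ ≤ h, the 4 gives n ≥ 4, and 2 `↧ₙ ε`
  -- ≤ n goes into `small-error`.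
  main ε ε>0 G (_ , divides h size≡ , _ , least) large m log = Counts.bounds G q k h q≡ n≡ pr q-least m reg ε ε>0 (≤-trans (m≤n+m (2 * ↧ₙ ε) (q * θ₀ + 4)) (≤-trans (≤-reflexive (+-assoc (q * θ₀) 4 _)) large))
    where
    n : ℕ
    n = FiniteAbelianGroup.size G
    n≡ : n ≡ q * h
    n≡ = trans size≡ (*-comm h q)
    q-least : ∀ c → c ∣ n → c % 3 ≡ 2 → q ≤ c
    q-least zero c∣n ()
    q-least c@(suc _) c∣n c%3 = go (prime-factor-2mod3 c c%3)
      where
      go : ∃[ p ] (Prime p × p ∣ c × p % 3 ≡ 2) → q ≤ c
      go (p , prp , p∣c , p%3) = ≤-trans (least p prp (∣-trans p∣c c∣n) p%3) (∣⇒≤ p∣c)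
    θ₀≤h : θ₀ ≤ h
    θ₀≤h = *-cancelˡ-≤ q {{prime⇒nonZero pr}} (≤-trans (m≤m+n (q * θ₀) _) (≤-trans large (≤-reflexive n≡)))
    reg : Regime q k h n m
    reg = regime q k h n m n≡ (nonTrivial⇒n>1 q {{prime⇒nonTrivial pr}}) θ₀≤h (≤-trans (m≤m+n 4 (2 * ↧ₙ ε)) (≤-trans (m≤n+m (4 + 2 * ↧ₙ ε) (q * θ₀)) large))
      (MulLogLe-bound (4 * W₀ * (4 * W₀) * n) n (m * m) log)
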